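{- There is a randomized algorithm with worst-case running time $\widetilde O(n^4)$ which, given a simple directed graph on $n$ vertices, outputs a shortest even directed cycle with probability $1-O(n^{ -3})$ whenever an even directed cycle exists. Every cycle it outputs is an actual simple even cycle of the input. On a graph without an even cycle it always reports that fact correctly. Its direct implementation uses $O(n^3)$ field elements of space.
   Context: Graphs are simple directed graphs without loops; oppositely directed arcs are allowed. A cycle is always directed and simple (no repeated vertices); its length is its number of arcs, and it is even if its length is even (so two oppositely directed arcs form an even cycle of length two). A shortest even cycle is an even cycle of minimum length among all even cycles. Running time is measured in bit operations, and $\widetilde O$ hides logarithmic factors. Probability is over the internal randomness of the algorithm. Field elements are elements of a binary extension field $\mathbb F_{2^d}$ with $d=O(\log n)$. -}

module Defs where

open import Data.Bool using (Bool; true; false; if_then_else_)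
import Data.Bool as Bool
open import Data.Empty using (⊥)
open import Data.Fin using (Fin; toℕ; fromℕ<; remQuot)
open import Data.Fin.Properties using (toℕ-injective; toℕ<n; toℕ-fromℕ<; all?)
import Data.Fin.Properties as Fin
import Data.Integer as ℤ
open import Data.List using (List; []; _∷_; _++_; _∷ʳ_; map; length; filter)
open import Data.List.Properties using (map-injective)
import Data.List.Properties as List
open import Data.List.Relation.Unary.Linked using (Linked; linked?)
open import Data.List.Relation.Unary.Unique.Propositional using (Unique)
import Data.List.Relation.Unary.Unique.DecPropositional as DecUnique
open import Data.Nat using (ℕ; zero; suc; _+_; _*_; _∸_; _^_; _≤_; _<_; _<?_; _≡ᵇ_; NonZero; ⌊_/2⌋)
open import Data.Nat.Divisibility using (_∣_; _∣?_)
open import Data.Nat.GeneralisedArithmetic using (iterate)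
open import Data.Nat.Logarithm using (⌊log₂_⌋)
open import Data.Nat.Properties using (m^n≢0; allUpTo?; ≰⇒>; <⇒≱; _≤?_)
open import Data.Product using (∃-syntax; _×_; _,_)
open import Data.Rational using (ℚ; _/_) renaming (_≤_ to _≤ℚ_)
open import Data.Vec using (Vec; []; _∷_; toList; fromList)
open import Data.Vec.Properties using (toList∘fromList; length-toList)
open import Relation.Binary.PropositionalEquality using (_≡_; refl; sym; trans; cong₂; subst)
open import Relation.Nullary using (Dec; yes; no; ¬_; ¬?; map′; _×-dec_)
open import Relation.Unary using (Pred; Decidable)
open import Level using (0ℓ)

record Digraph (n : ℕ) : Set where
  field
    adjacent : Fin n → Fin n → Bool
    loopless : ∀ v → adjacent v v ≡ false

open Digraph public

Arc : ∀ {n} → Digraph n → Fin n → Fin n → Set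
Arc G u v = adjacent G u v ≡ true

-- The cycle v₁ → v₂ → … → vₖ → v₁ is given as the list v₁ , … , vₖ, whose
-- length is therefore also the number of arcs.
IsCycle : ∀ {n} → Digraph n → List (Fin n) → Set
IsCycle G []       = ⊥
IsCycle G (v ∷ vs) = Unique (v ∷ vs) × Linked (Arc G) (v ∷ vs ∷ʳ v)

IsEvenCycle : ∀ {n} → Digraph n → List (Fin n) → Set
IsEvenCycle G c = IsCycle G c × 2 ∣ length c

IsShortestEvenCycle : ∀ {n} → Digraph n → List (Fin n) → Set
IsShortestEvenCycle G c =
  IsEvenCycle G c × (∀ c′ → IsEvenCycle G c′ → length c ≤ length c′)

-- The machine model: a probabilistic random access machine, programmed in
-- a structured language and charged by the number of bits it handles.
--
-- There are registers and a memory, both holding natural numbers, and a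
-- write-only output.  A program is one finite text, the same for all inputs
-- of all sizes; it names finitely many registers.

Reg : Set
Reg = ℕ

data Stmt : Set where
  const  : Reg → ℕ → Stmt
  add    : Reg → Reg → Reg → Stmt
  sub    : Reg → Reg → Reg → Stmt
  mul    : Reg → Reg → Reg → Stmt
  half   : Reg → Reg → Stmt
  load   : Reg → Reg → Stmt
  store  : Reg → Reg → Stmt
  flip   : Reg → Stmt
  emit   : Reg → Stmt
  branch : Reg → List Stmt → List Stmt → Stmt    -- first block iff nonzero
  while  : Reg → List Stmt → Stmt                -- repeat while nonzero

Program : Set
Program = List Stmt

record Config : Set where
  constructor ⟪_,_,_,_,_,_⟫
  field
    code   : List Stmt      -- what remains to be executed
    regs   : ℕ → ℕ
    mem    : ℕ → ℕ
    coins  : List Bool      -- coins not yet flipped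
    output : List ℕ
    clock  : ℕ              -- bit operations spent so far

open Config public

_[_≔_] : (ℕ → ℕ) → ℕ → ℕ → (ℕ → ℕ)
(f [ i ≔ x ]) j = if i ≡ᵇ j then x else f j

-- Number of binary digits, with bits 0 = 1.
bits : ℕ → ℕ
bits x = suc ⌊log₂ x ⌋

-- Every instruction costs at least one bit operation; a memory access is
-- charged for its address as well as for its content, and a multiplication
-- at the schoolbook rate.  A flip without coins left blocks forever.
step : Config → Config
step c@(⟪ [] , R , M , ω , o , t ⟫) = c
step ⟪ const r k ∷ p , R , M , ω , o , t ⟫ =
  ⟪ p , R [ r ≔ k ] , M , ω , o , t + bits k ⟫
step ⟪ add r a b ∷ p , R , M , ω , o , t ⟫ =
  ⟪ p , R [ r ≔ R a + R b ] , M , ω , o , t + (bits (R a) + bits (R b)) ⟫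
step ⟪ sub r a b ∷ p , R , M , ω , o , t ⟫ =
  ⟪ p , R [ r ≔ R a ∸ R b ] , M , ω , o , t + (bits (R a) + bits (R b)) ⟫
step ⟪ mul r a b ∷ p , R , M , ω , o , t ⟫ =
  ⟪ p , R [ r ≔ R a * R b ] , M , ω , o , t + bits (R a) * bits (R b) ⟫
step ⟪ half r a ∷ p , R , M , ω , o , t ⟫ =
  ⟪ p , R [ r ≔ ⌊ R a /2⌋ ] , M , ω , o , t + bits (R a) ⟫
step ⟪ load r a ∷ p , R , M , ω , o , t ⟫ =
  ⟪ p , R [ r ≔ M (R a) ] , M , ω , o , t + (bits (R a) + bits (M (R a))) ⟫
step ⟪ store a b ∷ p , R , M , ω , o , t ⟫ =
  ⟪ p , R , M [ R a ≔ R b ] , ω , o , t + (bits (R a) + bits (R b)) ⟫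
step c@(⟪ flip r ∷ p , R , M , [] , o , t ⟫) = c
step ⟪ flip r ∷ p , R , M , b ∷ ω , o , t ⟫ =
  ⟪ p , R [ r ≔ (if b then 1 else 0) ] , M , ω , o , t + 1 ⟫
step ⟪ emit a ∷ p , R , M , ω , o , t ⟫ =
  ⟪ p , R , M , ω , o ∷ʳ R a , t + bits (R a) ⟫
step ⟪ branch a p₁ p₂ ∷ p , R , M , ω , o , t ⟫ =
  ⟪ (if R a ≡ᵇ 0 then p₂ else p₁) ++ p , R , M , ω , o , t + bits (R a) ⟫
step ⟪ while a q ∷ p , R , M , ω , o , t ⟫ =
  ⟪ (if R a ≡ᵇ 0 then p else q ++ while a q ∷ p) , R , M , ω , o , t + bits (R a) ⟫

-- Row-major adjacency matrix at addresses 0 , … , n * n ∸ 1.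
inputMemory : ∀ {n} → Digraph n → ℕ → ℕ
inputMemory {n} G a with a <? n * n
... | no _     = 0
... | yes a<nn = let (u , v) = remQuot {n} n (fromℕ< a<nn) in
                 if adjacent G u v then 1 else 0

-- Register 0 initially holds n.
initial : ∀ {n m} → Program → Digraph n → Vec Bool m → Config
initial {n} p G ω = ⟪ p , (λ _ → 0) [ 0 ≔ n ] , inputMemory G , toList ω , [] , 0 ⟫

-- The configuration after t steps (constant from halting on).
run : ∀ {n m} → Program → Digraph n → Vec Bool m → ℕ → Config
run p G ω t = iterate step (initial p G ω) t

-- Each step of an unhalted, unblocked run advances the clock, so a run that
-- halts within t bit operations has halted after t steps.
HaltsWithin : ∀ {n m} → Program → Digraph n → Vec Bool m → ℕ → Set
HaltsWithin p G ω t = code (run p G ω t) ≡ [] × clock (run p G ω t) ≤ t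

-- An element of the field with 2 ^ d elements is stored as d bits, that is, as
-- a number below 2 ^ d.  The memory, including the input and all auxiliary
-- data, never exceeds s such elements; each of the constantly many
-- registers holds one more.
UsesSpace : ∀ {n m} → Program → Digraph n → Vec Bool m → (s d : ℕ) → Set
UsesSpace p G ω s d = ∀ t →
    (∀ r → regs (run p G ω t) r < 2 ^ d)
  × (∀ a → mem (run p G ω t) a < 2 ^ d)
  × (∀ a → s ≤ a → mem (run p G ω t) a ≡ 0)

-- An empty output reports that there is no even cycle; a nonempty
-- output is a claimed cycle, listed by the numbers of its vertices.
ReportsNone : List ℕ → Set
ReportsNone o = o ≡ []

Reports : ∀ {n} → List ℕ → List (Fin n) → Set
Reports o c = o ≡ map toℕ c

ReportsShortest : ∀ {n} → Digraph n → List ℕ → Set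
ReportsShortest G o = ∃[ c ] (Reports o c × IsShortestEvenCycle G c)

infix 4 _=O_ _=Õ_

_=O_ : (ℕ → ℕ) → (ℕ → ℕ) → Set
f =O g = ∃[ C ] ∃[ n₀ ] (∀ n → n₀ ≤ n → f n ≤ C * g n)

_=Õ_ : (ℕ → ℕ) → (ℕ → ℕ) → Set
f =Õ g = ∃[ k ] f =O (λ n → g n * ⌊log₂ n ⌋ ^ k)

_=O[1/n^_] : (ℕ → ℚ) → ℕ → Set
ε =O[1/n^ k ] = ∃[ C ] ∃[ n₀ ] (∀ n → .{{_ : NonZero n}} → n₀ ≤ n →
  ε n ≤ℚ _/_ (ℤ.+ C) (n ^ k) {{m^n≢0 n k}})

allCoins : ∀ m → List (Vec Bool m)
allCoins zero    = [] ∷ []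
allCoins (suc m) = map (false ∷_) (allCoins m) ++ map (true ∷_) (allCoins m)

Pr : ∀ m {P : Pred (Vec Bool m) 0ℓ} → Decidable P → ℚ
Pr m P? = _/_ (ℤ.+ length (filter P? (allCoins m))) (2 ^ m) {{m^n≢0 2 m}}

isCycle? : ∀ {n} (G : Digraph n) → Decidable (IsCycle G)
isCycle? G []       = no λ ()
isCycle? G (v ∷ vs) =
  DecUnique.unique? Fin._≟_ (v ∷ vs)
  ×-dec linked? (λ x y → adjacent G x y Bool.≟ true) (v ∷ vs ∷ʳ v)

isEvenCycle? : ∀ {n} (G : Digraph n) → Decidable (IsEvenCycle G)
isEvenCycle? G c = isCycle? G c ×-dec (2 ∣? length c)

allVec? : ∀ {n} k {P : Pred (Vec (Fin n) k) 0ℓ} → Decidable P → Dec (∀ v → P v)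
allVec? zero    P? = map′ (λ { p [] → p }) (λ f → f []) (P? [])
allVec? (suc k) P? = map′ (λ { f (x ∷ v) → f x v }) (λ f x v → f (x ∷ v))
  (all? λ x → allVec? k λ v → P? (x ∷ v))

isShortestEvenCycle? : ∀ {n} (G : Digraph n) → Decidable (IsShortestEvenCycle G)
isShortestEvenCycle? {n} G c = isEvenCycle? G c ×-dec map′ to from
  (allUpTo? {P = NoEvenCycleOfLength}
            (λ k → allVec? k (λ v → ¬? (isEvenCycle? G (toList v)))) (length c))
  where
  NoEvenCycleOfLength : ℕ → Set
  NoEvenCycleOfLength k = (v : Vec (Fin n) k) → ¬ IsEvenCycle G (toList v)

  to : (∀ {k} → k < length c → NoEvenCycleOfLength k) →
       ∀ c′ → IsEvenCycle G c′ → length c ≤ length c′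
  to h c′ e with length c ≤? length c′
  ... | yes l = l
  ... | no ¬l with () ← h (≰⇒> ¬l) (fromList c′)
                          (subst (IsEvenCycle G) (sym (toList∘fromList c′)) e)

  from : (∀ c′ → IsEvenCycle G c′ → length c ≤ length c′) →
         ∀ {k} → k < length c → NoEvenCycleOfLength k
  from h k< v e = <⇒≱ k< (subst (length c ≤_) (length-toList v) (h (toList v) e))

decodable? : ∀ n (o : List ℕ) → Dec (∃[ c ] Reports {n} o c)
decodable? n []      = yes ([] , refl)
decodable? n (x ∷ o) = map′
  (λ { (x<n , c , e) → fromℕ< x<n ∷ c , cong₂ _∷_ (sym (toℕ-fromℕ< x<n)) e })
  (λ { (v ∷ c , e) → subst (_< n) (sym (List.∷-injectiveˡ e)) (toℕ<n v)
                   , c , List.∷-injectiveʳ e })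
  ((x <? n) ×-dec decodable? n o)

reportsShortest? : ∀ {n} (G : Digraph n) → Decidable (ReportsShortest G)
reportsShortest? {n} G o with decodable? n o
... | no ¬d       = no λ { (c , e , _) → ¬d (c , e) }
... | yes (c , e) = map′
  (λ s → c , e , s)
  (λ { (c′ , e′ , s) → subst (IsShortestEvenCycle G)
         (map-injective toℕ-injective (trans (sym e′) e)) s })
  (isShortestEvenCycle? G c)

{-# OPTIONS --safe #-}
-- In characteristic two the permanent is the determinant, and if transpositions
-- get the sign 1 + η with η² = 0, the coefficient of η sums over the odd
-- permutations. For the matrix I + y W of a randomly weighted digraph the lowest
-- power of y in this sum belongs to the shortest even cycles, and by the
-- Schwartz–Zippel lemma its coefficient rarely vanishes. It is interpolated from
-- the values at several y, which rank one updates of the inverse matrices keep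
-- current while the arcs of one vertex after the other are pruned, until a
-- single shortest even cycle is left. All this is compiled to a RAM program.
module Submission where

open import Defs using (Digraph; adjacent; loopless; Arc; IsEvenCycle; isEvenCycle?; allCoins)
open import Data.Bool using (Bool; true; false; if_then_else_; _∧_; _xor_)
open import Data.Fin using (Fin; zero; suc; toℕ; fromℕ<; remQuot)
open import Data.List using (List; []; _∷_; _++_; _∷ʳ_; length; map; take; drop)
open import Data.List.Membership.Propositional using (_∈_; _∉_)
open import Data.List.Relation.Unary.All as All using (All; []; _∷_)
open import Data.List.Relation.Unary.AllPairs using ([]; _∷_)
open import Data.List.Relation.Unary.Any using (here; there)
open import Data.List.Relation.Unary.Linked as Linked using (Linked; []; [-]; _∷_)
open import Data.List.Relation.Unary.Unique.Propositional using (Unique)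
open import Data.Nat as ℕ using (ℕ; zero; suc; _<_; z≤n; s≤s; _∸_; _≤ᵇ_; _≡ᵇ_; _≤?_)
open import Data.Nat.Tactic.RingSolver using (solve-∀)
open import Data.Product using (∃-syntax; _×_; _,_; proj₁; proj₂)
open import Data.Sum as Sum using (_⊎_; inj₁; inj₂)
open import Data.Unit using (tt)
open import Data.Vec using (Vec; []; _∷_; toList; fromList)
open import Data.Vec.Properties using (length-toList; toList∘fromList)
open import Function using (_∘_)
open import Relation.Binary.PropositionalEquality using (_≡_; _≢_; refl; sym; trans; cong; cong₂; subst; subst₂; module ≡-Reasoning)
open import Relation.Nullary using (¬_; ¬?; Dec; yes; no; does; map′; contradiction)
open import Relation.Nullary.Decidable using (⌊_⌋)
open import Relation.Unary using (Pred; Decidable)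
import Data.Bool.Properties as Bool
import Data.Fin.Properties as Fin
import Data.List.Membership.DecPropositional as DecMembership
import Data.List.Relation.Unary.All.Properties as All
import Data.Nat.Properties as ℕ
import Relation.Binary.PropositionalEquality as ≡

infixr 6 _·_
infixr 5 _·≤_ _≡≤_ _≤≡_

_·_ : ∀ {a} {A : Set a} {x y z : A} → x ≡ y → y ≡ z → x ≡ z
_·_ = trans

_·≤_ : ∀ {l m n} → l ℕ.≤ m → m ℕ.≤ n → l ℕ.≤ n
_·≤_ = ℕ.≤-trans

_≡≤_ : ∀ {l m n} → l ≡ m → m ℕ.≤ n → l ℕ.≤ n
e ≡≤ h = ℕ.≤-reflexive e ·≤ h

_≤≡_ : ∀ {l m n} → l ℕ.≤ m → m ≡ n → l ℕ.≤ n
h ≤≡ e = h ·≤ ℕ.≤-reflexive e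

module BRing where
 open import Algebra.Bundles using (CommutativeRing; RawRing)
 open import Algebra.Structures using (IsCommutativeRing)
 open import Algebra.Solver.Ring.AlmostCommutativeRing using (AlmostCommutativeRing; fromCommutativeRing; _-Raw-AlmostCommutative⟶_)
 import Algebra.Solver.Ring as RingSolver
 import Algebra.Properties.Semiring.Sum as SemiringSum
 import Algebra.Properties.CommutativeMonoid.Sum as MonoidSum
 open import Data.Maybe using (Maybe; just; nothing)

 record BinaryRing : Set₁ where
  infixl 6 _+_
  infixl 7 _*_
  field
   Carrier : Set
   _+_ _*_ : Carrier → Carrier → Carrier
   0# 1# : Carrier
   isCommutativeRing : IsCommutativeRing _≡_ _+_ _*_ (λ x → x) 0# 1#

 module RingTheory (𝓡 : BinaryRing) where
  open BinaryRing 𝓡 public using (Carrier; isCommutativeRing)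

  commutativeRing : CommutativeRing _ _
  commutativeRing = record { isCommutativeRing = isCommutativeRing }

  open CommutativeRing commutativeRing public
   using (_+_; _*_; 0#; 1#; semiring; +-commutativeMonoid;
    +-assoc; +-comm; +-identityˡ; +-identityʳ; *-assoc; *-comm;
    *-identityˡ; *-identityʳ; distribˡ; distribʳ; zeroˡ; zeroʳ)

  x+x≡0 : ∀ x → x + x ≡ 0#
  x+x≡0 = CommutativeRing.-‿inverseʳ commutativeRing

  bit : Bool → Carrier
  bit b = if b then 1# else 0#

  private
   Coeff : RawRing _ _
   Coeff = record { Carrier = Bool ; _≈_ = _≡_ ; _+_ = _xor_ ; _*_ = _∧_ ; -_ = λ b → b ; 0# = false ; 1# = true }
   almost = fromCommutativeRing commutativeRing
   bit-+ : ∀ a b → bit (a xor b) ≡ bit a + bit b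
   bit-+ false b = sym (+-identityˡ _)
   bit-+ true false = sym (+-identityʳ _)
   bit-+ true true = sym (x+x≡0 _)
   bit-* : ∀ a b → bit (a ∧ b) ≡ bit a * bit b
   bit-* false b = sym (zeroˡ _)
   bit-* true b = sym (*-identityˡ _)
   morphism : Coeff -Raw-AlmostCommutative⟶ almost
   morphism = record
    { ⟦_⟧ = bit ; +-homo = bit-+ ; *-homo = bit-* ; -‿homo = λ _ → refl
    ; 0-homo = refl ; 1-homo = refl }
   decide : ∀ a b → Maybe (bit a ≡ bit b)
   decide a b with a Bool.≟ b
   ... | yes a≡b = just (cong bit a≡b)
   ... | no _ = nothing

  module Solver = RingSolver Coeff almost morphism decide
  open Solver public using (solve; _:=_; _:+_; _:*_; con)

  module ∑ = SemiringSum semiring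
  module ∑' = MonoidSum +-commutativeMonoid

  -- Abstract, so that unification can infer f from sum f.
  abstract
   sum : ∀ {n} → (Fin n → Carrier) → Carrier
   sum = ∑.sum
   sum-empty : (f : Fin 0 → Carrier) → sum f ≡ 0#
   sum-empty f = refl
   sum-suc : ∀ {n} (f : Fin (suc n) → Carrier) → sum f ≡ f zero + sum (λ i → f (suc i))
   sum-suc f = refl
   sum-cong-≗ : ∀ {n} {f g : Fin n → Carrier} → (∀ i → f i ≡ g i) → sum f ≡ sum g
   sum-cong-≗ = ∑.sum-cong-≗
   *-distribˡ-sum : ∀ {n} x (f : Fin n → Carrier) → x * sum f ≡ sum (λ i → x * f i)
   *-distribˡ-sum = ∑.*-distribˡ-sum
   *-distribʳ-sum : ∀ {n} x (f : Fin n → Carrier) → sum f * x ≡ sum (λ i → f i * x)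
   *-distribʳ-sum = ∑.*-distribʳ-sum
   ∑-distrib-+ : ∀ {n} (f g : Fin n → Carrier) → sum (λ i → f i + g i) ≡ sum f + sum g
   ∑-distrib-+ = ∑'.∑-distrib-+
   ∑-comm : ∀ {m n} (f : Fin m → Fin n → Carrier) → sum (λ i → sum (f i)) ≡ sum (λ j → sum λ i → f i j)
   ∑-comm = ∑'.∑-comm
   sum-zero : ∀ {n} (f : Fin n → Carrier) → (∀ i → f i ≡ 0#) → sum f ≡ 0#
   sum-zero {n} f f=0 = ∑.sum-cong-≗ f=0 · ∑.sum-replicate-zero n

  x+y≡0⇒x≡y : ∀ x y → x + y ≡ 0# → x ≡ y
  x+y≡0⇒x≡y x y e = solve 2 (λ x y → x := (x :+ y) :+ y) refl x y ·
   cong (_+ y) e · +-identityˡ y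

  sum-single : ∀ {n} (f : Fin n → Carrier) i → (∀ j → j ≢ i → f j ≡ 0#) → sum f ≡ f i
  sum-single f zero f=0 = sum-suc f · cong (f zero +_) (sum-zero _ λ j → f=0 (suc j) λ ()) · +-identityʳ _
  sum-single f (suc i) f=0 = sum-suc f · (cong₂ _+_ (f=0 zero λ ())
   (sum-single (λ j → f (suc j)) i λ j j#i → f=0 (suc j) λ { refl → j#i refl })) · +-identityˡ _

  δ : ∀ {n} → Fin n → Fin n → Carrier
  δ i j with i Fin.≟ j
  ... | yes _ = 1#
  ... | no _ = 0#

  δ-same : ∀ {n} (i : Fin n) → δ i i ≡ 1#
  δ-same i with i Fin.≟ i
  ... | yes _ = refl
  ... | no i#i = contradiction refl i#i

  δ-diff : ∀ {n} {i j : Fin n} → i ≢ j → δ i j ≡ 0#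
  δ-diff {i = i} {j} i#j with i Fin.≟ j
  ... | yes i≡j = contradiction i≡j i#j
  ... | no _ = refl

  δ-sym : ∀ {n} (i j : Fin n) → δ i j ≡ δ j i
  δ-sym i j with i Fin.≟ j
  ... | yes refl = sym (δ-same i)
  ... | no i#j = sym (δ-diff λ j≡i → i#j (sym j≡i))

  sum-δˡ : ∀ {n} i (f : Fin n → Carrier) → sum (λ j → δ i j * f j) ≡ f i
  sum-δˡ i f = (sum-single _ i λ j j#i → cong (_* f j) (δ-diff λ e → j#i (sym e)) · zeroˡ _) ·
   cong (_* f i) (δ-same i) · *-identityˡ _

  sum-δʳ : ∀ {n} i (f : Fin n → Carrier) → sum (λ j → f j * δ j i) ≡ f i
  sum-δʳ i f = (sum-cong-≗ λ j → *-comm _ _ · cong (_* f j) (δ-sym j i)) · sum-δˡ i f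

 -- R[η]/(η²), with a + b η represented by (a , b).
 dual : BinaryRing → BinaryRing
 dual 𝓡 = record
  { Carrier = Carrier × Carrier
  ; _+_ = λ (a , b) (c , d) → a + c , b + d
  ; _*_ = λ (a , b) (c , d) → a * c , a * d + b * c
  ; 0# = 0# , 0#
  ; 1# = 1# , 0#
  ; isCommutativeRing = record
   { isRing = record
    { +-isAbelianGroup = record
     { isGroup = record
      { isMonoid = record
       { isSemigroup = record
        { isMagma = record
         { isEquivalence = ≡.isEquivalence
         ; ∙-cong = cong₂ _ }
        ; assoc = λ _ _ _ → cong₂ _,_ (+-assoc _ _ _) (+-assoc _ _ _) }
       ; identity = (λ _ → cong₂ _,_ (+-identityˡ _) (+-identityˡ _))
        , (λ _ → cong₂ _,_ (+-identityʳ _) (+-identityʳ _)) }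
      ; inverse = (λ _ → cong₂ _,_ (x+x≡0 _) (x+x≡0 _)) , (λ _ → cong₂ _,_ (x+x≡0 _) (x+x≡0 _))
      ; ⁻¹-cong = λ e → e }
     ; comm = λ _ _ → cong₂ _,_ (+-comm _ _) (+-comm _ _) }
    ; *-cong = cong₂ _
    ; *-assoc = λ (a , b) (c , d) (e , f) → cong₂ _,_ (*-assoc _ _ _)
     (solve 6 (λ a b c d e f → (a :* c) :* f :+ (a :* d :+ b :* c) :* e
      := a :* (c :* f :+ d :* e) :+ b :* (c :* e)) refl a b c d e f)
    ; *-identity = (λ (a , b) → cong₂ _,_ (*-identityˡ _) (solve 2 (λ a b → con true :* b :+ con false :* a := b) refl a b))
     , (λ (a , b) → cong₂ _,_ (*-identityʳ _) (solve 2 (λ a b → a :* con false :+ b :* con true := b) refl a b))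
    ; distrib = (λ (a , b) (c , d) (e , f) → cong₂ _,_ (distribˡ _ _ _)
     (solve 6 (λ a b c d e f → a :* (d :+ f) :+ b :* (c :+ e)
      := (a :* d :+ b :* c) :+ (a :* f :+ b :* e)) refl a b c d e f))
     , (λ (a , b) (c , d) (e , f) → cong₂ _,_ (distribʳ _ _ _)
      (solve 6 (λ a b c d e f → (c :+ e) :* b :+ (d :+ f) :* a
       := (c :* b :+ d :* a) :+ (e :* b :+ f :* a)) refl a b c d e f)) }
   ; *-comm = λ (a , b) (c , d) → cong₂ _,_ (*-comm _ _)
    (solve 4 (λ a b c d → a :* d :+ b :* c := c :* b :+ d :* a) refl a b c d) } }
  where open RingTheory 𝓡

module DetS where
 open BRing public

 Mat : Set → ℕ → Set
 Mat A n = Fin n → Fin n → A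

 infixl 9 _[_←_]

 _[_←_] : ∀ {A : Set} {n} → Mat A n → Fin n → (Fin n → A) → Mat A n
 (A [ i ← r ]) j with j Fin.≟ i
 ... | yes _ = r
 ... | no _ = A j

 ←-same : ∀ {A : Set} {n} (M : Mat A n) i r k → (M [ i ← r ]) i k ≡ r k
 ←-same M i r k with i Fin.≟ i
 ... | yes _ = refl
 ... | no i#i = contradiction refl i#i

 ←-diff : ∀ {A : Set} {n} (M : Mat A n) {i j} r k → j ≢ i → (M [ i ← r ]) j k ≡ M j k
 ←-diff M {i} {j} r k j#i with j Fin.≟ i
 ... | yes j≡i = contradiction j≡i j#i
 ... | no _ = refl

 -- The sum over all permutations σ of s ^ (parity of σ) ∏I A i (σ i).  Every
 -- permutation is the composite of one fixing 0 with at most one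
 -- transposition (0 i), whence the recursion.
 module SignedPermanent (𝓡 : BinaryRing) (s : BinaryRing.Carrier 𝓡) (s*s≡1 : BinaryRing._*_ 𝓡 s s ≡ BinaryRing.1# 𝓡) where
  open RingTheory 𝓡

  private
   variable
    n : ℕ

  minor : Mat Carrier (suc n) → Mat Carrier n
  minor A i j = A (suc i) (suc j)

  top : Mat Carrier (suc n) → Fin n → Carrier
  top A j = A zero (suc j)

  D : Mat Carrier n → Carrier
  D {zero} A = 1#
  D {suc n} A = A zero zero * D (minor A) + s * sum (λ i → A (suc i) zero * D (minor A [ i ← top A ]))

  _≗₂_ : Mat Carrier n → Mat Carrier n → Set
  A ≗₂ B = ∀ i j → A i j ≡ B i j

  Agree : Fin n → Mat Carrier n → Mat Carrier n → Set
  Agree i A B = ∀ j k → j ≢ i → A j k ≡ B j k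

  Agree-minor : ∀ {i} {A B : Mat Carrier (suc n)} → Agree (suc i) A B → Agree i (minor A) (minor B)
  Agree-minor A~B j k j#i = A~B (suc j) (suc k) λ { refl → j#i refl }

  ←-cong : ∀ {A B : Mat Carrier n} {r r' : Fin n → Carrier} i →
   Agree i A B → (∀ k → r k ≡ r' k) → (A [ i ← r ]) ≗₂ (B [ i ← r' ])
  ←-cong i A~B r≗r' j k with j Fin.≟ i
  ... | yes _ = r≗r' k
  ... | no j#i = A~B j k j#i

  ←-agree : ∀ (A : Mat Carrier n) i r → Agree i (A [ i ← r ]) A
  ←-agree A i r j k = ←-diff A r k

  D-cong : {A B : Mat Carrier n} → A ≗₂ B → D A ≡ D B
  D-cong {zero} A≗B = refl
  D-cong {suc n} A≗B = cong₂ _+_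
   (cong₂ _*_ (A≗B zero zero) (D-cong λ i j → A≗B (suc i) (suc j)))
   (cong (s *_) (sum-cong-≗ λ i → cong₂ _*_ (A≗B (suc i) zero)
    (D-cong (←-cong i (λ j k _ → A≗B (suc j) (suc k)) λ k → A≗B zero (suc k)))))

  ←-self : ∀ (A : Mat Carrier n) i → (A [ i ← A i ]) ≗₂ A
  ←-self A i j k with j Fin.≟ i
  ... | yes refl = refl
  ... | no _ = refl

  ←-twice : ∀ (A : Mat Carrier n) i r r' → (A [ i ← r ] [ i ← r' ]) ≗₂ (A [ i ← r' ])
  ←-twice A i r r' = ←-cong i (←-agree A i r) (λ _ → refl)

  ←-comm : ∀ (A : Mat Carrier n) {i j} r r' → i ≢ j → (A [ i ← r ] [ j ← r' ]) ≗₂ (A [ j ← r' ] [ i ← r ])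
  ←-comm A {i} {j} r r' i#j k l with k Fin.≟ i | k Fin.≟ j
  ... | yes refl | yes refl = contradiction refl i#j
  ... | yes refl | no _ = ←-same A k r l
  ... | no _ | yes refl = sym (←-same A k r' l)
  ... | no k#i | no k#j = ←-diff A r l k#i · sym (←-diff A r' l k#j)

  Agree-← : ∀ {i} {A B : Mat Carrier n} {r r' : Fin n → Carrier} j →
   Agree i A B → (∀ k → r k ≡ r' k) → Agree i (A [ j ← r ]) (B [ j ← r' ])
  Agree-← j A~B r≗r' k l k#i with k Fin.≟ j
  ... | yes _ = r≗r' l
  ... | no _ = A~B k l k#i

  sum-linear : ∀ {m} {f g h : Fin m → Carrier} b c → (∀ i → f i ≡ b * g i + c * h i) →
   sum f ≡ b * sum g + c * sum h
  sum-linear {f = f} {g} {h} b c f≗ = begin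
   sum f ≡⟨ sum-cong-≗ f≗ ⟩
   sum (λ i → b * g i + c * h i) ≡⟨ ∑-distrib-+ (λ i → b * g i) (λ i → c * h i) ⟩
   sum (λ i → b * g i) + sum (λ i → c * h i) ≡⟨ cong₂ _+_ (sym (*-distribˡ-sum b g)) (sym (*-distribˡ-sum c h)) ⟩
   b * sum g + c * sum h ∎
   where open ≡-Reasoning

  D-linear : ∀ {A B C : Mat Carrier n} i b c → Agree i A B → Agree i A C →
   (∀ k → A i k ≡ b * B i k + c * C i k) → D A ≡ b * D B + c * D C
  D-linear {suc n} {A} {B} {C} zero b c A~B A~C Ai =
   combine (Ai zero)
    (D-cong λ i j → A~B (suc i) (suc j) λ ())
    (D-cong λ i j → A~C (suc i) (suc j) λ ())
    (sum-linear b c λ j → cong (A (suc j) zero *_) (D-linear j b c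
     (λ k l k#j → ←-diff (minor A) (top A) l k#j ·
      (A~B (suc k) (suc l) λ ()) · sym (←-diff (minor B) (top B) l k#j))
     (λ k l k#j → ←-diff (minor A) (top A) l k#j ·
      (A~C (suc k) (suc l) λ ()) · sym (←-diff (minor C) (top C) l k#j))
     λ k → ←-same (minor A) j _ k · Ai (suc k) ·
      cong₂ (λ x y → b * x + c * y) (sym (←-same (minor B) j _ k)) (sym (←-same (minor C) j _ k))) ·
     distrib (A (suc j) zero) b _ c _ ·
      cong₂ (λ x y → b * (x * D (minor B [ j ← top B ])) + c * (y * D (minor C [ j ← top C ])))
       (A~B (suc j) zero λ ()) (A~C (suc j) zero λ ()))
   where
   distrib = solve 5 (λ a b x c y → a :* (b :* x :+ c :* y) := b :* (a :* x) :+ c :* (a :* y)) refl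
   combine : ∀ {a a1 a2 d d1 d2 S S1 S2} → a ≡ b * a1 + c * a2 → d ≡ d1 → d ≡ d2 → S ≡ b * S1 + c * S2 →
    a * d + s * S ≡ b * (a1 * d1 + s * S1) + c * (a2 * d2 + s * S2)
   combine {a1 = a1} {a2} {d} {S1 = S1} {S2} refl refl refl refl =
    solve 8 (λ b c a1 a2 d S1 S2 s → (b :* a1 :+ c :* a2) :* d :+ s :* (b :* S1 :+ c :* S2)
     := b :* (a1 :* d :+ s :* S1) :+ c :* (a2 :* d :+ s :* S2)) refl b c a1 a2 d S1 S2 s
  D-linear {suc n} {A} {B} {C} (suc i) b c A~B A~C Ai =
   combine (A~B zero zero λ ()) (A~C zero zero λ ())
    (D-linear i b c (Agree-minor A~B) (Agree-minor A~C) (Ai ∘ suc))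
    (sum-linear b c term)
   where
   distrib = solve 5 (λ a b x c y → a :* (b :* x :+ c :* y) := b :* (a :* x) :+ c :* (a :* y)) refl
   combine : ∀ {a a1 a2 d d1 d2 S S1 S2} → a ≡ a1 → a ≡ a2 → d ≡ b * d1 + c * d2 → S ≡ b * S1 + c * S2 →
    a * d + s * S ≡ b * (a1 * d1 + s * S1) + c * (a2 * d2 + s * S2)
   combine {a} {d1 = d1} {d2} {S1 = S1} {S2} refl refl refl refl =
    solve 8 (λ b c a d1 d2 S1 S2 s → a :* (b :* d1 :+ c :* d2) :+ s :* (b :* S1 :+ c :* S2)
     := b :* (a :* d1 :+ s :* S1) :+ c :* (a :* d2 :+ s :* S2)) refl b c a d1 d2 S1 S2 s
   top≗ : ∀ {B} → Agree (suc i) A B → ∀ k → top A k ≡ top B k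
   top≗ A~B k = A~B zero (suc k) λ ()
   term : ∀ j → A (suc j) zero * D (minor A [ j ← top A ])
    ≡ b * (B (suc j) zero * D (minor B [ j ← top B ])) + c * (C (suc j) zero * D (minor C [ j ← top C ]))
   term j with j Fin.≟ i
   ... | yes refl = cong (_* D (minor A [ j ← top A ])) (Ai zero) ·
    solve 5 (λ b x c y d → (b :* x :+ c :* y) :* d := b :* (x :* d) :+ c :* (y :* d)) refl b _ c _ _ ·
     cong₂ (λ x y → b * (B (suc j) zero * x) + c * (C (suc j) zero * y))
      (D-cong (←-cong j (Agree-minor A~B) (top≗ A~B)))
      (D-cong (←-cong j (Agree-minor A~C) (top≗ A~C)))
   ... | no j#i = cong (A (suc j) zero *_) (D-linear i b c
    (Agree-← j (Agree-minor A~B) (top≗ A~B)) (Agree-← j (Agree-minor A~C) (top≗ A~C))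
    λ k → ←-diff (minor A) _ k (j#i ∘ sym) · Ai (suc k) ·
     cong₂ (λ x y → b * x + c * y) (sym (←-diff (minor B) _ k (j#i ∘ sym))) (sym (←-diff (minor C) _ k (j#i ∘ sym)))) ·
    distrib (A (suc j) zero) b _ c _ ·
     cong₂ (λ x y → b * (x * D (minor B [ j ← top B ])) + c * (y * D (minor C [ j ← top C ])))
      (A~B (suc j) zero λ { refl → j#i refl }) (A~C (suc j) zero λ { refl → j#i refl })

  D-zero-row : ∀ (A : Mat Carrier n) i → (∀ k → A i k ≡ 0#) → D A ≡ 0#
  D-zero-row A i Ai=0 = D-linear i 0# 0# (λ _ _ _ → refl) (λ _ _ _ → refl)
   (λ k → Ai=0 k · solve 1 (λ x → con Data.Bool.false := con Data.Bool.false :* x :+ con Data.Bool.false :* x) refl (A i k)) ·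
   solve 1 (λ x → con Data.Bool.false :* x :+ con Data.Bool.false :* x := con Data.Bool.false) refl (D A)
   where import Data.Bool

  D-row-sum : ∀ {m} (A : Mat Carrier n) i (c : Fin m → Carrier) (v : Fin m → Fin n → Carrier) →
   (∀ k → A i k ≡ sum λ l → c l * v l k) → D A ≡ sum (λ l → c l * D (A [ i ← v l ]))
  D-row-sum {m = zero} A i c v Ai = (D-zero-row A i λ k → Ai k · sum-empty _) · sym (sum-empty _)
  D-row-sum {m = suc m} A i c v Ai = D-linear i (c zero) 1# (λ j k j#i → sym (←-diff A _ k j#i)) (λ j k j#i → sym (←-diff A _ k j#i))
   (λ k → Ai k · sum-suc _ · (cong₂ _+_ (cong (c zero *_) (sym (←-same A i _ k)))
    (sym (*-identityˡ _) · cong (1# *_) (sym (←-same A i rest k))))) ·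
   cong (c zero * D (A [ i ← v zero ]) +_) (*-identityˡ _ ·
    D-row-sum (A [ i ← rest ]) i (c ∘ suc) (v ∘ suc) (←-same A i rest) ·
     (sum-cong-≗ λ l → cong (c (suc l) *_) (D-cong (←-twice A i rest (v (suc l)))))) ·
    sym (sum-suc _)
   where
   rest : _ → Carrier
   rest k = sum (λ l → c (suc l) * v (suc l) k)

  record Swapped (i k : Fin n) (A B : Mat Carrier n) : Set where
   constructor swapped
   field
    i#k : i ≢ k
    row-i : ∀ l → B i l ≡ A k l
    row-k : ∀ l → B k l ≡ A i l
    other : ∀ j l → j ≢ i → j ≢ k → B j l ≡ A j l

  sum-swap : ∀ {m} (f g : Fin m → Carrier) {i k} → i ≢ k → g i ≡ f k → g k ≡ f i →
   (∀ j → j ≢ i → j ≢ k → g j ≡ f j) → sum g ≡ sum f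
  sum-swap f g {i} {k} i#k gi gk g≗ = begin
   sum g ≡⟨ sum-cong-≗ pointwise ⟩
   sum (λ j → f j + (δ i j * e + δ k j * e)) ≡⟨ ∑-distrib-+ f _ ⟩
   sum f + sum (λ j → δ i j * e + δ k j * e) ≡⟨ cong (sum f +_) (∑-distrib-+ (λ j → δ i j * e) λ j → δ k j * e) ⟩
   sum f + (sum (λ j → δ i j * e) + sum λ j → δ k j * e) ≡⟨ cong (sum f +_) (cong₂ _+_ (sum-δˡ i λ _ → e) (sum-δˡ k λ _ → e)) ⟩
   sum f + (e + e) ≡⟨ cong (sum f +_) (x+x≡0 e) · +-identityʳ _ ⟩
   sum f ∎
   where
   open ≡-Reasoning
   e = f i + f k
   pointwise : ∀ j → g j ≡ f j + (δ i j * e + δ k j * e)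
   pointwise j with j Fin.≟ i | j Fin.≟ k
   ... | yes refl | _ = gi · solve 2 (λ x y → y := x :+ (con true :* (x :+ y) :+ con false :* (x :+ y))) refl (f i) (f k) ·
    cong₂ (λ x y → f i + (x * e + y * e)) (sym (δ-same i)) (sym (δ-diff (i#k ∘ sym)))
   ... | no _ | yes refl = gk · solve 2 (λ x y → x := y :+ (con false :* (x :+ y) :+ con true :* (x :+ y))) refl (f i) (f k) ·
    cong₂ (λ x y → f k + (x * e + y * e)) (sym (δ-diff i#k)) (sym (δ-same k))
   ... | no j#i | no j#k = g≗ j j#i j#k · solve 2 (λ x y → x := x :+ (con false :* y :+ con false :* y)) refl (f j) e ·
    cong₂ (λ x y → f j + (x * e + y * e)) (sym (δ-diff (j#i ∘ sym))) (sym (δ-diff (j#k ∘ sym)))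

  sum-except : ∀ {m} (f g : Fin m → Carrier) c k → (∀ j → j ≢ k → g j ≡ c * f j) →
   sum g ≡ g k + c * (sum f + f k)
  sum-except f g c k g≗ = begin
   sum g ≡⟨ sum-cong-≗ pointwise ⟩
   sum (λ j → c * f j + 1# * (δ k j * (g k + c * f k))) ≡⟨ sum-linear {g = f} {h = λ j → δ k j * (g k + c * f k)} c 1# (λ _ → refl) ⟩
   c * sum f + 1# * sum (λ j → δ k j * (g k + c * f k)) ≡⟨ cong (λ x → c * sum f + 1# * x) (sum-δˡ k λ _ → g k + c * f k) ⟩
   c * sum f + 1# * (g k + c * f k) ≡⟨ solve 4 (λ c S gk fk → c :* S :+ con true :* (gk :+ c :* fk) := gk :+ c :* (S :+ fk)) refl c (sum f) (g k) (f k) ⟩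
   g k + c * (sum f + f k) ∎
   where
   open ≡-Reasoning
   pointwise : ∀ j → g j ≡ c * f j + 1# * (δ k j * (g k + c * f k))
   pointwise j with j Fin.≟ k
   ... | yes refl = solve 2 (λ x y → x := y :+ con true :* (con true :* (x :+ y))) refl (g k) (c * f k) ·
    cong (λ x → c * f k + 1# * (x * (g k + c * f k))) (sym (δ-same k))
   ... | no j#k = g≗ j j#k · solve 2 (λ x y → y := y :+ con true :* (con false :* x)) refl (g k + c * f k) (c * f j) ·
    cong (λ x → c * f j + 1# * (x * (g k + c * f k))) (sym (δ-diff (j#k ∘ sym)))

  private
   combine-swap : ∀ {a b a' b' S S'} → a ≡ a' → b ≡ s * b' → S ≡ s * S' →
    a * b + s * S ≡ s * (a' * b' + s * S')
   combine-swap {a} {b' = b'} {S' = S'} refl refl refl =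
    solve 4 (λ a b s S → a :* (s :* b) :+ s :* (s :* S) := s :* (a :* b :+ s :* S)) refl a b' s S'
   SwapLaw : ℕ → Set
   SwapLaw n = ∀ {A B : Mat Carrier n} {i k} → Swapped i k A B → D B ≡ s * D A
   D-swap₀ : SwapLaw n → ∀ {A B : Mat Carrier (suc n)} {k} → Swapped zero (suc k) A B → D B ≡ s * D A

  D-swap : SwapLaw n
  D-swap {i = zero} {zero} (swapped i#k _ _ _) = contradiction refl i#k
  D-swap {suc n} {A} {B} {suc i} {suc k} (swapped i#k row-i row-k other) =
   combine-swap (other zero zero (λ ()) λ ())
    (D-swap (swapped i#k' (row-i ∘ suc) (row-k ∘ suc)
     λ j l j#i j#k → other (suc j) (suc l) (suc≢ j#i) (suc≢ j#k)))
    ((sum-swap (λ j → s * f j) g i#k' (term i k row-i row-k other i#k') (term k i row-k row-i (λ j l p q → other j l q p) (i#k' ∘ sym))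
     λ j j#i j#k → (cong₂ _*_ (other (suc j) zero (suc≢ j#i) (suc≢ j#k)) (D-swap (swapped i#k'
      (λ l → ←-diff (minor B) _ l (j#i ∘ sym) · row-i (suc l) · sym (←-diff (minor A) _ l (j#k ∘ sym)))
      (λ l → ←-diff (minor B) _ l (j#k ∘ sym) · row-k (suc l) · sym (←-diff (minor A) _ l (j#i ∘ sym)))
      λ m l m#i m#k → ←-cong' j m l (other (suc m) (suc l) (suc≢ m#i) (suc≢ m#k)) (other zero (suc l) (λ ()) λ ())))) ·
      solve 3 (λ a s d → a :* (s :* d) := s :* (a :* d)) refl (A (suc j) zero) s _) ·
     sym (*-distribˡ-sum s f))
   where
   i#k' : i ≢ k
   i#k' refl = i#k refl
   suc≢ : ∀ {j l : Fin n} → j ≢ l → suc j ≢ suc l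
   suc≢ j#l refl = j#l refl
   f g : Fin n → Carrier
   f j = A (suc j) zero * D (minor A [ j ← top A ])
   g j = B (suc j) zero * D (minor B [ j ← top B ])
   ←-cong' : ∀ j m l → B (suc m) (suc l) ≡ A (suc m) (suc l) → B zero (suc l) ≡ A zero (suc l) →
    (minor B [ j ← top B ]) m l ≡ (minor A [ j ← top A ]) m l
   ←-cong' j m l e1 e2 with m Fin.≟ j
   ... | yes _ = e2
   ... | no _ = e1
   term : ∀ i k → (∀ l → B (suc i) l ≡ A (suc k) l) → (∀ l → B (suc k) l ≡ A (suc i) l) →
    (∀ j l → j ≢ suc i → j ≢ suc k → B j l ≡ A j l) → i ≢ k → g i ≡ s * f k
   term i k row-i row-k other i#k = cong₂ _*_ (row-i zero) (D-swap (swapped i#k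
    (λ l → ←-same (minor B) i _ l · other zero (suc l) (λ ()) (λ ()) · sym (←-same (minor A) k _ l))
    (λ l → ←-diff (minor B) _ l (i#k ∘ sym) · row-k (suc l) · sym (←-diff (minor A) _ l i#k))
    λ m l m#i m#k → ←-diff (minor B) _ l m#i ·
     other (suc m) (suc l) (suc≢ m#i) (suc≢ m#k) · sym (←-diff (minor A) _ l m#k))) ·
    solve 3 (λ a s d → a :* (s :* d) := s :* (a :* d)) refl (A (suc k) zero) s _
  D-swap {i = zero} {suc k} sw = D-swap₀ D-swap sw
  D-swap {i = suc i} {zero} (swapped i#k row-i row-k other) =
   D-swap₀ D-swap (swapped (i#k ∘ sym) row-k row-i λ j l p q → other j l q p)

  D-swap₀ {n} rec {A} {B} {k} (swapped i#k row-i row-k other) = begin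
   B zero zero * D (minor B) + s * sum g ≡⟨ cong₂ (λ x y → x + s * y) (cong₂ _*_ (row-i zero) (D-cong minorB)) (sum-except f g s k g≗) ⟩
   f k + s * (g k + s * (sum f + f k)) ≡⟨ solve 4 (λ x y S s → x :+ s :* (y :+ s :* (S :+ x)) := x :+ s :* y :+ (s :* s) :* (S :+ x)) refl (f k) (g k) (sum f) s ⟩
   f k + s * g k + (s * s) * (sum f + f k) ≡⟨ cong (λ x → f k + s * g k + x * (sum f + f k)) s*s≡1 ⟩
   f k + s * g k + 1# * (sum f + f k) ≡⟨ solve 4 (λ x y S s → x :+ s :* y :+ con true :* (S :+ x) := s :* y :+ con true :* S) refl (f k) (g k) (sum f) s ⟩
   s * g k + 1# * sum f ≡⟨ cong₂ (λ x y → s * x + y * sum f) gk (sym s*s≡1) ⟩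
   s * (A zero zero * D (minor A)) + s * s * sum f ≡⟨ solve 3 (λ x S s → s :* x :+ s :* s :* S := s :* (x :+ s :* S)) refl (A zero zero * D (minor A)) (sum f) s ⟩
   s * D A ∎
   where
   open ≡-Reasoning
   f g : Fin n → Carrier
   f j = A (suc j) zero * D (minor A [ j ← top A ])
   g j = B (suc j) zero * D (minor B [ j ← top B ])
   other' : ∀ j l → j ≢ k → B (suc j) l ≡ A (suc j) l
   other' j l j#k = other (suc j) l (λ ()) λ { refl → j#k refl }
   minorB : minor B ≗₂ (minor A [ k ← top A ])
   minorB j l with j Fin.≟ k
   ... | yes refl = row-k (suc l)
   ... | no j#k = other' j (suc l) j#k
   gk = cong₂ _*_ (row-k zero) (D-cong λ j l → ←-cong k (λ j l j#k → other' j (suc l) j#k) (λ l → row-i (suc l)) j l · ←-self (minor A) k j l)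
   g≗ : ∀ j → j ≢ k → g j ≡ s * f j
   g≗ j j#k = cong₂ _*_ (other' j zero j#k) (rec (swapped j#k
    (λ l → ←-same (minor B) j _ l · row-i (suc l) · sym (←-diff (minor A) _ l (j#k ∘ sym)))
    (λ l → ←-diff (minor B) _ l (j#k ∘ sym) · row-k (suc l) · sym (←-same (minor A) j _ l))
    λ m l m#j m#k → ←-diff (minor B) _ l m#j · other' m (suc l) m#k · sym (←-diff (minor A) _ l m#j))) ·
    solve 3 (λ a s d → a :* (s :* d) := s :* (a :* d)) refl (A (suc j) zero) s _

  private
   D-terms-zero : (A : Mat Carrier (suc n)) → A zero zero * D (minor A) ≡ 0# →
    (∀ j → A (suc j) zero * D (minor A [ j ← top A ]) ≡ 0#) → D A ≡ 0#
   D-terms-zero A e f = cong₂ (λ x y → x + s * y) e (sum-zero _ f) · +-identityˡ _ · zeroʳ s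
   0*_ : ∀ {x} y → x ≡ 0# → x * y ≡ 0#
   (0* y) refl = zeroˡ y
   _*0 : ∀ x {y} → y ≡ 0# → x * y ≡ 0#
   (x *0) refl = zeroʳ x
   UnitRowsLaw : ℕ → Set
   UnitRowsLaw n = ∀ (A : Mat Carrier n) {i k} c → i ≢ k →
    (∀ j → j ≢ c → A i j ≡ 0#) → (∀ j → j ≢ c → A k j ≡ 0#) → D A ≡ 0#
   D-parallel-unit-rows₀ : UnitRowsLaw n → ∀ (A : Mat Carrier (suc n)) {k} c →
    (∀ j → j ≢ c → A zero j ≡ 0#) → (∀ j → j ≢ c → A (suc k) j ≡ 0#) → D A ≡ 0#

  D-parallel-unit-rows : UnitRowsLaw n
  D-parallel-unit-rows A {zero} {zero} c i#k _ _ = contradiction refl i#k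
  D-parallel-unit-rows {suc n} A {suc i} {suc k} c i#k Ai Ak = by-column c Ai Ak
   where
   i#k' : i ≢ k
   i#k' refl = i#k refl
   by-column : ∀ c → (∀ j → j ≢ c → A (suc i) j ≡ 0#) → (∀ j → j ≢ c → A (suc k) j ≡ 0#) → D A ≡ 0#
   by-column zero Ai Ak = D-terms-zero A ((_ *0) (D-zero-row (minor A) i λ l → Ai (suc l) λ ())) λ j → (_ *0) (term j)
    where
    term : ∀ j → D (minor A [ j ← top A ]) ≡ 0#
    term j with i Fin.≟ j
    ... | no i#j = D-zero-row _ i λ l → ←-diff (minor A) _ l i#j · (Ai (suc l) λ ())
    ... | yes refl = D-zero-row _ k λ l → ←-diff (minor A) _ l (i#k' ∘ sym) · (Ak (suc l) λ ())
   by-column (suc c) Ai Ak = D-terms-zero A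
    ((_ *0) (D-parallel-unit-rows (minor A) c i#k' (λ j j#c → Ai (suc j) (suc≢ j#c)) λ j j#c → Ak (suc j) (suc≢ j#c))) term
    where
    suc≢ : ∀ {j} → j ≢ c → suc j ≢ suc c
    suc≢ j#c refl = j#c refl
    term : ∀ j → A (suc j) zero * D (minor A [ j ← top A ]) ≡ 0#
    term j with j Fin.≟ i | j Fin.≟ k
    ... | yes refl | _ = (0* _) (Ai zero λ ())
    ... | no _ | yes refl = (0* _) (Ak zero λ ())
    ... | no j#i | no j#k = (_ *0) (D-parallel-unit-rows _ c i#k'
     (λ l l#c → ←-diff (minor A) _ l (j#i ∘ sym) · Ai (suc l) (suc≢ l#c))
     λ l l#c → ←-diff (minor A) _ l (j#k ∘ sym) · Ak (suc l) (suc≢ l#c))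
  D-parallel-unit-rows A {zero} {suc k} c _ Ai Ak = D-parallel-unit-rows₀ D-parallel-unit-rows A c Ai Ak
  D-parallel-unit-rows A {suc i} {zero} c _ Ai Ak = D-parallel-unit-rows₀ D-parallel-unit-rows A c Ak Ai

  D-parallel-unit-rows₀ rec A {k} zero Ai Ak = D-terms-zero A
   ((_ *0) (D-zero-row (minor A) k λ l → Ak (suc l) λ ()))
   λ j → (_ *0) (D-zero-row _ j λ l → ←-same (minor A) j _ l · (Ai (suc l) λ ()))
  D-parallel-unit-rows₀ {n} rec A {k} (suc c) Ai Ak = D-terms-zero A ((0* _) (Ai zero λ ())) term
   where
   suc≢ : ∀ {j} → j ≢ c → suc j ≢ suc c
   suc≢ j#c refl = j#c refl
   term : ∀ j → A (suc j) zero * D (minor A [ j ← top A ]) ≡ 0#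
   term j with j Fin.≟ k
   ... | yes refl = (0* _) (Ak zero λ ())
   ... | no j#k = (_ *0) (rec _ c j#k
    (λ l l#c → ←-same (minor A) j _ l · Ai (suc l) (suc≢ l#c))
    λ l l#c → ←-diff (minor A) _ l (j#k ∘ sym) · Ak (suc l) (suc≢ l#c))

  D-identity : D {n} δ ≡ 1#
  D-identity {zero} = refl
  D-identity {suc n} = cong₂ (λ x y → 1# * x + s * y) (D-cong δ-suc · D-identity {n}) (sum-zero {n} _ λ j → zeroˡ (D (minor δ [ j ← top (δ {suc n}) ]))) ·
   solve 1 (λ s → con true :* con true :+ s :* con false := con true) refl s
   where
   δ-suc : ∀ i j → δ (suc i) (suc j) ≡ δ {n} i j
   δ-suc i j with i Fin.≟ j
   ... | yes _ = refl
   ... | no _ = refl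

module RowUpd where
 open DetS public

 -- With the sign s = 1 + η of a transposition, the coefficient of η in the
 -- signed permanent is the sum over the odd permutations, and the constant
 -- coefficient is the determinant (in characteristic two, also the permanent).
 module OddPermutations (𝓡 : BinaryRing) where
  open RingTheory 𝓡

  private
   variable
    n : ℕ
   module Dual = RingTheory (dual 𝓡)

  s = 1# , 1#

  s*s≡1 = cong₂ _,_ (*-identityˡ 1#) (x+x≡0 (1# * 1#))

  module P = SignedPermanent (dual 𝓡) s s*s≡1

  lift : Mat Carrier n → Mat (Carrier × Carrier) n
  lift A i j = A i j , 0#

  Det Odd : Mat Carrier n → Carrier
  Det A = proj₁ (P.D (lift A))
  Odd A = proj₂ (P.D (lift A))

  private
   lift-← : ∀ (A : Mat Carrier n) i r → (lift (A [ i ← r ])) P.≗₂ (lift A [ i ← (λ k → r k , 0#) ])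
   lift-← A i r j k with j Fin.≟ i
   ... | yes _ = refl
   ... | no _ = refl
   proj₁-sum : ∀ {m} (f : Fin m → Carrier × Carrier) → proj₁ (Dual.sum f) ≡ sum (proj₁ ∘ f)
   proj₁-sum {zero} f = cong proj₁ (Dual.sum-empty f) · sym (sum-empty _)
   proj₁-sum {suc m} f = cong proj₁ (Dual.sum-suc f) · cong (proj₁ (f zero) +_) (proj₁-sum (f ∘ suc)) · sym (sum-suc _)
   proj₂-sum : ∀ {m} (f : Fin m → Carrier × Carrier) → proj₂ (Dual.sum f) ≡ sum (proj₂ ∘ f)
   proj₂-sum {zero} f = cong proj₂ (Dual.sum-empty f) · sym (sum-empty _)
   proj₂-sum {suc m} f = cong proj₂ (Dual.sum-suc f) · cong (proj₂ (f zero) +_) (proj₂-sum (f ∘ suc)) · sym (sum-suc _)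
   scaleˡ : ∀ a e o → (a , 0#) Dual.* (e , o) ≡ (a * e , a * o)
   scaleˡ a e o = cong (a * e ,_) (solve 3 (λ a e o → a :* o :+ con false :* e := a :* o) refl a e o)
   _≗ᵣ_ : Mat Carrier n → Mat Carrier n → Set
   A ≗ᵣ B = ∀ i j → A i j ≡ B i j

  D-cong' : {A B : Mat Carrier n} → A ≗ᵣ B → P.D (lift A) ≡ P.D (lift B)
  D-cong' A≗B = P.D-cong λ i j → cong (_, 0#) (A≗B i j)

  Det-cong Odd-cong : {A B : Mat Carrier n} → A ≗ᵣ B → _
  Det-cong {A = A} {B} A≗B = cong proj₁ (D-cong' {A = A} {B} A≗B)
  Odd-cong {A = A} {B} A≗B = cong proj₂ (D-cong' {A = A} {B} A≗B)

  D-linear' : ∀ {A B C : Mat Carrier n} i b c → (∀ j k → j ≢ i → A j k ≡ B j k) → (∀ j k → j ≢ i → A j k ≡ C j k) →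
   (∀ k → A i k ≡ b * B i k + c * C i k) →
   Det A ≡ b * Det B + c * Det C × Odd A ≡ b * Odd B + c * Odd C
  D-linear' {A = A} {B} {C} i b c A~B A~C Ai = cong proj₁ e , cong proj₂ e
   where
   e = P.D-linear i (b , 0#) (c , 0#) (λ j k p → cong (_, 0#) (A~B j k p)) (λ j k p → cong (_, 0#) (A~C j k p))
    (λ k → cong (_, 0#) (Ai k) · (cong₂ _,_ refl
     (solve 4 (λ b x c y → con false := b :* con false :+ con false :* x :+ (c :* con false :+ con false :* y)) refl b _ c _))) ·
    cong₂ Dual._+_ (scaleˡ b _ _) (scaleˡ c _ _)

  D-row-sum' : ∀ {m} (A : Mat Carrier n) i (c : Fin m → Carrier) (v : Fin m → Fin n → Carrier) →
   (∀ k → A i k ≡ sum λ l → c l * v l k) →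
   Det A ≡ sum (λ l → c l * Det (A [ i ← v l ])) × Odd A ≡ sum (λ l → c l * Odd (A [ i ← v l ]))
  D-row-sum' A i c v Ai =
   cong proj₁ e · proj₁-sum _ · (sum-cong-≗ λ l → cong (c l *_) (cong proj₁ (sym (P.D-cong (lift-← A i (v l))))))
   , cong proj₂ e · proj₂-sum _ · (sum-cong-≗ λ l → cong proj₂ (scaleˡ (c l) _ _) ·
    cong (c l *_) (cong proj₂ (sym (P.D-cong (lift-← A i (v l))))))
   where
   e = P.D-row-sum (lift A) i (λ l → c l , 0#) (λ l k → v l k , 0#) λ k → cong (_, 0#) (Ai k) ·
    (cong₂ _,_ (sym (proj₁-sum _))
     (sym (proj₂-sum (λ l → (c l , 0#) Dual.* (v l k , 0#)) · (sum-zero _ λ l →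
      solve 2 (λ c x → c :* con false :+ con false :* x := con false) refl (c l) (v l k)))))

  record Swapped (i k : Fin n) (A B : Mat Carrier n) : Set where
   constructor swapped
   field
    i#k : i ≢ k
    row-i : ∀ l → B i l ≡ A k l
    row-k : ∀ l → B k l ≡ A i l
    other : ∀ j l → j ≢ i → j ≢ k → B j l ≡ A j l

  D-swap' : ∀ {A B : Mat Carrier n} {i k} → Swapped i k A B → Det B ≡ Det A × Odd B ≡ Odd A + Det A
  D-swap' {A = A} {B} (swapped i#k ri rk o) = cong proj₁ e · *-identityˡ _
   , cong proj₂ e · solve 2 (λ o d → con true :* o :+ con true :* d := o :+ d) refl (Odd A) (Det A)
   where
   e = P.D-swap {A = lift A} {lift B} (P.swapped i#k (λ l → cong (_, 0#) (ri l)) (λ l → cong (_, 0#) (rk l))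
    λ j l p q → cong (_, 0#) (o j l p q))

  Det-equal-rows : ∀ (A : Mat Carrier n) {i k} → i ≢ k → (∀ l → A i l ≡ A k l) → Det A ≡ 0#
  Det-equal-rows A {i} {k} i#k e = solve 2 (λ o d → d := o :+ (o :+ d)) refl (Odd A) (Det A) ·
   cong (Odd A +_) (sym (proj₂ (D-swap' {A = A} {A} (swapped i#k e (λ l → sym (e l)) λ _ _ _ _ → refl)))) ·
    x+x≡0 (Odd A)

  Odd-parallel-unit-rows : ∀ (A : Mat Carrier n) {i k} c → i ≢ k →
   (∀ j → j ≢ c → A i j ≡ 0#) → (∀ j → j ≢ c → A k j ≡ 0#) → Odd A ≡ 0#
  Odd-parallel-unit-rows A c i#k Ai Ak = cong proj₂
   (P.D-parallel-unit-rows (lift A) c i#k (λ j p → cong (_, 0#) (Ai j p)) λ j p → cong (_, 0#) (Ak j p))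

  D-δ : P.D (lift {n} δ) ≡ (1# , 0#)
  D-δ {n} = P.D-cong lift-δ · P.D-identity {n}
   where
   lift-δ : lift {n} δ P.≗₂ Dual.δ
   lift-δ i j with i Fin.≟ j
   ... | yes _ = refl
   ... | no _ = refl

  Odd-zero-row : ∀ (A : Mat Carrier n) i → (∀ k → A i k ≡ 0#) → Odd A ≡ 0#
  Odd-zero-row A i Ai = cong proj₂ (P.D-zero-row (lift A) i λ k → cong (_, 0#) (Ai k))

  record Inverses (A N : Mat Carrier n) : Set where
   field
    AN : ∀ i j → sum (λ k → A i k * N k j) ≡ δ i j
    NA : ∀ i j → sum (λ k → N i k * A k j) ≡ δ i j

  quadratic-unique : (Q Q' : (Fin n → Carrier) → Carrier) (B : (Fin n → Carrier) → (Fin n → Carrier) → Carrier) →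
   (∀ {r r'} → (∀ k → r k ≡ r' k) → Q r ≡ Q r') → (∀ {r r'} → (∀ k → r k ≡ r' k) → Q' r ≡ Q' r') →
   (∀ r r' → Q (λ k → r k + r' k) ≡ Q r + Q r' + B r r') →
   (∀ r r' → Q' (λ k → r k + r' k) ≡ Q' r + Q' r' + B r r') →
   (∀ c l → Q (λ k → c * δ l k) ≡ 0#) → (∀ c l → Q' (λ k → c * δ l k) ≡ 0#) →
   Q (λ _ → 0#) ≡ 0# → Q' (λ _ → 0#) ≡ 0# →
   ∀ r → Q r ≡ Q' r
  quadratic-unique {n} Q Q' B Q-cong Q'-cong Q-polar Q'-polar Q-unit Q'-unit Q-0 Q'-0 r = begin
   Q r ≡⟨ Q-cong (λ k → sym (sum-δʳ k r)) ⟩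
   Q (λ k → sum λ l → r l * δ l k) ≡⟨ go r (λ l → l) ⟩
   Q' (λ k → sum λ l → r l * δ l k) ≡⟨ Q'-cong (λ k → sum-δʳ k r) ⟩
   Q' r ∎
   where
   open ≡-Reasoning
   go : ∀ {m} (c : Fin m → Carrier) (e : Fin m → Fin n) →
    Q (λ k → sum λ l → c l * δ (e l) k) ≡ Q' (λ k → sum λ l → c l * δ (e l) k)
   go {zero} c e = (Q-cong λ k → sum-empty _) · Q-0 · sym Q'-0 · (Q'-cong λ k → sym (sum-empty _))
   go {suc m} c e = (Q-cong λ k → sum-suc _) · Q-polar _ _ · cong₂ (λ x y → x + y + _) (Q-unit (c zero) (e zero) · sym (Q'-unit (c zero) (e zero))) (go (c ∘ suc) (e ∘ suc)) ·
    sym (Q'-polar _ _) · (Q'-cong λ k → sym (sum-suc _))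

  module _ {A N : Mat Carrier n} (inverses : Inverses A N) where
   open Inverses inverses
   open ≡-Reasoning
   coord : (Fin n → Carrier) → Fin n → Carrier
   coord r l = sum (λ k → r k * N k l)
   expand : ∀ r k → r k ≡ sum (λ l → coord r l * A l k)
   expand r k = sym (begin
    sum (λ l → sum (λ j → r j * N j l) * A l k) ≡⟨ sum-cong-≗ (λ l → *-distribʳ-sum (A l k) λ j → r j * N j l) ⟩
    sum (λ l → sum λ j → r j * N j l * A l k) ≡⟨ ∑-comm (λ l j → r j * N j l * A l k) ⟩
    sum (λ j → sum λ l → r j * N j l * A l k) ≡⟨ sum-cong-≗ (λ j → (sum-cong-≗ λ l → *-assoc (r j) (N j l) (A l k)) ·
     sym (*-distribˡ-sum (r j) λ l → N j l * A l k)) ⟩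
    sum (λ j → r j * sum λ l → N j l * A l k) ≡⟨ sum-cong-≗ (λ j → cong (r j *_) (NA j k)) ⟩
    sum (λ j → r j * δ j k) ≡⟨ sum-δʳ k r ⟩
    r k ∎)
   Det-replace : ∀ i r → Det (A [ i ← r ]) ≡ coord r i * Det A
   Det-replace i r = begin
    Det (A [ i ← r ]) ≡⟨ proj₁ (D-row-sum' (A [ i ← r ]) i (coord r) A
     λ k → ←-same A i r k · expand r k) ⟩
    sum (λ l → coord r l * Det (A [ i ← r ] [ i ← A l ])) ≡⟨ sum-single _ i other ⟩
    coord r i * Det (A [ i ← r ] [ i ← A i ]) ≡⟨ cong (coord r i *_) (Det-cong λ j k → P-twice j k · P-self j k) ⟩
    coord r i * Det A ∎
    where
    P-twice = λ {v} → SP.←-twice A i r v where module SP = SignedPermanent 𝓡 1# (*-identityˡ 1#)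
    P-self = SP.←-self A i where module SP = SignedPermanent 𝓡 1# (*-identityˡ 1#)
    other : ∀ l → l ≢ i → coord r l * Det (A [ i ← r ] [ i ← A l ]) ≡ 0#
    other l l#i = cong (coord r l *_) (Det-equal-rows (A [ i ← r ] [ i ← A l ]) (l#i ∘ sym)
     λ k → ←-same (A [ i ← r ]) i (A l) k · sym (←-diff (A [ i ← r ]) (A l) k l#i · ←-diff A r k l#i)) ·
     zeroʳ _
   Det-replace₂ : ∀ {i j} r r' → i ≢ j → Det (A [ i ← r ] [ j ← r' ]) ≡
    Det A * (coord r i * coord r' j + coord r j * coord r' i)
   Det-replace₂ {i} {j} r r' i#j = begin
    Det (A [ i ← r ] [ j ← r' ])
     ≡⟨ proj₁ (D-row-sum' (A [ i ← r ] [ j ← r' ]) i α A λ k →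
      ←-diff (A [ i ← r ]) r' k i#j · ←-same A i r k · expand r k) ⟩
    sum (λ l → α l * Det (A [ i ← r ] [ j ← r' ] [ i ← A l ]))
     ≡⟨ sum-cong-≗ term ⟩
    sum (λ l → δ i l * (α i * (β j * Det A)) + δ j l * (α j * (β i * Det A)))
     ≡⟨ ∑-distrib-+ (λ l → δ i l * (α i * (β j * Det A))) (λ l → δ j l * (α j * (β i * Det A))) ⟩
    sum (λ l → δ i l * (α i * (β j * Det A))) + sum (λ l → δ j l * (α j * (β i * Det A)))
     ≡⟨ cong₂ _+_ (sum-δˡ i _) (sum-δˡ j _) ⟩
    α i * (β j * Det A) + α j * (β i * Det A)
     ≡⟨ solve 5 (λ αi αj βi βj d → αi :* (βj :* d) :+ αj :* (βi :* d) := d :* (αi :* βj :+ αj :* βi)) refl (α i) (α j) (β i) (β j) (Det A) ⟩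
    Det A * (α i * β j + α j * β i) ∎
    where
    module SP = SignedPermanent 𝓡 1# (*-identityˡ 1#)
    α = coord r
    β = coord r'
    reorder : ∀ v k l → (A [ i ← r ] [ j ← r' ] [ i ← v ]) k l ≡ (A [ i ← v ] [ j ← r' ]) k l
    reorder v k l = SP.←-comm (A [ i ← r ]) r' v (i#j ∘ sym) k l ·
     SP.←-cong j (λ k l _ → SP.←-twice A i r v k l) (λ _ → refl) k l
    two : ∀ l x y → l ≢ i → l ≢ j → 0# ≡ δ i l * x + δ j l * y
    two l x y l#i l#j = solve 2 (λ x y → con false := con false :* x :+ con false :* y) refl x y ·
     cong₂ (λ p q → p * x + q * y) (sym (δ-diff (l#i ∘ sym))) (sym (δ-diff (l#j ∘ sym)))
    term : ∀ l → α l * Det (A [ i ← r ] [ j ← r' ] [ i ← A l ])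
     ≡ δ i l * (α i * (β j * Det A)) + δ j l * (α j * (β i * Det A))
    term l with l Fin.≟ i | l Fin.≟ j
    ... | yes refl | _ = cong (α l *_) ((Det-cong λ k m → reorder (A l) k m · SP.←-cong j (λ k m _ → SP.←-self A l k m) (λ _ → refl) k m) ·
     Det-replace j r') ·
     solve 2 (λ x y → x := con true :* x :+ con false :* y) refl _ (α j * (β l * Det A)) ·
      cong₂ (λ p q → p * (α l * (β j * Det A)) + q * (α j * (β l * Det A))) (sym (δ-same l)) (sym (δ-diff (i#j ∘ sym)))
    ... | no l#i | yes refl = cong (α l *_) (Det-cong (reorder (A l)) · proj₁ (D-swap' {A = A [ i ← r' ]} {A [ i ← A l ] [ l ← r' ]} (swapped i#j
     (λ k → ←-diff (A [ i ← A l ]) r' k i#j · ←-same A i (A l) k · sym (←-diff A r' k l#i))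
     (λ k → ←-same (A [ i ← A l ]) l r' k · sym (←-same A i r' k))
     λ m k m#i m#l → ←-diff (A [ i ← A l ]) r' k m#l · ←-diff A (A l) k m#i · sym (←-diff A r' k m#i))) ·
     Det-replace i r') ·
     solve 2 (λ x y → x := con false :* y :+ con true :* x) refl _ (α i * (β l * Det A)) ·
      cong₂ (λ p q → p * (α i * (β l * Det A)) + q * (α l * (β i * Det A))) (sym (δ-diff i#j)) (sym (δ-same l))
    ... | no l#i | no l#j = cong (α l *_) (Det-cong (reorder (A l)) ·
     (Det-equal-rows (A [ i ← A l ] [ j ← r' ]) (l#i ∘ sym) λ k → ←-diff (A [ i ← A l ]) r' k i#j ·
      ←-same A i (A l) k · sym (←-diff (A [ i ← A l ]) r' k l#j · ←-diff A (A l) k l#i))) ·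
     zeroʳ (α l) · two l _ _ l#i l#j
   private
    module SP = SignedPermanent 𝓡 1# (*-identityˡ 1#)
    both : ∀ (i j : Fin n) (r r' : Fin n → Carrier) → Mat Carrier n
    both i j r r' = A [ i ← r ] [ j ← r' ]
    both-i : ∀ {i j} r r' k → i ≢ j → both i j r r' i k ≡ r k
    both-i {i} {j} r r' k i#j = ←-diff (A [ i ← r ]) r' k i#j · ←-same A i r k
    both-j : ∀ i j r r' k → both i j r r' j k ≡ r' k
    both-j i j r r' k = ←-same (A [ i ← r ]) j r' k
    both-agreeⁱ : ∀ i j r r1 r' m k → m ≢ i → both i j r r' m k ≡ both i j r1 r' m k
    both-agreeⁱ i j r r1 r' m k m#i with m Fin.≟ j
    ... | yes _ = refl
    ... | no _ = ←-diff A r k m#i · sym (←-diff A r1 k m#i)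
    both-agreeʲ : ∀ i j r r' r1' m k → m ≢ j → both i j r r' m k ≡ both i j r r1' m k
    both-agreeʲ i j r r' r1' m k m#j = ←-diff (A [ i ← r ]) r' k m#j · sym (←-diff (A [ i ← r ]) r1' k m#j)
    split = solve 2 (λ x y → x :+ y := con true :* x :+ con true :* y) refl
    additiveⁱ : ∀ {i j} r1 r2 r3 → i ≢ j → Odd (both i j (λ k → r1 k + r2 k) r3) ≡ Odd (both i j r1 r3) + Odd (both i j r2 r3)
    additiveⁱ {i} {j} r1 r2 r3 i#j = proj₂ (D-linear' {A = both i j _ r3} {both i j r1 r3} {both i j r2 r3} i 1# 1#
     (λ m k → both-agreeⁱ i j _ r1 r3 m k) (λ m k → both-agreeⁱ i j _ r2 r3 m k)
     λ k → both-i _ r3 k i#j · split (r1 k) (r2 k) ·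
      cong₂ (λ x y → 1# * x + 1# * y) (sym (both-i r1 r3 k i#j)) (sym (both-i r2 r3 k i#j))) ·
     sym (split _ _)
    additiveʲ : ∀ i j r1 r2 r3 → Odd (both i j r1 λ k → r2 k + r3 k) ≡ Odd (both i j r1 r2) + Odd (both i j r1 r3)
    additiveʲ i j r1 r2 r3 = proj₂ (D-linear' {A = both i j r1 _} {both i j r1 r2} {both i j r1 r3} j 1# 1#
     (λ m k → both-agreeʲ i j r1 _ r2 m k) (λ m k → both-agreeʲ i j r1 _ r3 m k)
     λ k → both-j i j r1 _ k · split (r2 k) (r3 k) ·
      cong₂ (λ x y → 1# * x + 1# * y) (sym (both-j i j r1 r2 k)) (sym (both-j i j r1 r3 k))) ·
     sym (split _ _)
    commute : ∀ {i j} r r' → i ≢ j → Odd (both i j r' r) ≡ Odd (both i j r r') + Det (both i j r r')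
    commute {i} {j} r r' i#j = proj₂ (D-swap' {A = both i j r r'} {both i j r' r} (swapped i#j
     (λ l → both-i r' r l i#j · sym (both-j i j r r' l))
     (λ l → both-j i j r' r l · sym (both-i r r' l i#j))
     λ m l m#i m#j → both-agreeⁱ i j r' r r m l m#i · both-agreeʲ i j r r r' m l m#j))

   -- Both sides are quadratic forms in r which vanish on the multiples of
   -- the unit vectors and which have the same polar form, a determinant.
   Odd-replace₂ : ∀ {i j} r → i ≢ j → Odd (A [ i ← r ] [ j ← r ]) ≡
    Det A * (sum (λ k → r k * r k * (N k i * N k j)) + coord r i * coord r j)
   Odd-replace₂ {i} {j} r i#j = quadratic-unique Q Q' (λ r r' → Det (both i j r r')) Q-cong Q'-cong Q-polar Q'-polar Q-unit Q'-unit
    (Odd-zero-row _ j λ k → both-j i j (λ _ → 0#) (λ _ → 0#) k)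
    (cong₂ (λ x y → Det A * (x + y * coord (λ _ → 0#) j))
     (sum-zero _ λ k → solve 1 (λ x → con false :* con false :* x := con false) refl (N k i * N k j))
     (sum-zero _ λ k → zeroˡ (N k i)) ·
     solve 2 (λ d x → d :* (con false :+ con false :* x) := con false) refl (Det A) _) r
    where
    Q Q' S : (Fin n → Carrier) → Carrier
    Q r = Odd (both i j r r)
    S r = sum (λ k → r k * r k * (N k i * N k j))
    Q' r = Det A * (S r + coord r i * coord r j)
    both-cong : ∀ {r r'} → (∀ k → r k ≡ r' k) → ∀ m k → both i j r r m k ≡ both i j r' r' m k
    both-cong e m k with m Fin.≟ j
    ... | yes _ = e k
    ... | no _ with m Fin.≟ i
    ... | yes _ = e k
    ... | no _ = refl
    Q-cong : ∀ {r r'} → (∀ k → r k ≡ r' k) → Q r ≡ Q r'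
    Q-cong e = Odd-cong (both-cong e)
    coord-cong : ∀ {r r'} l → (∀ k → r k ≡ r' k) → coord r l ≡ coord r' l
    coord-cong l e = sum-cong-≗ λ k → cong (_* N k l) (e k)
    Q'-cong : ∀ {r r'} → (∀ k → r k ≡ r' k) → Q' r ≡ Q' r'
    Q'-cong e = cong (Det A *_) (cong₂ _+_ (sum-cong-≗ λ k → cong (_* (N k i * N k j)) (cong₂ _*_ (e k) (e k)))
     (cong₂ _*_ (coord-cong i e) (coord-cong j e)))
    Q-polar : ∀ r r' → Q (λ k → r k + r' k) ≡ Q r + Q r' + Det (both i j r r')
    Q-polar r r' = additiveⁱ r r' _ i#j · cong₂ _+_ (additiveʲ i j r r r') (additiveʲ i j r' r r' · cong (_+ Q r') (commute r r' i#j)) ·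
     solve 4 (λ a b c d → (a :+ b) :+ ((b :+ d) :+ c) := a :+ c :+ d) refl (Q r) (Odd (both i j r r')) (Q r') (Det (both i j r r'))
    coord-+ : ∀ r r' l → coord (λ k → r k + r' k) l ≡ coord r l + coord r' l
    coord-+ r r' l = (sum-cong-≗ λ k → distribʳ (N k l) (r k) (r' k)) · ∑-distrib-+ (λ k → r k * N k l) (λ k → r' k * N k l)
    Q'-polar : ∀ r r' → Q' (λ k → r k + r' k) ≡ Q' r + Q' r' + Det (both i j r r')
    Q'-polar r r' = cong (Det A *_) (cong₂ _+_
     ((sum-cong-≗ λ k → solve 3 (λ a b c → (a :+ b) :* (a :+ b) :* c := a :* a :* c :+ b :* b :* c) refl (r k) (r' k) (N k i * N k j)) ·
      ∑-distrib-+ (λ k → r k * r k * (N k i * N k j)) λ k → r' k * r' k * (N k i * N k j))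
     (cong₂ _*_ (coord-+ r r' i) (coord-+ r r' j))) ·
     solve 7 (λ d S S' α α' β β' → d :* ((S :+ S') :+ (α :+ α') :* (β :+ β'))
      := d :* (S :+ α :* β) :+ d :* (S' :+ α' :* β') :+ d :* (α :* β' :+ β :* α')) refl
      (Det A) (S r) (S r') (coord r i) (coord r' i) (coord r j) (coord r' j) ·
      cong (Q' r + Q' r' +_) (sym (Det-replace₂ r r' i#j))
    unit : ∀ c l m → m ≢ l → c * δ l m ≡ 0#
    unit c l m m#l = cong (c *_) (δ-diff (m#l ∘ sym)) · zeroʳ c
    Q-unit : ∀ c l → Q (λ k → c * δ l k) ≡ 0#
    Q-unit c l = Odd-parallel-unit-rows _ l i#j
     (λ m m#l → both-i _ _ m i#j · unit c l m m#l) (λ m m#l → both-j i j (λ k → c * δ l k) (λ k → c * δ l k) m · unit c l m m#l)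
    coord-unit : ∀ c l m → coord (λ k → c * δ l k) m ≡ c * N l m
    coord-unit c l m = (sum-cong-≗ λ k → *-assoc c (δ l k) (N k m)) ·
     sym (*-distribˡ-sum c λ k → δ l k * N k m) · cong (c *_) (sum-δˡ l λ k → N k m)
    Q'-unit : ∀ c l → Q' (λ k → c * δ l k) ≡ 0#
    Q'-unit c l = cong (Det A *_) (cong₂ _+_
     ((sum-single _ l λ k k#l → cong (_* (N k i * N k j)) (cong (_* (c * δ l k)) (unit c l k k#l) · zeroˡ _) · zeroˡ _) ·
      cong (λ x → c * x * (c * x) * (N l i * N l j)) (δ-same l))
     (cong₂ _*_ (coord-unit c l i) (coord-unit c l j))) ·
     solve 4 (λ d c x y → d :* (c :* con true :* (c :* con true) :* (x :* y) :+ c :* x :* (c :* y)) := con false) refl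
      (Det A) c (N l i) (N l j)
   oddRow : Fin n → Fin n → Carrier
   oddRow i j with j Fin.≟ i
   ... | yes _ = Odd A
   ... | no _ = Det A * sum (λ k → A j k * A j k * (N k i * N k j))
   Odd-replace : ∀ i r → Odd (A [ i ← r ]) ≡ sum (λ j → coord r j * oddRow i j)
   Odd-replace i r = proj₂ (D-row-sum' (A [ i ← r ]) i (coord r) A λ k → ←-same A i r k · expand r k) ·
    (sum-cong-≗ λ j → cong (coord r j *_) ((Odd-cong λ k l → SP.←-twice A i r (A j) k l) · term j))
    where
    term : ∀ j → Odd (A [ i ← A j ]) ≡ oddRow i j
    term j with j Fin.≟ i
    ... | yes refl = Odd-cong (SP.←-self A j)
    ... | no j#i = Odd-cong replaced · Odd-replace₂ (A j) (j#i ∘ sym) ·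
     cong (Det A *_) (cong (sum (λ k → A j k * A j k * (N k i * N k j)) +_) (cong (_* coord (A j) j) (AN j i · δ-diff j#i) · zeroˡ _) ·
      +-identityʳ _)
     where
     replaced : ∀ k l → (A [ i ← A j ]) k l ≡ both i j (A j) (A j) k l
     replaced k l with k Fin.≟ j
     ... | yes refl = ←-diff A (A j) l j#i
     ... | no _ = refl
   inverses-replace : ∀ i r μ (N' : Mat Carrier n) → coord r i * μ ≡ 1# →
    (∀ k l → N' k l ≡ δ i l * (N k i * μ) + (1# + δ i l) * (N k l + N k i * μ * coord r l)) →
    Inverses (A [ i ← r ]) N'
   inverses-replace i r μ N' λμ=1 N'≡ = record { AN = AN' ; NA = NA' }
    where
    λ' = coord r
    N'-i : ∀ k → N' k i ≡ N k i * μ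
    N'-i k = N'≡ k i · cong (λ x → x * (N k i * μ) + (1# + x) * (N k i + N k i * μ * λ' i)) (δ-same i) ·
     solve 2 (λ x y → con true :* x :+ (con true :+ con true) :* y := x) refl (N k i * μ) _
    N'-other : ∀ k l → l ≢ i → N' k l ≡ N k l + N k i * (μ * λ' l)
    N'-other k l l#i = N'≡ k l · cong (λ x → x * (N k i * μ) + (1# + x) * (N k l + N k i * μ * λ' l)) (δ-diff (l#i ∘ sym)) ·
     solve 5 (λ x n a m l → con false :* x :+ (con true :+ con false) :* (n :+ a :* m :* l) := n :+ a :* (m :* l)) refl (N k i * μ) (N k l) (N k i) μ (λ' l)
    dot : ∀ (v : Fin n → Carrier) l → sum (λ k → v k * N' k l) ≡
     δ i l * (sum (λ k → v k * N k i) * μ) + (1# + δ i l) * (sum (λ k → v k * N k l) + sum (λ k → v k * N k i) * (μ * λ' l))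
    dot v l with l Fin.≟ i
    ... | yes refl = begin
     sum (λ k → v k * N' k l) ≡⟨ sum-cong-≗ (λ k → cong (v k *_) (N'-i k) · sym (*-assoc (v k) (N k l) μ)) ⟩
     sum (λ k → v k * N k l * μ) ≡⟨ sym (*-distribʳ-sum μ λ k → v k * N k l) ⟩
     sum (λ k → v k * N k l) * μ ≡⟨ solve 2 (λ x y → x := con true :* x :+ (con true :+ con true) :* y) refl _ _ ⟩
     1# * (sum (λ k → v k * N k l) * μ) + (1# + 1#) * (sum (λ k → v k * N k l) + sum (λ k → v k * N k l) * (μ * λ' l))
      ≡⟨ cong (λ x → x * (sum (λ k → v k * N k l) * μ) + (1# + x) * (sum (λ k → v k * N k l) + sum (λ k → v k * N k l) * (μ * λ' l))) (sym (δ-same l)) ⟩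
     _ ∎
    ... | no l#i = begin
     sum (λ k → v k * N' k l) ≡⟨ sum-linear (λ k → cong (v k *_) (N'-other k l l#i) ·
      solve 4 (λ v n a m → v :* (n :+ a :* m) := con true :* (v :* n) :+ m :* (v :* a)) refl (v k) (N k l) (N k i) (μ * λ' l)) ⟩
     1# * sum (λ k → v k * N k l) + (μ * λ' l) * sum (λ k → v k * N k i)
      ≡⟨ solve 4 (λ x y m z → con true :* x :+ m :* y := con false :* z :+ (con true :+ con false) :* (x :+ y :* m)) refl _ _ (μ * λ' l) _ ⟩
     0# * (sum (λ k → v k * N k i) * μ) + (1# + 0#) * (sum (λ k → v k * N k l) + sum (λ k → v k * N k i) * (μ * λ' l))
      ≡⟨ cong (λ x → x * (sum (λ k → v k * N k i) * μ) + (1# + x) * (sum (λ k → v k * N k l) + sum (λ k → v k * N k i) * (μ * λ' l))) (sym (δ-diff (l#i ∘ sym))) ⟩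
     _ ∎
     where
     sum-linear = SP.sum-linear {g = λ k → v k * N k l} {h = λ k → v k * N k i} 1# (μ * λ' l)
    AN' : ∀ j l → sum (λ k → (A [ i ← r ]) j k * N' k l) ≡ δ j l
    AN' j l with j Fin.≟ i
    ... | yes refl = dot r l · at l
     where
     at : ∀ l → δ j l * (λ' j * μ) + (1# + δ j l) * (λ' l + λ' j * (μ * λ' l)) ≡ δ j l
     at l = solve 4 (λ d x m y → d :* (x :* m) :+ (con true :+ d) :* (y :+ x :* (m :* y)) := d :* (x :* m) :+ (con true :+ d) :* (y :+ (x :* m) :* y)) refl (δ j l) (λ' j) μ (λ' l) ·
      cong (λ x → δ j l * x + (1# + δ j l) * (λ' l + x * λ' l)) λμ=1 ·
       solve 2 (λ d y → d :* con true :+ (con true :+ d) :* (y :+ con true :* y) := d) refl (δ j l) (λ' l)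
    ... | no j#i = dot (A j) l · cong₂ (λ x y → δ i l * (x * μ) + (1# + δ i l) * (y + x * (μ * λ' l))) (AN j i · δ-diff j#i) (AN j l) ·
     solve 4 (λ d m e y → d :* (con false :* m) :+ (con true :+ d) :* (e :+ con false :* y) := e :+ d :* e) refl (δ i l) μ (δ j l) (μ * λ' l) ·
      cong (δ j l +_) (disjoint l) · +-identityʳ _
     where
     disjoint : ∀ l → δ i l * δ j l ≡ 0#
     disjoint l with i Fin.≟ l
     ... | yes refl = cong (1# *_) (δ-diff j#i) · zeroʳ _
     ... | no _ = zeroˡ _
    NA' : ∀ k m → sum (λ j → N' k j * (A [ i ← r ]) j m) ≡ δ k m
    NA' k m = begin
     sum (λ j → N' k j * (A [ i ← r ]) j m)
      ≡⟨ sum-cong-≗ term ⟩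
     sum (λ j → N k j * A j m + (N k i * μ * (λ' j * A j m) + δ i j * (N k i * μ * r m)))
      ≡⟨ ∑-distrib-+ (λ j → N k j * A j m) _ ⟩
     sum (λ j → N k j * A j m) + sum (λ j → N k i * μ * (λ' j * A j m) + δ i j * (N k i * μ * r m))
      ≡⟨ cong₂ _+_ (NA k m) (∑-distrib-+ (λ j → N k i * μ * (λ' j * A j m)) _) ⟩
     δ k m + (sum (λ j → N k i * μ * (λ' j * A j m)) + sum λ j → δ i j * (N k i * μ * r m))
      ≡⟨ cong (δ k m +_) (cong₂ _+_ (sym (*-distribˡ-sum (N k i * μ) λ j → λ' j * A j m) · cong (N k i * μ *_) (sym (expand r m))) (sum-δˡ i λ _ → N k i * μ * r m)) ⟩
     δ k m + (N k i * μ * r m + N k i * μ * r m)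
      ≡⟨ cong (δ k m +_) (x+x≡0 _) · +-identityʳ _ ⟩
     δ k m ∎
     where
     term : ∀ j → N' k j * (A [ i ← r ]) j m ≡ N k j * A j m + (N k i * μ * (λ' j * A j m) + δ i j * (N k i * μ * r m))
     term j with j Fin.≟ i
     ... | yes refl = cong (_* r m) (N'-i k) · solve 4 (λ n a m r → n :* m :* r := n :* a :+ (n :* con true :* a :+ con true :* (n :* m :* r))) refl (N k j) (A j m) μ (r m) ·
      cong₂ (λ x y → N k j * A j m + (x + y * (N k j * μ * r m)))
       (cong (λ x → N k j * x * A j m) (sym λμ=1) · solve 4 (λ n l m a → n :* (l :* m) :* a := n :* m :* (l :* a)) refl (N k j) (λ' j) μ (A j m))
       (sym (δ-same j))
     ... | no j#i = cong (_* A j m) (N'-other k j j#i) · solve 6 (λ nj ni m l a r → (nj :+ ni :* (m :* l)) :* a := nj :* a :+ (ni :* m :* (l :* a) :+ con false :* (ni :* m :* r))) refl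
      (N k j) (N k i) μ (λ' j) (A j m) (r m) ·
      cong (λ x → N k j * A j m + (N k i * μ * (λ' j * A j m) + x * (N k i * μ * r m))) (sym (δ-diff (j#i ∘ sym)))

module GraphPoly where
 open RowUpd public

 open import Data.List using (foldr)
 open import Data.List.Properties using (length-++)
 open import Data.List.Membership.Propositional.Properties using (∈-++⁻)
 import Data.List.Relation.Unary.Unique.Propositional.Properties as Unique
 open import Data.Nat using (_≤_)
 open import Data.Nat.Divisibility using (_∣_; _∣?_; divides; ∣m+n∣m⇒∣n; ∣1⇒≡1; ∣m∣n⇒∣m+n; ∣-refl)
 open import Data.Vec.Functional using (updateAt)
 open import Data.Vec.Functional.Properties using (updateAt-updates; updateAt-minimal)

 module GraphPolynomials (𝓡 : BinaryRing) where
  open RingTheory 𝓡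
  open OddPermutations 𝓡

  infixr 8 _^_
  _^_ : Carrier → ℕ → Carrier
  y ^ zero = 1#
  y ^ suc j = y * y ^ j

  private
   variable
    n : ℕ

  -- f is a combination of the monomials y ^ j with lo ≤ j ≤ hi.
  data Span (lo hi : ℕ) (f : Carrier → Carrier) : Set where
   nil : (∀ y → f y ≡ 0#) → Span lo hi f
   cons : ∀ {g} c j → lo ≤ j → j ≤ hi → Span lo hi g → (∀ y → f y ≡ c * y ^ j + g y) → Span lo hi f

  Span-cong : ∀ {lo hi f g} → (∀ y → g y ≡ f y) → Span lo hi f → Span lo hi g
  Span-cong e (nil z) = nil λ y → e y · z y
  Span-cong e (cons c j l h s p) = cons c j l h s λ y → e y · p y

  Span-+ : ∀ {lo hi f g} → Span lo hi f → Span lo hi g → Span lo hi (λ y → f y + g y)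
  Span-+ (nil z) t = Span-cong (λ y → cong (_+ _) (z y) · +-identityˡ _) t
  Span-+ (cons c j l h s p) t = cons c j l h (Span-+ s t) λ y → cong (_+ _) (p y) · +-assoc _ _ _

  Span-* : ∀ {lo hi f} c → Span lo hi f → Span lo hi (λ y → c * f y)
  Span-* d (nil z) = nil λ y → cong (d *_) (z y) · zeroʳ d
  Span-* d (cons c j l h s p) = cons (d * c) j l h (Span-* d s) λ y → cong (d *_) (p y) ·
   solve 4 (λ d c x y → d :* (c :* x :+ y) := d :* c :* x :+ d :* y) refl d c _ _

  Span-shift : ∀ {lo hi f} → Span lo hi f → Span (suc lo) (suc hi) (λ y → y * f y)
  Span-shift (nil z) = nil λ y → cong (y *_) (z y) · zeroʳ y
  Span-shift (cons c j l h s p) = cons c (suc j) (s≤s l) (s≤s h) (Span-shift s) λ y → cong (y *_) (p y) ·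
   solve 4 (λ d c x y → d :* (c :* x :+ y) := c :* (d :* x) :+ d :* y) refl y c _ _

  Span-weaken : ∀ {lo lo' hi hi' f} → lo' ≤ lo → hi ≤ hi' → Span lo hi f → Span lo' hi' f
  Span-weaken p q (nil z) = nil z
  Span-weaken p q (cons c j l h s e) = cons c j (p ·≤ l) (h ·≤ q) (Span-weaken p q s) e

  Span-sum : ∀ {lo hi m} {f : Fin m → Carrier → Carrier} → (∀ i → Span lo hi (f i)) → Span lo hi (λ y → sum λ i → f i y)
  Span-sum {m = zero} s = nil λ y → sum-empty _
  Span-sum {m = suc m} s = Span-cong (λ y → sum-suc _) (Span-+ (s zero) (Span-sum (s ∘ suc)))

  Span-const : ∀ {hi} → Span 0 hi (λ _ → 1#)
  Span-const = cons 1# 0 z≤n z≤n (nil {f = λ _ → 0#} λ _ → refl) λ y → solve 0 (con true := con true :* con true :+ con false) refl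

  module _ {m} (w point : Fin m → Carrier) where
   ext : (Carrier → Carrier) → Carrier
   ext f = sum (λ p → w p * f (point p))
   ext-cong : ∀ f g → (∀ y → f y ≡ g y) → ext f ≡ ext g
   ext-cong f g e = sum-cong-≗ λ p → cong (w p *_) (e (point p))
   ext-+ : ∀ f g → ext (λ y → f y + g y) ≡ ext f + ext g
   ext-+ f g = (sum-cong-≗ λ p → distribˡ (w p) _ _) · ∑-distrib-+ (λ p → w p * f (point p)) (λ p → w p * g (point p))
   ext-* : ∀ c f → ext (λ y → c * f y) ≡ c * ext f
   ext-* c f = (sum-cong-≗ λ p → solve 3 (λ w c x → w :* (c :* x) := c :* (w :* x)) refl (w p) c _) ·
    sym (*-distribˡ-sum c λ p → w p * f (point p))
   ext-Span : ∀ {lo hi f} → (∀ j → lo ≤ j → j ≤ hi → ext (_^ j) ≡ 0#) → Span lo hi f → ext f ≡ 0#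
   ext-Span v (nil z) = ext-cong _ (λ _ → 0#) z · (sum-zero _ λ p → zeroʳ (w p))
   ext-Span {f = f} v (cons {g} c j l h s e) = ext-cong f (λ y → c * y ^ j + g y) e · ext-+ (λ y → c * y ^ j) g ·
    cong₂ _+_ (ext-* c (_^ j) · cong (c *_) (v j l h) · zeroʳ c) (ext-Span v s) · +-identityˡ _

  par : ℕ → Carrier
  par zero = 0#
  par (suc a) = 1# + par a

  par-+ : ∀ a b → par (a ℕ.+ b) ≡ par a + par b
  par-+ zero b = sym (+-identityˡ _)
  par-+ (suc a) b = cong (1# +_) (par-+ a b) · sym (+-assoc _ _ _)

  par-even : ∀ a → 2 ∣ a → par a ≡ 0#
  par-even zero _ = refl
  par-even (suc zero) d with () ← ∣1⇒≡1 d
  par-even (suc (suc a)) d = sym (+-assoc _ _ _) · cong (_+ par a) (x+x≡0 1#) ·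
   +-identityˡ _ · par-even a (∣m+n∣m⇒∣n d ∣-refl)

  par-odd : ∀ a → ¬ 2 ∣ a → par a ≡ 1#
  par-odd zero d = contradiction (divides 0 refl) d
  par-odd (suc zero) _ = +-identityʳ _
  par-odd (suc (suc a)) d = sym (+-assoc _ _ _) · cong (_+ par a) (x+x≡0 1#) ·
   +-identityˡ _ · par-odd a (d ∘ ∣m∣n⇒∣m+n ∣-refl)

  masked : Digraph n → Mat Carrier n → Mat Carrier n
  masked H x i j = if adjacent H i j then x i j else 0#

  full : Mat Carrier n → Carrier → Mat Carrier n
  full x y i j = δ i j + y * x i j

  mat : Digraph n → Mat Carrier n → Carrier → Mat Carrier n
  mat H x = full (masked H x)

  masked-no-arc : ∀ (H : Digraph n) x {i j} → adjacent H i j ≡ false → masked H x i j ≡ 0#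
  masked-no-arc H x e rewrite e = refl

  module _ (H : Digraph n) (x : Mat Carrier n) (κ : ℕ) (long : ∀ c → IsEvenCycle H c → κ < length c) where
   private
    Path = Fin n × List (Fin n)
    head = proj₁
    last' : Fin n → List (Fin n) → Fin n
    last' h [] = h
    last' h (v ∷ t) = last' v t
    last : Path → Fin n
    last (h , t) = last' h t
    vertices : Path → List (Fin n)
    vertices (h , t) = h ∷ t
    _⁀_ : Path → Path → Path
    (h , t) ⁀ (h' , t') = h , t ++ h' ∷ t'
    last-⁀ : ∀ h t h' t' → last' h (t ++ h' ∷ t') ≡ last' h' t'
    last-⁀ h [] h' t' = refl
    last-⁀ h (v ∷ t) h' t' = last-⁀ v t h' t'
    last-∈ : ∀ h t → last' h t ∈ h ∷ t
    last-∈ h [] = here refl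
    last-∈ h (v ∷ t) = there (last-∈ v t)
    linked-⁀ : ∀ h t h' t' → Linked (Arc H) (h ∷ t) → Arc H (last' h t) h' → Linked (Arc H) (h' ∷ t') → Linked (Arc H) (h ∷ t ++ h' ∷ t')
    linked-⁀ h [] h' t' _ a l' = a ∷ l'
    linked-⁀ h (v ∷ t) h' t' (b ∷ l) a l' = b ∷ linked-⁀ v t h' t' l a l'
    record Valid {m} (Q : Fin m → Path) : Set where
     field
      linked : ∀ i → Linked (Arc H) (vertices (Q i))
      unique : ∀ i → Unique (vertices (Q i))
      disjoint : ∀ {i j v} → i ≢ j → v ∈ vertices (Q i) → v ∉ vertices (Q j)
    open Valid
    valid-tail : ∀ {m} {Q : Fin (suc m) → Path} → Valid Q → Valid (Q ∘ suc)
    valid-tail V = record { linked = linked V ∘ suc ; unique = unique V ∘ suc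
     ; disjoint = λ i#j → disjoint V λ { refl → i#j refl } }
    join : ∀ {m} → (Fin (suc m) → Path) → Fin m → Fin m → Path
    join Q i = updateAt (Q ∘ suc) i (_⁀ Q zero)
    data Joined {m} (Q : Fin (suc m) → Path) (i : Fin m) : Fin m → Path → Set where
     new : Joined Q i i (Q (suc i) ⁀ Q zero)
     old : ∀ {j} → j ≢ i → Joined Q i j (Q (suc j))
    joined : ∀ {m} (Q : Fin (suc m) → Path) i j → Joined Q i j (join Q i j)
    joined Q i j with j Fin.≟ i
    ... | yes refl = subst (Joined Q i i) (sym (updateAt-updates i (Q ∘ suc))) new
    ... | no j#i = subst (Joined Q i j) (sym (updateAt-minimal j i (Q ∘ suc) j#i)) (old j#i)
    valid-join : ∀ {m} {Q : Fin (suc m) → Path} i → Valid Q → Arc H (last (Q (suc i))) (head (Q zero)) → Valid (join Q i)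
    valid-join {Q = Q} i V a = record { linked = linked' ; unique = unique' ; disjoint = disjoint' }
     where
     linked' : ∀ j → Linked (Arc H) (vertices (join Q i j))
     linked' j with join Q i j | joined Q i j
     ... | _ | new = linked-⁀ _ (proj₂ (Q (suc i))) _ _ (linked V (suc i)) a (linked V zero)
     ... | _ | old _ = linked V (suc j)
     unique' : ∀ j → Unique (vertices (join Q i j))
     unique' j with join Q i j | joined Q i j
     ... | _ | new = Unique.++⁺ (unique V (suc i)) (unique V zero) λ (p , q) → disjoint V (λ ()) p q
     ... | _ | old _ = unique V (suc j)
     suc≢ : ∀ {m} {j k : Fin m} → j ≢ k → Fin.suc j ≢ suc k
     suc≢ j#k refl = j#k refl
     disjoint' : ∀ {j k v} → j ≢ k → v ∈ vertices (join Q i j) → v ∉ vertices (join Q i k)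
     disjoint' {j} {k} j#k p q with join Q i j | joined Q i j | join Q i k | joined Q i k
     ... | _ | new | _ | new = j#k refl
     ... | _ | old _ | _ | old _ = disjoint V (suc≢ j#k) p q
     ... | _ | new | _ | old k#i with ∈-++⁻ (vertices (Q (suc i))) p
     ... | inj₁ p' = disjoint V (suc≢ j#k) p' q
     ... | inj₂ p' = disjoint V (λ ()) p' q
     disjoint' {j} {k} j#k p q | _ | old j#i | _ | new with ∈-++⁻ (vertices (Q (suc i))) q
     ... | inj₁ q' = disjoint V (suc≢ j#k) p q'
     ... | inj₂ q' = disjoint V (λ ()) p q'
    arcs : ∀ {m} → (Fin m → Path) → ℕ
    arcs {zero} Q = 0
    arcs {suc m} Q = length (proj₂ (Q zero)) ℕ.+ arcs (Q ∘ suc)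
    arcs-updateAt : ∀ {m} (Q : Fin m → Path) i P → arcs (updateAt Q i (_⁀ P)) ≡ suc (length (proj₂ P)) ℕ.+ arcs Q
    arcs-updateAt {suc m} Q zero P = cong (ℕ._+ arcs (Q ∘ suc)) (length-++ (proj₂ (Q zero)) · ℕ.+-comm (length (proj₂ (Q zero))) _) ·
     ℕ.+-assoc (suc (length (proj₂ P))) _ _
    arcs-updateAt {suc m} Q (suc i) P = cong (length (proj₂ (Q zero)) ℕ.+_) (arcs-updateAt (Q ∘ suc) i P) ·
     sym (ℕ.+-assoc (length (proj₂ (Q zero))) (suc (length (proj₂ P))) _) · cong (ℕ._+ arcs (Q ∘ suc)) (ℕ.+-comm (length (proj₂ (Q zero))) (suc (length (proj₂ P)))) · ℕ.+-assoc (suc (length (proj₂ P))) _ _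

    -- Vertices are eliminated one at a time, their neighbours in the
    -- permutation being contracted to paths.
    B : ∀ {m} → (Fin m → Path) → Carrier → Mat Carrier m
    B Q y a b = mat H x y (last (Q a)) (head (Q b))
    open ≡-Reasoning
    B-join : ∀ {m} (Q : Fin (suc m) → Path) y i j k →
     (P.minor (lift (B Q y)) [ i ← P.top (lift (B Q y)) ]) j k ≡ lift (B (join Q i) y) j k
    B-join Q y i j k with j Fin.≟ i | join Q i j | joined Q i j | join Q i k | joined Q i k
    ... | yes refl | _ | new | _ | new = cong (λ v → mat H x y v _ , 0#) (sym (last-⁀ _ (proj₂ (Q (suc j))) _ _))
    ... | yes refl | _ | new | _ | old _ = cong (λ v → mat H x y v _ , 0#) (sym (last-⁀ _ (proj₂ (Q (suc j))) _ _))
    ... | yes refl | _ | old c | _ | _ = contradiction refl c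
    ... | no c | _ | new | _ | _ = contradiction refl c
    ... | no _ | _ | old _ | _ | new = refl
    ... | no _ | _ | old _ | _ | old _ = refl
    det odd : ∀ {m} → (Fin m → Path) → Carrier → Carrier
    det Q y = Det (B Q y)
    odd Q y = Odd (B Q y) + par (arcs Q) * Det (B Q y)
    module _ {m} (Q : Fin (suc m) → Path) (y : Carrier) where
     private
      b0 = B Q y zero zero
      b : Fin m → Carrier
      b i = B Q y (suc i) zero
      a = length (proj₂ (Q zero))
      module Dual = RingTheory (dual 𝓡)
      proj₁-sum : ∀ {m} (f : Fin m → Carrier × Carrier) → proj₁ (Dual.sum f) ≡ sum (proj₁ ∘ f)
      proj₁-sum {zero} f = cong proj₁ (Dual.sum-empty f) · sym (sum-empty _)
      proj₁-sum {suc m} f = cong proj₁ (Dual.sum-suc f) · cong (proj₁ (f zero) +_) (proj₁-sum (f ∘ suc)) · sym (sum-suc _)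
      proj₂-sum : ∀ {m} (f : Fin m → Carrier × Carrier) → proj₂ (Dual.sum f) ≡ sum (proj₂ ∘ f)
      proj₂-sum {zero} f = cong proj₂ (Dual.sum-empty f) · sym (sum-empty _)
      proj₂-sum {suc m} f = cong proj₂ (Dual.sum-suc f) · cong (proj₂ (f zero) +_) (proj₂-sum (f ∘ suc)) · sym (sum-suc _)
      D-step = cong (λ t → (b0 , 0#) Dual.* P.D (lift (B (Q ∘ suc) y)) Dual.+ s Dual.* t)
       (Dual.sum-cong-≗ λ i → cong ((b i , 0#) Dual.*_) (P.D-cong (B-join Q y i)))
     det-step = cong proj₁ D-step · cong (b0 * det (Q ∘ suc) y +_) (*-identityˡ _ · proj₁-sum _)
     odd-step = begin
      odd Q y
       ≡⟨ cong₂ (λ u v → u + par (arcs Q) * v) (cong proj₂ D-step) det-step ⟩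
      b0 * O' + 0# * E' + (1# * proj₂ (Dual.sum F) + 1# * proj₁ (Dual.sum F)) + par (a ℕ.+ arcs (Q ∘ suc)) * (b0 * E' + sum λ i → b i * det (join Q i) y)
       ≡⟨ cong₂ (λ u v → b0 * O' + 0# * E' + u + par (a ℕ.+ arcs (Q ∘ suc)) * (b0 * E' + v)) (cong₂ (λ u v → 1# * u + 1# * v) (proj₂-sum F) (proj₁-sum F)) refl ⟩
      b0 * O' + 0# * E' + (1# * ΣO + 1# * ΣE) + par (a ℕ.+ arcs (Q ∘ suc)) * (b0 * E' + ΣE)
       ≡⟨ cong (λ p → b0 * O' + 0# * E' + (1# * ΣO + 1# * ΣE) + p * (b0 * E' + ΣE)) (par-+ a (arcs (Q ∘ suc))) ⟩
      b0 * O' + 0# * E' + (1# * ΣO + 1# * ΣE) + (par a + p') * (b0 * E' + ΣE)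
       ≡⟨ solve 7 (λ b o e so se p p' → b :* o :+ con false :* e :+ (con true :* so :+ con true :* se) :+ (p :+ p') :* (b :* e :+ se)
        := b :* (o :+ p' :* e :+ p :* e) :+ (con true :* so :+ (con true :+ (p :+ p')) :* se)) refl b0 O' E' ΣO ΣE (par a) p' ⟩
      b0 * (odd (Q ∘ suc) y + par a * E') + (1# * ΣO + (1# + (par a + p')) * ΣE)
       ≡⟨ cong (b0 * (odd (Q ∘ suc) y + par a * E') +_) (sym (SP.sum-linear 1# (1# + (par a + p')) term)) ⟩
      b0 * (odd (Q ∘ suc) y + par a * E') + sum (λ i → b i * odd (join Q i) y) ∎
      where
      module SP = SignedPermanent 𝓡 1# (*-identityˡ 1#)
      F : Fin m → Carrier × Carrier
      F i = (b i , 0#) Dual.* P.D (lift (B (join Q i) y))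
      O' = Odd (B (Q ∘ suc) y)
      E' = Det (B (Q ∘ suc) y)
      ΣO = sum (λ i → proj₂ (F i))
      ΣE = sum (λ i → proj₁ (F i))
      p' = par (arcs (Q ∘ suc))
      term : ∀ i → b i * odd (join Q i) y ≡ 1# * proj₂ (F i) + (1# + (par a + p')) * proj₁ (F i)
      term i = cong (λ q → b i * (Odd (B (join Q i) y) + q * Det (B (join Q i) y)))
       (cong par (arcs-updateAt (Q ∘ suc) i (Q zero)) · cong (1# +_) (par-+ a (arcs (Q ∘ suc)))) ·
       solve 4 (λ b o q e → b :* (o :+ q :* e) := con true :* (b :* o :+ con false :* e) :+ q :* (b :* e)) refl
        (b i) (Odd (B (join Q i) y)) (1# + (par a + p')) (Det (B (join Q i) y))
    linked-∷ʳ : ∀ h t v → Linked (Arc H) (h ∷ t) → Arc H (last' h t) v → Linked (Arc H) (h ∷ t ∷ʳ v)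
    linked-∷ʳ h [] v _ a = a ∷ [-]
    linked-∷ʳ h (u ∷ t) v (b ∷ l) a = b ∷ linked-∷ʳ u t v l a
    Spanned : ∀ {m} → (Fin m → Path) → Set
    Spanned {m} Q = Span 0 m (det Q) × Span (suc κ ∸ arcs Q) m (odd Q)
    off-diagonal : ∀ {u v} y → u ≢ v → mat H x y u v ≡ y * masked H x u v
    off-diagonal {u} {v} y u#v = cong (_+ y * masked H x u v) (δ-diff u#v) · +-identityˡ _
    spanned : ∀ {m} (Q : Fin m → Path) → Valid Q → Spanned Q
    spanned {zero} Q V = Span-const , nil λ y → solve 0 (con false :+ con false :* con true := con false) refl
    spanned {suc m} Q V = Span-cong det-step' (Span-+ (proj₁ closing) (Span-sum (proj₁ ∘ joining)))
     , Span-cong odd-step' (Span-+ (proj₂ closing) (Span-sum (proj₂ ∘ joining)))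
     where
     det-step' = det-step Q
     odd-step' = odd-step Q
     h = proj₁ (Q zero)
     t = proj₂ (Q zero)
     tail-spanned = spanned (Q ∘ suc) (valid-tail V)
     times : ∀ {lo} (f g : Carrier → Carrier) c → (∀ y → g y ≡ y * c) → Span lo m f → Span (suc lo) (suc m) (λ y → g y * f y)
     times f g c e s = Span-cong (λ y → cong (_* f y) (e y) · *-assoc y c _) (Span-shift (Span-* c s))
     vanish : ∀ {lo hi} {f g : Carrier → Carrier} → (∀ y → g y ≡ y * 0#) → Span lo hi (λ y → g y * f y)
     vanish {f = f} e = nil λ y → cong (_* f y) (e y · zeroʳ y) · zeroˡ _
     joining : ∀ i → Span 0 (suc m) (λ y → B Q y (suc i) zero * det (join Q i) y)
      × Span (suc κ ∸ arcs Q) (suc m) (λ y → B Q y (suc i) zero * odd (join Q i) y)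
     joining i = by-adjacency (adjacent H (last (Q (suc i))) h) refl
      where
      by-adjacency : ∀ b → adjacent H (last (Q (suc i))) h ≡ b →
       Span 0 (suc m) (λ y → B Q y (suc i) zero * det (join Q i) y)
       × Span (suc κ ∸ arcs Q) (suc m) (λ y → B Q y (suc i) zero * odd (join Q i) y)
      by-adjacency false adj = vanish zero' , vanish zero'
       where
       zero' : ∀ y → B Q y (suc i) zero ≡ y * 0#
       zero' y = (off-diagonal y λ e → disjoint V (λ ()) (last-∈ _ (proj₂ (Q (suc i)))) (here e)) · cong (y *_) (masked-no-arc H x adj)
      by-adjacency true adj = Span-weaken z≤n ℕ.≤-refl (times (det (join Q i)) (λ y → B Q y (suc i) zero) _ mono (proj₁ IH)) ,
       Span-weaken bound ℕ.≤-refl (times (odd (join Q i)) (λ y → B Q y (suc i) zero) _ mono (proj₂ IH))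
       where
       mono : ∀ y → B Q y (suc i) zero ≡ y * masked H x (last (Q (suc i))) h
       mono y = off-diagonal y λ e → disjoint V (λ ()) (last-∈ _ (proj₂ (Q (suc i)))) (here e)
       IH = spanned (join Q i) (valid-join i V adj)
       bound : suc κ ∸ arcs Q ≤ suc (suc κ ∸ arcs (join Q i))
       bound rewrite arcs-updateAt (Q ∘ suc) i (Q zero) = ≤-suc-∸ (suc κ) (arcs Q)
        where
        ≤-suc-∸ : ∀ a b → a ∸ b ≤ suc (a ∸ suc b)
        ≤-suc-∸ zero zero = z≤n
        ≤-suc-∸ zero (suc b) = z≤n
        ≤-suc-∸ (suc a) zero = ℕ.≤-refl
        ≤-suc-∸ (suc a) (suc b) = ≤-suc-∸ a b
     closing : Span 0 (suc m) (λ y → B Q y zero zero * det (Q ∘ suc) y)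
      × Span (suc κ ∸ arcs Q) (suc m) (λ y → B Q y zero zero * (odd (Q ∘ suc) y + par (length t) * det (Q ∘ suc) y))
     closing with Q zero | linked V zero | unique V zero
     ... | h , [] | _ | _ =
      Span-weaken z≤n (ℕ.n≤1+n m) (Span-cong (λ y → cong (_* det (Q ∘ suc) y) (loop y) · *-identityˡ _) (proj₁ tail-spanned))
      , Span-weaken ℕ.≤-refl (ℕ.n≤1+n m) (Span-cong (λ y → cong (_* (odd (Q ∘ suc) y + 0# * det (Q ∘ suc) y)) (loop y) ·
       solve 2 (λ o e → con true :* (o :+ con false :* e) := o) refl (odd (Q ∘ suc) y) (det (Q ∘ suc) y)) (proj₂ tail-spanned))
      where
      loop : ∀ y → mat H x y h h ≡ 1#
      loop y = cong₂ (λ u v → u + y * v) (δ-same h) (masked-no-arc H x (loopless H h)) · cong (1# +_) (zeroʳ y) · +-identityʳ 1#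
     ... | h , v ∷ t | l | h∉ ∷ u = by-adjacency (adjacent H (last' v t) h) refl
      where
      by-adjacency : ∀ b → adjacent H (last' v t) h ≡ b →
       Span 0 (suc m) (λ y → mat H x y (last' v t) h * det (Q ∘ suc) y)
       × Span (suc κ ∸ (suc (length t) ℕ.+ arcs (Q ∘ suc))) (suc m)
        (λ y → mat H x y (last' v t) h * (odd (Q ∘ suc) y + par (suc (length t)) * det (Q ∘ suc) y))
      by-adjacency false adj = vanish zero' , vanish zero'
       where
       zero' : ∀ y → mat H x y (last' v t) h ≡ y * 0#
       zero' y = (off-diagonal y λ e → All.lookup h∉ (last-∈ v t) (sym e)) · cong (y *_) (masked-no-arc H x adj)
      by-adjacency true adj = Span-weaken z≤n ℕ.≤-refl (times (det (Q ∘ suc)) (λ y → mat H x y (last' v t) h) _ mono (proj₁ tail-spanned)) , odd-part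
       where
       mono : ∀ y → mat H x y (last' v t) h ≡ y * masked H x (last' v t) h
       mono y = off-diagonal y λ e → All.lookup h∉ (last-∈ v t) (sym e)
       r = arcs (Q ∘ suc)
       odd-part : Span (suc κ ∸ (suc (length t) ℕ.+ r)) (suc m)
        (λ y → mat H x y (last' v t) h * (odd (Q ∘ suc) y + par (suc (length t)) * det (Q ∘ suc) y))
       odd-part with 2 ∣? suc (suc (length t))
       ... | yes even = Span-weaken below ℕ.≤-refl (times {lo = 0} (λ y → odd (Q ∘ suc) y + par (suc (length t)) * det (Q ∘ suc) y) (λ y → mat H x y (last' v t) h) _ mono
        (Span-+ (Span-weaken z≤n ℕ.≤-refl (proj₂ tail-spanned)) (Span-* (par (suc (length t))) (proj₁ tail-spanned))))
        where
        below = ℕ.∸-monoʳ-≤ (suc κ) (ℕ.≤-pred (long (h ∷ v ∷ t) ((h∉ ∷ u , linked-∷ʳ h (v ∷ t) h l adj) , even)) ·≤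
         ℕ.m≤m+n (suc (length t)) r) ≤≡ ℕ.m+n∸n≡m 1 κ
       ... | no odd = Span-weaken (ℕ.∸-monoʳ-≤ (suc κ) (ℕ.m≤n+m r (suc (length t))) ·≤ ℕ.n≤1+n _) ℕ.≤-refl
        (times (λ y → odd' y + par (suc (length t)) * det (Q ∘ suc) y) (λ y → mat H x y (last' v t) h) _ mono (Span-cong (λ y → cong (λ p → odd' y + p * det (Q ∘ suc) y) parity · cong (odd' y +_) (zeroˡ _) · +-identityʳ _) (proj₂ tail-spanned)))
        where
        odd' = λ y → Odd (B (Q ∘ suc) y) + par r * Det (B (Q ∘ suc) y)
        parity = solve 1 (λ p → p := con true :+ (con true :+ p)) refl (par (suc (length t))) ·
         cong (1# +_) (par-odd _ odd) · x+x≡0 1#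
   Odd-span = subst (λ a → Span (suc κ ∸ a) n λ y → Odd (mat H x y)) (arcs-0 n _)
    (Span-cong (λ y → sym (cong (λ p → Odd (mat H x y) + par p * Det (mat H x y)) (arcs-0 n λ i → i) ·
     cong (Odd (mat H x y) +_) (zeroˡ _) · +-identityʳ _))
     (proj₂ (spanned (λ i → i , []) (record { linked = λ _ → [-] ; unique = λ _ → [] ∷ []
      ; disjoint = λ { i#j (here refl) (here refl) → i#j refl } }))))
    where
    arcs-0 : ∀ m (f : Fin m → Fin n) → arcs (λ i → f i , []) ≡ 0
    arcs-0 zero f = refl
    arcs-0 (suc m) f = arcs-0 m (f ∘ suc)

  pure : List (Fin n × Fin n) → Mat Carrier n → Mat Carrier n
  pure L A = foldr (λ (v , w) A → A [ v ← δ w ]) A L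

  pure-row : ∀ L (A : Mat Carrier n) {v} k → v ∉ map proj₁ L → pure L A v k ≡ A v k
  pure-row [] A k v∉ = refl
  pure-row ((u , w) ∷ L) A k v∉ = ←-diff (pure L A) (δ w) k (λ e → v∉ (here e)) · pure-row L A k (v∉ ∘ there)

  pure-agree : ∀ L (A A' : Mat Carrier n) v → (∀ k → A v k ≡ A' v k) → ∀ k → pure L A v k ≡ pure L A' v k
  pure-agree [] A A' v e k = e k
  pure-agree ((u , w) ∷ L) A A' v e k with v Fin.≟ u
  ... | yes _ = refl
  ... | no _ = pure-agree L A A' v e k

  module _ {m} (w point : Fin m → Carrier) (_≟0 : ∀ c → Dec (c ≡ 0#)) (H : Digraph n) where

   -- A row of the form δ v + y δ w can be traded for y δ w or for δ v
   -- because Odd is linear in the row.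
   unpeel : ∀ (L : List (Fin n × Fin n)) x → Unique (map proj₁ L) → All (λ (v , w) → Arc H v w) L →
    All (λ (v , _) → ∀ u → x v u ≡ 0#) L → (∀ {i j} → adjacent H i j ≡ false → x i j ≡ 0#) →
    ext w point (λ y → y ^ length L * Odd (pure L (full x y))) ≢ 0# →
    ∃[ x' ] ((∀ {i j} → adjacent H i j ≡ false → x' i j ≡ 0#) × ext w point (λ y → Odd (full x' y)) ≢ 0#)
   unpeel [] x _ _ _ supp nz = x , supp , λ e → nz ((ext-cong w point (λ y → 1# * Odd (full x y)) (λ y → Odd (full x y)) λ y → *-identityˡ _) · e)
   unpeel ((v , u) ∷ L) x (v∉ ∷ unique) (vu ∷ arcs) (xv ∷ xL) supp nz
    with ext w point (λ y → y ^ length L * Odd (pure L (full x y))) ≟0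
   ... | no nz' = unpeel L x unique arcs xL supp nz'
   ... | yes z = unpeel L x⁺ unique arcs (keep L xL v∉) supp⁺ λ z⁺ → nz (ext-cong w point _ (λ y → y ^ length L * Odd (pure L (full x⁺ y)) + y ^ length L * Odd (pure L (full x y))) split ·
    ext-+ w point (λ y → y ^ length L * Odd (pure L (full x⁺ y))) (λ y → y ^ length L * Odd (pure L (full x y))) · cong₂ _+_ z⁺ z · +-identityˡ 0#)
    where
    x⁺ = x [ v ← δ u ]
    v∉L : v ∉ map proj₁ L
    v∉L p = All.lookup v∉ p refl
    keep : ∀ L → All (λ (v , _) → ∀ u → x v u ≡ 0#) L → All (v ≢_) (map proj₁ L) → All (λ (v , _) → ∀ u → x⁺ v u ≡ 0#) L
    keep [] _ _ = []
    keep (p ∷ L) (e ∷ es) (q ∷ qs) = (λ k → ←-diff x (δ u) k (q ∘ sym) · e k) ∷ keep L es qs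
    supp⁺ : ∀ {i j} → adjacent H i j ≡ false → x⁺ i j ≡ 0#
    supp⁺ {i} {j} no-arc with i Fin.≟ v
    ... | no _ = supp no-arc
    ... | yes refl with u Fin.≟ j
    ... | yes refl with () ← trans (sym no-arc) vu
    ... | no _ = refl
    split : ∀ y → y ^ suc (length L) * Odd (pure ((v , u) ∷ L) (full x y))
     ≡ y ^ length L * Odd (pure L (full x⁺ y)) + y ^ length L * Odd (pure L (full x y))
    split y = solve 3 (λ y p o → y :* p :* o := p :* (con true :* (y :* o))) refl y (y ^ length L) _ ·
     cong (y ^ length L *_) (*-identityˡ _ · linear) · distribˡ _ _ _
     where
     A = pure L (full x y)
     row-v : ∀ k → A v k ≡ δ v k
     row-v k = pure-row L _ k v∉L · cong (λ e → δ v k + y * e) (xv k) · cong (δ v k +_) (zeroʳ y) · +-identityʳ _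
     row-v⁺ : ∀ k → pure L (full x⁺ y) v k ≡ 1# * A v k + y * (A [ v ← δ u ]) v k
     row-v⁺ k = pure-row L _ k v∉L · cong (λ e → δ v k + y * e) (←-same x v (δ u) k) ·
      cong (_+ y * δ u k) (sym (*-identityˡ _)) · cong₂ (λ p q → 1# * p + y * q) (sym (row-v k)) (sym (←-same A v (δ u) k))
     agree : ∀ j k → j ≢ v → pure L (full x⁺ y) j k ≡ A j k
     agree j k j#v = pure-agree L _ _ j (λ k → cong (λ e → δ j k + y * e) (←-diff x (δ u) k j#v)) k
     linear = solve 2 (λ q o → q := (con true :* o :+ q) :+ o) refl (y * Odd (A [ v ← δ u ])) (Odd A) ·
      cong (_+ Odd A) (sym (proj₂ (D-linear' {A = pure L (full x⁺ y)} {A} {A [ v ← δ u ]} v 1# y agree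
       (λ j k j#v → agree j k j#v · sym (←-diff A (δ u) k j#v)) row-v⁺)))

  private
   next : Fin n → List (Fin n) → Fin n
   next z [] = z
   next z (r ∷ _) = r
   cycleArcs : Fin n → List (Fin n) → List (Fin n × Fin n)
   cycleArcs z [] = []
   cycleArcs z (v ∷ r) = (v , next z r) ∷ cycleArcs z r
   map-proj₁ : ∀ (z : Fin n) r → map proj₁ (cycleArcs z r) ≡ r
   map-proj₁ z [] = refl
   map-proj₁ z (v ∷ r) = cong (v ∷_) (map-proj₁ z r)
   length-cycleArcs : ∀ (z : Fin n) r → length (cycleArcs z r) ≡ length r
   length-cycleArcs z [] = refl
   length-cycleArcs z (v ∷ r) = cong suc (length-cycleArcs z r)
   cycleArcs-arcs : ∀ (H : Digraph n) z v r → Linked (Arc H) (v ∷ r ∷ʳ z) → All (λ (v , w) → Arc H v w) (cycleArcs z (v ∷ r))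
   cycleArcs-arcs H z v [] (a ∷ _) = a ∷ []
   cycleArcs-arcs H z v (w ∷ r) (a ∷ l) = a ∷ cycleArcs-arcs H z w r l

  cycle-matrix : ∀ (v : Fin n) r → Unique (v ∷ r) →
   Det (pure (cycleArcs v (v ∷ r)) δ) ≡ 1# × Odd (pure (cycleArcs v (v ∷ r)) δ) ≡ par (length r)
  cycle-matrix {n} v [] _ = Det-cong same · cong proj₁ (D-δ {n}) , Odd-cong same · cong proj₂ (D-δ {n})
   where
   same : ∀ j k → (δ [ v ← δ v ]) j k ≡ δ j k
   same j k with j Fin.≟ v
   ... | yes refl = refl
   ... | no _ = refl
  cycle-matrix v (u ∷ r) ((v#u ∷ v∉) ∷ (u∉ ∷ unique)) =
   proj₁ swap · proj₁ IH
   , proj₂ swap · cong₂ _+_ (proj₂ IH) (proj₁ IH) · +-comm _ _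
   where
   IH = cycle-matrix v r (v∉ ∷ unique)
   T = cycleArcs v r
   M M' : Mat Carrier _
   M = pure ((v , next v r) ∷ T) δ
   M' = pure ((v , u) ∷ (u , next v r) ∷ T) δ
   u∉T : u ∉ map proj₁ ((v , next v r) ∷ T)
   u∉T (here u≡v) = v#u (sym u≡v)
   u∉T (there p) = All.lookup u∉ (subst (u ∈_) (map-proj₁ v r) p) refl
   swap = D-swap' {A = M} {M'} (swapped v#u
    (λ l → ←-same (pure ((u , next v r) ∷ T) δ) v (δ u) l · sym (pure-row ((v , next v r) ∷ T) δ l u∉T))
    (λ l → ←-diff (pure ((u , next v r) ∷ T) δ) (δ u) l (v#u ∘ sym) · ←-same (pure T δ) u _ l · sym (←-same (pure T δ) v _ l))
    λ j l j#v j#u → ←-diff (pure ((u , next v r) ∷ T) δ) (δ u) l j#v ·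
     ←-diff (pure T δ) _ l j#u · sym (←-diff (pure T δ) _ l j#v))

  even-cycle-witness : ∀ {m} (w point : Fin m → Carrier) → (∀ c → Dec (c ≡ 0#)) → (H : Digraph n) → ∀ c → IsEvenCycle H c →
   ext w point (_^ length c) ≢ 0# → ∃[ x ] (ext w point (λ y → Odd (mat H x y)) ≢ 0#)
  even-cycle-witness {n} w point _≟0 H (v ∷ r) ((unique , linked) , even) nz =
   let x , supp , nz' = unpeel w point _≟0 H (cycleArcs v (v ∷ r)) (λ _ _ → 0#)
        (subst Unique (sym (map-proj₁ v (v ∷ r))) unique)
        (cycleArcs-arcs H v v r linked)
        (All.universal (λ _ _ → refl) _) (λ _ → refl)
        λ e → nz ((ext-cong w point (_^ length (v ∷ r)) (λ y → y ^ length L * Odd (pure L (full (λ _ _ → 0#) y))) λ y → sym (value y)) · e)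
   in x , λ e → nz' ((ext-cong w point (λ y → Odd (full x y)) (λ y → Odd (mat H x y)) λ y → Odd-cong λ i j → cong (λ e → δ i j + y * e) (sym (support x supp i j))) · e)
   where
   L = cycleArcs v (v ∷ r)
   parity = solve 1 (λ p → p := con true :+ (con true :+ p)) refl (par (length r)) ·
    cong (1# +_) (par-even _ even) · +-identityʳ 1#
   full-0 : ∀ y i j → full (λ _ _ → 0#) y i j ≡ δ {n} i j
   full-0 y i j = cong (δ i j +_) (zeroʳ y) · +-identityʳ _
   value : ∀ y → y ^ length (cycleArcs v (v ∷ r)) * Odd (pure (cycleArcs v (v ∷ r)) (full (λ _ _ → 0#) y)) ≡ y ^ length (v ∷ r)
   value y = cong₂ (λ l o → y ^ l * o) (length-cycleArcs v (v ∷ r)) ((Odd-cong λ i j → pure-agree (cycleArcs v (v ∷ r)) _ δ i (full-0 y i) j) · proj₂ (cycle-matrix v r unique) · parity) ·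
    *-comm _ _ · *-identityˡ _
   support : ∀ x → (∀ {i j} → adjacent H i j ≡ false → x i j ≡ 0#) → ∀ i j → masked H x i j ≡ x i j
   support x supp i j with adjacent H i j in adj
   ... | true = refl
   ... | false = sym (supp adj)

module Tower where
 open BRing public

 open import Algebra.Bundles using (CommutativeRing)
 open import Algebra.Structures using (IsCommutativeRing)
 open import Data.List using (zipWith)
 open import Data.List.Properties using (length-++; ∷-injective; ++-cancelˡ)
 open import Data.Nat using (⌊_/2⌋; _≤_) renaming (_+_ to _+ℕ_; _*_ to _*ℕ_; _^_ to _^ℕ_)
 open import Data.Product.Properties using (≡-dec)
 open import Relation.Binary.Definitions using (DecidableEquality)

 𝔽₂ : BinaryRing
 𝔽₂ = record { Carrier = Bool ; _+_ = _xor_ ; _*_ = _∧_ ; 0# = false ; 1# = true ; isCommutativeRing = ring }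
  where
  ring : IsCommutativeRing _≡_ _xor_ _∧_ (λ x → x) false true
  ring = CommutativeRing.isCommutativeRing Bool.xor-∧-commutativeRing

 -- R[t]/(t² + t + a), with u + v t represented by (u , v).
 quadratic : (𝓡 : BinaryRing) → BinaryRing.Carrier 𝓡 → BinaryRing
 quadratic 𝓡 a = record
  { Carrier = Carrier × Carrier
  ; _+_ = λ (u , v) (u' , v') → u + u' , v + v'
  ; _*_ = λ (u , v) (u' , v') → u * u' + a * (v * v') , u * v' + v * u' + v * v'
  ; 0# = 0# , 0#
  ; 1# = 1# , 0#
  ; isCommutativeRing = record
   { isRing = record
    { +-isAbelianGroup = record
     { isGroup = record
      { isMonoid = record
       { isSemigroup = record
        { isMagma = record { isEquivalence = ≡.isEquivalence ; ∙-cong = cong₂ _ }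
        ; assoc = λ _ _ _ → cong₂ _,_ (+-assoc _ _ _) (+-assoc _ _ _) }
       ; identity = (λ _ → cong₂ _,_ (+-identityˡ _) (+-identityˡ _))
        , (λ _ → cong₂ _,_ (+-identityʳ _) (+-identityʳ _)) }
      ; inverse = (λ _ → cong₂ _,_ (x+x≡0 _) (x+x≡0 _)) , (λ _ → cong₂ _,_ (x+x≡0 _) (x+x≡0 _))
      ; ⁻¹-cong = λ e → e }
     ; comm = λ _ _ → cong₂ _,_ (+-comm _ _) (+-comm _ _) }
    ; *-cong = cong₂ _
    ; *-assoc = λ (u , v) (u' , v') (u'' , v'') → cong₂ _,_
     (solve 7 (λ a u v u' v' u'' v'' →
      (u :* u' :+ a :* (v :* v')) :* u'' :+ a :* ((u :* v' :+ v :* u' :+ v :* v') :* v'')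
      := u :* (u' :* u'' :+ a :* (v' :* v'')) :+ a :* (v :* (u' :* v'' :+ v' :* u'' :+ v' :* v''))) refl a u v u' v' u'' v'')
     (solve 7 (λ a u v u' v' u'' v'' →
      (u :* u' :+ a :* (v :* v')) :* v'' :+ (u :* v' :+ v :* u' :+ v :* v') :* u'' :+ (u :* v' :+ v :* u' :+ v :* v') :* v''
      := u :* (u' :* v'' :+ v' :* u'' :+ v' :* v'') :+ v :* (u' :* u'' :+ a :* (v' :* v'')) :+ v :* (u' :* v'' :+ v' :* u'' :+ v' :* v''))
       refl a u v u' v' u'' v'')
    ; *-identity =
     (λ (u , v) → cong₂ _,_ (solve 3 (λ a u v → con true :* u :+ a :* (con false :* v) := u) refl a u v)
      (solve 2 (λ u v → con true :* v :+ con false :* u :+ con false :* v := v) refl u v))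
     , (λ (u , v) → cong₂ _,_ (solve 3 (λ a u v → u :* con true :+ a :* (v :* con false) := u) refl a u v)
      (solve 2 (λ u v → u :* con false :+ v :* con true :+ v :* con false := v) refl u v))
    ; distrib =
     (λ (u , v) (u' , v') (u'' , v'') → cong₂ _,_
      (solve 7 (λ a u v u' v' u'' v'' → u :* (u' :+ u'') :+ a :* (v :* (v' :+ v''))
       := (u :* u' :+ a :* (v :* v')) :+ (u :* u'' :+ a :* (v :* v''))) refl a u v u' v' u'' v'')
      (solve 6 (λ u v u' v' u'' v'' → u :* (v' :+ v'') :+ v :* (u' :+ u'') :+ v :* (v' :+ v'')
       := (u :* v' :+ v :* u' :+ v :* v') :+ (u :* v'' :+ v :* u'' :+ v :* v'')) refl u v u' v' u'' v''))
     , (λ (u , v) (u' , v') (u'' , v'') → cong₂ _,_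
      (solve 7 (λ a u v u' v' u'' v'' → (u' :+ u'') :* u :+ a :* ((v' :+ v'') :* v)
       := (u' :* u :+ a :* (v' :* v)) :+ (u'' :* u :+ a :* (v'' :* v))) refl a u v u' v' u'' v'')
      (solve 6 (λ u v u' v' u'' v'' → (u' :+ u'') :* v :+ (v' :+ v'') :* u :+ (v' :+ v'') :* v
       := (u' :* v :+ v' :* u :+ v' :* v) :+ (u'' :* v :+ v'' :* u :+ v'' :* v)) refl u v u' v' u'' v'')) }
   ; *-comm = λ (u , v) (u' , v') → cong₂ _,_
    (solve 5 (λ a u v u' v' → u :* u' :+ a :* (v :* v') := u' :* u :+ a :* (v' :* v)) refl a u v u' v')
    (solve 4 (λ u v u' v' → u :* v' :+ v :* u' :+ v :* v' := u' :* v :+ v' :* u :+ v' :* v) refl u v u' v') } }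
  where open RingTheory 𝓡

 -- Conway's tower of the fields with 2 ^ 2 ^ k elements.
 tower : ℕ → BinaryRing
 gen : ∀ k → BinaryRing.Carrier (tower k)

 tower zero = 𝔽₂
 tower (suc k) = quadratic (tower k) (gen k)

 gen zero = true
 gen (suc k) = BinaryRing.0# (tower k) , gen k

 F : ℕ → Set
 F k = BinaryRing.Carrier (tower k)

 record IsField (𝓡 : BinaryRing) : Set where
  open RingTheory 𝓡
  field
   _≟_ : DecidableEquality Carrier
   1≢0 : 1# ≢ 0#
   reciprocal : ∀ x → x ≢ 0# → ∃[ y ] x * y ≡ 1#

  x*y≡0⇒y≡0 : ∀ {x} y → x ≢ 0# → x * y ≡ 0# → y ≡ 0#
  x*y≡0⇒y≡0 {x} y x≢0 xy=0 = let z , xz=1 = reciprocal x x≢0 in begin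
   y ≡⟨ sym (*-identityˡ y) ⟩
   1# * y ≡⟨ cong (_* y) (sym xz=1) ⟩
   x * z * y ≡⟨ solve 3 (λ x y z → x :* z :* y := z :* (x :* y)) refl x y z ⟩
   z * (x * y) ≡⟨ cong (z *_) xy=0 · zeroʳ z ⟩
   0# ∎
   where open ≡-Reasoning

 module _ (𝓡 : BinaryRing) (isField : IsField 𝓡) where
  open RingTheory 𝓡
  open IsField isField

  quadratic-isField : ∀ a → (∀ v → v * v + v ≢ a) → IsField (quadratic 𝓡 a)
  quadratic-isField a irreducible = record
   { _≟_ = ≡-dec _≟_ _≟_ ; 1≢0 = 1≢0 ∘ cong proj₁ ; reciprocal = recip }
   where
   norm : Carrier → Carrier → Carrier
   norm u v = u * (u + v) + a * (v * v)
   norm≢0 : ∀ u v → (u , v) ≢ (0# , 0#) → norm u v ≢ 0#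
   norm≢0 u v nz N=0 with v ≟ 0#
   ... | yes refl with u ≟ 0#
   ... | yes refl = nz refl
   ... | no u≢0 = u≢0 (x*y≡0⇒y≡0 u u≢0 (solve 2 (λ u a → u :* u := u :* (u :+ con false) :+ a :* (con false :* con false)) refl u a · N=0))
   norm≢0 u v nz N=0 | no v≢0 = let z , vz=1 = reciprocal v v≢0 in irreducible (u * z) (begin
    u * z * (u * z) + u * z ≡⟨ solve 2 (λ u z → u :* z :* (u :* z) :+ u :* z := u :* z :* (u :* z) :+ con true :* u :* z) refl u z ⟩
    u * z * (u * z) + 1# * u * z ≡⟨ cong (λ e → u * z * (u * z) + e * u * z) (sym vz=1) ⟩
    u * z * (u * z) + v * z * u * z ≡⟨ solve 4 (λ u v z a → u :* z :* (u :* z) :+ v :* z :* u :* z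
     := (u :* (u :+ v) :+ a :* (v :* v)) :* (z :* z) :+ a :* (v :* z :* (v :* z))) refl u v z a ⟩
    norm u v * (z * z) + a * (v * z * (v * z)) ≡⟨ cong₂ (λ p q → p * (z * z) + a * (q * q)) N=0 vz=1 ⟩
    0# * (z * z) + a * (1# * 1#) ≡⟨ solve 2 (λ z a → con false :* (z :* z) :+ a :* (con true :* con true) := a) refl z a ⟩
    a ∎)
    where open ≡-Reasoning
   recip : ∀ x → x ≢ (0# , 0#) → ∃[ y ] BinaryRing._*_ (quadratic 𝓡 a) x y ≡ (1# , 0#)
   recip (u , v) nz = let i , Ni=1 = reciprocal (norm u v) (norm≢0 u v nz) in
    (i * (u + v) , i * v) , cong₂ _,_
     (solve 4 (λ a u v i → u :* (i :* (u :+ v)) :+ a :* (v :* (i :* v)) := (u :* (u :+ v) :+ a :* (v :* v)) :* i) refl a u v i · Ni=1)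
     (solve 3 (λ u v i → u :* (i :* v) :+ v :* (i :* (u :+ v)) :+ v :* (i :* v) := con false) refl u v i)

 irreducible : ∀ k → let open BinaryRing (tower k) in ∀ v → v * v + v ≢ gen k
 irreducible zero false ()
 irreducible zero true ()
 irreducible (suc k) (u , v) e = irreducible k v (solve 2 (λ u v → v :* v :+ v := (u :* v :+ v :* u :+ v :* v) :+ v) refl u v · cong proj₂ e)
  where open RingTheory (tower k)

 tower-isField : ∀ k → IsField (tower k)
 tower-isField zero = record { _≟_ = Bool._≟_ ; 1≢0 = λ () ; reciprocal = λ { true _ → true , refl ; false f → contradiction refl f } }
 tower-isField (suc k) = quadratic-isField (tower k) (tower-isField k) (gen k) (irreducible k)

 width : ℕ → ℕ
 width zero = 1
 width (suc k) = width k +ℕ width k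

 width>0 : ∀ k → 0 < width k
 width>0 zero = s≤s z≤n
 width>0 (suc k) = width>0 k ·≤ ℕ.m≤m+n _ _

 module Frobenius (𝓡 : BinaryRing) where
  open RingTheory 𝓡

  frob : ℕ → Carrier → Carrier
  frob zero x = x
  frob (suc m) x = frob m x * frob m x

  frob-+ : ∀ m n x → frob (m +ℕ n) x ≡ frob m (frob n x)
  frob-+ zero n x = refl
  frob-+ (suc m) n x = cong₂ _*_ (frob-+ m n x) (frob-+ m n x)

  -- x ^ (2 + 4 + … + 2 ^ m)
  powers : ℕ → Carrier → Carrier
  powers zero x = 1#
  powers (suc m) x = powers m x * frob (suc m) x

  x*x*powers : ∀ m x → x * (x * powers m x) ≡ frob (suc m) x
  x*x*powers zero x = solve 1 (λ x → x :* (x :* con true) := x :* x) refl x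
  x*x*powers (suc m) x = solve 3 (λ x p f → x :* (x :* (p :* f)) := (x :* (x :* p)) :* f) refl x (powers m x) (frob (suc m) x) ·
   cong (_* frob (suc m) x) (x*x*powers m x)

 fermat : ∀ k x → Frobenius.frob (tower k) (width k) x ≡ x
 fermat zero false = refl
 fermat zero true = refl
 fermat (suc k) (u , v) = K'.frob-+ q q (u , v) · cong (K'.frob q) (once u v) · once _ v ·
  cong (_, v) (solve 2 (λ u e → u :+ e :+ e := u) refl u (τ q * v))
  where
  open RingTheory (tower k)
  module K = Frobenius (tower k)
  module K' = Frobenius (tower (suc k))
  q = width k
  a = gen k
  τ : ℕ → Carrier
  τ zero = 0#
  τ (suc m) = τ m * τ m + a
  expand : ∀ m u v → K'.frob m (u , v) ≡ (K.frob m u + τ m * K.frob m v , K.frob m v)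
  expand zero u v = cong (_, v) (solve 2 (λ u v → u := u :+ con false :* v) refl u v)
  expand (suc m) u v rewrite expand m u v = cong₂ _,_
   (solve 4 (λ a p t w → (p :+ t :* w) :* (p :+ t :* w) :+ a :* (w :* w) := p :* p :+ (t :* t :+ a) :* (w :* w)) refl a (K.frob m u) (τ m) (K.frob m v))
   (solve 3 (λ p t w → (p :+ t :* w) :* w :+ w :* (p :+ t :* w) :+ w :* w := w :* w) refl (K.frob m u) (τ m) (K.frob m v))
  once : ∀ u v → K'.frob q (u , v) ≡ (u + τ q * v , v)
  once u v = expand q u v · cong₂ (λ x y → x + τ q * y , y) (fermat k u) (fermat k v)

 inverse : ∀ k → F k → F k
 inverse k = Frobenius.powers (tower k) (ℕ.pred (width k))

 inverse-correct : ∀ k x → let open BinaryRing (tower k) in x ≢ 0# → x * inverse k x ≡ 1#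
 inverse-correct k x x≢0 = x+y≡0⇒x≡y _ _ (x*y≡0⇒y≡0 (x * inverse k x + 1#) x≢0 (solve 2 (λ x y → x :* (y :+ con true) := x :* y :+ x) refl x (x * inverse k x) ·
  cong (_+ x) (x*x*powers (ℕ.pred (width k)) x ·
   cong (λ w → frob w x) (ℕ.suc-pred (width k) {{ℕ.>-nonZero (width>0 k)}}) · fermat k x) · x+x≡0 x))
  where
  open RingTheory (tower k)
  open IsField (tower-isField k)
  open Frobenius (tower k)

 val : List Bool → ℕ
 val [] = 0
 val (b ∷ bs) = (if b then 1 else 0) +ℕ 2 *ℕ val bs

 val-++ : ∀ as bs → val (as ++ bs) ≡ val as +ℕ 2 ^ℕ length as *ℕ val bs
 val-++ [] bs = sym (ℕ.+-identityʳ _)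
 val-++ (a ∷ as) bs = cong (λ x → (if a then 1 else 0) +ℕ 2 *ℕ x) (val-++ as bs) ·
  rearrange (if a then 1 else 0) (val as) (2 ^ℕ length as) (val bs)
  where
  rearrange : ∀ a x p y → a +ℕ 2 *ℕ (x +ℕ p *ℕ y) ≡ a +ℕ 2 *ℕ x +ℕ 2 *ℕ p *ℕ y
  rearrange = solve-∀

 val< : ∀ bs → val bs < 2 ^ℕ length bs
 val< [] = s≤s z≤n
 val< (b ∷ bs) = ℕ.+-monoˡ-≤ (2 *ℕ val bs) (bit b) ·≤ sym (ℕ.*-suc 2 (val bs)) ≡≤ ℕ.*-monoʳ-≤ 2 (val< bs)
  where
  bit : ∀ b → suc (if b then 1 else 0) ≤ 2
  bit false = s≤s z≤n
  bit true = s≤s (s≤s z≤n)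

 half-val : ∀ b bs → ⌊ val (b ∷ bs) /2⌋ ≡ val bs
 half-val false bs = half-even (val bs)
  where
  half-even : ∀ m → ⌊ 2 *ℕ m /2⌋ ≡ m
  half-even m = cong (λ x → ⌊ m +ℕ x /2⌋) (ℕ.+-identityʳ m) · sym (ℕ.n≡⌊n+n/2⌋ m)
 half-val true bs = half-odd (val bs)
  where
  half-odd : ∀ m → ⌊ suc (2 *ℕ m) /2⌋ ≡ m
  half-odd zero = refl
  half-odd (suc m) = cong ⌊_/2⌋ (cong (λ x → suc (suc x)) (ℕ.+-suc m (m +ℕ 0))) · cong suc (half-odd m)

 val-injective : ∀ as bs → length as ≡ length bs → val as ≡ val bs → as ≡ bs
 val-injective [] [] _ _ = refl
 val-injective (a ∷ as) (b ∷ bs) l e = cong₂ _∷_ (head a b (cong (λ x → (if a then 1 else 0) +ℕ 2 *ℕ x) (sym tail) · e))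
  (val-injective as bs (ℕ.suc-injective l) tail)
  where
  tail : val as ≡ val bs
  tail = sym (half-val a as) · cong ⌊_/2⌋ e · half-val b bs
  head : ∀ a b {m} → (if a then 1 else 0) +ℕ m ≡ (if b then 1 else 0) +ℕ m → a ≡ b
  head false false _ = refl
  head true true _ = refl
  head false true {m} e = contradiction (sym e) (ℕ.1+n≢n {m})
  head true false {m} e = contradiction e (ℕ.1+n≢n {m})

 toBits : ∀ k → F k → List Bool
 toBits zero b = b ∷ []
 toBits (suc k) (u , v) = toBits k u ++ toBits k v

 length-toBits : ∀ k x → length (toBits k x) ≡ width k
 length-toBits zero x = refl
 length-toBits (suc k) (u , v) = length-++ (toBits k u) · cong₂ _+ℕ_ (length-toBits k u) (length-toBits k v)

 fromBits : ∀ k → List Bool → F k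
 fromBits zero [] = false
 fromBits zero (b ∷ _) = b
 fromBits (suc k) bs = fromBits k (take (width k) bs) , fromBits k (drop (width k) bs)

 toBits-fromBits : ∀ k bs → length bs ≡ width k → toBits k (fromBits k bs) ≡ bs
 toBits-fromBits zero (b ∷ []) _ = refl
 toBits-fromBits (suc k) bs l = (cong₂ _++_ (toBits-fromBits k _ (List.length-take (width k) bs · cong (width k ℕ.⊓_) l · ℕ.m≤n⇒m⊓n≡m (ℕ.m≤m+n _ _)))
  (toBits-fromBits k _ (List.length-drop (width k) bs · cong (_∸ width k) l · ℕ.m+n∸n≡m (width k) (width k)))) ·
  List.take++drop≡id (width k) bs
  where import Data.List.Properties as List

 enc : ∀ k → F k → ℕ
 enc k x = val (toBits k x)

 enc-pair : ∀ k u v → enc (suc k) (u , v) ≡ enc k u +ℕ 2 ^ℕ width k *ℕ enc k v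
 enc-pair k u v = val-++ (toBits k u) (toBits k v) · cong (λ l → enc k u +ℕ 2 ^ℕ l *ℕ enc k v) (length-toBits k u)

 enc< : ∀ k x → enc k x < 2 ^ℕ width k
 enc< k x = subst (λ l → enc k x < 2 ^ℕ l) (length-toBits k x) (val< (toBits k x))

 toBits-injective : ∀ k x y → toBits k x ≡ toBits k y → x ≡ y
 toBits-injective zero x y refl = refl
 toBits-injective (suc k) (u , v) (u' , v') e = cong₂ _,_ u= v=
  where
  prefix : ∀ (as bs : List Bool) {cs ds} → length as ≡ length bs → as ++ cs ≡ bs ++ ds → as ≡ bs
  prefix [] [] _ _ = refl
  prefix (a ∷ as) (b ∷ bs) l e = cong₂ _∷_ (proj₁ (∷-injective e)) (prefix as bs (ℕ.suc-injective l) (proj₂ (∷-injective e)))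
  u= = toBits-injective k u u' (prefix _ _ (length-toBits k u · sym (length-toBits k u')) e)
  v= = toBits-injective k v v' (++-cancelˡ (toBits k u) _ _ (e · cong (λ u → toBits k u ++ toBits k v') (sym u=)))

 enc-injective : ∀ k {x y} → enc k x ≡ enc k y → x ≡ y
 enc-injective k {x} {y} e = toBits-injective k x y (val-injective _ _ (length-toBits k x · sym (length-toBits k y)) e)

 enc-0 : ∀ k → enc k (BinaryRing.0# (tower k)) ≡ 0
 enc-0 zero = refl
 enc-0 (suc k) = enc-pair k _ _ · cong₂ (λ x y → x +ℕ 2 ^ℕ width k *ℕ y) (enc-0 k) (enc-0 k) · ℕ.*-zeroʳ (2 ^ℕ width k)

 enc-1 : ∀ k → enc k (BinaryRing.1# (tower k)) ≡ 1
 enc-1 zero = refl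
 enc-1 (suc k) = enc-pair k _ _ · cong₂ (λ x y → x +ℕ 2 ^ℕ width k *ℕ y) (enc-1 k) (enc-0 k) · cong (1 +ℕ_) (ℕ.*-zeroʳ (2 ^ℕ width k))

 odd : ℕ → Bool
 odd zero = false
 odd (suc zero) = true
 odd (suc (suc v)) = odd v

 digits : ℕ → ℕ → List Bool
 digits zero v = []
 digits (suc w) v = odd v ∷ digits w ⌊ v /2⌋

 length-digits : ∀ w v → length (digits w v) ≡ w
 length-digits zero v = refl
 length-digits (suc w) v = cong suc (length-digits w ⌊ v /2⌋)

 val-digits : ∀ w v → v < 2 ^ℕ w → val (digits w v) ≡ v
 val-digits zero zero _ = refl
 val-digits zero (suc v) (s≤s ())
 val-digits (suc w) v v< = cong (λ x → (if odd v then 1 else 0) +ℕ 2 *ℕ x) (val-digits w ⌊ v /2⌋ (half< v v<)) · recompose v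
  where
  double-half : ∀ v → 2 *ℕ ⌊ v /2⌋ ≤ v
  double-half zero = z≤n
  double-half (suc zero) = z≤n
  double-half (suc (suc v)) = (ℕ.*-suc 2 ⌊ v /2⌋) ≡≤ s≤s (s≤s (double-half v))
  half< : ∀ v → v < 2 *ℕ 2 ^ℕ w → ⌊ v /2⌋ < 2 ^ℕ w
  half< v v< = ℕ.*-cancelˡ-< 2 _ _ (ℕ.≤-<-trans (double-half v) v<)
  recompose : ∀ v → (if odd v then 1 else 0) +ℕ 2 *ℕ ⌊ v /2⌋ ≡ v
  recompose zero = refl
  recompose (suc zero) = refl
  recompose (suc (suc v)) = cong ((if odd v then 1 else 0) +ℕ_) (ℕ.*-suc 2 ⌊ v /2⌋) ·
   ℕ.+-suc (if odd v then 1 else 0) _ · cong suc (ℕ.+-suc (if odd v then 1 else 0) _ · cong suc (recompose v))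

 dec : ∀ k → ℕ → F k
 dec k v = fromBits k (digits (width k) v)

 enc-dec : ∀ k v → v < 2 ^ℕ width k → enc k (dec k v) ≡ v
 enc-dec k v v< = cong val (toBits-fromBits k _ (length-digits (width k) v)) · val-digits (width k) v v<

 toBits-+ : ∀ k x y → toBits k (BinaryRing._+_ (tower k) x y) ≡ zipWith _xor_ (toBits k x) (toBits k y)
 toBits-+ zero x y = refl
 toBits-+ (suc k) (u , v) (u' , v') = cong₂ _++_ (toBits-+ k u u') (toBits-+ k v v') ·
  sym (zipWith-++ (toBits k u) _ (length-toBits k u · sym (length-toBits k u')))
  where
  zipWith-++ : ∀ as bs {cs ds} → length as ≡ length bs →
   zipWith _xor_ (as ++ cs) (bs ++ ds) ≡ zipWith _xor_ as bs ++ zipWith _xor_ cs ds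
  zipWith-++ [] [] _ = refl
  zipWith-++ (a ∷ as) (b ∷ bs) l = cong (_ ∷_) (zipWith-++ as bs (ℕ.suc-injective l))

 enc-gen : ∀ k → enc k (gen k) ≡ 2 ^ℕ ℕ.pred (width k)
 enc-gen zero = refl
 enc-gen (suc k) = enc-pair k _ _ · cong₂ (λ x y → x +ℕ 2 ^ℕ width k *ℕ y) (enc-0 k) (enc-gen k) ·
  sym (ℕ.^-distribˡ-+-* 2 (width k) (ℕ.pred (width k))) · cong (2 ^ℕ_) (lemma (width k) (width>0 k))
  where
  lemma : ∀ w → 0 < w → w +ℕ ℕ.pred w ≡ ℕ.pred (w +ℕ w)
  lemma (suc w) _ = sym (ℕ.+-suc w w)

 -- The field element with code 2 ^ i.
 basis : ∀ k → ℕ → F k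
 basis zero i = true
 basis (suc k) i with i ℕ.<? width k
 ... | yes _ = basis k i , BinaryRing.0# (tower k)
 ... | no _ = BinaryRing.0# (tower k) , basis k (i ∸ width k)

 basis-low : ∀ k {i} → i < width k → basis (suc k) i ≡ (basis k i , BinaryRing.0# (tower k))
 basis-low k {i} i< with i ℕ.<? width k
 ... | yes _ = refl
 ... | no i≮ = contradiction i< i≮

 basis-high : ∀ k i → basis (suc k) (width k +ℕ i) ≡ (BinaryRing.0# (tower k) , basis k i)
 basis-high k i with width k +ℕ i ℕ.<? width k
 ... | yes lt = contradiction lt (ℕ.≤⇒≯ (ℕ.m≤m+n (width k) i))
 ... | no _ = cong (λ j → BinaryRing.0# (tower k) , basis k j) (ℕ.m+n∸m≡n (width k) i)

 module Combination (𝓡 : BinaryRing) where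
  open RingTheory 𝓡

  combination : (ℕ → Carrier) → List Bool → Carrier
  combination f [] = 0#
  combination f (b ∷ bs) = (if b then f 0 else 0#) + combination (f ∘ suc) bs

  combination-++ : ∀ f as bs → combination f (as ++ bs) ≡ combination f as + combination (λ i → f (length as +ℕ i)) bs
  combination-++ f [] bs = sym (+-identityˡ _)
  combination-++ f (a ∷ as) bs = cong ((if a then f 0 else 0#) +_) (combination-++ (f ∘ suc) as bs) · sym (+-assoc _ _ _)

  combination-* : ∀ f bs y → combination f bs * y ≡ combination (λ i → f i * y) bs
  combination-* f [] y = zeroˡ y
  combination-* f (b ∷ bs) y = distribʳ y _ _ · (cong₂ _+_ (scale b) (combination-* (f ∘ suc) bs y))
   where
   scale : ∀ b → (if b then f 0 else 0#) * y ≡ (if b then f 0 * y else 0#)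
   scale false = zeroˡ y
   scale true = refl

 combination-basis : ∀ k x → Combination.combination (tower k) (basis k) (toBits k x) ≡ x
 combination-basis zero false = refl
 combination-basis zero true = refl
 combination-basis (suc k) (u , v) = combination-++ (basis (suc k)) (toBits k u) (toBits k v) ·
  cong₂ K'._+_
   ((first (toBits k u) (basis (suc k)) (basis k) λ i i< → basis-low k (subst (i <_) (length-toBits k u) i<)) · cong (_, 0#) (combination-basis k u))
   ((second (toBits k v) _ (basis k) λ i → cong (λ l → basis (suc k) (l +ℕ i)) (length-toBits k u) · basis-high k i) ·
    cong (0# ,_) (combination-basis k v)) ·
  (cong₂ _,_ (+-identityʳ u) (+-identityˡ v))
  where
  open RingTheory (tower k)
  module K' = RingTheory (tower (suc k))
  open Combination (tower (suc k))
  module C = Combination (tower k)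
  first : ∀ bs (f : ℕ → F (suc k)) (g : ℕ → F k) → (∀ i → i < length bs → f i ≡ (g i , 0#)) → combination f bs ≡ (C.combination g bs , 0#)
  first [] f g e = refl
  first (true ∷ bs) f g e = cong₂ K'._+_ (e 0 (s≤s z≤n)) (first bs _ _ λ i i< → e (suc i) (s≤s i<)) · (cong₂ _,_ refl (+-identityˡ 0#))
  first (false ∷ bs) f g e = cong (K'.0# K'.+_) (first bs _ _ λ i i< → e (suc i) (s≤s i<)) · (cong₂ _,_ refl (+-identityˡ 0#))
  second : ∀ bs (f : ℕ → F (suc k)) (g : ℕ → F k) → (∀ i → f i ≡ (0# , g i)) → combination f bs ≡ (0# , C.combination g bs)
  second [] f g e = refl
  second (true ∷ bs) f g e = cong₂ K'._+_ (e 0) (second bs _ _ λ i → e (suc i)) · (cong₂ _,_ (+-identityˡ 0#) refl)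
  second (false ∷ bs) f g e = cong (K'.0# K'.+_) (second bs _ _ λ i → e (suc i)) · (cong₂ _,_ (+-identityˡ 0#) refl)

module Machine where
 open import Defs hiding (run)
 open import Data.Bool using (T)
 open import Data.Empty using (⊥; ⊥-elim)
 open import Data.List.Properties using (++-assoc)
 open import Data.Nat
 open import Data.Nat.Properties
 open import Data.Nat.GeneralisedArithmetic using (iterate)
 open import Data.Nat.Logarithm
 open import Data.Unit using (⊤)

 ⌊n/2⌋<2^k : ∀ n k → n < 2 ^ suc k → ⌊ n /2⌋ < 2 ^ k
 ⌊n/2⌋<2^k n k n< = *-cancelˡ-< 2 _ _ (≤-<-trans (double n) n<)
  where
  double : ∀ n → 2 * ⌊ n /2⌋ ≤ n
  double zero = z≤n
  double (suc zero) = z≤n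
  double (suc (suc n)) = cong suc (+-suc ⌊ n /2⌋ (⌊ n /2⌋ + 0)) ≡≤ s≤s (s≤s (double n))

 bits-≤ : ∀ k x → x < 2 ^ suc k → bits x ≤ suc k
 bits-≤ zero x x<2 = s≤s (⌊log₂⌋-mono-≤ (≤-pred x<2) ≤≡ ⌊log₂1⌋)
  where
  ⌊log₂1⌋ : ⌊log₂ 1 ⌋ ≡ 0
  ⌊log₂1⌋ = refl
 bits-≤ (suc k) x x< = s≤s ((pred≤ ⌊log₂ x ⌋) ·≤
  subst (λ l → suc l ≤ suc k) (⌊log₂⌊n/2⌋⌋≡⌊log₂n⌋∸1 x) (bits-≤ k ⌊ x /2⌋ (⌊n/2⌋<2^k x (suc k) x<)))
  where
  pred≤ : ∀ l → l ≤ suc (l ∸ 1)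
  pred≤ zero = z≤n
  pred≤ (suc l) = ≤-refl

 +shift : ∀ k {m t} → k + suc m ≡ t → suc k + m ≡ t
 +shift k {m} e = sym (+-suc k m) · e

 +shift< : ∀ k {m t} → k + suc m ≡ t → k < t
 +shift< k {m} e = m≤m+n (suc k) m ≤≡ +shift k e

 m<2^m : ∀ m → m < 2 ^ m
 m<2^m zero = s≤s z≤n
 m<2^m (suc m) = +-mono-≤ (m^n>0 2 m) (m<2^m m) ≤≡ cong (2 ^ m +_) (sym (+-identityʳ _))

 record State : Set where
  constructor ⟨_,_,_,_⟩
  field
   R : ℕ → ℕ
   M : ℕ → ℕ
   ω : List Bool
   o : List ℕ

 open State public

 config : Program → State → ℕ → Config
 config p σ t = ⟪ p , R σ , M σ , ω σ , o σ , t ⟫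

 -- The state after an instruction; the argument occurs in it only once,
 -- which keeps the states of long programs small.
 set : Reg → (State → ℕ) → State → State
 set r f σ = ⟨ R σ [ r ≔ f σ ] , M σ , ω σ , o σ ⟩

 afterConst : Reg → ℕ → State → State
 afterConst r k = set r λ _ → k

 afterAdd afterSub afterMul : (r i j : Reg) → State → State
 afterAdd r i j = set r λ σ → R σ i + R σ j
 afterSub r i j = set r λ σ → R σ i ∸ R σ j
 afterMul r i j = set r λ σ → R σ i * R σ j

 afterHalf afterLoad afterStore : (r i : Reg) → State → State
 afterHalf r i = set r λ σ → ⌊ R σ i /2⌋
 afterLoad r i = set r λ σ → M σ (R σ i)
 afterStore i j σ = ⟨ R σ , M σ [ R σ i ≔ R σ j ] , ω σ , o σ ⟩

 afterFlip : Reg → Bool → List Bool → State → State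
 afterFlip r c ω' σ = ⟨ R σ [ r ≔ (if c then 1 else 0) ] , M σ , ω' , o σ ⟩

 afterEmit : Reg → State → State
 afterEmit r σ = ⟨ R σ , M σ , ω σ , o σ ∷ʳ R σ r ⟩

 after : Stmt → State → State
 after (const r k) = afterConst r k
 after (add r i j) = afterAdd r i j
 after (sub r i j) = afterSub r i j
 after (mul r i j) = afterMul r i j
 after (half r i) = afterHalf r i
 after (load r i) = afterLoad r i
 after (store i j) = afterStore i j
 after (emit r) = afterEmit r
 after _ = λ σ → σ

 afters : Program → State → State
 afters [] σ = σ
 afters (i ∷ p) σ = afters p (after i σ)

 -- Executions whose registers and memory cells remain below 2 ^ suc b and
 -- which do not touch the memory from address s on.
 module Execution (b s : ℕ) where

  limit : ℕ
  limit = 2 ^ suc b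

  Fits : (R M : ℕ → ℕ) → Set
  Fits R M = (∀ r → R r < limit) × (∀ a → M a < limit) × (∀ a → s ≤ a → M a ≡ 0)

  stepCost : ℕ
  stepCost = suc b * suc b + (suc b + suc b)

  data Path : Config → ℕ → Config → Set where
   stop : ∀ {c} → Fits (regs c) (mem c) → Path c 0 c
   next : ∀ {c k c'} → Fits (regs c) (mem c) → Path (step c) k c' → Path c (suc k) c'

  _⊕ₚ_ : ∀ {c c' c'' k k'} → Path c k c' → Path c' k' c'' → Path c (k + k') c''
  stop _ ⊕ₚ q = q
  next f p ⊕ₚ q = next f (p ⊕ₚ q)

  iterate-halted : ∀ {c} t → code c ≡ [] → iterate step c t ≡ c
  iterate-halted {c} zero e = refl
  iterate-halted {⟪ [] , _ , _ , _ , _ , _ ⟫} (suc t) refl = iterate-halted t refl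

  path-halts : ∀ {c k c'} t → Path c k c' → code c' ≡ [] → k ≤ t → iterate step c t ≡ c'
  path-halts t (stop _) e _ = iterate-halted t e
  path-halts (suc t) (next _ p) e (s≤s k≤t) = path-halts t p e k≤t

  FitsConfig : Config → Set
  FitsConfig c = Fits (regs c) (mem c)

  path-fits : ∀ {c k c'} t → Path c k c' → code c' ≡ [] → FitsConfig (iterate step c t)
  path-fits t (stop f) e = subst FitsConfig (sym (iterate-halted t e)) f
  path-fits zero (next f _) e = f
  path-fits (suc t) (next _ p) e = path-fits t p e

  FitsState : State → Set
  FitsState σ = Fits (R σ) (M σ)

  record Exec (p : Program) (σ : State) (B : ℕ) (Q : State → Set) : Set where
   constructor exec
   field
    run : FitsState σ → ∃[ σ' ] ∃[ k ] (k ≤ B × Q σ' × FitsState σ' ×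
     (∀ rest t → ∃[ t' ] (t' ≤ t + k * stepCost × Path (config (p ++ rest) σ t) k (config rest σ' t'))))

  open Exec public

  bits-≤' : ∀ {x} → x < limit → bits x ≤ suc b
  bits-≤' = bits-≤ b _

  cost1 : ∀ {x} → x < limit → bits x ≤ stepCost
  cost1 x< = bits-≤' x< ·≤ m≤n+m (suc b) (suc b) ·≤ m≤n+m _ (suc b * suc b)

  cost2 : ∀ {x y} → x < limit → y < limit → bits x + bits y ≤ stepCost
  cost2 x< y< = +-mono-≤ (bits-≤' x<) (bits-≤' y<) ·≤ m≤n+m _ (suc b * suc b)

  cost× : ∀ {x y} → x < limit → y < limit → bits x * bits y ≤ stepCost
  cost× x< y< = *-mono-≤ (bits-≤' x<) (bits-≤' y<) ·≤ m≤m+n _ _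

  cost-1 : 1 ≤ stepCost
  cost-1 = cost1 {0} (m^n>0 2 (suc b))

  instruction : ∀ {p σ B Q} i σ1 → (FitsState σ → FitsState σ1) →
   (FitsState σ → ∃[ c ] (c ≤ stepCost × ∀ rest t → step (config (i ∷ rest) σ t) ≡ config rest σ1 (t + c))) →
   Exec p σ1 B Q → Exec (i ∷ p) σ (suc B) Q
  instruction {p} {σ} i σ1 fits steps (exec e) = exec λ f →
   let c , c≤ , st = steps f
       σ' , k , k≤ , q , f' , paths = e (fits f) in
   σ' , suc k , s≤s k≤ , q , f' , λ rest t →
    let t' , t'≤ , path = paths rest (t + c) in
    t' , t'≤ ·≤ +-assoc t c _ ≡≤ +-monoʳ-≤ t (+-monoˡ-≤ _ c≤) ,
    next f (subst (λ c → Path c k (config rest σ' t')) (sym (st (p ++ rest) t)) path)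

  set-fits : ∀ {R M x} r → x < limit → Fits R M → Fits (R [ r ≔ x ]) M
  set-fits {R} {x = x} r x< (fR , fM , fS) = bounded , fM , fS
   where
   bounded : ∀ j → (R [ r ≔ x ]) j < limit
   bounded j with r ≡ᵇ j
   ... | true = x<
   ... | false = fR j

  store-fits : ∀ {R M} i j → R i < s → Fits R M → Fits R (M [ R i ≔ R j ])
  store-fits {R} {M} i j i< (fR , fM , fS) = fR , bounded , outside
   where
   bounded : ∀ a → (M [ R i ≔ R j ]) a < limit
   bounded a with R i ≡ᵇ a
   ... | true = fR j
   ... | false = fM a
   outside : ∀ a → s ≤ a → (M [ R i ≔ R j ]) a ≡ 0
   outside a s≤a with R i ≡ᵇ a in e
   ... | true = ⊥-elim (<⇒≱ i< (subst (s ≤_) (sym (≡ᵇ⇒≡ (R i) a (subst T (sym e) tt))) s≤a))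
   ... | false = fS a s≤a

  coin< : ∀ c → (if c then 1 else 0) < limit
  coin< false = m^n>0 2 (suc b)
  coin< true = +-mono-≤ (m^n>0 2 b) (m^n>0 2 b) ≤≡ cong (2 ^ b +_) (sym (+-identityʳ _))

  module _ {p : Program} {B : ℕ} {Q : State → Set} {σ : State} where
   x-const : ∀ {r k} → k < limit → Exec p (afterConst r k σ) B Q → Exec (const r k ∷ p) σ (suc B) Q
   x-const {r} {k} k< = instruction _ (afterConst r k σ) (set-fits r k<) λ _ → _ , cost1 k< , λ _ _ → refl
   x-add : ∀ {r i j} → R σ i + R σ j < limit → Exec p (afterAdd r i j σ) B Q → Exec (add r i j ∷ p) σ (suc B) Q
   x-add {r} {i} {j} k< = instruction _ (afterAdd r i j σ) (set-fits r k<) λ (f , _) → _ , cost2 (f i) (f j) , λ _ _ → refl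
   x-sub : ∀ {r i j} → Exec p (afterSub r i j σ) B Q → Exec (sub r i j ∷ p) σ (suc B) Q
   x-sub {r} {i} {j} = instruction _ (afterSub r i j σ) (λ f → set-fits r (≤-<-trans (m∸n≤m (R σ i) (R σ j)) (proj₁ f i)) f)
    λ (f , _) → _ , cost2 (f i) (f j) , λ _ _ → refl
   x-mul : ∀ {r i j} → R σ i * R σ j < limit → Exec p (afterMul r i j σ) B Q → Exec (mul r i j ∷ p) σ (suc B) Q
   x-mul {r} {i} {j} k< = instruction _ (afterMul r i j σ) (set-fits r k<) λ (f , _) → _ , cost× (f i) (f j) , λ _ _ → refl
   x-half : ∀ {r i} → Exec p (afterHalf r i σ) B Q → Exec (half r i ∷ p) σ (suc B) Q
   x-half {r} {i} = instruction _ (afterHalf r i σ) (λ f → set-fits r (≤-<-trans (⌊n/2⌋≤n (R σ i)) (proj₁ f i)) f)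
    λ (f , _) → _ , cost1 (f i) , λ _ _ → refl
   x-load : ∀ {r i} → Exec p (afterLoad r i σ) B Q → Exec (load r i ∷ p) σ (suc B) Q
   x-load {r} {i} = instruction _ (afterLoad r i σ) (λ f → set-fits r (proj₁ (proj₂ f) (R σ i)) f)
    λ (f , g , _) → _ , cost2 (f i) (g (R σ i)) , λ _ _ → refl
   x-store : ∀ {i j} → R σ i < s → Exec p (afterStore i j σ) B Q → Exec (store i j ∷ p) σ (suc B) Q
   x-store {i} {j} i< = instruction _ (afterStore i j σ) (store-fits i j i<) λ (f , _) → _ , cost2 (f i) (f j) , λ _ _ → refl
   x-flip : ∀ {r c ω'} → ω σ ≡ c ∷ ω' → Exec p (afterFlip r c ω' σ) B Q → Exec (flip r ∷ p) σ (suc B) Q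
   x-flip {r} {c} {ω'} e = instruction _ (afterFlip r c ω' σ) (set-fits r (coin< c)) λ _ → 1 , cost-1 , λ rest t →
    cong (λ ω → step ⟪ flip r ∷ rest , R σ , M σ , ω , o σ , t ⟫) e
   x-emit : ∀ {r} → Exec p (afterEmit r σ) B Q → Exec (emit r ∷ p) σ (suc B) Q
   x-emit {r} = instruction _ (afterEmit r σ) (λ f → f) λ (f , _) → _ , cost1 (f r) , λ _ _ → refl
   ≢0⇒false : ∀ {x} → x ≢ 0 → (x ≡ᵇ 0) ≡ false
   ≢0⇒false {zero} x≢0 = contradiction refl x≢0
   ≢0⇒false {suc x} _ = refl
   jump : ∀ i q {B Q} → (FitsState σ → ∃[ c ] (c ≤ stepCost × ∀ rest t →
    step (config (i ∷ p ++ rest) σ t) ≡ config (q ++ rest) σ (t + c))) →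
    Exec q σ B Q → Exec (i ∷ p) σ (suc B) Q
   jump i q steps (exec e) = exec λ f →
    let c , c≤ , st = steps f
        σ' , k , k≤ , q , f' , paths = e f in
    σ' , suc k , s≤s k≤ , q , f' , λ rest t →
     let t' , t'≤ , path = paths rest (t + c) in
     t' , t'≤ ·≤ +-assoc t c _ ≡≤ +-monoʳ-≤ t (+-monoˡ-≤ _ c≤) ,
     next f (subst (λ c → Path c k (config rest σ' t')) (sym (st rest t)) path)
   x-branch-≢0 : ∀ {a p1 p2} → R σ a ≢ 0 → Exec (p1 ++ p) σ B Q → Exec (branch a p1 p2 ∷ p) σ (suc B) Q
   x-branch-≢0 {a} {p1} {p2} a≢0 = jump (branch a p1 p2) (p1 ++ p) λ (f , _) → bits (R σ a) , cost1 (f a) , λ rest t →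
    cong (λ b → config ((if b then p2 else p1) ++ p ++ rest) σ (t + bits (R σ a))) (≢0⇒false a≢0) ·
     cong (λ q → config q σ (t + bits (R σ a))) (sym (++-assoc p1 p rest))
   x-branch-0 : ∀ {a p1 p2} → R σ a ≡ 0 → Exec (p2 ++ p) σ B Q → Exec (branch a p1 p2 ∷ p) σ (suc B) Q
   x-branch-0 {a} {p1} {p2} a=0 = jump (branch a p1 p2) (p2 ++ p) λ (f , _) → bits (R σ a) , cost1 (f a) , λ rest t →
    cong (λ b → config ((if b ≡ᵇ 0 then p2 else p1) ++ p ++ rest) σ (t + bits (R σ a))) a=0 ·
     cong (λ q → config q σ (t + bits (R σ a))) (sym (++-assoc p2 p rest))
   x-while-≢0 : ∀ {a q} → R σ a ≢ 0 → Exec (q ++ while a q ∷ p) σ B Q → Exec (while a q ∷ p) σ (suc B) Q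
   x-while-≢0 {a} {q} a≢0 = jump (while a q) (q ++ while a q ∷ p) λ (f , _) → bits (R σ a) , cost1 (f a) , λ rest t →
    cong (λ b → config (if b then p ++ rest else q ++ while a q ∷ p ++ rest) σ (t + bits (R σ a))) (≢0⇒false a≢0) ·
     cong (λ q → config q σ (t + bits (R σ a))) (sym (++-assoc q (while a q ∷ p) rest))
   x-while-0 : ∀ {a q} → R σ a ≡ 0 → Exec p σ B Q → Exec (while a q ∷ p) σ (suc B) Q
   x-while-0 {a} {q} a=0 = jump (while a q) p λ (f , _) → bits (R σ a) , cost1 (f a) , λ rest t →
    cong (λ b → config (if b ≡ᵇ 0 then p ++ rest else q ++ while a q ∷ p ++ rest) σ (t + bits (R σ a))) a=0

  -- The side conditions of a straight-line program.
  Safe : Program → State → Set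
  Safe [] σ = ⊤
  Safe (const r k ∷ p) σ = k < limit × Safe p (afterConst r k σ)
  Safe (add r i j ∷ p) σ = R σ i + R σ j < limit × Safe p (afterAdd r i j σ)
  Safe (sub r i j ∷ p) σ = Safe p (afterSub r i j σ)
  Safe (mul r i j ∷ p) σ = R σ i * R σ j < limit × Safe p (afterMul r i j σ)
  Safe (half r i ∷ p) σ = Safe p (afterHalf r i σ)
  Safe (load r i ∷ p) σ = Safe p (afterLoad r i σ)
  Safe (store i j ∷ p) σ = R σ i < s × Safe p (afterStore i j σ)
  Safe (emit r ∷ p) σ = Safe p (afterEmit r σ)
  Safe (_ ∷ p) σ = ⊥

  x-done : ∀ {σ Q} → Q σ → Exec [] σ 0 Q
  x-done q = exec λ f → _ , 0 , z≤n , q , f , λ rest t → t , m≤m+n t 0 , stop f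

  x-≤ : ∀ {p σ B B' Q} → B ≤ B' → Exec p σ B Q → Exec p σ B' Q
  x-≤ B≤ (exec e) = exec λ f → let σ' , k , k≤ , r = e f in σ' , k , k≤ ·≤ B≤ , r

  x-block : ∀ m {p σ B Q} → Safe (take m p) σ → Exec (drop m p) (afters (take m p) σ) B Q → Exec p σ (m + B) Q
  x-block zero h e = e
  x-block (suc m) {[]} h e = x-≤ (m≤n+m _ (suc m)) e
  x-block (suc m) {const r k ∷ p} (b , h) e = x-const b (x-block m h e)
  x-block (suc m) {add r i j ∷ p} (b , h) e = x-add b (x-block m h e)
  x-block (suc m) {sub r i j ∷ p} h e = x-sub (x-block m h e)
  x-block (suc m) {mul r i j ∷ p} (b , h) e = x-mul b (x-block m h e)
  x-block (suc m) {half r i ∷ p} h e = x-half (x-block m h e)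
  x-block (suc m) {load r i ∷ p} h e = x-load (x-block m h e)
  x-block (suc m) {store i j ∷ p} (b , h) e = x-store b (x-block m h e)
  x-block (suc m) {emit r ∷ p} h e = x-emit (x-block m h e)
  x-block (suc m) {flip r ∷ p} ()
  x-block (suc m) {branch a p q ∷ r} ()
  x-block (suc m) {while a p ∷ q} ()

  x-mono : ∀ {p σ B Q Q'} → (∀ σ' → Q σ' → Q' σ') → Exec p σ B Q → Exec p σ B Q'
  x-mono g (exec e) = exec λ f → let σ' , k , k≤ , q , r = e f in σ' , k , k≤ , g σ' q , r

  x-seq : ∀ {p p' σ B B' Q Q'} → Exec p σ B Q → (∀ σ' → Q σ' → Exec p' σ' B' Q') → Exec (p ++ p') σ (B + B') Q'
  x-seq {p} {p'} {σ} (exec e) g = exec λ f →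
   let σ1 , k1 , k1≤ , q1 , f1 , paths1 = e f
       σ2 , k2 , k2≤ , q2 , f2 , paths2 = run (g σ1 q1) f1 in
   σ2 , k1 + k2 , +-mono-≤ k1≤ k2≤ , q2 , f2 , λ rest t →
    let t1 , t1≤ , path1 = paths1 (p' ++ rest) t
        t2 , t2≤ , path2 = paths2 rest t1 in
    t2 , t2≤ ·≤ +-monoˡ-≤ _ t1≤ ≤≡ +-assoc t _ _ · cong (t +_) (sym (*-distribʳ-+ stepCost k1 k2)) ,
    subst (λ q → Path (config q σ t) (k1 + k2) (config rest σ2 t2)) (sym (++-assoc p p' rest)) (path1 ⊕ₚ path2)

  x-loop : ∀ {a q p B B' Q} (I : ℕ → State → Set) →
   (∀ m σ → I (suc m) σ → R σ a ≢ 0) → (∀ σ → I 0 σ → R σ a ≡ 0) →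
   (∀ m σ → I (suc m) σ → Exec q σ B (I m)) → (∀ σ → I 0 σ → Exec p σ B' Q) →
   ∀ m {σ} → I m σ → Exec (while a q ∷ p) σ (m * suc B + suc B') Q
  x-loop I ≢0 ≡0 body exit zero i = x-while-0 (≡0 _ i) (exit _ i)
  x-loop {B = B} {B'} I ≢0 ≡0 body exit (suc m) i = x-≤ (≤-reflexive (cong suc (sym (+-assoc B (m * suc B) (suc B')))))
   (x-while-≢0 (≢0 m _ i) (x-seq (body m _ i) λ σ' i' → x-loop I ≢0 ≡0 body exit m i'))

  x-for : ∀ {a q p B B' Q} (I : ℕ → State → Set) → (∀ {m σ} → I m σ → R σ a ≡ m) →
   (∀ m σ → I (suc m) σ → Exec q σ B (I m)) → (∀ σ → I 0 σ → Exec p σ B' Q) →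
   ∀ m {σ} → I m σ → Exec (while a q ∷ p) σ (m * suc B + suc B') Q
  x-for I count = x-loop I (λ m σ i e → 1+n≢0 (sym (count i) · e)) (λ σ → count)

module FieldProg where
 open Tower public
 open Machine public

 open import Defs hiding (run)
 open import Data.List using (zipWith)
 open import Data.Nat
 open import Data.Nat.Properties

 xorBody xorP accumulate mulRow mulRows mulInner mulP invBody invP : Program

 xorBody =
  half 3 0 ∷ add 4 3 3 ∷ sub 5 0 4 ∷ half 0 0 ∷
  half 3 1 ∷ add 4 3 3 ∷ sub 6 1 4 ∷ half 1 1 ∷
  add 5 5 6 ∷ half 3 5 ∷ add 3 3 3 ∷ sub 5 5 3 ∷
  mul 5 5 7 ∷ add 2 2 5 ∷ add 7 7 7 ∷ sub 8 8 41 ∷ []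

 xorP = const 2 0 ∷ const 7 1 ∷ add 8 43 42 ∷ while 8 xorBody ∷ []

 accumulate = load 1 20 ∷ add 0 14 42 ∷ xorP ++ add 14 2 42 ∷ []

 mulInner = half 17 19 ∷ add 18 17 17 ∷ sub 18 19 18 ∷ half 19 19 ∷ branch 18 accumulate [] ∷ add 20 20 41 ∷ sub 21 21 41 ∷ []

 mulRow = add 19 13 42 ∷ add 20 15 42 ∷ add 21 43 42 ∷ while 21 mulInner ∷ []

 mulRows = half 17 12 ∷ add 18 17 17 ∷ sub 18 12 18 ∷ half 12 12 ∷ branch 18 mulRow [] ∷ add 15 15 45 ∷ sub 16 16 41 ∷ []

 mulP = const 14 0 ∷ add 15 44 42 ∷ add 16 43 42 ∷ while 16 mulRows ∷ []

 invBody = add 12 24 42 ∷ add 13 24 42 ∷ mulP ++ add 24 14 42 ∷ add 12 25 42 ∷ add 13 14 42 ∷ mulP ++ add 25 14 42 ∷ sub 26 26 41 ∷ []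

 invP = const 25 1 ∷ sub 26 43 41 ∷ while 26 invBody ∷ []

 bit01 : Bool → ℕ
 bit01 b = if b then 1 else 0

 bit-of : ∀ {x} a as → x ≡ val (a ∷ as) → x ∸ (⌊ x /2⌋ + ⌊ x /2⌋) ≡ bit01 a
 bit-of a as refl rewrite half-val a as = cong (λ y → bit01 a + (val as + y) ∸ (val as + val as)) (+-identityʳ (val as)) · m+n∸n≡m (bit01 a) (val as + val as)

 half-of : ∀ {x} a as → x ≡ val (a ∷ as) → ⌊ x /2⌋ ≡ val as
 half-of a as refl = half-val a as

 double-half≤ : ∀ x → ⌊ x /2⌋ + ⌊ x /2⌋ ≤ x
 double-half≤ x = (+-monoʳ-≤ ⌊ x /2⌋ (⌊n/2⌋≤⌈n/2⌉ x)) ≤≡ ⌊n/2⌋+⌈n/2⌉≡n x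

 xor-bit : ∀ {p q} a b → p ≡ bit01 a → q ≡ bit01 b → p + q ∸ (⌊ p + q /2⌋ + ⌊ p + q /2⌋) ≡ bit01 (a xor b)
 xor-bit false false refl refl = refl
 xor-bit false true refl refl = refl
 xor-bit true false refl refl = refl
 xor-bit true true refl refl = refl

 record Frame (k : ℕ) (σ σ' : State) : Set where
  constructor frame
  field
   regs= : ∀ r → R σ' (k + r) ≡ R σ (k + r)
   mem= : M σ' ≡ M σ
   coins= : ω σ' ≡ ω σ
   out= : o σ' ≡ o σ

 open Frame public

 module Routines (b s P S : ℕ) where
  open Execution b s

  xorCost : ℕ → ℕ
  xorCost w = 3 + (w * 17 + 1)

  module _ (k : ℕ) where
   w = width k
   open RingTheory (tower k) using () renaming (_+_ to _⊕_; _*_ to _⊗_; 0# to 0F; 1# to 1F)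
   record Constants (σ : State) : Set where
    constructor constants
    field
     one : R σ 41 ≡ 1
     zero' : R σ 42 ≡ 0
     width' : R σ 43 ≡ w
     table : R σ 44 ≡ P
     stride : R σ 45 ≡ S
   open Constants
   Constants-frame : ∀ {σ σ'} → (∀ r → R σ' (40 + r) ≡ R σ (40 + r)) → Constants σ → Constants σ'
   Constants-frame f (constants a b c d e) =
    constants (f 1 · a) (f 2 · b) (f 3 · c) (f 4 · d) (f 5 · e)
   Table : (ℕ → ℕ) → Set
   Table M = ∀ i j → i < w → j < w → M (P + (i * S + j)) ≡ enc k (basis k i ⊗ basis k j)
   module _ (wide : 2 ^ suc w ≤ limit) where
    <limit : ∀ {x} → x ≤ 2 ^ w → x < limit
    <limit x≤ = s≤s x≤ ·≤ +-monoˡ-≤ (2 ^ w) (m^n>0 2 w) ·≤ cong (2 ^ w +_) (sym (+-identityʳ _)) ≡≤ wide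
    record XorInv (σ0 : State) (total m : ℕ) (σ : State) : Set where
     constructor xorInv
     field
      as bs : List Bool
      las : length as ≡ m
      lbs : length bs ≡ m
      a= : R σ 0 ≡ val as
      b= : R σ 1 ≡ val bs
      count : R σ 8 ≡ m
      weight : R σ 7 * 2 ^ m ≡ 2 ^ w
      sum : R σ 2 + R σ 7 * val (zipWith _xor_ as bs) ≡ total
      same : Frame 12 σ0 σ
    xor-spec : ∀ {σ} as bs → Constants σ → length as ≡ w → length bs ≡ w → R σ 0 ≡ val as → R σ 1 ≡ val bs →
     Exec xorP σ (xorCost w) λ σ' → R σ' 2 ≡ val (zipWith _xor_ as bs) × Frame 12 σ σ'
    xor-spec {σ0} as bs c las lbs a= b= =
     x-block 3 (<limit z≤n , <limit (m^n>0 2 w) , <limit count≤ , tt) (x-for (XorInv σ0 total) XorInv.count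
      body
      exit
      w start)
     where
     total = val (zipWith _xor_ as bs)
     count= = cong₂ _+_ (width' c) (zero' c) · +-identityʳ w
     count≤ = count= ≡≤ (<⇒≤ (m<2^m w))
     start = xorInv as bs las lbs a= b= count= (*-identityˡ _) (*-identityˡ _) (frame (λ _ → refl) refl refl refl)
     zip-length : ∀ as bs {m} → length as ≡ m → length bs ≡ m → length (zipWith _xor_ as bs) ≡ m
     zip-length [] [] refl _ = refl
     zip-length (a ∷ as) (b ∷ bs) refl l = cong suc (zip-length as bs refl (suc-injective l))
     total< = subst (λ l → total < 2 ^ l) (zip-length as bs las lbs) (val< (zipWith _xor_ as bs))
     body : ∀ m σ → XorInv σ0 total (suc m) σ → Exec xorBody σ 16 (XorInv σ0 total m)
     body m σ (xorInv (a ∷ as) (b ∷ bs) las lbs a= b= count weight sum same) =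
      x-block 16 (<limit (double-half≤ (R σ 0) ·≤ a≤ {as = a ∷ as} las a=) , <limit (double-half≤ (R σ 1) ·≤ a≤ {as = b ∷ bs} lbs b=) , <limit (cong₂ _+_ p= q= ≡≤ +-mono-≤ (bit≤ a) (bit≤ b) ·≤ 2≤) , <limit (double-half≤ _ ·≤ cong₂ _+_ p= q= ≡≤ +-mono-≤ (bit≤ a) (bit≤ b) ·≤ 2≤) , <limit (cong (_* R σ 7) bit= ≡≤ m≤n+m _ (R σ 2) ·≤ acc≤) , <limit (cong (λ x → R σ 2 + x * R σ 7) bit= ≡≤ acc≤) , <limit weight≤ , tt) (x-done
       (xorInv as bs (suc-injective las) (suc-injective lbs) (half-of a as a=) (half-of b bs b=)
        (cong₂ _∸_ count (regs= same 29 · one c) · refl)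
        (double-weight (R σ 7) (2 ^ m) · weight)
        (cong (λ x → R σ 2 + x * R σ 7 + (R σ 7 + R σ 7) * val (zipWith _xor_ as bs)) bit= ·
         regroup (R σ 2) (bit01 (a xor b)) (R σ 7) (val (zipWith _xor_ as bs)) · sum)
        (frame (regs= same) (mem= same) (coins= same) (out= same))))
      where
      p= = bit-of a as a=
      q= = bit-of b bs b=
      bit= = xor-bit a b p= q=
      bit≤ : ∀ b → bit01 b ≤ 1
      bit≤ false = z≤n
      bit≤ true = ≤-refl
      2≤ = ^-monoʳ-≤ 2 (width>0 k)
      m≤w : suc m ≤ w
      m≤w = ≮⇒≥ λ w<m → <⇒≱ (^-monoʳ-< 2 (s≤s (s≤s z≤n)) w<m) (m≤n*m (2 ^ suc m) (R σ 7) {{>-nonZero (pos (R σ 7) weight)}} ≤≡ weight)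
       where
       pos : ∀ x → x * 2 ^ suc m ≡ 2 ^ w → 0 < x
       pos zero e = contradiction (subst (0 <_) (sym e) (m^n>0 2 w)) λ ()
       pos (suc x) _ = s≤s z≤n
      a≤ : ∀ {x} {as : List Bool} → length as ≡ suc m → x ≡ val as → x ≤ 2 ^ w
      a≤ {as = as} l refl = (<⇒≤ (subst (λ l → val as < 2 ^ l) l (val< as))) ·≤ ^-monoʳ-≤ 2 m≤w
      double-weight : ∀ u p → (u + u) * p ≡ u * (2 * p)
      double-weight = solve-∀
      weight≤ = m≤m*n (R σ 7 + R σ 7) (2 ^ m) {{m^n≢0 2 m}} ≤≡ double-weight (R σ 7) (2 ^ m) · weight
      regroup : ∀ a x u v → a + x * u + (u + u) * v ≡ a + u * (x + 2 * v)
      regroup = solve-∀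
      acc≤ = m≤m+n _ ((R σ 7 + R σ 7) * val (zipWith _xor_ as bs)) ·≤
       regroup (R σ 2) (bit01 (a xor b)) (R σ 7) (val (zipWith _xor_ as bs)) · sum ≡≤ (<⇒≤ total<)
     exit : ∀ σ → XorInv σ0 total 0 σ → Exec [] σ 0 λ σ' → R σ' 2 ≡ total × Frame 12 σ0 σ'
     exit σ (xorInv [] [] _ _ _ _ _ _ sum same) = x-done (sym (cong (R σ 2 +_) (*-zeroʳ (R σ 7)) · +-identityʳ _) · sum , same)
    copy : ∀ {x y} → y ≡ 0 → x + y ≡ x
    copy {x} refl = +-identityʳ x
    <limit-enc : ∀ {x y} z → x ≡ enc k z → y ≡ 0 → x + y < limit
    <limit-enc z e e' = <limit (copy e' · e ≡≤ (<⇒≤ (enc< k z)))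
    <limit-width : ∀ {x y} → x ≡ w → y ≡ 0 → x + y < limit
    <limit-width e e' = <limit (copy e' · e ≡≤ (<⇒≤ (m<2^m w)))
    record Accumulated (z v : F k) (σ σ' : State) : Set where
     constructor accumulated
     field
      acc= : R σ' 14 ≡ enc k (z ⊕ v)
      r12 : R σ' 12 ≡ R σ 12
      r13 : R σ' 13 ≡ R σ 13
      same : Frame 15 σ σ'
    accumulate-cost : ℕ
    accumulate-cost = suc (suc (xorCost w + 1))
    accumulate-spec : ∀ {σ} z v → Constants σ → R σ 14 ≡ enc k z → M σ (R σ 20) ≡ enc k v →
     Exec accumulate σ accumulate-cost (Accumulated z v σ)
    accumulate-spec {σ} z v c z= v= = x-block 2 (<limit-enc z z= (zero' c) , tt) (x-seq {p = xorP} (xor-spec (toBits k z) (toBits k v) (Constants-frame (λ _ → refl) c) (length-toBits k z) (length-toBits k v)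
     (copy (zero' c) · z=) v=)
     λ σ1 (e , f) → x-block 1 (<limit-enc (z ⊕ v) (e · cong val (sym (toBits-+ k z v))) (regs= f 30 · zero' c) , tt) (x-done (accumulated (copy (regs= f 30 · zero' c) · e · cong val (sym (toBits-+ k z v)))
      (regs= f 0) (regs= f 1) (frame (λ r → regs= f (3 + r)) (mem= f) (coins= f) (out= f)))))
    open Combination (tower k)
    combination-cong : ∀ {f g : ℕ → F k} bs → (∀ i → f i ≡ g i) → combination f bs ≡ combination g bs
    combination-cong [] e = refl
    combination-cong (b ∷ bs) e = cong₂ (λ x y → (if b then x else 0F) ⊕ y) (e 0) (combination-cong bs (e ∘ suc))
    module Ring = RingTheory (tower k)
    record Kept (σ σ' : State) : Set where
     constructor kept
     field
      k12 : R σ' 12 ≡ R σ 12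
      k13 : R σ' 13 ≡ R σ 13
      k15 : R σ' 15 ≡ R σ 15
      k16 : R σ' 16 ≡ R σ 16
      rest : Frame 24 σ σ'
    module _ (room : P + (w * S + w) < limit) where
     address< : ∀ {i j} → i < w → j ≤ w → P + (i * S + j) ≤ P + (w * S + w)
     address< i< j≤ = +-monoʳ-≤ P (+-mono-≤ (*-monoˡ-≤ S (<⇒≤ i<)) j≤)
     record RowInv (σ0 : State) (i : ℕ) (target : F k) (m : ℕ) (σ : State) : Set where
      constructor rowInv
      field
       bs : List Bool
       j : ℕ
       z : F k
       length= : length bs ≡ m
       j+m : j + m ≡ w
       bits= : R σ 19 ≡ val bs
       pointer : R σ 20 ≡ P + (i * S + j)
       count : R σ 21 ≡ m
       acc= : R σ 14 ≡ enc k z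
       sum= : z ⊕ combination (λ l → basis k i ⊗ basis k (j + l)) bs ≡ target
       keep : Kept σ0 σ
     row-cost : ℕ
     row-cost = 3 + (w * suc (4 + suc (accumulate-cost + 2)) + 1)
     row-spec : ∀ {σ} i y z → i < w → Constants σ → Table (M σ) → R σ 13 ≡ enc k y → R σ 15 ≡ P + i * S → R σ 14 ≡ enc k z →
      Exec mulRow σ row-cost λ σ' → R σ' 14 ≡ enc k (z ⊕ basis k i ⊗ y) × Kept σ σ'
     row-spec {σ0} i y z i< c table y= ptr= z= =
      x-block 3 (<limit-enc y y= (zero' c) , ≤-<-trans (≤-reflexive (copy (zero' c) · ptr= · cong (P +_) (sym (+-identityʳ _))))
       (≤-<-trans (address< i< z≤n) room) , <limit-width (width' c) (zero' c) , tt) (x-for (RowInv σ0 i target) RowInv.count body exit w start)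
      where
      target = z ⊕ basis k i ⊗ y
      start = rowInv (toBits k y) 0 z (length-toBits k y) refl (copy (zero' c) · y=)
       (copy (zero' c) · ptr= · cong (P +_) (sym (+-identityʳ _))) (copy (zero' c) · width' c) z=
       (cong (z ⊕_) (combination-cong (toBits k y) (λ l → Ring.*-comm (basis k i) (basis k l)) ·
        sym (combination-* (basis k) (toBits k y) (basis k i)) · cong (_⊗ basis k i) (combination-basis k y) · Ring.*-comm y (basis k i)))
       (kept refl refl refl refl (frame (λ _ → refl) refl refl refl))
      body : ∀ m σ → RowInv σ0 i target (suc m) σ → Exec mulInner σ (4 + suc (accumulate-cost + 2)) (RowInv σ0 i target m)
      body m σ (rowInv (b ∷ bs) j z length= j+m bits= pointer count acc= sum= keep) =
       x-block 4 (<limit (double-half≤ (R σ 19) ·≤ bits= ≡≤ (<⇒≤ (val< (b ∷ bs) ·≤ ^-monoʳ-≤ 2 length≤))) , tt) (by-bit b (bit-of b bs bits=) sum=)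
       where
       length≤ = length= ≡≤ m≤n+m (suc m) j ≤≡ j+m
       j<w = +shift< j j+m
       σ1 = afterHalf 19 19 (afterSub 18 19 18 (afterAdd 18 17 17 (afterHalf 17 19 σ)))
       consts : ∀ {σ2} → (∀ r → R σ2 (40 + r) ≡ R σ (40 + r)) → Constants σ2
       consts f = Constants-frame (λ r → f r · regs= (Kept.rest keep) (16 + r)) c
       tail : ∀ {v} σ2 → Accumulated z v σ1 σ2 → z ⊕ v ⊕ combination (λ l → basis k i ⊗ basis k (j + suc l)) bs ≡ target →
        Exec (add 20 20 41 ∷ sub 21 21 41 ∷ []) σ2 2 (RowInv σ0 i target m)
       tail {v} σ2 (accumulated acc2 r12 r13 f) e = x-block 2 (cong suc pointer' ≡≤ (≤-<-trans (address< i< j<w) room) , tt) (x-done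
        (rowInv bs (suc j) (z ⊕ v) (suc-injective length=) (+shift j j+m) (regs= f 4 · half-of b bs bits=) pointer'
         (cong₂ _∸_ (regs= f 6 · count) one2) acc2
         (cong (z ⊕ v ⊕_) (combination-cong bs λ l → cong (λ n → basis k i ⊗ basis k n) (sym (+-suc j l))) · e)
         (kept (r12 · Kept.k12 keep) (r13 · Kept.k13 keep) (regs= f 0 · Kept.k15 keep) (regs= f 1 · Kept.k16 keep)
          (frame (λ r → regs= f (9 + r) · regs= (Kept.rest keep) r) (mem= f · mem= (Kept.rest keep))
           (coins= f · coins= (Kept.rest keep)) (out= f · out= (Kept.rest keep))))))
        where
        one2 = one (consts {σ2} λ r → regs= f (25 + r))
        pointer' = cong₂ _+_ (regs= f 5 · pointer) one2 · +-assoc P _ 1 · cong (P +_) (+-assoc (i * S) j 1 · cong (i * S +_) (+-comm j 1))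
       by-bit : ∀ b → R σ1 18 ≡ bit01 b → z ⊕ combination (λ l → basis k i ⊗ basis k (j + l)) (b ∷ bs) ≡ target →
        Exec (branch 18 accumulate [] ∷ add 20 20 41 ∷ sub 21 21 41 ∷ []) σ1 (suc (accumulate-cost + 2)) (RowInv σ0 i target m)
       by-bit true e sum= = x-branch-≢0 (λ e' → 1+n≢0 (sym e · e'))
        (x-seq {p = accumulate} (accumulate-spec z (basis k i ⊗ basis k j) (consts λ _ → refl) acc=
         (cong₂ (λ M a → M a) (mem= (Kept.rest keep)) pointer · table i j i< j<w))
        λ σ2 acc → tail σ2 acc (Ring.+-assoc z _ _ · cong (λ n → z ⊕ (basis k i ⊗ basis k n ⊕ combination (λ l → basis k i ⊗ basis k (j + suc l)) bs)) (sym (+-identityʳ j)) · sum=))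
       by-bit false e sum= = x-≤ (s≤s (m≤n+m 2 accumulate-cost)) (x-branch-0 e
        (tail {0F} σ1 (accumulated (acc= · cong (enc k) (sym (Ring.+-identityʳ z))) refl refl (frame (λ _ → refl) refl refl refl))
         (Ring.+-assoc z _ _ · sum=)))
      exit : ∀ σ → RowInv σ0 i target 0 σ → Exec [] σ 0 _
      exit σ (rowInv [] j z _ _ _ _ _ acc= sum= keep) = x-done (acc= · cong (enc k) (sym (Ring.+-identityʳ z) · sum=) , keep)
     record MulInv (σ0 : State) (y target : F k) (m : ℕ) (σ : State) : Set where
      constructor mulInv
      field
       bs : List Bool
       i : ℕ
       z : F k
       length= : length bs ≡ m
       i+m : i + m ≡ w
       bits= : R σ 12 ≡ val bs
       y= : R σ 13 ≡ enc k y
       pointer : R σ 15 ≡ P + i * S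
       count : R σ 16 ≡ m
       acc= : R σ 14 ≡ enc k z
       sum= : z ⊕ combination (λ l → basis k (i + l) ⊗ y) bs ≡ target
       keep : Frame 24 σ0 σ
     mul-cost = 3 + (w * suc (4 + suc (row-cost + 2)) + 1)
     mul-spec : ∀ {σ} x y → Constants σ → Table (M σ) → R σ 12 ≡ enc k x → R σ 13 ≡ enc k y →
      Exec mulP σ mul-cost λ σ' → R σ' 14 ≡ enc k (x ⊗ y) × Frame 24 σ σ'
     mul-spec {σ0} x y c table x= y= =
      x-block 3 (<limit z≤n , cong suc base= ≡≤ (≤-<-trans (m≤m+n P _) room) , <limit-width (width' c) (zero' c) , tt) (x-for (MulInv σ0 y (x ⊗ y)) MulInv.count body exit w start)
      where
      base= = copy (zero' c) · Constants.table c
      start = mulInv (toBits k x) 0 0F (length-toBits k x) refl x= y= (base= · sym (+-identityʳ P)) (copy (zero' c) · width' c) (sym (enc-0 k))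
       (Ring.+-identityˡ _ · sym (combination-* (basis k) (toBits k x) y) · cong (_⊗ y) (combination-basis k x))
       (frame (λ _ → refl) refl refl refl)
      body : ∀ m σ → MulInv σ0 y (x ⊗ y) (suc m) σ → Exec mulRows σ (4 + suc (row-cost + 2)) (MulInv σ0 y (x ⊗ y) m)
      body m σ (mulInv (b ∷ bs) i z length= i+m bits= y= pointer count acc= sum= keep) =
       x-block 4 (<limit (double-half≤ (R σ 12) ·≤ bits= ≡≤ (<⇒≤ (val< (b ∷ bs) ·≤ ^-monoʳ-≤ 2 length≤))) , tt) (by-bit b (bit-of b bs bits=) sum=)
       where
       length≤ = length= ≡≤ m≤n+m (suc m) i ≤≡ i+m
       i<w = +shift< i i+m
       σ1 = afterHalf 12 12 (afterSub 18 12 18 (afterAdd 18 17 17 (afterHalf 17 12 σ)))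
       consts : ∀ {σ2} → (∀ r → R σ2 (40 + r) ≡ R σ (40 + r)) → Constants σ2
       consts f = Constants-frame (λ r → f r · regs= keep (16 + r)) c
       tail : ∀ {v} σ2 → R σ2 14 ≡ enc k (z ⊕ v) → Kept σ1 σ2 → z ⊕ v ⊕ combination (λ l → basis k (i + suc l) ⊗ y) bs ≡ x ⊗ y →
        Exec (add 15 15 45 ∷ sub 16 16 41 ∷ []) σ2 2 (MulInv σ0 y (x ⊗ y) m)
       tail {v} σ2 acc2 kp e = x-block 2 (cong suc pointer' ≡≤ (≤-<-trans (+-monoʳ-≤ P (*-monoˡ-≤ S i<w ·≤ m≤m+n (w * S) w)) room) , tt) (x-done
        (mulInv bs (suc i) (z ⊕ v) (suc-injective length=) (+shift i i+m) (Kept.k12 kp · half-of b bs bits=) (Kept.k13 kp · y=) pointer'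
         (cong₂ _∸_ (Kept.k16 kp · count) (one c2)) acc2
         (cong (z ⊕ v ⊕_) (combination-cong bs λ l → cong (λ n → basis k n ⊗ y) (sym (+-suc i l))) · e)
         (frame (λ r → regs= f r · regs= keep r) (mem= f · mem= keep) (coins= f · coins= keep) (out= f · out= keep))))
        where
        f = Kept.rest kp
        c2 = consts {σ2} (λ r → regs= f (16 + r))
        pointer' = cong₂ _+_ (Kept.k15 kp · pointer) (stride c2) · +-assoc P (i * S) S · cong (P +_) (+-comm (i * S) S)
       by-bit : ∀ b → R σ1 18 ≡ bit01 b → z ⊕ combination (λ l → basis k (i + l) ⊗ y) (b ∷ bs) ≡ x ⊗ y →
        Exec (branch 18 mulRow [] ∷ add 15 15 45 ∷ sub 16 16 41 ∷ []) σ1 (suc (row-cost + 2)) (MulInv σ0 y (x ⊗ y) m)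
       by-bit true e sum= = x-branch-≢0 (λ e' → 1+n≢0 (sym e · e'))
        (x-seq {p = mulRow} (row-spec i y z i<w (consts λ _ → refl) (λ i j i< j< → cong (λ M → M (P + (i * S + j))) (mem= keep) · table i j i< j<) y= pointer acc=)
        λ σ2 (acc , kp) → tail σ2 acc kp (Ring.+-assoc z _ _ · cong (λ n → z ⊕ (basis k n ⊗ y ⊕ combination (λ l → basis k (i + suc l) ⊗ y) bs)) (sym (+-identityʳ i)) · sum=))
       by-bit false e sum= = x-≤ (s≤s (m≤n+m 2 row-cost)) (x-branch-0 e
        (tail {0F} σ1 (acc= · cong (enc k) (sym (Ring.+-identityʳ z))) (kept refl refl refl refl (frame (λ _ → refl) refl refl refl))
         (Ring.+-assoc z _ _ · sum=)))
      exit : ∀ σ → MulInv σ0 y (x ⊗ y) 0 σ → Exec [] σ 0 _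
      exit σ (mulInv [] i z _ _ _ _ _ _ acc= sum= keep) = x-done (acc= · cong (enc k) (sym (Ring.+-identityʳ z) · sum=) , keep)
     inv-cost = 2 + (pred w * suc (2 + (mul-cost + (3 + (mul-cost + 2)))) + 1)
     open Frobenius (tower k)
     record InvInv (σ0 : State) (x : F k) (m : ℕ) (σ : State) : Set where
      constructor invInv
      field
       j : ℕ
       j+m : j + m ≡ pred w
       frob= : R σ 24 ≡ enc k (frob j x)
       powers= : R σ 25 ≡ enc k (powers j x)
       count : R σ 26 ≡ m
       keep : Frame 27 σ0 σ
     inv-spec : ∀ {σ} x → Constants σ → Table (M σ) → R σ 24 ≡ enc k x →
      Exec invP σ inv-cost λ σ' → R σ' 25 ≡ enc k (inverse k x) × Frame 27 σ σ'
     inv-spec {σ0} x c table x= =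
      x-block 2 (<limit (m^n>0 2 w) , tt) (x-for (InvInv σ0 x) InvInv.count body exit (pred w)
       (invInv 0 refl x= (sym (enc-1 k)) (cong₂ _∸_ (width' c) (one c) · ∸1 w) (frame (λ _ → refl) refl refl refl)))
      where
      ∸1 : ∀ w → w ∸ 1 ≡ pred w
      ∸1 zero = refl
      ∸1 (suc w) = refl
      body : ∀ m σ → InvInv σ0 x (suc m) σ → Exec invBody σ (2 + (mul-cost + (3 + (mul-cost + 2)))) (InvInv σ0 x m)
      body m σ (invInv j j+m frob= powers= count keep) =
       x-block 2 (<limit-enc (frob j x) frob= (zero' c1) , <limit-enc (frob j x) frob= (zero' c1) , tt) (x-seq {p = mulP} (mul-spec (frob j x) (frob j x) (Constants-frame (λ _ → refl) c1) table1 (copy (zero' c1) · frob=) (copy (zero' c1) · frob=))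
       λ σ2 (e2 , f2) → let c2 = Constants-frame {σ} {σ2} (λ r → regs= f2 (16 + r)) c1 in
       x-block 3 (<limit-enc (frob (suc j) x) e2 (zero' c2) , <limit-enc (powers j x) (regs= f2 1 · powers=) (zero' c2) , <limit-enc (frob (suc j) x) e2 (zero' c2) , tt) (x-seq {p = mulP} (mul-spec (powers j x) (frob (suc j) x) (Constants-frame (λ _ → refl) c2)
        (λ i j i< j< → cong (λ M → M (P + (i * S + j))) (mem= f2) · table1 i j i< j<)
        (copy (zero' c2) · regs= f2 1 · powers=) (copy (zero' c2) · e2))
       λ σ3 (e3 , f3) → let c3 = Constants-frame {σ2} {σ3} (λ r → regs= f3 (16 + r)) c2 in
       x-block 2 (<limit-enc (powers (suc j) x) e3 (zero' c3) , tt) (x-done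
        (invInv (suc j) (+shift j j+m) (regs= f3 0 · copy (zero' c2) · e2) (copy (zero' c3) · e3)
         (cong₂ _∸_ (regs= f3 2 · regs= f2 2 · count) (one c3))
         (frame (λ r → regs= f3 (3 + r) · regs= f2 (3 + r) · regs= keep r) (mem= f3 · mem= f2 · mem= keep)
          (coins= f3 · coins= f2 · coins= keep) (out= f3 · out= f2 · out= keep))))))
       where
       c1 = Constants-frame {σ0} {σ} (λ r → regs= keep (13 + r)) c
       table1 : Table (M σ)
       table1 i j i< j< = cong (λ M → M (P + (i * S + j))) (mem= keep) · table i j i< j<
      exit : ∀ σ → InvInv σ0 x 0 σ → Exec [] σ 0 _
      exit σ (invInv j j+0 _ powers= _ keep) = x-done (powers= · cong (λ j → enc k (powers j x)) (sym (+-identityʳ j) · j+0) , keep)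

module Lang where
 open FieldProg

 open import Defs hiding (run)
 open import Data.Bool using (T)
 open import Data.Fin using (combine)
 open import Data.List.Properties using (map-++)
 open import Data.Nat
 open import Data.Nat.Properties

 combine-index : ∀ {m n} (i : Fin m) (j : Fin n) → toℕ (combine i j) ≡ toℕ i * n + toℕ j
 combine-index {n = n} i j = Fin.toℕ-combine i j · cong (_+ toℕ j) (*-comm n (toℕ i))

 -- Polynomials in two variables with natural coefficients, for running times.
 infixl 6 _⊞_
 infixl 7 _⊠_
 data Poly : Set where
  conᴾ : ℕ → Poly
  N W : Poly
  _⊞_ _⊠_ : Poly → Poly → Poly

 eval : Poly → ℕ → ℕ → ℕ
 eval (conᴾ c) n w = c
 eval N n w = n
 eval W n w = w
 eval (p ⊞ q) n w = eval p n w + eval q n w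
 eval (p ⊠ q) n w = eval p n w * eval q n w

 arrays : ℕ
 arrays = 40

 data Op : Set where
  plus times : Op

 -- Variables are named by their de Bruijn level.
 data Ix (Γ : ℕ) : Set where
  origin : Ix Γ
  var : Fin Γ → Ix Γ

 data Exp (Γ : ℕ) : Set where
  arr : Fin arrays → (i j k : Ix Γ) → Exp Γ
  pt : Ix Γ → Exp Γ
  lit : Bool → Exp Γ
  bin : Op → (e f : Exp Γ) → Exp Γ
  inv : Exp Γ → Exp Γ
  fold : Op → Exp (suc Γ) → Exp Γ
  ifz : (e f g : Exp Γ) → Exp Γ
  ifle : (i j : Ix Γ) → (f g : Exp Γ) → Exp Γ

 infixr 5 _⨾_
 data Cmd (Γ : ℕ) : Set where
  store : Fin arrays → (i j k : Ix Γ) → Exp Γ → Cmd Γ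
  for : Cmd (suc Γ) → Cmd Γ
  _⨾_ : Cmd Γ → Cmd Γ → Cmd Γ
  emit : Exp Γ → Ix Γ → Cmd Γ

 iter : ∀ {S : Set} {n} → (Fin n → S → S) → S → S
 iter {n = zero} g s = s
 iter {n = suc n} g s = g zero (iter (g ∘ suc) s)

 iter-from : ∀ {S : Set} {n} → ℕ → (Fin n → S → S) → S → S
 iter-from zero g s = iter g s
 iter-from {n = zero} (suc m) g s = s
 iter-from {n = suc n} (suc m) g s = iter-from m (g ∘ suc) s

 iter-from-step : ∀ {S : Set} {n} (i : Fin n) (g : Fin n → S → S) s → iter-from (toℕ i) g s ≡ g i (iter-from (suc (toℕ i)) g s)
 iter-from-step zero g s = refl
 iter-from-step (suc i) g s = iter-from-step i (g ∘ suc) s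

 iter-from-end : ∀ {S : Set} n (g : Fin n → S → S) s → iter-from n g s ≡ s
 iter-from-end zero g s = refl
 iter-from-end (suc n) g s = iter-from-end n (g ∘ suc) s

 _[_↦_] : ∀ {A : Set} → (ℕ → A) → ℕ → A → ℕ → A
 (ρ [ i ↦ v ]) j = if i ≡ᵇ j then v else ρ j

 module Semantics (K n' : ℕ) where
  open BinaryRing (tower K) using (0#; 1#) renaming (_+_ to _+F_; _*_ to _*F_)

  n : ℕ
  n = suc n'

  Arrays : Set
  Arrays = ℕ → Fin n → Fin n → Fin n → F K

  Env : Set
  Env = ℕ → Fin n

  record Store : Set where
   constructor store⟨_,_⟩
   field
    arrs : Arrays
    outp : List (Fin n)

  open Store public

  ⟦_⟧I : ∀ {Γ} → Ix Γ → Env → Fin n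
  ⟦ origin ⟧I ρ = zero
  ⟦ var i ⟧I ρ = ρ (toℕ i)

  ⟦_⟧ₒ : Op → F K → F K → F K
  ⟦ plus ⟧ₒ = _+F_
  ⟦ times ⟧ₒ = _*F_

  unit : Op → F K
  unit plus = 0#
  unit times = 1#

  ifzero : F K → F K → F K → F K
  ifzero x y z with IsField._≟_ (tower-isField K) x 0#
  ... | yes _ = y
  ... | no _ = z

  ⟦_⟧E : ∀ {Γ} → Exp Γ → Env → Arrays → F K
  ⟦ arr a i j k ⟧E ρ A = A (toℕ a) (⟦ i ⟧I ρ) (⟦ j ⟧I ρ) (⟦ k ⟧I ρ)
  ⟦ pt i ⟧E ρ A = dec K (suc (toℕ (⟦ i ⟧I ρ)))
  ⟦ lit b ⟧E ρ A = if b then 1# else 0#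
  ⟦ bin p e f ⟧E ρ A = ⟦ p ⟧ₒ (⟦ e ⟧E ρ A) (⟦ f ⟧E ρ A)
  ⟦ inv e ⟧E ρ A = inverse K (⟦ e ⟧E ρ A)
  ⟦_⟧E {Γ} (fold p e) ρ A = iter (λ v x → ⟦ p ⟧ₒ x (⟦ e ⟧E (ρ [ Γ ↦ v ]) A)) (unit p)
  ⟦ ifz e f g ⟧E ρ A = ifzero (⟦ e ⟧E ρ A) (⟦ f ⟧E ρ A) (⟦ g ⟧E ρ A)
  ⟦ ifle i j f g ⟧E ρ A = if toℕ (⟦ i ⟧I ρ) ≤ᵇ toℕ (⟦ j ⟧I ρ) then ⟦ f ⟧E ρ A else ⟦ g ⟧E ρ A

  _==_ : Fin n → Fin n → Bool
  i == j = toℕ i ≡ᵇ toℕ j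

  setCell : ℕ → (i j k : Fin n) → F K → Arrays → Arrays
  setCell a i j k x A a' i' j' k' = if (a ≡ᵇ a') ∧ (i == i') ∧ (j == j') ∧ (k == k') then x else A a' i' j' k'

  ⟦_⟧ : ∀ {Γ} → Cmd Γ → Env → Store → Store
  ⟦ store a i j k e ⟧ ρ s = store⟨ setCell (toℕ a) (⟦ i ⟧I ρ) (⟦ j ⟧I ρ) (⟦ k ⟧I ρ) (⟦ e ⟧E ρ (arrs s)) (arrs s) , outp s ⟩
  ⟦_⟧ {Γ} (for c) ρ s = iter (λ v → ⟦ c ⟧ (ρ [ Γ ↦ v ])) s
  ⟦ c ⨾ d ⟧ ρ s = ⟦ d ⟧ ρ (⟦ c ⟧ ρ s)
  ⟦ emit e i ⟧ ρ s with IsField._≟_ (tower-isField K) (⟦ e ⟧E ρ (arrs s)) 0#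
  ... | yes _ = s
  ... | no _ = store⟨ arrs s , outp s ∷ʳ ⟦ i ⟧I ρ ⟩

 ixReg : ∀ {Γ} → Ix Γ → Reg
 ixReg origin = 42
 ixReg (var i) = 50 + 2 * toℕ i

 st : ℕ → Reg
 st δ = 51 + 2 * δ

 addressP : ∀ {Γ} → Fin arrays → (i j k : Ix Γ) → Program
 addressP a i j k =
  mul 30 (ixReg i) 40 ∷ add 30 30 (ixReg j) ∷ mul 30 30 40 ∷ add 30 30 (ixReg k) ∷
  mul 30 30 47 ∷ const 31 (toℕ a) ∷ add 30 30 31 ∷ add 30 30 46 ∷ []

 binP : Op → ℕ → Program
 binP plus δ = add 0 (st δ) 42 ∷ add 1 (st (suc δ)) 42 ∷ xorP ++ add (st δ) 2 42 ∷ []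
 binP times δ = add 12 (st δ) 42 ∷ add 13 (st (suc δ)) 42 ∷ mulP ++ add (st δ) 14 42 ∷ []

 loopP : ℕ → Program → Program
 loopP Γ p = add 32 40 42 ∷ while 32 (sub (50 + 2 * Γ) 32 41 ∷ p ++ add 32 (50 + 2 * Γ) 42 ∷ []) ∷ []

 unitℕ : Op → ℕ
 unitℕ plus = 0
 unitℕ times = 1

 compileE : ∀ {Γ} → ℕ → Exp Γ → Program
 compileE δ (arr a i j k) = addressP a i j k ++ load (st δ) 30 ∷ []
 compileE δ (pt i) = add (st δ) (ixReg i) 41 ∷ []
 compileE δ (lit b) = const (st δ) (bit01 b) ∷ []
 compileE δ (bin p e f) = compileE δ e ++ compileE (suc δ) f ++ binP p δ
 compileE δ (inv e) = compileE δ e ++ add 24 (st δ) 42 ∷ invP ++ add (st δ) 25 42 ∷ []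
 compileE {Γ} δ (fold p e) = const (st δ) (unitℕ p) ∷ loopP Γ (compileE (suc δ) e ++ binP p δ)
 compileE δ (ifz e f g) = compileE δ e ++ branch (st δ) (compileE δ g) (compileE δ f) ∷ []
 compileE δ (ifle i j f g) = sub 30 (ixReg i) (ixReg j) ∷ branch 30 (compileE δ g) (compileE δ f) ∷ []

 compile : ∀ {Γ} → Cmd Γ → Program
 compile (store a i j k e) = compileE 0 e ++ addressP a i j k ++ store 30 (st 0) ∷ []
 compile {Γ} (for c) = loopP Γ (compile c)
 compile (c ⨾ d) = compile c ++ compile d
 compile (emit e i) = compileE 0 e ++ branch (st 0) (emit (ixReg i) ∷ []) [] ∷ []

 xorᴾ accᴾ rowᴾ mulᴾ invᴾ : Poly
 xorᴾ = conᴾ 3 ⊞ (W ⊠ conᴾ 17 ⊞ conᴾ 1)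
 accᴾ = conᴾ 2 ⊞ (xorᴾ ⊞ conᴾ 1)
 rowᴾ = conᴾ 3 ⊞ (W ⊠ (conᴾ 5 ⊞ (conᴾ 1 ⊞ (accᴾ ⊞ conᴾ 2))) ⊞ conᴾ 1)
 mulᴾ = conᴾ 3 ⊞ (W ⊠ (conᴾ 5 ⊞ (conᴾ 1 ⊞ (rowᴾ ⊞ conᴾ 2))) ⊞ conᴾ 1)
 invᴾ = conᴾ 2 ⊞ (W ⊠ (conᴾ 3 ⊞ (mulᴾ ⊞ (conᴾ 3 ⊞ (mulᴾ ⊞ conᴾ 2)))) ⊞ conᴾ 1)

 binᴾ : Op → Poly
 binᴾ plus = conᴾ 2 ⊞ (xorᴾ ⊞ conᴾ 1)
 binᴾ times = conᴾ 2 ⊞ (mulᴾ ⊞ conᴾ 1)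

 loopᴾ : Poly → Poly
 loopᴾ p = conᴾ 1 ⊞ (N ⊠ (conᴾ 2 ⊞ (p ⊞ conᴾ 1)) ⊞ conᴾ 1)

 costE : ∀ {Γ} → Exp Γ → Poly
 costE (arr a i j k) = conᴾ 9
 costE (pt i) = conᴾ 1
 costE (lit b) = conᴾ 1
 costE (bin p e f) = costE e ⊞ (costE f ⊞ binᴾ p)
 costE (inv e) = costE e ⊞ (conᴾ 1 ⊞ (invᴾ ⊞ conᴾ 1))
 costE (fold p e) = conᴾ 1 ⊞ loopᴾ (costE e ⊞ binᴾ p)
 costE (ifz e f g) = costE e ⊞ (conᴾ 1 ⊞ (costE f ⊞ costE g))
 costE (ifle i j f g) = conᴾ 2 ⊞ (costE f ⊞ costE g)

 cost : ∀ {Γ} → Cmd Γ → Poly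
 cost (store a i j k e) = costE e ⊞ conᴾ 9
 cost (for c) = loopᴾ (cost c)
 cost (c ⨾ d) = cost c ⊞ cost d
 cost (emit e i) = costE e ⊞ conᴾ 2

 upd-same : ∀ (R : ℕ → ℕ) r x → (R [ r ≔ x ]) r ≡ x
 upd-same R r x with r ≡ᵇ r in e
 ... | true = refl
 ... | false with () ← subst T e (≡⇒≡ᵇ r r refl)

 upd-diff : ∀ (R : ℕ → ℕ) r x {j} → r ≢ j → (R [ r ≔ x ]) j ≡ R j
 upd-diff R r x {j} r#j with r ≡ᵇ j in e
 ... | true = contradiction (≡ᵇ⇒≡ r j (subst T (sym e) tt)) r#j
 ... | false = refl

 -- The registers that a program with Γ variables and a stack of height δ keeps.
 data Kept (Γ δ : ℕ) : Reg → Set where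
  low : ∀ r → r < 10 → Kept Γ δ (40 + r)
  ix : ∀ i → i < Γ → Kept Γ δ (50 + 2 * i)
  stk : ∀ d → d < δ → Kept Γ δ (51 + 2 * d)

 Kept-weaken : ∀ {Γ Γ' δ δ' r} → Γ ≤ Γ' → δ ≤ δ' → Kept Γ δ r → Kept Γ' δ' r
 Kept-weaken p q (low r r<) = low r r<
 Kept-weaken p q (ix i i<) = ix i (i< ·≤ p)
 Kept-weaken p q (stk d d<) = stk d (d< ·≤ q)

 Kept≥40 : ∀ {Γ δ r} → Kept Γ δ r → ∃[ r' ] r ≡ 40 + r'
 Kept≥40 (low r _) = r , refl
 Kept≥40 (ix i _) = 10 + 2 * i , refl
 Kept≥40 (stk d _) = 11 + 2 * d , refl

 st-free : ∀ {Γ δ d r} → δ ≤ d → Kept Γ δ r → st d ≢ r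
 st-free {d = d} δ≤d (low r r<) e = <⇒≱ (+-monoʳ-< 40 r<) (m≤m+n 50 (suc (2 * d)) ≤≡ e)
 st-free {d = d} δ≤d (ix i _) e = even≢odd i d (sym (+-cancelˡ-≡ 50 (suc (2 * d)) (2 * i) e))
 st-free {d = d} δ≤d (stk d' d<) e = <⇒≱ d< (δ≤d ≤≡ *-cancelˡ-≡ d d' 2 (+-cancelˡ-≡ 51 (2 * d) (2 * d') e))

 ix-free : ∀ {Γ δ i r} → Γ ≤ i → Kept Γ δ r → 50 + 2 * i ≢ r
 ix-free {i = i} Γ≤i (low r r<) e = <⇒≱ (+-monoʳ-< 40 r<) (m≤m+n 50 (2 * i) ≤≡ e)
 ix-free {i = i} Γ≤i (ix i' i<) e = <⇒≱ i< (Γ≤i ≤≡ *-cancelˡ-≡ i i' 2 (+-cancelˡ-≡ 50 (2 * i) (2 * i') e))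
 ix-free {i = i} Γ≤i (stk d _) e = even≢odd i d (+-cancelˡ-≡ 50 (2 * i) (suc (2 * d)) e)

 record Keep (Γ δ : ℕ) (σ σ' : State) : Set where
  constructor keep
  field
   kept : ∀ {r} → Kept Γ δ r → R σ' r ≡ R σ r
   mem : M σ' ≡ M σ
   coins : ω σ' ≡ ω σ
   out : o σ' ≡ o σ

 Keep-trans : ∀ {Γ δ σ σ1 σ2} → Keep Γ δ σ σ1 → Keep Γ δ σ1 σ2 → Keep Γ δ σ σ2
 Keep-trans (keep a b c d) (keep a' b' c' d') = keep (λ k → a' k · a k) (b' · b) (c' · c) (d' · d)

 Keep-weaken : ∀ {Γ Γ' δ δ' σ σ'} → Γ ≤ Γ' → δ ≤ δ' → Keep Γ' δ' σ σ' → Keep Γ δ σ σ'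
 Keep-weaken p q (keep a b c d) = keep (λ k → a (Kept-weaken p q k)) b c d

 Keep-frame : ∀ {Γ δ σ σ'} → Frame 40 σ σ' → Keep Γ δ σ σ'
 Keep-frame {σ = σ} {σ'} (frame a b c d) = keep (λ k → at (Kept≥40 k)) b c d
  where
  at : ∀ {r} → ∃[ r' ] r ≡ 40 + r' → R σ' r ≡ R σ r
  at (r' , refl) = a r'

 Keep-set : ∀ {Γ δ σ r x} → (∀ {j} → Kept Γ δ j → r ≢ j) → Keep Γ δ σ ⟨ R σ [ r ≔ x ] , M σ , ω σ , o σ ⟩
 Keep-set {σ = σ} {r} {x} free = keep (λ k → upd-diff (R σ) r x (free k)) refl refl refl

 -- Abstract, because unfolding the arithmetic makes type checking infeasible.
 module Layout (n na base : ℕ) where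
  abstract
   cells : ℕ
   cells = base + n * n * n * na
   cells= : cells ≡ base + n * n * n * na
   cells= = refl
   address : ℕ → (i j k : Fin n) → ℕ
   address a i j k = ((toℕ i * n + toℕ j) * n + toℕ k) * na + a + base
   address= : ∀ a i j k → address a i j k ≡ ((toℕ i * n + toℕ j) * n + toℕ k) * na + a + base
   address= a i j k = refl
   address-combine : ∀ (a : Fin na) i j k → address (toℕ a) i j k ≡ toℕ (combine (combine (combine i j) k) a) + base
   address-combine a i j k = cong (_+ base) (sym (combine-index ijk a · cong (λ x → x * na + toℕ a) e2))
    where
    ijk : Fin (n * n * n)
    ijk = combine (combine i j) k
    e2 : toℕ ijk ≡ (toℕ i * n + toℕ j) * n + toℕ k
    e2 = combine-index (combine i j) k · cong (λ x → x * n + toℕ k) (combine-index i j)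
   base≤ : ∀ a i j k → base ≤ address a i j k
   base≤ a i j k = m≤n+m base _
   address< : ∀ (a : Fin na) i j k → address (toℕ a) i j k < cells
   address< a i j k = cong suc (address-combine a i j k) ≡≤
    +-monoˡ-≤ base {suc (toℕ ijka)} {n * n * n * na} (Fin.toℕ<n ijka) ≤≡ +-comm (n * n * n * na) base
    where
    ijka : Fin (n * n * n * na)
    ijka = combine (combine (combine i j) k) a
   address-injective : ∀ (a a' : Fin na) {i j k i' j' k'} → address (toℕ a) i j k ≡ address (toℕ a') i' j' k' →
    toℕ a ≡ toℕ a' × i ≡ i' × j ≡ j' × k ≡ k'
   address-injective a a' {i} {j} {k} {i'} {j'} {k'} e = split (Fin.combine-injective x a x' a' (Fin.toℕ-injective codes=))
    where
    x x' : Fin (n * n * n)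
    x = combine (combine i j) k
    x' = combine (combine i' j') k'
    codes= : toℕ (combine x a) ≡ toℕ (combine x' a')
    codes= = +-cancelʳ-≡ base (toℕ (combine x a)) (toℕ (combine x' a'))
     (sym (address-combine a i j k) · e · address-combine a' i' j' k')
    split : x ≡ x' × a ≡ a' → toℕ a ≡ toℕ a' × i ≡ i' × j ≡ j' × k ≡ k'
    split (e1 , a=) =
     let e2 , k= = Fin.combine-injective (combine i j) k (combine i' j') k' e1
         i= , j= = Fin.combine-injective i j i' j' e2
     in cong toℕ a= , i= , j= , k=

 module Correctness (b K n' P S base : ℕ) where
  open Semantics K n'
  open Layout n arrays base

  open Execution b cells
  module Rt = Routines b cells P S
  open Rt using (constants; Table; xor-spec; mul-spec; inv-spec)
  open Rt.Constants

  w : ℕ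
  w = width K

  module _ (wide : 2 ^ suc w ≤ limit) (room : P + (w * S + w) < limit) (cells≤ : cells ≤ limit) (n<q : n < 2 ^ w)
   (below : ∀ i j → i < w → j < w → P + (i * S + j) < base) where
   record Sim (Γ : ℕ) (ρ : Env) (A : Arrays) (σ : State) : Set where
    constructor sim
    field
     consts : Rt.Constants K σ
     size : R σ 40 ≡ n
     base= : R σ 46 ≡ base
     count : R σ 47 ≡ arrays
     tab : Table K (M σ)
     ixs : ∀ (i : Fin Γ) → R σ (50 + 2 * toℕ i) ≡ toℕ (ρ (toℕ i))
     cell : ∀ (a : Fin arrays) i j k → M σ (address (toℕ a) i j k) ≡ enc K (A (toℕ a) i j k)
   open Sim
   regs-sim : ∀ {Γ ρ A σ σ'} → (∀ {r} → Kept Γ 0 r → R σ' r ≡ R σ r) → M σ' ≡ M σ → Sim Γ ρ A σ → Sim Γ ρ A σ'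
   regs-sim {Γ} {σ = σ} {σ'} f m s = sim
    (constants (f (lo 1) · one (consts s)) (f (lo 2) · zero' (consts s)) (f (lo 3) · width' (consts s))
     (f (lo 4) · table (consts s)) (f (lo 5) · stride (consts s)))
    (f (lo 0) · size s) (f (lo 6) · base= s) (f (lo 7) · count s)
    (λ i j i< j< → cong (λ M → M _) m · tab s i j i< j<)
    (λ i → f (ix (toℕ i) (Fin.toℕ<n i)) · ixs s i)
    (λ a i j k → cong (λ M → M _) m · cell s a i j k)
    where
    lo : ∀ r {r< : T (r <ᵇ 10)} → Kept Γ 0 (40 + r)
    lo r {r<} = low r (<ᵇ⇒< r 10 r<)
   Sim-keep : ∀ {Γ δ ρ A σ σ'} → Keep Γ δ σ σ' → Sim Γ ρ A σ → Sim Γ ρ A σ'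
   Sim-keep (keep f m _ _) = regs-sim (λ k → f (Kept-weaken ≤-refl z≤n k)) m
   Sim-ix : ∀ {Γ ρ A σ} v → R σ (50 + 2 * Γ) ≡ toℕ v → Sim Γ ρ A σ → Sim (suc Γ) (ρ [ Γ ↦ v ]) A σ
   Sim-ix {Γ} {ρ} {A} {σ} v e s = record { Sim s; ixs = ixs' }
    where
    ixs' : ∀ (i : Fin (suc Γ)) → R σ (50 + 2 * toℕ i) ≡ toℕ ((ρ [ Γ ↦ v ]) (toℕ i))
    ixs' i with Γ ≡ᵇ toℕ i in b
    ... | true = cong (λ j → R σ (50 + 2 * j)) (sym (≡ᵇ⇒≡ Γ (toℕ i) (subst T (sym b) tt))) · e
    ... | false = subst (λ j → R σ (50 + 2 * j) ≡ toℕ (ρ j)) (Fin.toℕ-fromℕ< i<Γ) (ixs s (fromℕ< i<Γ))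
     where
     i<Γ : toℕ i < Γ
     i<Γ = ≤∧≢⇒< (≤-pred (Fin.toℕ<n i)) λ i≡Γ → subst T b (≡⇒≡ᵇ Γ (toℕ i) (sym i≡Γ))
   ixReg-sim : ∀ {Γ ρ A σ} → Sim Γ ρ A σ → (i : Ix Γ) → R σ (ixReg i) ≡ toℕ (⟦ i ⟧I ρ)
   ixReg-sim s origin = zero' (consts s)
   ixReg-sim s (var i) = ixs s i
   copy' : ∀ {x y} → y ≡ 0 → x + y ≡ x
   copy' {x} refl = +-identityʳ x
   <limit : ∀ {x} → x < 2 ^ w → x < limit
   <limit x< = x< ·≤ m≤m+n (2 ^ w) _ ·≤ wide
   enc<limit : ∀ {x y} z → x ≡ enc K z → y ≡ 0 → x + y < limit
   enc<limit z e e' = <limit (subst (_< 2 ^ w) (sym (copy' e' · e)) (enc< K z))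
   ix30 : ∀ {Γ} (i : Ix Γ) R x → (R [ 30 ≔ x ]) (ixReg i) ≡ R (ixReg i)
   ix30 origin R x = refl
   ix30 (var i) R x = refl
   address-spec : ∀ {Γ ρ A σ} (a : Fin arrays) (i j k : Ix Γ) → Sim Γ ρ A σ →
    Exec (addressP a i j k) σ 8 λ σ' → R σ' 30 ≡ address (toℕ a) (⟦ i ⟧I ρ) (⟦ j ⟧I ρ) (⟦ k ⟧I ρ) × Frame 40 σ σ'
   address-spec {ρ = ρ} {σ = σ} a i j k s =
    x-block 8 (below-address (≤-reflexive e1) s1≤ , below-address (≤-reflexive e2) s2≤ , below-address (≤-reflexive e3) s3≤ , below-address (≤-reflexive e4) s4≤ , below-address (≤-reflexive e5) s5≤ , below-address ≤-refl (m≤n+m (toℕ a) (((i' * n + j') * n + k') * arrays) ·≤ s6≤) , below-address (≤-reflexive e6) s6≤ , below-address (≤-reflexive e7) ≤-refl , tt) (x-done (e7 , frame (λ _ → refl) refl refl refl))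
    where
    i' = toℕ (⟦ i ⟧I ρ)
    j' = toℕ (⟦ j ⟧I ρ)
    k' = toℕ (⟦ k ⟧I ρ)
    e1 : R σ (ixReg i) * R σ 40 ≡ i' * n
    e1 = cong₂ _*_ (ixReg-sim s i) (size s)
    σ1 = afterMul 30 (ixReg i) 40 σ
    σ2 = afterAdd 30 30 (ixReg j) σ1
    σ3 = afterMul 30 30 40 σ2
    σ4 = afterAdd 30 30 (ixReg k) σ3
    σ5 = afterMul 30 30 47 σ4
    σ6 = afterConst 31 (toℕ a) σ5
    e2 : R σ1 30 + R σ1 (ixReg j) ≡ i' * n + j'
    e2 = cong₂ _+_ e1 (ix30 j (R σ) _ · ixReg-sim s j)
    e3 : R σ2 30 * R σ2 40 ≡ (i' * n + j') * n
    e3 = cong₂ _*_ e2 (size s)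
    e4 : R σ3 30 + R σ3 (ixReg k) ≡ (i' * n + j') * n + k'
    e4 = cong₂ _+_ e3 (ix30 k (R σ2) _ · ix30 k (R σ1) _ · ix30 k (R σ) _ · ixReg-sim s k)
    e5 : R σ4 30 * R σ4 47 ≡ ((i' * n + j') * n + k') * arrays
    e5 = cong₂ _*_ e4 (count s)
    e6 : R σ6 30 + R σ6 31 ≡ ((i' * n + j') * n + k') * arrays + toℕ a
    e6 = cong (_+ toℕ a) e5
    total = address (toℕ a) (⟦ i ⟧I ρ) (⟦ j ⟧I ρ) (⟦ k ⟧I ρ)
    total= : _ ≡ total
    total= = sym (address= (toℕ a) (⟦ i ⟧I ρ) (⟦ j ⟧I ρ) (⟦ k ⟧I ρ))
    e7 : R (afterAdd 30 30 31 σ6) 30 + R (afterAdd 30 30 31 σ6) 46 ≡ total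
    e7 = cong₂ _+_ e6 (base= s) · total=
    s6≤ = m≤m+n _ base ≤≡ total=
    s5≤ = m≤m+n _ (toℕ a) ·≤ s6≤
    s4≤ = m≤m*n _ arrays ·≤ s5≤
    s3≤ = m≤m+n _ k' ·≤ s4≤
    s2≤ = m≤m*n _ n ·≤ s3≤
    s1≤ : i' * n ≤ total
    s1≤ = m≤m+n _ j' ·≤ s2≤
    below-address : ∀ {x y} → x ≤ y → y ≤ total → x < limit
    below-address p q = s≤s (p ·≤ q) ·≤ address< a (⟦ i ⟧I ρ) (⟦ j ⟧I ρ) (⟦ k ⟧I ρ) ·≤ cells≤
   bin-spec : ∀ p δ {Γ ρ A σ} x y → Sim Γ ρ A σ → R σ (st δ) ≡ enc K x → R σ (st (suc δ)) ≡ enc K y →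
    Exec (binP p δ) σ (eval (binᴾ p) n w) λ σ' → R σ' (st δ) ≡ enc K (⟦ p ⟧ₒ x y) × Keep Γ δ σ σ'
   bin-spec plus δ {σ = σ} x y s x= y= =
    x-block 2 (enc<limit x x= (zero' (consts s)) , enc<limit y y= (zero' (consts s)) , tt) (x-seq {p = xorP} (xor-spec K wide (toBits K x) (toBits K y) (Rt.Constants-frame K (λ _ → refl) (consts s)) (length-toBits K x) (length-toBits K y)
     (copy' (zero' (consts s)) · x=) (copy' (zero' (consts s)) · y=))
    λ σ1 (e , f) → let z= = e · cong val (sym (toBits-+ K x y)) ; 0= = regs= f 30 · zero' (consts s) in
    x-block 1 (enc<limit _ z= 0= , tt) (x-done (upd-same (R σ1) (st δ) _ · copy' 0= · z=
     , Keep-trans (Keep-frame (frame (λ r → regs= f (28 + r)) (mem= f) (coins= f) (out= f))) (Keep-set (st-free ≤-refl)))))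
   bin-spec times δ {σ = σ} x y s x= y= =
    x-block 2 (enc<limit x x= (zero' (consts s)) , enc<limit y y= (zero' (consts s)) , tt) (x-seq {p = mulP} (mul-spec K wide room x y (Rt.Constants-frame K (λ _ → refl) (consts s)) (tab s)
     (copy' (zero' (consts s)) · x=) (copy' (zero' (consts s)) · y=))
    λ σ1 (z= , f) → let 0= = regs= f 18 · zero' (consts s) in
    x-block 1 (enc<limit _ z= 0= , tt) (x-done (upd-same (R σ1) (st δ) _ · copy' 0= · z=
     , Keep-trans (Keep-frame (frame (λ r → regs= f (16 + r)) (mem= f) (coins= f) (out= f))) (Keep-set (st-free ≤-refl)))))

   -- A loop runs its index downwards, in accordance with iter.
   module _ {Γ δ : ℕ} {p : Program} {B : ℕ} (J : ℕ → State → Set)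
    (J-keep : ∀ {m σ σ'} → (∀ {r} → Kept Γ δ r → R σ' r ≡ R σ r) → M σ' ≡ M σ → ω σ' ≡ ω σ → o σ' ≡ o σ → J m σ → J m σ')
    (size : ∀ {m σ} → J m σ → R σ 40 ≡ n) (one1 : ∀ {m σ} → J m σ → R σ 41 ≡ 1) (zero1 : ∀ {m σ} → J m σ → R σ 42 ≡ 0)
    (body : ∀ (v : Fin n) σ → J (suc (toℕ v)) σ → R σ (50 + 2 * Γ) ≡ toℕ v →
     Exec p σ B λ σ' → J (toℕ v) σ' × R σ' (50 + 2 * Γ) ≡ toℕ v) where
    n<limit : ∀ {x} → x ≤ n → x < limit
    n<limit x≤ = <limit (≤-<-trans x≤ n<q)
    Inv : ℕ → State → Set
    Inv m σ = J m σ × R σ 32 ≡ m × m ≤ n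
    temp : ∀ r {r< : T (r <ᵇ 40)} {j} → Kept Γ δ j → r ≢ j
    temp r {r<} k refl with Kept≥40 k
    ... | r' , e = <⇒≱ (<ᵇ⇒< r 40 r<) (m≤m+n 40 r' ≤≡ sym e)
    set-keep : ∀ {m σ} r x → (∀ {j} → Kept Γ δ j → r ≢ j) → J m σ → J m ⟨ R σ [ r ≔ x ] , M σ , ω σ , o σ ⟩
    set-keep {m} {σ} r x free = J-keep {m} (λ k → upd-diff (R σ) r x (free k)) refl refl refl
    go : ∀ m σ → Inv (suc m) σ → Exec (sub (50 + 2 * Γ) 32 41 ∷ p ++ add 32 (50 + 2 * Γ) 42 ∷ []) σ (suc (B + 1)) (Inv m)
    go m σ (j , c , m<n) = x-block 1 tt (x-seq {p = p} (body v _
     (subst (λ m → J (suc m) _) (sym v=) (set-keep (50 + 2 * Γ) _ (ix-free ≤-refl) j))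
     (upd-same (R σ) (50 + 2 * Γ) _ · cong₂ _∸_ c (one1 j) · sym v=))
     λ σ' (j' , e) → let e' = cong₂ _+_ e (zero1 j') · +-identityʳ _ · v= in
     x-block 1 (n<limit (e' ≡≤ (<⇒≤ m<n)) , tt) (x-done (set-keep 32 _ (temp 32) (subst (λ m → J m σ') v= j') , e' , <⇒≤ m<n)))
     where
     v = fromℕ< m<n
     v= : toℕ v ≡ m
     v= = Fin.toℕ-fromℕ< m<n
    loop-spec : ∀ {σ} → J n σ → Exec (loopP Γ p) σ (1 + (n * (2 + (B + 1)) + 1)) (J 0)
    loop-spec {σ} j = x-block 1 (n<limit (≤-reflexive n=) , tt) (x-for Inv (proj₁ ∘ proj₂)
     go (λ σ (j , _) → x-done j) n (set-keep 32 _ (temp 32) j , n= , ≤-refl))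
     where
     n= = cong₂ _+_ (size j) (zero1 j) · +-identityʳ n
   enc-bit : ∀ b → bit01 b ≡ enc K (if b then BinaryRing.1# (tower K) else BinaryRing.0# (tower K))
   enc-bit true = sym (enc-1 K)
   enc-bit false = sym (enc-0 K)
   enc-unit : ∀ p → unitℕ p ≡ enc K (unit p)
   enc-unit plus = sym (enc-0 K)
   enc-unit times = sym (enc-1 K)
   1<2^w : 1 < 2 ^ w
   1<2^w = ^-monoʳ-≤ 2 (width>0 K)
   compileE-correct : ∀ {Γ} (e : Exp Γ) δ {ρ A σ} → Sim Γ ρ A σ →
    Exec (compileE δ e) σ (eval (costE e) n w) λ σ' → R σ' (st δ) ≡ enc K (⟦ e ⟧E ρ A) × Keep Γ δ σ σ'
   compileE-correct (arr a i j k) δ {ρ} {σ = σ} s = x-seq {p = addressP a i j k} {B' = 1} (address-spec a i j k s) λ σ1 (e , f) →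
    x-block 1 tt (x-done (upd-same (R σ1) (st δ) _ · cong₂ (λ M a → M a) (mem= f) e · cell s a (⟦ i ⟧I ρ) (⟦ j ⟧I ρ) (⟦ k ⟧I ρ)
     , Keep-trans (Keep-frame f) (Keep-set (st-free ≤-refl))))
   compileE-correct (pt i) δ {ρ} {σ = σ} s = x-block 1 (<limit (subst (_< 2 ^ w) (sym e) point<) , tt) (x-done (upd-same (R σ) (st δ) _ · e · sym (enc-dec K _ point<) , Keep-set (st-free ≤-refl)))
    where
    e = cong₂ _+_ (ixReg-sim s i) (one (consts s)) · +-comm _ 1
    point< = ≤-<-trans (Fin.toℕ<n (⟦ i ⟧I ρ)) n<q
   compileE-correct (lit b) δ {σ = σ} s = x-block 1 (<limit (≤-<-trans (bit≤ b) 1<2^w) , tt) (x-done (upd-same (R σ) (st δ) _ · enc-bit b , Keep-set (st-free ≤-refl)))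
    where
    bit≤ : ∀ b → bit01 b ≤ 1
    bit≤ true = ≤-refl
    bit≤ false = z≤n
   compileE-correct (bin p e f) δ {ρ} {A} s =
    x-seq {p = compileE δ e} (compileE-correct e δ s) λ σ1 (e1 , k1) →
    x-seq {p = compileE (suc δ) f} (compileE-correct f (suc δ) (Sim-keep k1 s)) λ σ2 (e2 , k2) →
    x-mono (λ σ3 (e3 , k3) → e3 , Keep-trans k1 (Keep-trans (Keep-weaken ≤-refl (n≤1+n δ) k2) k3))
     (bin-spec p δ (⟦ e ⟧E ρ A) (⟦ f ⟧E ρ A) (Sim-keep k2 (Sim-keep k1 s)) (Keep.kept k2 (stk δ ≤-refl) · e1) e2)
   compileE-correct (inv e) δ {ρ} {A} s =
    x-seq {p = compileE δ e} (compileE-correct e δ s) λ σ1 (e1 , k1) → let s1 = Sim-keep k1 s in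
    x-block 1 (enc<limit _ e1 (zero' (consts s1)) , tt) (x-seq {p = invP} (x-≤ (+-monoʳ-≤ 2 (+-monoˡ-≤ 1 (*-monoˡ-≤ _ (pred[n]≤n {w})))) (inv-spec K wide room (⟦ e ⟧E ρ A) (Rt.Constants-frame K (λ _ → refl) (consts s1)) (tab s1)
     (copy' (zero' (consts s1)) · e1)))
    λ σ2 (z= , f) → let 0= = regs= f 15 · zero' (consts s1) in
    x-block 1 (enc<limit _ z= 0= , tt) (x-done (upd-same (R σ2) (st δ) _ · copy' 0= · z=
     , Keep-trans k1 (Keep-trans (Keep-frame (frame (λ r → regs= f (13 + r)) (mem= f) (coins= f) (out= f))) (Keep-set (st-free ≤-refl))))))
   compileE-correct {Γ} (fold p e) δ {ρ} {A} {σ0} s =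
    x-block 1 (<limit (subst (_< 2 ^ w) (sym (enc-unit p)) (enc< K _)) , tt) (x-mono (λ σ' (k , e') → e' , k)
     (loop-spec {Γ} {suc δ} J (λ {m} → J-keep {m}) (λ (k , _) → size (Sim-keep k s)) (λ (k , _) → one (consts (Sim-keep k s))) (λ (k , _) → zero' (consts (Sim-keep k s))) body
      ( Keep-set (st-free ≤-refl)
      , upd-same (R σ0) (st δ) _ · enc-unit p · cong (enc K) (sym (iter-from-end n g (unit p))))))
    where
    g : Fin n → F K → F K
    g v x = ⟦ p ⟧ₒ x (⟦ e ⟧E (ρ [ Γ ↦ v ]) A)
    J : ℕ → State → Set
    J m σ = Keep Γ δ σ0 σ × R σ (st δ) ≡ enc K (iter-from m g (unit p))
    J-keep : ∀ {m σ σ'} → (∀ {r} → Kept Γ (suc δ) r → R σ' r ≡ R σ r) → M σ' ≡ M σ → ω σ' ≡ ω σ → o σ' ≡ o σ → J m σ → J m σ'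
    J-keep f m c o' (k , e') = Keep-trans k (keep (λ r → f (Kept-weaken ≤-refl (n≤1+n δ) r)) m c o') , f (stk δ ≤-refl) · e'
    body : ∀ v σ → J (suc (toℕ v)) σ → R σ (50 + 2 * Γ) ≡ toℕ v →
     Exec (compileE (suc δ) e ++ binP p δ) σ (eval (costE e ⊞ binᴾ p) n w) λ σ' → J (toℕ v) σ' × R σ' (50 + 2 * Γ) ≡ toℕ v
    body v σ (k , e') ix= =
     x-seq {p = compileE (suc δ) e} (compileE-correct e (suc δ) s1) λ σ1 (e1 , k1) →
     x-mono (λ σ2 (e2 , k2) →
      ( Keep-trans (Keep-trans k (Keep-weaken (n≤1+n Γ) (n≤1+n δ) k1)) (Keep-weaken (n≤1+n Γ) ≤-refl k2)
       , e2 · cong (enc K) (sym (iter-from-step v g (unit p))))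
      , Keep.kept k2 (ix Γ ≤-refl) · Keep.kept k1 (ix Γ ≤-refl) · ix=)
      (bin-spec p δ _ _ (Sim-keep k1 s1) (Keep.kept k1 (stk δ ≤-refl) · e') e1)
     where
     s1 = Sim-ix v ix= (Sim-keep k s)
   compileE-correct (ifz e f g) δ {ρ} {A} s =
    x-seq {p = compileE δ e} (compileE-correct e δ s) λ σ1 (e1 , k1) → decide σ1 e1 k1
    where
    x = ⟦ e ⟧E ρ A
    decide : ∀ σ1 → R σ1 (st δ) ≡ enc K x → Keep _ δ _ σ1 →
     Exec (branch (st δ) (compileE δ g) (compileE δ f) ∷ []) σ1 (1 + (eval (costE f) n w + eval (costE g) n w))
      λ σ' → R σ' (st δ) ≡ enc K (ifzero x (⟦ f ⟧E ρ A) (⟦ g ⟧E ρ A)) × Keep _ δ _ σ'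
    decide σ1 e1 k1 with IsField._≟_ (tower-isField K) x (BinaryRing.0# (tower K))
    ... | yes x=0 = x-branch-0 (e1 · cong (enc K) x=0 · enc-0 K) (x-≤ (+-identityʳ _ ≡≤ m≤m+n _ _)
     (x-seq {p = compileE δ f} {B' = 0} (x-mono (λ _ (e2 , k2) → e2 , Keep-trans k1 k2) (compileE-correct f δ (Sim-keep k1 s))) λ _ q → x-done q))
    ... | no x≢0 = x-branch-≢0 (λ e0 → x≢0 (enc-injective K (sym e1 · e0 · sym (enc-0 K)))) (x-≤ (+-identityʳ _ ≡≤ m≤n+m _ (eval (costE f) n w))
     (x-seq {p = compileE δ g} {B' = 0} (x-mono (λ _ (e2 , k2) → e2 , Keep-trans k1 k2) (compileE-correct g δ (Sim-keep k1 s))) λ _ q → x-done q))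
   compileE-correct (ifle i j f g) δ {ρ} {A} {σ} s = x-block 1 tt (decide (toℕ (⟦ i ⟧I ρ) ≤ᵇ toℕ (⟦ j ⟧I ρ)) refl)
    where
    σ1 = afterSub 30 (ixReg i) (ixReg j) σ
    k1 : Keep _ δ σ σ1
    k1 = Keep-frame (frame (λ _ → refl) refl refl refl)
    difference = cong₂ _∸_ (ixReg-sim s i) (ixReg-sim s j)
    decide : ∀ b → (toℕ (⟦ i ⟧I ρ) ≤ᵇ toℕ (⟦ j ⟧I ρ)) ≡ b →
     Exec (branch 30 (compileE δ g) (compileE δ f) ∷ []) σ1 (1 + (eval (costE f) n w + eval (costE g) n w))
      λ σ' → R σ' (st δ) ≡ enc K (if b then ⟦ f ⟧E ρ A else ⟦ g ⟧E ρ A) × Keep _ δ _ σ'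
    decide true b = x-branch-0 (difference · m≤n⇒m∸n≡0 {toℕ (⟦ i ⟧I ρ)} {toℕ (⟦ j ⟧I ρ)} (≤ᵇ⇒≤ (toℕ (⟦ i ⟧I ρ)) (toℕ (⟦ j ⟧I ρ)) (subst T (sym b) tt))) (x-≤ (+-identityʳ _ ≡≤ m≤m+n _ _)
     (x-seq {p = compileE δ f} {B' = 0} (x-mono (λ _ (e2 , k2) → e2 , Keep-trans k1 k2) (compileE-correct f δ (Sim-keep k1 s))) λ _ q → x-done q))
    decide false b = x-branch-≢0 (λ e0 → subst T b (≤⇒≤ᵇ (m∸n≡0⇒m≤n {toℕ (⟦ i ⟧I ρ)} {toℕ (⟦ j ⟧I ρ)} (sym difference · e0)))) (x-≤ (+-identityʳ _ ≡≤ m≤n+m _ (eval (costE f) n w))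
     (x-seq {p = compileE δ g} {B' = 0} (x-mono (λ _ (e2 , k2) → e2 , Keep-trans k1 k2) (compileE-correct g δ (Sim-keep k1 s))) λ _ q → x-done q))
   record SimS (Γ : ℕ) (ρ : Env) (s : Store) (σ : State) : Set where
    constructor simS
    field
     simA : Sim Γ ρ (arrs s) σ
     outs : o σ ≡ map toℕ (outp s)
   open SimS
   KeepC : ℕ → State → State → Set
   KeepC Γ σ σ' = (∀ {r} → Kept Γ 0 r → R σ' r ≡ R σ r) × ω σ' ≡ ω σ
   ∧-T : ∀ a b → T (a ∧ b) → T a × T b
   ∧-T true true _ = tt , tt
   ==-refl : ∀ i → T (i == i)
   ==-refl i = ≡⇒≡ᵇ (toℕ i) (toℕ i) refl
   ==⇒≡ : ∀ i j → T (i == j) → i ≡ j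
   ==⇒≡ i j t = Fin.toℕ-injective (≡ᵇ⇒≡ (toℕ i) (toℕ j) t)
   setCell-sim : ∀ (a : Fin arrays) i j k x A M0 → (∀ (a : Fin arrays) i j k → M0 (address (toℕ a) i j k) ≡ enc K (A (toℕ a) i j k)) →
    ∀ (a' : Fin arrays) i' j' k' → (M0 [ address (toℕ a) i j k ≔ enc K x ]) (address (toℕ a') i' j' k') ≡ enc K (setCell (toℕ a) i j k x A (toℕ a') i' j' k')
   setCell-sim a i j k x A M0 h a' i' j' k' with (toℕ a ≡ᵇ toℕ a') ∧ (i == i') ∧ (j == j') ∧ (k == k') in c
   ... | true with t1 , t ← ∧-T (toℕ a ≡ᵇ toℕ a') _ (subst T (sym c) tt)
    with t2 , t ← ∧-T (i == i') _ t
    with t3 , t4 ← ∧-T (j == j') _ t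
    with refl ← ==⇒≡ i i' t2 | refl ← ==⇒≡ j j' t3 | refl ← ==⇒≡ k k' t4 | e ← ≡ᵇ⇒≡ (toℕ a) (toℕ a') t1 =
    cong (λ b → (M0 [ address (toℕ a) i j k ≔ enc K x ]) (address b i j k)) (sym e) · upd-same M0 _ _
   ... | false = upd-diff M0 _ _ differ · h a' i' j' k'
    where
    differ : address (toℕ a) i j k ≢ address (toℕ a') i' j' k'
    differ e with e1 , refl , refl , refl ← address-injective a a' {i} {j} {k} {i'} {j'} {k'} e =
     subst T c (all (≡⇒≡ᵇ (toℕ a) (toℕ a') e1) (all (==-refl i) (all (==-refl j) (==-refl k))))
     where
     all : ∀ {a b} → T a → T b → T (a ∧ b)
     all {true} _ t = t
   compile-correct : ∀ {Γ} (c : Cmd Γ) {ρ s σ} → SimS Γ ρ s σ →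
    Exec (compile c) σ (eval (cost c) n w) λ σ' → SimS Γ ρ (⟦ c ⟧ ρ s) σ' × KeepC Γ σ σ'
   compile-correct (store a i j k e) {ρ} {s} {σ} S =
    x-seq {p = compileE 0 e} (compileE-correct e 0 (simA S)) λ σ1 (e1 , k1) → let s1 = Sim-keep k1 (simA S) in
    x-seq {p = addressP a i j k} {B' = 1} (address-spec a i j k s1) λ σ2 (e2 , f2) →
    let s2 = Sim-keep (Keep-frame {_} {0} f2) s1 ; e3 = regs= f2 11 · e1 in
    x-block 1 (subst (_< cells) (sym e2) (address< a (⟦ i ⟧I ρ) (⟦ j ⟧I ρ) (⟦ k ⟧I ρ)) , tt) (x-done
     ( simS (record { consts = Rt.Constants-frame K {σ2} (λ _ → refl) (consts s2) ; size = size s2 ; base= = base= s2 ; count = count s2 ; ixs = ixs s2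
      ; tab = λ i' j' i< j< → (upd-diff (M σ2) _ _ λ q → <⇒≱ (below i' j' i< j<) (base≤ (toℕ a) (⟦ i ⟧I ρ) (⟦ j ⟧I ρ) (⟦ k ⟧I ρ) ≤≡ sym e2 · q)) · tab s2 i' j' i< j<
      ; cell = λ a' i' j' k' → cong₂ (λ p v → (M σ2 [ p ≔ v ]) (address (toℕ a') i' j' k')) e2 e3 ·
       setCell-sim a (⟦ i ⟧I ρ) (⟦ j ⟧I ρ) (⟦ k ⟧I ρ) (⟦ e ⟧E ρ (arrs s)) (arrs s) (M σ2) (cell s2) a' i' j' k' })
      (out= f2 · Keep.out k1 · outs S)
     , (λ k → Keep.kept (Keep-frame {_} {0} f2) k · Keep.kept k1 k) , coins= f2 · Keep.coins k1))
   compile-correct {Γ} (for c) {ρ} {s} {σ0} S =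
    x-mono (λ σ' (q , k) → q , k)
     (loop-spec {Γ} {0} J (λ {m} → J-keep {m}) (λ j → size (simA (proj₁ j))) (λ j → one (consts (simA (proj₁ j)))) (λ j → zero' (consts (simA (proj₁ j)))) body
      (subst (λ s → SimS Γ ρ s σ0) (sym (iter-from-end n g s)) S , (λ _ → refl) , refl))
    where
    g : Fin n → Store → Store
    g v = ⟦ c ⟧ (ρ [ Γ ↦ v ])
    J : ℕ → State → Set
    J m σ = SimS Γ ρ (iter-from m g s) σ × KeepC Γ σ0 σ
    J-keep : ∀ {m σ σ'} → (∀ {r} → Kept Γ 0 r → R σ' r ≡ R σ r) → M σ' ≡ M σ → ω σ' ≡ ω σ → o σ' ≡ o σ → J m σ → J m σ'
    J-keep f m c o' (simS A O , k , c') = simS (regs-sim f m A) (o' · O) , (λ r → f r · k r) , c · c'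
    body : ∀ v σ → J (suc (toℕ v)) σ → R σ (50 + 2 * Γ) ≡ toℕ v → Exec (compile c) σ (eval (cost c) n w) λ σ' → J (toℕ v) σ' × R σ' (50 + 2 * Γ) ≡ toℕ v
    body v σ (simS A O , k , c') ix= = x-mono
     (λ σ' (simS A' O' , k' , c'') →
      ( subst (λ s → SimS Γ ρ s σ') (sym (iter-from-step v g s)) (simS (record { Sim A' ; ixs = λ i → k' (ix (toℕ i) (Fin.toℕ<n i ·≤ n≤1+n Γ)) · ixs A i }) O')
      , (λ r → k' (Kept-weaken (n≤1+n Γ) z≤n r) · k r) , c'' · c')
      , k' (ix Γ ≤-refl) · ix=)
     (compile-correct c (simS (Sim-ix v ix= A) O))
   compile-correct (c ⨾ d) {ρ} S =
    x-seq {p = compile c} (compile-correct c S) λ σ1 (S1 , k1 , c1) →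
    x-mono (λ σ2 (S2 , k2 , c2) → S2 , (λ r → k2 r · k1 r) , c2 · c1) (compile-correct d S1)
   compile-correct {Γ} (emit e i) {ρ} {s} {σ} S =
    x-seq {p = compileE 0 e} (compileE-correct e 0 (simA S)) λ σ1 (e1 , k1) → decide σ1 e1 k1
    where
    x = ⟦ e ⟧E ρ (arrs s)
    decide : ∀ σ1 → R σ1 (st 0) ≡ enc K x → Keep Γ 0 σ σ1 → Exec (branch (st 0) (emit (ixReg i) ∷ []) [] ∷ []) σ1 2
     λ σ' → SimS Γ ρ (⟦ emit e i ⟧ ρ s) σ' × KeepC Γ σ σ'
    decide σ1 e1 k1 with IsField._≟_ (tower-isField K) x (BinaryRing.0# (tower K))
    ... | yes x=0 = x-≤ (s≤s z≤n) (x-branch-0 (e1 · cong (enc K) x=0 · enc-0 K)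
     (x-done (simS (Sim-keep k1 (simA S)) (Keep.out k1 · outs S) , Keep.kept k1 , Keep.coins k1)))
    ... | no x≢0 = x-branch-≢0 (λ e0 → x≢0 (enc-injective K (sym e1 · e0 · sym (enc-0 K))))
     (x-block 1 tt (x-done (simS (regs-sim (λ _ → refl) refl (Sim-keep k1 (simA S)))
      (cong₂ _∷ʳ_ (Keep.out k1 · outs S) (ixReg-sim (Sim-keep k1 (simA S)) i) · sym (map-++ toℕ (outp s) (⟦ i ⟧I ρ ∷ [])))
      , Keep.kept k1 , Keep.coins k1)))

module Setup where
 open FieldProg
 open Lang

 open import Defs hiding (run)
 open import Data.Nat
 open import Data.Nat.Properties

 octuple : ℕ → ℕ
 octuple n = let m = n + n ; l = m + m in l + l

 -- (8 n) ^ 7, in the form in which the program computes it.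
 threshold : ℕ → ℕ
 threshold n = let t = octuple n ; t² = t * t in t² * t² * t² * t

 eval-mono : ∀ p n {w w'} → w ≤ w' → eval p n w ≤ eval p n w'
 eval-mono (conᴾ c) n w≤ = ≤-refl
 eval-mono N n w≤ = ≤-refl
 eval-mono W n w≤ = w≤
 eval-mono (p ⊞ r) n w≤ = +-mono-≤ (eval-mono p n w≤) (eval-mono r n w≤)
 eval-mono (p ⊠ r) n w≤ = *-mono-≤ (eval-mono p n w≤) (eval-mono r n w≤)

 cellᴾ tableRowᴾ levelᴾ tableᴾ : Poly
 cellᴾ = conᴾ 8 ⊞ (mulᴾ ⊞ conᴾ 5)
 tableRowᴾ = conᴾ 2 ⊞ (W ⊠ (conᴾ 1 ⊞ cellᴾ) ⊞ conᴾ 3)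
 levelᴾ = conᴾ 4 ⊞ (W ⊠ (conᴾ 1 ⊞ tableRowᴾ) ⊞ conᴾ 4)
 tableᴾ = conᴾ 4 ⊞ (W ⊠ (conᴾ 1 ⊞ levelᴾ) ⊞ conᴾ 1)

 sizesP cellP rowP levelP tableP : Program

 widthBody : Program
 widthBody = add 43 43 43 ∷ mul 6 6 6 ∷ sub 7 4 6 ∷ []

 sizesP =
  const 41 1 ∷ add 40 0 42 ∷ const 47 arrays ∷
  add 2 0 0 ∷ add 2 2 2 ∷ add 2 2 2 ∷ mul 3 2 2 ∷ mul 4 3 3 ∷ mul 4 4 3 ∷ mul 4 4 2 ∷
  const 43 1 ∷ const 6 2 ∷ sub 7 4 6 ∷ while 7 widthBody ∷
  add 45 43 42 ∷ mul 44 0 0 ∷ mul 8 43 43 ∷ add 46 44 8 ∷ []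

 cellP =
  load 32 30 ∷ mul 34 32 48 ∷ add 35 30 43 ∷ store 35 34 ∷ add 36 30 33 ∷ store 36 34 ∷
  add 12 27 42 ∷ add 13 32 42 ∷ mulP ++ add 34 34 14 ∷ add 36 36 43 ∷ store 36 34 ∷ add 30 30 41 ∷ sub 31 31 41 ∷ []

 rowP = add 30 28 42 ∷ add 31 43 42 ∷ while 31 cellP ∷ add 28 28 45 ∷ sub 29 29 41 ∷ []

 levelP =
  half 27 48 ∷ add 28 44 42 ∷ add 29 43 42 ∷ mul 33 43 45 ∷ while 29 rowP ∷
  add 43 43 43 ∷ mul 48 48 48 ∷ sub 49 45 43 ∷ []

 tableP = store 44 41 ∷ const 43 1 ∷ const 48 2 ∷ sub 49 45 43 ∷ while 49 levelP ∷ []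

 module Sizes (b s n K : ℕ) (n>0 : 0 < n) where
  open Execution b s

  S P base q : ℕ
  S = width K
  P = n * n
  base = P + S * S
  q = 2 ^ S

  private
   t = octuple n
   n≤t : n ≤ t
   n≤t = m≤m+n n n ·≤ m≤m+n (n + n) (n + n) ·≤ m≤m+n (n + n + (n + n)) _
   t>0 : 0 < t
   t>0 = n>0 ·≤ n≤t
   instance
    t≢0 : NonZero t
    t≢0 = >-nonZero t>0
    tt≢0 : NonZero (t * t)
    tt≢0 = m*n≢0 t t
    tttt≢0 = m*n≢0 (t * t) (t * t)

  t≤thr : t ≤ threshold n
  t≤thr = m≤n*m t (t * t * (t * t) * (t * t)) {{m*n≢0 (t * t * (t * t)) (t * t)}}

  t⁶≤ : t * t * (t * t) * (t * t) ≤ threshold n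
  t⁶≤ = m≤m*n _ t
  t⁴≤ : t * t * (t * t) ≤ threshold n
  t⁴≤ = m≤m*n _ (t * t) ·≤ t⁶≤
  t²≤ : t * t ≤ threshold n
  t²≤ = m≤m*n _ (t * t) ·≤ t⁴≤

  n²≤thr : n * n ≤ threshold n
  n²≤thr = *-mono-≤ n≤t n≤t ·≤ t²≤

  width-mono : ∀ {k l} → k ≤ l → width k ≤ width l
  width-mono {zero} {l} _ = width>0 l
  width-mono {suc k} {suc l} (s≤s k≤l) = +-mono-≤ (width-mono k≤l) (width-mono k≤l)

  2^-double : ∀ m → 2 ^ m * 2 ^ m ≡ 2 ^ (m + m)
  2^-double m = sym (^-distribˡ-+-* 2 m m)

  module _ (roomy : 4 * (q * q) ≤ limit) (big : threshold n ≤ q) (least : ∀ k → k < K → 2 ^ width k < threshold n) where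
   q>0 : 0 < q
   q>0 = m^n>0 2 S
   q≤qq : q ≤ q * q
   q≤qq = m≤m*n q q {{>-nonZero q>0}}
   ≤3qq⇒< : ∀ {x} → x ≤ q * q + (q * q + q * q) → x < limit
   ≤3qq⇒< {x} x≤ = s≤s x≤ ·≤ +-monoˡ-≤ _ (*-mono-≤ q>0 q>0) ·≤ four (q * q) ≡≤ roomy
    where
    four : ∀ x → x + (x + (x + x)) ≡ 4 * x
    four = solve-∀
   ≤qq⇒< : ∀ {x} → x ≤ q * q → x < limit
   ≤qq⇒< x≤ = ≤3qq⇒< (x≤ ·≤ m≤m+n _ _)
   ≤q⇒< : ∀ {x} → x ≤ q → x < limit
   ≤q⇒< x≤ = ≤qq⇒< (x≤ ·≤ q≤qq)
   ≤thr⇒< : ∀ {x} → x ≤ threshold n → x < limit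
   ≤thr⇒< x≤ = ≤q⇒< (x≤ ·≤ big)
   S≤q : S ≤ q
   S≤q = <⇒≤ (m<2^m S)
   base-bound = +-assoc P (S * S) S ≡≤
    +-mono-≤ (n²≤thr ·≤ big ·≤ q≤qq) (+-mono-≤ (*-mono-≤ S≤q S≤q) (S≤q ·≤ q≤qq))
   record Sized (σ : State) : Set where
    constructor sized
    field
     input : R σ 0 ≡ n
     size : R σ 40 ≡ n
     one : R σ 41 ≡ 1
     zero' : R σ 42 ≡ 0
     width' : R σ 43 ≡ S
     table : R σ 44 ≡ P
     stride : R σ 45 ≡ S
     base= : R σ 46 ≡ base
     count : R σ 47 ≡ arrays
   record WidthInv (σ0 : State) (m : ℕ) (σ : State) : Set where
    constructor widthInv
    field
     k : ℕ
     k+m : k + m ≡ K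
     r43 : R σ 43 ≡ width k
     r6 : R σ 6 ≡ 2 ^ width k
     r4 : R σ 4 ≡ threshold n
     r7 : R σ 7 ≡ R σ 4 ∸ R σ 6
     r0 : R σ 0 ≡ n
     r40 : R σ 40 ≡ n
     r41 : R σ 41 ≡ 1
     r42 : R σ 42 ≡ 0
     r47 : R σ 47 ≡ arrays
     mem= : M σ ≡ M σ0
     ω= : ω σ ≡ ω σ0
     o= : o σ ≡ o σ0
   sizes-spec : ∀ {σ} → arrays < limit → R σ 0 ≡ n → R σ 42 ≡ 0 →
    Exec sizesP σ (13 + (K * 4 + suc 4)) λ σ' → Sized σ' × M σ' ≡ M σ × ω σ' ≡ ω σ × o σ' ≡ o σ
   sizes-spec {σ0} arrays< n= 0= =
    x-block 13 (≤q⇒< q>0 , ≤thr⇒< (n=' ≡≤ n≤t ·≤ t≤thr) , arrays< , ≤thr⇒< (cong₂ _+_ n= n= ≡≤ m≤m+n (n + n) (n + n) ·≤ m≤m+n (n + n + (n + n)) _ ·≤ t≤thr) , ≤thr⇒< (cong (λ n → n + n + (n + n)) n= ≡≤ m≤m+n (n + n + (n + n)) _ ·≤ t≤thr) , ≤thr⇒< (t= ≡≤ t≤thr) , ≤thr⇒< (cong (λ t → t * t) t= ≡≤ t²≤) , ≤thr⇒< (cong (λ t → t * t * (t * t)) t= ≡≤ t⁴≤) , ≤thr⇒< (cong (λ t → t * t * (t * t) * (t * t)) t= ≡≤ t⁶≤) , ≤thr⇒< (≤-reflexive (cong threshold n=)) , ≤q⇒< q>0 , ≤q⇒< (^-monoʳ-≤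 2 (width>0 K) ·≤ ≤-refl) , tt) (x-loop (WidthInv σ0) positive zero-case body exit K
     (widthInv 0 refl refl refl (cong threshold n=) refl n= n=' refl 0= refl refl refl refl))
    where
    t= = cong octuple n=
    n=' = cong₂ _+_ n= 0= · +-identityʳ n
    positive : ∀ m σ → WidthInv σ0 (suc m) σ → R σ 7 ≢ 0
    positive m σ i e = <⇒≱ (least k k<K) (m∸n≡0⇒m≤n (sym (r7 · cong₂ _∸_ r4 r6) · e))
     where
     open WidthInv i
     k<K : k < K
     k<K = +shift< k k+m
    zero-case : ∀ σ → WidthInv σ0 0 σ → R σ 7 ≡ 0
    zero-case σ i = r7 · cong₂ _∸_ r4 r6 · m≤n⇒m∸n≡0 (subst (λ k → threshold n ≤ 2 ^ width k) (sym k+m · +-identityʳ k) big)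
     where open WidthInv i
    body : ∀ m σ → WidthInv σ0 (suc m) σ → Exec widthBody σ 3 (WidthInv σ0 m)
    body m σ (widthInv k k+m r43 r6 r4 r7 r0 r40 r41 r42 r47 mem= ω= o=) =
     x-block 3 (≤q⇒< (cong₂ _+_ r43 r43 ≡≤ width-mono k<K ·≤ S≤q) , ≤q⇒< (sq ≡≤ ^-monoʳ-≤ 2 (width-mono k<K)) , tt) (x-done (widthInv (suc k) (+shift k k+m) (cong₂ _+_ r43 r43) sq r4 refl r0 r40 r41 r42 r47 mem= ω= o=))
     where
     k<K : suc k ≤ K
     k<K = +shift< k k+m
     sq = cong₂ _*_ r6 r6 · 2^-double (width k)
    exit : ∀ σ → WidthInv σ0 0 σ → Exec (add 45 43 42 ∷ mul 44 0 0 ∷ mul 8 43 43 ∷ add 46 44 8 ∷ []) σ 4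
     λ σ' → Sized σ' × M σ' ≡ M σ0 × ω σ' ≡ ω σ0 × o σ' ≡ o σ0
    exit σ (widthInv k k+0 r43 r6 r4 r7 r0 r40 r41 r42 r47 mem= ω= o=) =
     x-block 4 (≤q⇒< (S=' ≡≤ S≤q) , ≤thr⇒< (cong₂ _*_ r0 r0 ≡≤ n²≤thr) , ≤qq⇒< (cong₂ _*_ S= S= ≡≤ *-mono-≤ S≤q S≤q) , ≤3qq⇒< (base' ≡≤ m≤m+n base S ·≤ base-bound) , tt) (x-done (sized r0 r40 r41 r42 S= (cong₂ _*_ r0 r0) S=' base' r47 , mem= , ω= , o=))
     where
     S= : R σ 43 ≡ S
     S= = r43 · cong width (sym (+-identityʳ k) · k+0)
     S=' = cong₂ _+_ S= r42 · +-identityʳ S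
     base' = cong₂ _+_ (cong₂ _*_ r0 r0) (cong₂ _*_ S= S=)
   addr : ℕ → ℕ → ℕ
   addr i j = P + (i * S + j)
   addr-injective : ∀ {i j i' j'} → j < S → j' < S → addr i j ≡ addr i' j' → i ≡ i' × j ≡ j'
   addr-injective {i} {j} {i'} {j'} j< j'< e = i= , +-cancelˡ-≡ (i * S) j j' (e' · cong (λ i → i * S + j') (sym i=))
    where
    e' = +-cancelˡ-≡ P _ _ e
    apart : ∀ {i j i' j'} → j < S → i < i' → i * S + j ≢ i' * S + j'
    apart {i} {j} {i'} {j'} j< i< e = <⇒≱ (+-monoʳ-< (i * S) j< ≤≡ +-comm (i * S) S)
     (*-monoˡ-≤ S i< ·≤ m≤m+n (i' * S) j' ≤≡ sym e)
    i= : i ≡ i'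
    i= = ≤-antisym (≮⇒≥ λ lt → apart j'< lt (sym e')) (≮⇒≥ λ lt → apart j< lt e')
   Outside : (M M0 : ℕ → ℕ) → Set
   Outside M M0 = ∀ a → a < P ⊎ base ≤ a → M a ≡ M0 a
   module Rt = Routines b s P S
   module Level (k : ℕ) (k<K : k < K) (base≤s : base ≤ s) where
    private
     B = width k
     open RingTheory (tower k) using () renaming (_*_ to _⊗_; 0# to 0F; 1# to 1F)
     module R1 = RingTheory (tower k)
     module R2 = RingTheory (tower (suc k))
    right : ℕ → ℕ → ℕ
    right i j = enc (suc k) (basis (suc k) i R2.* basis (suc k) j)
    Good : (ℕ → ℕ) → ℕ → ℕ → Set
    Good M i j = M (addr i j) ≡ right i j
    value : ℕ → ℕ → F k
    value i j = basis k i ⊗ basis k j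
    enc2 : ∀ {x} u v → x ≡ (u , v) → enc (suc k) x ≡ enc k u + enc k v * 2 ^ B
    enc2 u v e = cong (enc (suc k)) e · enc-pair k u v · cong (enc k u +_) (*-comm (2 ^ B) (enc k v))
    open R1 using (solve; _:=_; _:+_; _:*_; con)
    a = gen k
    right00 : ∀ {i j} → i < B → j < B → right i j ≡ enc k (value i j)
    right00 {i} {j} i< j< = enc2 (value i j) 0F (cong₂ R2._*_ (basis-low k i<) (basis-low k j<) ·
     (cong₂ _,_ (solve 3 (λ x y a → x :* y :+ a :* (con false :* con false) := x :* y) refl (basis k i) (basis k j) a)
      (solve 2 (λ x y → x :* con false :+ con false :* y :+ con false :* con false := con false) refl (basis k i) (basis k j)))) ·
     cong (λ z → enc k (value i j) + z * 2 ^ B) (enc-0 k) · +-identityʳ _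
    right01 : ∀ {i j} → i < B → right i (B + j) ≡ enc k (value i j) * 2 ^ B
    right01 {i} {j} i< = enc2 0F (value i j) (cong₂ R2._*_ (basis-low k i<) (basis-high k j) ·
     (cong₂ _,_ (solve 3 (λ x y a → x :* con false :+ a :* (con false :* y) := con false) refl (basis k i) (basis k j) a)
      (solve 2 (λ x y → x :* y :+ con false :* con false :+ con false :* y := x :* y) refl (basis k i) (basis k j)))) ·
     cong (_+ enc k (value i j) * 2 ^ B) (enc-0 k)
    right10 : ∀ {i j} → j < B → right (B + i) j ≡ enc k (value i j) * 2 ^ B
    right10 {i} {j} j< = enc2 0F (value i j) (cong₂ R2._*_ (basis-high k i) (basis-low k j<) ·
     (cong₂ _,_ (solve 3 (λ x y a → con false :* y :+ a :* (x :* con false) := con false) refl (basis k i) (basis k j) a)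
      (solve 2 (λ x y → con false :* con false :+ x :* y :+ x :* con false := x :* y) refl (basis k i) (basis k j)))) ·
     cong (_+ enc k (value i j) * 2 ^ B) (enc-0 k)
    right11 : ∀ i j → right (B + i) (B + j) ≡ enc k (a ⊗ value i j) + enc k (value i j) * 2 ^ B
    right11 i j = enc2 (a ⊗ value i j) (value i j) (cong₂ R2._*_ (basis-high k i) (basis-high k j) ·
     (cong₂ _,_ (solve 3 (λ x y a → con false :* con false :+ a :* (x :* y) := a :* (x :* y)) refl (basis k i) (basis k j) a)
      (solve 2 (λ x y → con false :* y :+ x :* con false :+ x :* y := x :* y) refl (basis k i) (basis k j))))
    2B≤S : B + B ≤ S
    2B≤S = width-mono k<K
    B≤S : B ≤ S
    B≤S = m≤m+n B B ·≤ 2B≤S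
    set-good : ∀ {M p v i0 j0 i j} → p ≡ addr i0 j0 → v ≡ right i0 j0 → j0 < S → j < S →
     Good M i j ⊎ (i ≡ i0 × j ≡ j0) → Good (M [ p ≔ v ]) i j
    set-good {M} {i0 = i0} {j0} {i} {j} refl refl j0< j< g with addr i0 j0 ≟ addr i j
    ... | yes e = cong (λ c → (M [ addr i0 j0 ≔ right i0 j0 ]) c) (sym e) · upd-same M (addr i0 j0) _ ·
     cong₂ right (proj₁ (addr-injective {i0} {j0} {i} {j} j0< j< e)) (proj₂ (addr-injective {i0} {j0} {i} {j} j0< j< e))
    ... | no ne with g
    ... | inj₁ good = upd-diff M (addr i0 j0) _ ne · good
    ... | inj₂ (refl , refl) = contradiction refl ne
    addr<base : ∀ {i j} → i < S → j < S → addr i j < base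
    addr<base {i} {j} i< j< = +-monoʳ-< P (+-monoʳ-< (i * S) j< ·≤ +-comm (i * S) S ≡≤ *-monoˡ-≤ S i<)
    set-outside : ∀ {M M0 p v i j} → p ≡ addr i j → i < S → j < S → Outside M M0 → Outside (M [ p ≔ v ]) M0
    set-outside {M} {i = i} {j} refl i< j< out a (inj₁ a<P) = (upd-diff M (addr i j) _ λ e → <⇒≱ a<P (m≤m+n P (i * S + j) ≤≡ e)) · out a (inj₁ a<P)
    set-outside {M} {i = i} {j} refl i< j< out a (inj₂ ≤a) = (upd-diff M (addr i j) _ λ e → <⇒≱ (addr<base i< j<) (≤a ≤≡ sym e)) · out a (inj₂ ≤a)
    Done : (i0 j0 i j : ℕ) → Set
    Done i0 j0 i j = i < i0 ⊎ (i ≡ i0 × j < j0)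
    record Cells (M : ℕ → ℕ) (i0 j0 : ℕ) : Set where
     constructor cells
     field
      block : ∀ i j → i < B → j < B → Good M i j
      new : ∀ i j → i < B → j < B → Done i0 j0 i j → Good M i (B + j) × Good M (B + i) j × Good M (B + i) (B + j)
    wide = ^-monoʳ-≤ 2 (+-monoˡ-≤ B (width>0 k) ·≤ 2B≤S) ·≤ (<⇒≤ S') ·≤ ≤-refl
     where
     S' : q < limit
     S' = ≤q⇒< ≤-refl
    room = ≤3qq⇒< (+-monoʳ-≤ P (+-mono-≤ (*-monoˡ-≤ S B≤S) B≤S) ·≤ sym (+-assoc P (S * S) S) ≡≤ base-bound)
    table-of : ∀ {M i j} → Cells M i j → Rt.Table k M
    table-of (cells block _) i j i< j< = block i j i< j< · right00 i< j<
    record Start (σ : State) : Set where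
     constructor start
     field
      consts : Rt.Constants k σ
      axis : R σ 27 ≡ 2 ^ pred B
      rows : R σ 33 ≡ B * S
      shift : R σ 48 ≡ 2 ^ B
    record CellInv (σ0 : State) (i m : ℕ) (σ : State) : Set where
     constructor cellInv
     field
      j : ℕ
      j+m : j + m ≡ B
      r27 : R σ 27 ≡ R σ0 27
      r28 : R σ 28 ≡ R σ0 28
      r29 : R σ 29 ≡ R σ0 29
      r33 : R σ 33 ≡ R σ0 33
      ptr : R σ 30 ≡ addr i j
      count : R σ 31 ≡ m
      high : ∀ r → R σ (37 + r) ≡ R σ0 (37 + r)
      cells' : Cells (M σ) i j
      outside : Outside (M σ) (M σ0)
      ω= : ω σ ≡ ω σ0
      o= : o σ ≡ o σ0
    cell-cost : ℕ
    cell-cost = 8 + (Rt.mul-cost k wide room + 5)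
    cell-body : ∀ {σ0} → Start σ0 → ∀ i → i < B → ∀ m σ → CellInv σ0 i (suc m) σ → Exec cellP σ cell-cost (CellInv σ0 i m)
    cell-body {σ0} st i i< m σ (cellInv j j+m r27 r28 r29 r33 ptr count high cs outside ω= o=) =
     x-block 8 (≤q⇒< (e34 ≡≤ shifted≤) , <limit e35 i<S Bj<S , <s e35 i<S Bj<S , <limit e36 Bi<S j<S , <s e36 Bi<S j<S , ≤q⇒< (e12 ≡≤ ^-monoʳ-≤ 2 (pred[n]≤n {B} ·≤ B≤S)) , ≤q⇒< (e13 ≡≤ v≤q) , tt) (x-seq {p = mulP} (Rt.mul-spec k wide room a (value i j) c2 (table-of cells2) (e12 · sym (enc-gen k)) e13)
     λ σ3 (e14 , f) → let one3 = regs= f 17 · high 4 · Rt.Constants.one consts ; w3 = regs= f 19 · width=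
                          e34' = cong₂ _+_ (regs= f 10 · e34) e14 · +-comm (enc k (value i j) * 2 ^ B) _ · sym (right11 i j)
                          e36' = cong₂ _+_ (regs= f 12 · e36) w3 · addr11
                          e30 = cong₂ _+_ (regs= f 6 · ptr) one3 · +-assoc P _ 1 · cong (P +_) (+-assoc (i * S) j 1 · cong (i * S +_) (+-comm j 1)) in
     x-block 5 (≤q⇒< (e34' ≡≤ right≤ (B + i) (B + j)) , <limit e36' Bi<S Bj<S , <s e36' Bi<S Bj<S , ≤3qq⇒< (e30 ≡≤ +-monoʳ-≤ P (+-mono-≤ (*-monoˡ-≤ S (<⇒≤ i<S)) (j<S)) ·≤ sym (+-assoc P (S * S) S) ≡≤ base-bound) , tt) (x-done (cellInv (suc j) (+shift j j+m) (regs= f 3 · r27) (regs= f 4 · r28) (regs= f 5 · r29) (regs= f 9 · r33)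
      e30 (cong₂ _∸_ (regs= f 7 · count) one3) (λ r → regs= f (13 + r) · high r)
      (cells3 (M σ3) (mem= f) e36' e34')
      (λ c out → set-outside {M σ3} e36' Bi<S Bj<S (λ c out → cong (λ M → M c) (mem= f) · outside2 c out) c out)
      (coins= f · ω=) (out= f · o=))))
     where
     open Start st
     j<B : j < B
     j<B = +shift< j j+m
     i<S = i< ·≤ B≤S
     j<S = j<B ·≤ B≤S
     Bi<S : B + i < S
     Bi<S = +-monoʳ-< B i< ·≤ 2B≤S
     Bj<S : B + j < S
     Bj<S = +-monoʳ-< B j<B ·≤ 2B≤S
     width= : R σ 43 ≡ B
     width= = high 6 · Rt.Constants.width' consts
     zero= : R σ 42 ≡ 0
     zero= = high 5 · Rt.Constants.zero' consts
     e32 = cong (M σ) ptr · table-of cs i j i< j<B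
     v≤q = (<⇒≤ (enc< k (value i j))) ·≤ ^-monoʳ-≤ 2 B≤S
     e34 = cong₂ _*_ e32 (high 11 · shift)
     shifted≤ = *-monoˡ-≤ (2 ^ B) (<⇒≤ (enc< k (value i j))) ·≤ 2^-double B ≡≤ ^-monoʳ-≤ 2 2B≤S
     right≤ : ∀ i j → right i j ≤ q
     right≤ i j = (<⇒≤ (enc< (suc k) _)) ·≤ ^-monoʳ-≤ 2 2B≤S
     e35 = cong₂ _+_ ptr width= · rearrange P (i * S) j B
      where
      rearrange : ∀ p x j b → p + (x + j) + b ≡ p + (x + (b + j))
      rearrange = solve-∀
     e36 = cong₂ _+_ ptr (r33 · rows) · rearrange P i S j B
      where
      rearrange : ∀ p i s j b → p + (i * s + j) + b * s ≡ p + ((b + i) * s + j)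
      rearrange = solve-∀
     addr11 = rearrange P ((B + i) * S) j B
      where
      rearrange : ∀ p x j b → p + (x + j) + b ≡ p + (x + (b + j))
      rearrange = solve-∀
     e12 = cong₂ _+_ (r27 · axis) zero= · +-identityʳ _
     e13 = cong₂ _+_ e32 zero= · +-identityʳ _
     <limit : ∀ {x i j} → x ≡ addr i j → i < S → j < S → x < limit
     <limit refl i< j< = ≤3qq⇒< ((<⇒≤ (addr<base i< j<)) ·≤ m≤m+n base S ·≤ base-bound)
     <s : ∀ {x i j} → x ≡ addr i j → i < S → j < S → x < s
     <s refl i< j< = addr<base i< j< ·≤ base≤s
     σ2 = afterAdd 13 32 42 (afterAdd 12 27 42 (afterStore 36 34 (afterAdd 36 30 33 (afterStore 35 34 (afterAdd 35 30 43 (afterMul 34 32 48 (afterLoad 32 30 σ)))))))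
     p1 p2 v : ℕ
     p1 = R σ 30 + R σ 43
     p2 = R σ 30 + R σ 33
     v = M σ (R σ 30) * R σ 48
     M1 : ℕ → ℕ
     M1 = M σ [ p1 ≔ v ]
     c2 : Rt.Constants k σ2
     c2 = Rt.Constants-frame k {σ0} {σ2} (λ r → high (3 + r)) consts
     grow : ∀ {M' p v i0 j0} → p ≡ addr i0 j0 → v ≡ right i0 j0 → j0 < S → ∀ {i j} → j < S → Good M' i j → Good (M' [ p ≔ v ]) i j
     grow {M'} p= v= j0< j< g = set-good {M'} p= v= j0< j< (inj₁ g)
     v1 = e34 · sym (right01 {i} {j} i<)
     v2 = e34 · sym (right10 {i} {j} j<B)
     both : ∀ {i' j'} → j' < S → Good (M σ) i' j' → Good (M σ2) i' j'
     both j< g = grow {M1} {p2} {v} e36 v2 j<S j< (grow {M σ} {p1} {v} e35 v1 Bj<S j< g)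
     low< : ∀ {j} → j < B → j < S
     low< j< = j< ·≤ B≤S
     high< : ∀ {j} → j < B → B + j < S
     high< j< = +-monoʳ-< B j< ·≤ 2B≤S
     cells2 : Cells (M σ2) i j
     cells2 = cells (λ i' j' p r → both (low< r) (Cells.block cs i' j' p r))
      λ i' j' p r d → let g1 , g2 , g3 = Cells.new cs i' j' p r d in both (high< r) g1 , both (low< r) g2 , both (high< r) g3
     outside2 = set-outside {M1} {p = p2} {v} e36 Bi<S j<S (set-outside {M σ} {p = p1} {v} e35 i<S Bj<S outside)
     cells3 : ∀ M3 {p v} → M3 ≡ M σ2 → p ≡ addr (B + i) (B + j) → v ≡ right (B + i) (B + j) → Cells (M3 [ p ≔ v ]) i (suc j)
     cells3 _ {p} {u} refl p= u= = cells (λ i' j' p r → third (low< r) (Cells.block cells2 i' j' p r)) new'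
      where
      third : ∀ {i' j'} → j' < S → Good (M σ2) i' j' → Good (M σ2 [ p ≔ u ]) i' j'
      third j< g = grow {M σ2} {p} {u} p= u= Bj<S j< g
      now = third Bj<S (grow {M1} {p2} {v} e36 v2 j<S Bj<S (set-good {M σ} {p1} {v} e35 v1 Bj<S Bj<S (inj₂ (refl , refl))))
       , third j<S (set-good {M1} {p2} {v} e36 v2 j<S j<S (inj₂ (refl , refl)))
       , set-good {M σ2} {p} {u} p= u= Bj<S Bj<S (inj₂ (refl , refl))
      new' : ∀ i' j' → i' < B → j' < B → Done i (suc j) i' j' → _
      new' i' j' i< j< d with older d
       where
       older : Done i (suc j) i' j' → Done i j i' j' ⊎ (i' ≡ i × j' ≡ j)
       older (inj₁ lt) = inj₁ (inj₁ lt)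
       older (inj₂ (e , s≤s j'≤j)) with m≤n⇒m<n∨m≡n j'≤j
       ... | inj₁ lt = inj₁ (inj₂ (e , lt))
       ... | inj₂ e' = inj₂ (e , e')
      ... | inj₁ d' = let g1 , g2 , g3 = Cells.new cells2 i' j' i< j< d' in third (high< j<) g1 , third (low< j<) g2 , third (high< j<) g3
      ... | inj₂ (refl , refl) = now
    record RowInv (σ0 : State) (m : ℕ) (σ : State) : Set where
     constructor rowInv
     field
      i : ℕ
      i+m : i + m ≡ B
      r27 : R σ 27 ≡ R σ0 27
      r33 : R σ 33 ≡ R σ0 33
      ptr : R σ 28 ≡ P + i * S
      count : R σ 29 ≡ m
      high : ∀ r → R σ (37 + r) ≡ R σ0 (37 + r)
      cells' : Cells (M σ) i 0
      outside : Outside (M σ) (M σ0)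
      ω= : ω σ ≡ ω σ0
      o= : o σ ≡ o σ0
    row-body : ∀ {σ0} → Start σ0 → ∀ m σ → RowInv σ0 (suc m) σ → Exec rowP σ (eval tableRowᴾ 0 B) (RowInv σ0 m)
    row-body {σ0} st m σ (rowInv i i+m r27 r33 ptr count high cs outside ω= o=) =
     x-block 2 (≤3qq⇒< (e30 ≡≤ +-monoʳ-≤ P (*-monoˡ-≤ S (<⇒≤ i<S)) ·≤ m≤m+n base S ·≤ base-bound) , ≤q⇒< (e31 ≡≤ B≤S ·≤ S≤q) , tt) (x-for (CellInv σ1 i) CellInv.count (cell-body st1 i i<B) exit B
      (cellInv 0 refl refl refl refl refl (e30 · cong (P +_) (sym (+-identityʳ _))) e31 (λ _ → refl) cs (λ _ _ → refl) refl refl))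
     where
     open Start st
     i<B : i < B
     i<B = +shift< i i+m
     i<S = i<B ·≤ B≤S
     zero= : R σ 42 ≡ 0
     zero= = high 5 · Rt.Constants.zero' consts
     e30 = cong₂ _+_ ptr zero= · +-identityʳ _
     e31 = cong₂ _+_ (high 6 · Rt.Constants.width' consts) zero= · +-identityʳ _
     σ1 = afterAdd 31 43 42 (afterAdd 30 28 42 σ)
     st1 : Start σ1
     st1 = start (Rt.Constants-frame k {σ0} {σ1} (λ r → high (3 + r)) consts) (r27 · axis) (r33 · rows) (high 11 · shift)
     exit : ∀ σ2 → CellInv σ1 i 0 σ2 → Exec (add 28 28 45 ∷ sub 29 29 41 ∷ []) σ2 2 (RowInv σ0 m)
     exit σ2 (cellInv j j+0 r27' r28' r29' r33' _ _ high' cs' outside' ω=' o=') =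
      x-block 2 (≤3qq⇒< (advance ≡≤ +-monoʳ-≤ P (*-monoˡ-≤ S i<S) ·≤ m≤m+n base S ·≤ base-bound) , tt) (x-done (rowInv (suc i) (+shift i i+m) (r27' · r27) (r33' · r33) advance
       (cong₂ _∸_ (r29' · count) (high' 4 · high 4 · Rt.Constants.one consts))
       (λ r → high' r · high r)
       (cells (Cells.block cs') λ i' j' i< j< d → Cells.new cs' i' j' i< j< (older j< d))
       (λ a out → outside' a out · outside a out) (ω=' · ω=) (o=' · o=)))
      where
      advance = cong₂ _+_ (r28' · ptr) (high' 8 · high 8 · Rt.Constants.stride consts) ·
       +-assoc P (i * S) S · cong (P +_) (+-comm (i * S) S)
      j≡B : j ≡ B
      j≡B = sym (+-identityʳ j) · j+0
      older : ∀ {i' j'} → j' < B → Done (suc i) 0 i' j' → Done i j i' j'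
      older j< (inj₂ (_ , ()))
      older j< (inj₁ (s≤s i'≤i)) with m≤n⇒m<n∨m≡n i'≤i
      ... | inj₁ lt = inj₁ lt
      ... | inj₂ refl = inj₂ (refl , j< ≤≡ sym j≡B)
    next-table : ∀ {M} → Cells M B 0 → Rt.Table (suc k) M
    next-table {M} (cells block new) i j i< j< = by-halves (i <? B) (j <? B)
     where
     rest : ∀ {j} → j < B + B → ¬ (j < B) → j ∸ B < B
     rest {j} j< r = +-cancelˡ-< B _ _ (cong suc (m+[n∸m]≡n (≮⇒≥ r)) ≡≤ j<)
     by-halves : Dec (i < B) → Dec (j < B) → Good M i j
     by-halves (yes p) (yes r) = block i j p r
     by-halves (yes p) (no r) = subst (Good M i) (m+[n∸m]≡n (≮⇒≥ r)) (proj₁ (new i (j ∸ B) p (rest j< r) (inj₁ p)))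
     by-halves (no p) (yes r) = subst (λ i → Good M i j) (m+[n∸m]≡n (≮⇒≥ p)) (proj₁ (proj₂ (new (i ∸ B) j (rest i< p) r (inj₁ (rest i< p)))))
     by-halves (no p) (no r) = subst₂ (Good M) (m+[n∸m]≡n (≮⇒≥ p)) (m+[n∸m]≡n (≮⇒≥ r))
      (proj₂ (proj₂ (new (i ∸ B) (j ∸ B) (rest i< p) (rest j< r) (inj₁ (rest i< p)))))
   record Tabled (σ0 : State) (k : ℕ) (σ : State) : Set where
    constructor tabled
    field
     consts : Rt.Constants k σ
     tab : Rt.Table k (M σ)
     r40 : R σ 40 ≡ R σ0 40
     r46 : R σ 46 ≡ R σ0 46
     r47 : R σ 47 ≡ R σ0 47
     outside : Outside (M σ) (M σ0)
     ω= : ω σ ≡ ω σ0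
     o= : o σ ≡ o σ0
   record LevelInv (σ0 : State) (m : ℕ) (σ : State) : Set where
    constructor levelInv
    field
     k : ℕ
     k+m : k + m ≡ K
     state : Tabled σ0 k σ
     r48 : R σ 48 ≡ 2 ^ width k
     r49 : R σ 49 ≡ S ∸ width k
   half-power : ∀ {m} → 0 < m → ⌊ 2 ^ m /2⌋ ≡ 2 ^ pred m
   half-power {suc m} _ = cong (λ x → ⌊ 2 ^ m + x /2⌋) (+-identityʳ (2 ^ m)) · sym (n≡⌊n+n/2⌋ (2 ^ m))
   level-body : base ≤ s → ∀ {σ0} m σ → LevelInv σ0 (suc m) σ → Exec levelP σ (eval levelᴾ 0 S) (LevelInv σ0 m)
   level-body base≤s {σ0} m σ (levelInv k k+m (tabled c tab r40 r46 r47 outside ω= o=) r48 r49) =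
    x-≤ (eval-mono levelᴾ 0 B≤S) (x-block 4 (≤3qq⇒< (P= ≡≤ m≤m+n P (S * S) ·≤ m≤m+n base S ·≤ base-bound) , ≤q⇒< (B= ≡≤ B≤S ·≤ S≤q) , ≤qq⇒< (BS= ≡≤ *-mono-≤ (B≤S ·≤ S≤q) S≤q) , tt) (x-for (RowInv σ1) RowInv.count (row-body st1) exit B
     (rowInv 0 refl refl refl (P= · sym (+-identityʳ P)) B= (λ _ → refl) (cells (λ i j i< j< → tab i j i< j< · sym (right00 i< j<)) λ { _ _ _ _ (inj₁ ()) ; _ _ _ _ (inj₂ (_ , ())) })
      (λ _ _ → refl) refl refl)))
    where
    k<K : k < K
    k<K = +shift< k k+m
    open Level k k<K base≤s
    B = width k
    P= = cong₂ _+_ (Rt.Constants.table c) (Rt.Constants.zero' c) · +-identityʳ P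
    B= = cong₂ _+_ (Rt.Constants.width' c) (Rt.Constants.zero' c) · +-identityʳ B
    BS= = cong₂ _*_ (Rt.Constants.width' c) (Rt.Constants.stride c)
    σ1 = afterMul 33 43 45 (afterAdd 29 43 42 (afterAdd 28 44 42 (afterHalf 27 48 σ)))
    st1 : Start σ1
    st1 = start (Rt.Constants-frame k {σ} {σ1} (λ _ → refl) c) (cong ⌊_/2⌋ r48 · half-power (width>0 k)) BS= r48
    exit : ∀ σ2 → RowInv σ1 0 σ2 → Exec (add 43 43 43 ∷ mul 48 48 48 ∷ sub 49 45 43 ∷ []) σ2 3 (LevelInv σ0 m)
    exit σ2 (rowInv i i+0 _ _ _ _ high cs out' ω=' o=') =
     x-block 3 (≤q⇒< (BB= ≡≤ 2B≤S ·≤ S≤q) , ≤q⇒< (sq ≡≤ ^-monoʳ-≤ 2 2B≤S) , tt) (x-done (levelInv (suc k) (+shift k k+m)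
      (tabled (constants (high 4 · one) (high 5 · zero') BB= (high 7 · table) (high 8 · stride))
       (next-table (subst (λ i → Cells (M σ2) i 0) (sym (+-identityʳ i) · i+0) cs))
       (high 3 · r40) (high 9 · r46) (high 10 · r47) (λ a p → out' a p · outside a p) (ω=' · ω=) (o=' · o=))
      sq (cong₂ _∸_ (high 8 · stride) BB=)))
     where
     open Rt.Constants c
     open Rt using (constants)
     BB= = cong₂ _+_ (high 6 · width') (high 6 · width')
     sq = cong₂ _*_ (high 11 · r48) (high 11 · r48) · 2^-double B
   n≤width : ∀ k → k ≤ width k
   n≤width zero = z≤n
   n≤width (suc k) = +-comm 1 k ≡≤ +-mono-≤ (n≤width k) (width>0 k)
   table-spec : base ≤ s → ∀ {σ} → Sized σ → Exec tableP σ (eval tableᴾ 0 S) (Tabled σ K)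
   table-spec base≤s {σ0} z = x-≤ (+-monoʳ-≤ 4 (+-monoˡ-≤ 1 (*-monoˡ-≤ (suc (eval levelᴾ 0 S)) (n≤width K))))
    (x-block 4 (cong suc table ≡≤ P<base ·≤ base≤s , ≤q⇒< q>0 , ≤q⇒< (^-monoʳ-≤ 2 (width>0 K)) , tt) (x-loop (LevelInv σ0) positive zero-case (level-body base≤s) exit K
     (levelInv 0 refl (tabled (constants one zero' refl table stride) table0 refl refl refl outside0 refl refl) refl (cong (_∸ 1) stride))))
    where
    open Sized z
    open Rt using (constants)
    P<base : P < base
    P<base = +-comm 1 P ≡≤ +-monoʳ-≤ P (*-mono-≤ (width>0 K) (width>0 K))
    M1 = M σ0 [ R σ0 44 ≔ R σ0 41 ]
    table0 : Rt.Table 0 M1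
    table0 zero zero _ _ = cong₂ (λ a v → (M σ0 [ a ≔ v ]) (P + 0)) table one · cong (M σ0 [ P ≔ 1 ]) (+-identityʳ P) · upd-same (M σ0) P 1
    table0 (suc i) _ (s≤s ()) _
    table0 zero (suc j) _ (s≤s ())
    outside0 : Outside M1 (M σ0)
    outside0 a (inj₁ a<P) = upd-diff (M σ0) _ _ λ e → <-irrefl (sym e · table) a<P
    outside0 a (inj₂ ≤a) = upd-diff (M σ0) _ _ λ e → <⇒≱ P<base (≤a ≤≡ sym e · table)
    positive : ∀ m σ → LevelInv σ0 (suc m) σ → R σ 49 ≢ 0
    positive m σ (levelInv k k+m _ _ r49) e = <⇒≱ (m<m+n (width k) (width>0 k) ·≤ width-mono k<K) (m∸n≡0⇒m≤n (sym r49 · e))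
     where
     k<K : k < K
     k<K = +shift< k k+m
    zero-case : ∀ σ → LevelInv σ0 0 σ → R σ 49 ≡ 0
    zero-case σ (levelInv k k+0 _ _ r49) = r49 · cong (λ k → S ∸ width k) (sym (+-identityʳ k) · k+0) · n∸n≡0 S
    exit : ∀ σ → LevelInv σ0 0 σ → Exec [] σ 0 (Tabled σ0 K)
    exit σ (levelInv k k+0 t _ _) = x-done (subst (λ k → Tabled σ0 k σ) (sym (+-identityʳ k) · k+0) t)

module Input where
 open FieldProg
 open Lang hiding (low)

 open import Defs hiding (run)
 open import Data.Fin using (combine)
 open import Data.List.Properties using (length-take; length-drop; take++drop≡id; drop-drop)
 open import Data.Nat
 open import Data.Nat.Properties

 coinBody inputBody inputP : Program

 coinBody = flip 35 ∷ mul 35 35 33 ∷ add 32 32 35 ∷ add 33 33 33 ∷ sub 34 34 41 ∷ []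

 inputBody =
  load 31 29 ∷ store 28 31 ∷ const 32 0 ∷ const 33 1 ∷ add 34 45 42 ∷ while 34 coinBody ∷
  add 36 28 41 ∷ store 36 32 ∷ add 28 28 27 ∷ add 29 29 41 ∷ sub 30 30 41 ∷ []

 inputP = add 28 46 42 ∷ mul 27 40 47 ∷ const 29 0 ∷ add 30 44 42 ∷ while 30 inputBody ∷ []

 inputᴾ : Poly
 inputᴾ = conᴾ 4 ⊞ (N ⊠ N ⊠ (conᴾ 6 ⊞ (W ⊠ conᴾ 6 ⊞ conᴾ 6)) ⊞ conᴾ 1)

 inputMemory-arc : ∀ {n} (G : Digraph n) i j → inputMemory G (toℕ i * n + toℕ j) ≡ (if adjacent G i j then 1 else 0)
 inputMemory-arc {n} G i j = at (toℕ i * n + toℕ j) (sym (combine-index i j))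
  where
  at : ∀ a → a ≡ toℕ (combine i j) → inputMemory G a ≡ (if adjacent G i j then 1 else 0)
  at a e with a <? n * n
  ... | no a≮ = contradiction (subst (_< n * n) (sym e) (Fin.toℕ<n (combine i j))) a≮
  ... | yes a<nn = cong (λ (u , v) → if adjacent G u v then 1 else 0)
   (cong (remQuot {n} n) (Fin.toℕ-injective {i = fromℕ< a<nn} (Fin.toℕ-fromℕ< a<nn · e)) · Fin.remQuot-combine i j)

 module InputCorrectness (b K n' : ℕ) where
  open Semantics K n'

  P S base : ℕ
  S = width K
  P = n * n
  base = P + S * S

  open Layout n arrays base
  open Execution b cells
  open BinaryRing (tower K) using (0#; 1#)
  module Rt = Routines b cells P S

  inputArrays : Digraph n → (Fin n → Fin n → F K) → Arrays
  inputArrays G x 0 i j zero = if adjacent G i j then 1# else 0#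
  inputArrays G x 1 i j zero = x i j
  inputArrays G x _ i j _ = 0#

  record Ready (σ : State) : Set where
   constructor ready
   field
    consts : Rt.Constants K σ
    size : R σ 40 ≡ n
    base= : R σ 46 ≡ base
    count : R σ 47 ≡ arrays
    tab : Rt.Table K (M σ)

  module _ (cells< : cells < limit) (2q≤ : 2 ^ suc S ≤ limit) (below : ∀ i j → i < S → j < S → P + (i * S + j) < base)
   (G : Digraph n) (coins : List Bool) (enough : n * n * S ≤ length coins) where
   chunk : ℕ → List Bool
   chunk a = take S (drop (a * S) coins)
   weight : Fin n → Fin n → F K
   weight i j = fromBits K (chunk (toℕ i * n + toℕ j))
   A = inputArrays G weight
   q : ℕ
   q = 2 ^ S
   <limit : ∀ {x} → x ≤ q → x < limit
   <limit x≤ = s≤s x≤ ·≤ +-monoˡ-≤ q (m^n>0 2 S) ·≤ cong (q +_) (sym (+-identityʳ q)) ≡≤ 2q≤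
   S≤q = <⇒≤ (m<2^m S)
   record CoinInv (σ0 : State) (rest : List Bool) (total m : ℕ) (σ : State) : Set where
    constructor coinInv
    field
     bs : List Bool
     length= : length bs ≡ m
     coins= : ω σ ≡ bs ++ rest
     power : R σ 33 * 2 ^ m ≡ q
     sum= : R σ 32 + R σ 33 * val bs ≡ total
     count : R σ 34 ≡ m
     low : ∀ r → r < 4 → R σ (27 + r) ≡ R σ0 (27 + r)
     high : ∀ r → R σ (40 + r) ≡ R σ0 (40 + r)
     mem= : M σ ≡ M σ0
     o= : o σ ≡ o σ0
   coin-body : ∀ {σ0 rest total} → R σ0 41 ≡ 1 → total < q → ∀ m σ → CoinInv σ0 rest total (suc m) σ → Exec coinBody σ 5 (CoinInv σ0 rest total m)
   coin-body {total = total} one total< m σ (coinInv (c ∷ bs) length= coins= power sum= count low high mem= o=) =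
    x-flip coins= (x-block 4 (<limit (m≤n+m _ (R σ 32) ·≤ acc≤) , <limit acc≤ , <limit power≤ , tt) (x-done
     (coinInv bs (suc-injective length=) refl (double (R σ 33) (2 ^ m) · power)
      (regroup (R σ 32) (bit01 c) (R σ 33) (val bs) · sum=)
      (cong₂ _∸_ count (high 1 · one))
      (λ { 0 p → low 0 p ; 1 p → low 1 p ; 2 p → low 2 p ; 3 p → low 3 p ; (suc (suc (suc (suc _)))) (s≤s (s≤s (s≤s (s≤s ())))) }) high mem= o=)))
    where
    double : ∀ u p → (u + u) * p ≡ u * (2 * p)
    double = solve-∀
    regroup : ∀ a x u v → a + x * u + (u + u) * v ≡ a + u * (x + 2 * v)
    regroup = solve-∀
    power≤ = m≤m*n (R σ 33 + R σ 33) (2 ^ m) {{m^n≢0 2 m}} ≤≡ double (R σ 33) (2 ^ m) · power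
    acc≤ = m≤m+n _ ((R σ 33 + R σ 33) * val bs) ·≤ regroup (R σ 32) (bit01 c) (R σ 33) (val bs) · sum= ≡≤ (<⇒≤ total<)
   n² = n * n
   stride = n * arrays
   record InputInv (σ0 : State) (m : ℕ) (σ : State) : Set where
    constructor inputInv
    field
     a : ℕ
     a+m : a + m ≡ n²
     step= : R σ 27 ≡ stride
     ptr : R σ 28 ≡ a * stride + base
     input : R σ 29 ≡ a
     count : R σ 30 ≡ m
     high : ∀ r → R σ (40 + r) ≡ R σ0 (40 + r)
     under : ∀ c → c < base → M σ c ≡ M σ0 c
     done : ∀ i j → toℕ i * n + toℕ j < a → ∀ (id : Fin arrays) k → M σ (address (toℕ id) i j k) ≡ enc K (A (toℕ id) i j k)
     todo : ∀ i j → a ≤ toℕ i * n + toℕ j → ∀ (id : Fin arrays) k → M σ (address (toℕ id) i j k) ≡ 0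
     coins= : ω σ ≡ drop (a * S) coins
     o= : o σ ≡ o σ0
   input-spec : ∀ {σ} → Ready σ → ω σ ≡ coins → (∀ c → c < P → M σ c ≡ inputMemory G c) → (∀ c → base ≤ c → M σ c ≡ 0) →
    Exec inputP σ (eval inputᴾ n S) λ σ' → Ready σ' × (∀ (id : Fin arrays) i j k → M σ' (address (toℕ id) i j k) ≡ enc K (A (toℕ id) i j k)) × o σ' ≡ o σ
   input-spec {σ0} rd coins0 input0 zero0 =
    x-block 4 (cong suc base' ≡≤ base< , cong suc stride= ≡≤ stride< , <limit z≤n , cong suc P= ≡≤ (≤-<-trans (m≤m+n P (S * S)) base<) , tt) (x-for (InputInv σ0) InputInv.count body exit n²
     (inputInv 0 refl stride= base' refl P= (λ _ → refl) (λ _ _ → refl) (λ _ _ ()) (λ i j _ id k → zero0 _ (base≤ (toℕ id) i j k)) coins0 refl))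
    where
    open Ready rd
    one0 = Rt.Constants.one consts
    zero= = Rt.Constants.zero' consts
    base' = cong₂ _+_ base= zero= · +-identityʳ base
    P= = cong₂ _+_ (Rt.Constants.table consts) zero= · +-identityʳ n²
    stride= = cong₂ _*_ size count
    ptr-bound : ∀ a → a ≤ n² → a * stride + base ≤ cells
    ptr-bound a a≤ = +-monoˡ-≤ base (*-monoˡ-≤ stride a≤) ≤≡ total n arrays base · sym cells=
     where
     total : ∀ n c b → n * n * (n * c) + b ≡ b + n * n * n * c
     total = solve-∀
    base< = ≤-<-trans (ptr-bound 0 z≤n) cells<
    stride< = ≤-<-trans (m≤m+n stride base ·≤ +-monoˡ-≤ base (m≤n*m stride 1) ·≤ ptr-bound 1 (s≤s z≤n)) cells<
    body : ∀ m σ → InputInv σ0 (suc m) σ → Exec inputBody σ (5 + (S * 6 + 6)) (InputInv σ0 m)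
    body m σ (inputInv a a+m step= ptr input count high under done todo coins= o=) =
     x-block 5 (cong suc ptr ≡≤ at< , <limit z≤n , <limit (m^n>0 2 S) , <limit (S= ≡≤ S≤q) , tt) (x-for (CoinInv σ1 rest (val (chunk a))) CoinInv.count
      (coin-body (high 1 · one0) (subst (λ l → val (chunk a) < 2 ^ l) chunk-length (val< (chunk a)))) coins-exit S
      (coinInv (chunk a) chunk-length (coins= · sym (take++drop≡id S (drop (a * S) coins))) (*-identityˡ q) (*-identityˡ (val (chunk a))) S=
       (λ { 0 _ → refl ; 1 _ → refl ; 2 _ → refl ; 3 _ → refl ; (suc (suc (suc (suc _)))) (s≤s (s≤s (s≤s (s≤s ())))) }) (λ _ → refl) refl refl))
     where
     rest = drop S (drop (a * S) coins)
     σ1 = afterAdd 34 45 42 (afterConst 33 1 (afterConst 32 0 (afterStore 28 31 (afterLoad 31 29 σ))))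
     a<n² = +shift< a a+m
     S= = cong₂ _+_ (high 5 · Rt.Constants.stride consts) (high 2 · zero=) · +-identityʳ S
     chunk-length = length-take S (drop (a * S) coins) · m≤n⇒m⊓n≡m (+-cancelˡ-≤ (a * S) _ _ (+-comm (a * S) S ≡≤ *-monoˡ-≤ S a<n² ·≤ enough ≤≡ sym (m+[n∸m]≡n (*-monoˡ-≤ S (<⇒≤ a<n²) ·≤ enough))) ≤≡ sym (length-drop (a * S) coins))
     i0 j0 : Fin n
     i0 = proj₁ (remQuot {n} n (fromℕ< a<n²))
     j0 = proj₂ (remQuot {n} n (fromℕ< a<n²))
     a= = sym (combine-index i0 j0) · cong toℕ (Fin.combine-remQuot {n} n (fromℕ< a<n²)) · Fin.toℕ-fromℕ< a<n²
     same-index : ∀ i j → toℕ i * n + toℕ j ≡ a → i ≡ i0 × j ≡ j0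
     same-index i j e = Fin.combine-injective i j i0 j0 (Fin.toℕ-injective (combine-index i j ·
      e · sym a= · sym (combine-index i0 j0)))
     address0 = cong (λ a → a * stride + base) (sym a=) · cong (_+ base) (flat (toℕ i0 * n + toℕ j0) n arrays) · sym (address= 0 i0 j0 zero)
      where
      flat : ∀ a n c → a * (n * c) ≡ (a * n + 0) * c + 0
      flat = solve-∀
     address1 = cong (_+ 1) (address0 · address= 0 i0 j0 zero) · shift (((toℕ i0 * n + toℕ j0) * n + 0) * arrays) base · sym (address= 1 i0 j0 zero)
      where
      shift : ∀ x b → x + 0 + b + 1 ≡ x + 1 + b
      shift = solve-∀
     at< = subst (_< cells) (sym address0) (address< zero i0 j0 zero)
     arc= = cong (M σ) input · under a (a<n² ·≤ m≤m+n n² (S * S)) · input0 a a<n² ·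
      cong (inputMemory G) (sym a=) · inputMemory-arc G i0 j0 · enc-arc (adjacent G i0 j0)
      where
      enc-arc : ∀ b → (if b then 1 else 0) ≡ enc K (if b then 1# else 0#)
      enc-arc true = sym (enc-1 K)
      enc-arc false = sym (enc-0 K)
     coins-exit : ∀ σ2 → CoinInv σ1 rest (val (chunk a)) 0 σ2 →
      Exec (add 36 28 41 ∷ store 36 32 ∷ add 28 28 27 ∷ add 29 29 41 ∷ sub 30 30 41 ∷ []) σ2 5 (InputInv σ0 m)
     coins-exit σ2 (coinInv [] _ coins2 _ sum2 _ low2 high2 mem2 o2) =
      x-block 5 (cong suc p1= ≡≤ (<-trans (address< (suc zero) i0 j0 zero) cells<) , subst (_< cells) (sym p1=) (address< (suc zero) i0 j0 zero) , cong suc ptr2 ≡≤ (≤-<-trans (ptr-bound (suc a) a<n²) cells<) , cong suc input2 ≡≤ (≤-<-trans a<n² (≤-<-trans (m≤m+n n² (S * S)) base<)) , tt) (x-done (inputInv (suc a) (+shift a a+m) (low2 0 (s≤s z≤n) · step=) ptr2 input2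
       (cong₂ _∸_ (low2 3 ≤-refl · count) one2) (λ r → high2 r · high r) under' done' todo'
       (coins2 · drop-drop (a * S) S coins · cong (λ l → drop l coins) (+-comm (a * S) S)) (o2 · o=)))
      where
      one2 = high2 1 · high 1 · one0
      p1= = cong₂ _+_ (low2 1 (s≤s (s≤s z≤n)) · ptr) one2 · address1
      ptr2 = cong₂ _+_ (low2 1 (s≤s (s≤s z≤n)) · ptr) (low2 0 (s≤s z≤n) · step=) · advance a stride base
       where
       advance : ∀ a s b → a * s + b + s ≡ suc a * s + b
       advance = solve-∀
      input2 = cong₂ _+_ (low2 2 (s≤s (s≤s (s≤s z≤n))) · input) one2 · +-comm a 1
      weight= = sym (cong (R σ2 32 +_) (*-zeroʳ (R σ2 33)) · +-identityʳ _) · sum2 ·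
       cong val (sym (toBits-fromBits K (chunk a) chunk-length)) · cong (λ a → enc K (fromBits K (chunk a))) (sym a=)
      M1 M2 : ℕ → ℕ
      M1 = M σ [ R σ 28 ≔ M σ (R σ 29) ]
      M2 = M σ2 [ R σ2 28 + R σ2 41 ≔ R σ2 32 ]
      p0= = ptr · address0
      apart : ∀ c → c ≢ address 0 i0 j0 zero → c ≢ address 1 i0 j0 zero → M2 c ≡ M σ c
      apart c ≢₀ ≢₁ = (upd-diff (M σ2) _ _ λ e → ≢₁ (sym e · p1=)) · cong (λ M → M c) mem2 ·
       (upd-diff (M σ) _ _ λ e → ≢₀ (sym e · p0=))
      under' : ∀ c → c < base → M2 c ≡ M σ0 c
      under' c c< = apart c (λ e → <⇒≱ c< (base≤ 0 i0 j0 zero ≤≡ sym e)) (λ e → <⇒≱ c< (base≤ 1 i0 j0 zero ≤≡ sym e)) · under c c<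
      elsewhere : ∀ i j → toℕ i * n + toℕ j ≢ a → ∀ (id : Fin arrays) k → M2 (address (toℕ id) i j k) ≡ M σ (address (toℕ id) i j k)
      elsewhere i j ne id k = apart _ (λ e → differ zero e) (λ e → differ (suc zero) e)
       where
       differ : ∀ (id' : Fin arrays) → address (toℕ id) i j k ≢ address (toℕ id') i0 j0 zero
       differ id' e with address-injective id id' {i} {j} {k} {i0} {j0} {zero} e
       ... | _ , refl , refl , _ = ne a=
      empty : ∀ (id : Fin arrays) k → ¬ (toℕ id ≡ 0 × k ≡ zero) → ¬ (toℕ id ≡ 1 × k ≡ zero) → A (toℕ id) i0 j0 k ≡ 0# →
       M2 (address (toℕ id) i0 j0 k) ≡ enc K (A (toℕ id) i0 j0 k)
      empty id k ≢₀ ≢₁ e = apart _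
       (λ e → let id= , _ , _ , k= = address-injective id zero {i0} {j0} {k} {i0} {j0} {zero} e in ≢₀ (id= , k=))
       (λ e → let id= , _ , _ , k= = address-injective id (suc zero) {i0} {j0} {k} {i0} {j0} {zero} e in ≢₁ (id= , k=)) ·
       todo i0 j0 (≤-reflexive (sym a=)) id k · sym (cong (enc K) e · enc-0 K)
      here' : ∀ (id : Fin arrays) k → M2 (address (toℕ id) i0 j0 k) ≡ enc K (A (toℕ id) i0 j0 k)
      here' zero zero = (upd-diff (M σ2) _ _ λ e → 0≢1 (sym p1= · e)) · cong (λ M → M _) mem2 ·
       cong M1 (sym p0=) · upd-same (M σ) (R σ 28) _ · arc=
       where
       0≢1 : address 1 i0 j0 zero ≢ address 0 i0 j0 zero
       0≢1 e with () ← proj₁ (address-injective (suc zero) zero {i0} {j0} {zero} {i0} {j0} {zero} e)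
      here' (suc zero) zero = cong M2 (sym p1=) · upd-same (M σ2) _ _ · weight=
      here' id@zero (suc k) = empty id (suc k) (λ { (_ , ()) }) (λ { (_ , ()) }) refl
      here' id@(suc zero) (suc k) = empty id (suc k) (λ { (_ , ()) }) (λ { (_ , ()) }) refl
      here' id@(suc (suc _)) zero = empty id zero (λ { (() , _) }) (λ { (() , _) }) refl
      here' id@(suc (suc _)) (suc k) = empty id (suc k) (λ { (_ , ()) }) (λ { (_ , ()) }) refl
      done' : ∀ i j → toℕ i * n + toℕ j < suc a → ∀ (id : Fin arrays) k → M2 (address (toℕ id) i j k) ≡ enc K (A (toℕ id) i j k)
      done' i j lt id k with toℕ i * n + toℕ j ≟ a
      ... | no ne = elsewhere i j ne id k · done i j (≤∧≢⇒< (≤-pred lt) ne) id k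
      ... | yes e with refl , refl ← same-index i j e = here' id k
      todo' : ∀ i j → suc a ≤ toℕ i * n + toℕ j → ∀ (id : Fin arrays) k → M2 (address (toℕ id) i j k) ≡ 0
      todo' i j le id k = elsewhere i j (λ e → <-irrefl (sym e) le) id k · todo i j (<⇒≤ le) id k
    exit : ∀ σ → InputInv σ0 0 σ → Exec [] σ 0 _
    exit σ (inputInv a a+0 _ _ _ _ high under done _ _ o=) = x-done
     ( ready (Rt.Constants-frame K {σ0} {σ} high consts) (high 0 · size) (high 6 · base=) (high 7 · count)
      (λ i j i< j< → under _ (below i j i< j<) · tab i j i< j<)
     , (λ id i j k → done i j (subst (toℕ i * n + toℕ j <_) (sym a+0 · +-identityʳ a) (index< i j)) id k)
     , o=)
     where
     index< : ∀ i j → toℕ i * n + toℕ j < n²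
     index< i j = subst (_< n²) (combine-index i j) (Fin.toℕ<n (combine i j))

module Fills where
 open Tower
 open Lang hiding (keep)

 open import Data.Bool using (T; not)
 open import Data.Empty using (⊥)
 open import Data.Nat.Properties using (≡ᵇ⇒≡; ≡⇒≡ᵇ)

 v0 : ∀ {Γ} → Ix (suc Γ)
 v0 = var zero
 v1 : ∀ {Γ} → Ix (suc (suc Γ))
 v1 = var (suc zero)
 v2 : ∀ {Γ} → Ix (suc (suc (suc Γ)))
 v2 = var (suc (suc zero))
 v3 : ∀ {Γ} → Ix (suc (suc (suc (suc Γ))))
 v3 = var (suc (suc (suc zero)))

 -- Simultaneous assignment to an array of the given dimension, in the scope of
 -- a loop variable v0; the indices of the array are v1, v2 and v3.
 data Fill : Set where
  fill0 : Fin arrays → Exp 1 → Fill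
  fill1 : Fin arrays → Exp 2 → Fill
  fill2 : Fin arrays → Exp 3 → Fill
  fill3 : Fin arrays → Exp 4 → Fill

 fill : Fill → Cmd 1
 fill (fill0 a e) = store a origin origin origin e
 fill (fill1 a e) = for (store a v1 origin origin e)
 fill (fill2 a e) = for (for (store a v1 v2 origin e))
 fill (fill3 a e) = for (for (for (store a v1 v2 v3 e)))

 fills : Fill → List Fill → Cmd 1
 fills f [] = fill f
 fills f (g ∷ gs) = fill f ⨾ fills g gs

 fresh : ∀ {Γ} → Fin arrays → Exp Γ → Bool
 fresh a (arr b i j k) = not (toℕ a ≡ᵇ toℕ b)
 fresh a (pt i) = true
 fresh a (lit b) = true
 fresh a (bin p e f) = fresh a e ∧ fresh a f
 fresh a (inv e) = fresh a e
 fresh a (fold p e) = fresh a e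
 fresh a (ifz e f g) = fresh a e ∧ fresh a f ∧ fresh a g
 fresh a (ifle i j f g) = fresh a f ∧ fresh a g

 -- Otherwise the sequential execution would not agree with the model below.
 legal : Fill → Bool
 legal (fill0 a e) = fresh a e
 legal (fill1 a e) = fresh a e
 legal (fill2 a e) = fresh a e
 legal (fill3 a e) = fresh a e

 iter-cong : ∀ {S : Set} {n} {g h : Fin n → S → S} (s : S) → (∀ v s → g v s ≡ h v s) → iter g s ≡ iter h s
 iter-cong {n = zero} s e = refl
 iter-cong {n = suc n} {h = h} s e = e zero _ · cong (h zero) (iter-cong s λ v → e (suc v))

 module Model (K n' : ℕ) where
  open Semantics K n'

  env : Fin n → Env
  env v = (λ _ → zero) [ 0 ↦ v ]

  arrayOf : Fill → Fin arrays
  arrayOf (fill0 a e) = a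
  arrayOf (fill1 a e) = a
  arrayOf (fill2 a e) = a
  arrayOf (fill3 a e) = a

  content : Fill → Fin n → Arrays → (i j k : Fin n) → F K
  content (fill0 a e) v A i j k = ⟦ e ⟧E (env v) A
  content (fill1 a e) v A i j k = ⟦ e ⟧E (env v [ 1 ↦ i ]) A
  content (fill2 a e) v A i j k = ⟦ e ⟧E (env v [ 1 ↦ i ] [ 2 ↦ j ]) A
  content (fill3 a e) v A i j k = ⟦ e ⟧E (env v [ 1 ↦ i ] [ 2 ↦ j ] [ 3 ↦ k ]) A

  covered : Fill → (i j k : Fin n) → Bool
  covered (fill0 a e) zero zero zero = true
  covered (fill1 a e) i zero zero = true
  covered (fill2 a e) i j zero = true
  covered (fill3 a e) i j k = true
  covered _ i j k = false

  assign : Fill → Fin n → Arrays → Arrays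
  assign f v A a i j k = if toℕ (arrayOf f) ≡ᵇ a then (if covered f i j k then content f v A i j k else A a i j k) else A a i j k

  assigns : List Fill → Fin n → Arrays → Arrays
  assigns [] v A = A
  assigns (f ∷ fs) v A = assigns fs v (assign f v A)

  _≈_ : Arrays → Arrays → Set
  A ≈ B = ∀ a i j k → A a i j k ≡ B a i j k

  ⟦⟧E-local : ∀ {Γ} a (e : Exp Γ) {ρ σ A B} → T (fresh a e) → (∀ i → ρ i ≡ σ i) →
   (∀ a' → toℕ a ≢ a' → ∀ i j k → A a' i j k ≡ B a' i j k) → ⟦ e ⟧E ρ A ≡ ⟦ e ⟧E σ B
  ⟦⟧I-cong : ∀ {Γ} (i : Ix Γ) {ρ σ : Env} → (∀ i → ρ i ≡ σ i) → ⟦ i ⟧I ρ ≡ ⟦ i ⟧I σ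
  ⟦⟧I-cong origin e = refl
  ⟦⟧I-cong (var i) e = e (toℕ i)

  update-cong : ∀ {ρ σ : Env} Γ v → (∀ i → ρ i ≡ σ i) → ∀ i → (ρ [ Γ ↦ v ]) i ≡ (σ [ Γ ↦ v ]) i
  update-cong Γ v e i with Γ ≡ᵇ i
  ... | true = refl
  ... | false = e i

  T-∧⁻ : ∀ {x y} → T (x ∧ y) → T x × T y
  T-∧⁻ {true} {true} _ = tt , tt

  ⟦⟧E-local a (arr b i j k) {ρ} {σ} {A} {B} t e s = s (toℕ b) (λ eq → not-T (toℕ a ≡ᵇ toℕ b) t (≡⇒≡ᵇ _ _ eq)) _ _ _ · at (⟦⟧I-cong i e) (⟦⟧I-cong j e) (⟦⟧I-cong k e)
   where
   not-T : ∀ b → T (not b) → T b → ⊥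
   not-T true () _
   at : ∀ {i i' j j' k k'} → i ≡ i' → j ≡ j' → k ≡ k' → B (toℕ b) i j k ≡ B (toℕ b) i' j' k'
   at refl refl refl = refl
  ⟦⟧E-local a (pt i) t e s = cong (λ i → dec K (suc (toℕ i))) (⟦⟧I-cong i e)
  ⟦⟧E-local a (lit b) t e s = refl
  ⟦⟧E-local a (bin p f g) t e s = let t1 , t2 = T-∧⁻ {fresh a f} t in cong₂ ⟦ p ⟧ₒ (⟦⟧E-local a f t1 e s) (⟦⟧E-local a g t2 e s)
  ⟦⟧E-local a (inv f) t e s = cong (inverse K) (⟦⟧E-local a f t e s)
  ⟦⟧E-local {Γ} a (fold p f) t e s = iter-cong (unit p) λ v x → cong (⟦ p ⟧ₒ x) (⟦⟧E-local a f t (update-cong Γ v e) s)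
  ⟦⟧E-local a (ifz f g h) {ρ} {σ} {A} {B} t e s =
   let t1 , t23 = T-∧⁻ {fresh a f} t ; t2 , t3 = T-∧⁻ {fresh a g} t23 in
   cong (λ x → ifzero x (⟦ g ⟧E ρ A) (⟦ h ⟧E ρ A)) (⟦⟧E-local a f t1 e s) · cong₂ (ifzero (⟦ f ⟧E σ B)) (⟦⟧E-local a g t2 e s) (⟦⟧E-local a h t3 e s)
  ⟦⟧E-local a (ifle i j g h) {ρ} {σ} {A} {B} t e s =
   let t2 , t3 = T-∧⁻ {fresh a g} t in
   cong₂ (λ i j → if toℕ i ≤ᵇ toℕ j then ⟦ g ⟧E ρ A else ⟦ h ⟧E ρ A) (⟦⟧I-cong i e) (⟦⟧I-cong j e) ·
    cong₂ (λ x y → if toℕ (⟦ i ⟧I σ) ≤ᵇ toℕ (⟦ j ⟧I σ) then x else y) (⟦⟧E-local a g t2 e s) (⟦⟧E-local a h t3 e s)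

  ⟦⟧E-cong : ∀ {Γ} (e : Exp Γ) {ρ σ A B} → (∀ i → ρ i ≡ σ i) → A ≈ B → ⟦ e ⟧E ρ A ≡ ⟦ e ⟧E σ B
  ⟦⟧E-cong (arr b i j k) {B = B} e s = s _ _ _ _ · at (⟦⟧I-cong i e) (⟦⟧I-cong j e) (⟦⟧I-cong k e)
   where
   at : ∀ {i i' j j' k k'} → i ≡ i' → j ≡ j' → k ≡ k' → B (toℕ b) i j k ≡ B (toℕ b) i' j' k'
   at refl refl refl = refl
  ⟦⟧E-cong (pt i) e s = cong (λ i → dec K (suc (toℕ i))) (⟦⟧I-cong i e)
  ⟦⟧E-cong (lit b) e s = refl
  ⟦⟧E-cong (bin p f g) e s = cong₂ ⟦ p ⟧ₒ (⟦⟧E-cong f e s) (⟦⟧E-cong g e s)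
  ⟦⟧E-cong (inv f) e s = cong (inverse K) (⟦⟧E-cong f e s)
  ⟦⟧E-cong {Γ} (fold p f) e s = iter-cong (unit p) λ v x → cong (⟦ p ⟧ₒ x) (⟦⟧E-cong f (update-cong Γ v e) s)
  ⟦⟧E-cong (ifz f g h) {ρ} {σ} {A} {B} e s =
   cong (λ x → ifzero x (⟦ g ⟧E ρ A) (⟦ h ⟧E ρ A)) (⟦⟧E-cong f e s) · cong₂ (ifzero (⟦ f ⟧E σ B)) (⟦⟧E-cong g e s) (⟦⟧E-cong h e s)
  ⟦⟧E-cong (ifle i j g h) {ρ} {σ} {A} {B} e s =
   cong₂ (λ i j → if toℕ i ≤ᵇ toℕ j then ⟦ g ⟧E ρ A else ⟦ h ⟧E ρ A) (⟦⟧I-cong i e) (⟦⟧I-cong j e) ·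
    cong₂ (λ x y → if toℕ (⟦ i ⟧I σ) ≤ᵇ toℕ (⟦ j ⟧I σ) then x else y) (⟦⟧E-cong g e s) (⟦⟧E-cong h e s)

  content-cong : ∀ f v {A B} → A ≈ B → ∀ i j k → content f v A i j k ≡ content f v B i j k
  content-cong (fill0 a e) v s i j k = ⟦⟧E-cong e (λ _ → refl) s
  content-cong (fill1 a e) v s i j k = ⟦⟧E-cong e (λ _ → refl) s
  content-cong (fill2 a e) v s i j k = ⟦⟧E-cong e (λ _ → refl) s
  content-cong (fill3 a e) v s i j k = ⟦⟧E-cong e (λ _ → refl) s

  assign-cong : ∀ f v {A B} → A ≈ B → assign f v A ≈ assign f v B
  assign-cong f v s a i j k with toℕ (arrayOf f) ≡ᵇ a | covered f i j k
  ... | false | _ = s a i j k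
  ... | true | false = s a i j k
  ... | true | true = content-cong f v s i j k

  assigns-cong : ∀ fs v {A B} → A ≈ B → assigns fs v A ≈ assigns fs v B
  assigns-cong [] v s = s
  assigns-cong (f ∷ fs) v s = assigns-cong fs v (assign-cong f v s)

  module _ (a : Fin arrays) (A0 : Arrays) (x : Fin n → Fin n → Fin n → F K) (touched : Fin n → Fin n → Fin n → Bool) (out0 : List (Fin n)) where
   record Partial (s : Store) : Set where
    constructor partial'
    field
     others : ∀ a' → toℕ a ≢ a' → ∀ i j k → arrs s a' i j k ≡ A0 a' i j k
     old : ∀ i j k → touched i j k ≡ false → arrs s (toℕ a) i j k ≡ A0 (toℕ a) i j k
     output : outp s ≡ out0
   Filled : (i j k : Fin n) → Store → Set
   Filled i j k s = arrs s (toℕ a) i j k ≡ x i j k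
   record Covers (Z : (i j k : Fin n) → Set) (g : Store → Store) : Set where
    field
     filling : ∀ s → Partial s → Partial (g s) × (∀ {i j k} → Z i j k → Filled i j k (g s))
     keeping : ∀ s → Partial s → ∀ i j k → Filled i j k s → Filled i j k (g s)
   open Covers
   covers-cong : ∀ {Z Z' g} → (∀ {i j k} → Z' i j k → Z i j k) → Covers Z g → Covers Z' g
   covers-cong h c = record { filling = λ s p → let p' , f = filling c s p in p' , f ∘ h ; keeping = keeping c }
   covers-loop : ∀ {m} {Z : Fin m → (i j k : Fin n) → Set} {g} → (∀ v → Covers (Z v) (g v)) → Covers (λ i j k → ∃[ v ] Z v i j k) (iter g)
   covers-loop {zero} c = record { filling = λ s p → p , λ () ; keeping = λ s p i j k f → f }
   covers-loop {suc m} c = record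
    { filling = λ s p → let p' , f = filling rest s p ; p'' , f0 = filling (c zero) _ p' in
     p'' , λ { (zero , z) → f0 z ; (suc v , z) → keeping (c zero) _ p' _ _ _ (f (v , z)) }
    ; keeping = λ s p i j k f → keeping (c zero) _ (proj₁ (filling rest s p)) i j k (keeping rest s p i j k f) }
    where rest = covers-loop (c ∘ suc)
   ∧-split : ∀ {x y} → T (x ∧ y) → T x × T y
   ∧-split {true} {true} _ = tt , tt
   all : ∀ {a b} → T a → T b → T (a ∧ b)
   all {true} _ t = t
   hit : ∀ i j k v A → setCell (toℕ a) i j k v A (toℕ a) i j k ≡ v
   hit i j k v A with (toℕ a ≡ᵇ toℕ a) ∧ (i == i) ∧ (j == j) ∧ (k == k) in e
   ... | true = refl
   ... | false with () ← subst T e (all {toℕ a ≡ᵇ toℕ a} (≡⇒≡ᵇ (toℕ a) _ refl) (all {i == i} (≡⇒≡ᵇ (toℕ i) _ refl) (all {j == j} (≡⇒≡ᵇ (toℕ j) _ refl) (≡⇒≡ᵇ (toℕ k) _ refl))))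
   miss : ∀ {P : F K → Set} i j k v A a' i' j' k' → (toℕ a ≡ a' → i ≡ i' → j ≡ j' → k ≡ k' → P v) → P (A a' i' j' k') → P (setCell (toℕ a) i j k v A a' i' j' k')
   miss i j k v A a' i' j' k' p q with (toℕ a ≡ᵇ a') ∧ (i == i') ∧ (j == j') ∧ (k == k') in e
   ... | false = q
   ... | true with t1 , t ← ∧-split {toℕ a ≡ᵇ a'} (subst T (sym e) tt)
    with t2 , t ← ∧-split {i == i'} t
    with t3 , t4 ← ∧-split {j == j'} t =
    p (≡ᵇ⇒≡ _ _ t1) (Fin.toℕ-injective (≡ᵇ⇒≡ _ _ t2)) (Fin.toℕ-injective (≡ᵇ⇒≡ _ _ t3)) (Fin.toℕ-injective (≡ᵇ⇒≡ _ _ t4))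
   module _ {Γ} (e : Exp Γ) (e-fresh : T (fresh a e)) (ix jx kx : Ix Γ) (ρ : Env)
    (x= : ⟦ e ⟧E ρ A0 ≡ x (⟦ ix ⟧I ρ) (⟦ jx ⟧I ρ) (⟦ kx ⟧I ρ)) (t= : touched (⟦ ix ⟧I ρ) (⟦ jx ⟧I ρ) (⟦ kx ⟧I ρ) ≡ true) where
    content-≡ : ∀ {s} → Partial s → ⟦ e ⟧E ρ (arrs s) ≡ x (⟦ ix ⟧I ρ) (⟦ jx ⟧I ρ) (⟦ kx ⟧I ρ)
    content-≡ p = ⟦⟧E-local a e e-fresh (λ _ → refl) (Partial.others p) · x=
    covers-store : Covers (λ i j k → i ≡ ⟦ ix ⟧I ρ × j ≡ ⟦ jx ⟧I ρ × k ≡ ⟦ kx ⟧I ρ) (⟦ store a ix jx kx e ⟧ ρ)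
    covers-store = record
     { filling = λ s p →
      partial' (λ a' ne i j k → miss {_≡ A0 a' i j k} (⟦ ix ⟧I ρ) (⟦ jx ⟧I ρ) (⟦ kx ⟧I ρ) _ (arrs s) a' i j k (λ q _ _ _ → contradiction q ne) (Partial.others p a' ne i j k))
       (λ i j k u → miss {_≡ A0 (toℕ a) i j k} (⟦ ix ⟧I ρ) (⟦ jx ⟧I ρ) (⟦ kx ⟧I ρ) _ (arrs s) (toℕ a) i j k (λ { _ refl refl refl → contradiction (sym u · t=) λ () }) (Partial.old p i j k u))
       (Partial.output p)
      , λ { (refl , refl , refl) → hit (⟦ ix ⟧I ρ) (⟦ jx ⟧I ρ) (⟦ kx ⟧I ρ) _ (arrs s) · content-≡ p }
     ; keeping = λ s p i j k f → miss {_≡ x i j k} (⟦ ix ⟧I ρ) (⟦ jx ⟧I ρ) (⟦ kx ⟧I ρ) _ (arrs s) (toℕ a) i j k (λ { _ refl refl refl → content-≡ p }) f }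

  covers-fill : ∀ f v s → T (legal f) →
   Covers (arrayOf f) (arrs s) (content f v (arrs s)) (covered f) (outp s) (λ i j k → covered f i j k ≡ true) (⟦ fill f ⟧ (env v))
  covers-fill (fill0 a e) v s t = covers-cong a _ _ _ _ (λ { {zero} {zero} {zero} _ → refl , refl , refl })
   (covers-store a (arrs s) _ _ (outp s) e t origin origin origin (env v) refl refl)
  covers-fill (fill1 a e) v s t = covers-cong a _ _ _ _ (λ { {i} {zero} {zero} _ → i , refl , refl , refl })
   (covers-loop a _ _ _ _ λ i → covers-store a (arrs s) _ _ (outp s) e t v1 origin origin (env v [ 1 ↦ i ]) refl refl)
  covers-fill (fill2 a e) v s t = covers-cong a _ _ _ _ (λ { {i} {j} {zero} _ → i , j , refl , refl , refl })
   (covers-loop a _ _ _ _ λ i → covers-loop a _ _ _ _ λ j → covers-store a (arrs s) _ _ (outp s) e t v1 v2 origin (env v [ 1 ↦ i ] [ 2 ↦ j ]) refl refl)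
  covers-fill (fill3 a e) v s t = covers-cong a _ _ _ _ (λ {i} {j} {k} _ → i , j , k , refl , refl , refl)
   (covers-loop a _ _ _ _ λ i → covers-loop a _ _ _ _ λ j → covers-loop a _ _ _ _ λ k →
    covers-store a (arrs s) _ _ (outp s) e t v1 v2 v3 (env v [ 1 ↦ i ] [ 2 ↦ j ] [ 3 ↦ k ]) refl refl)

  fill-correct : ∀ f v s → T (legal f) → arrs (⟦ fill f ⟧ (env v) s) ≈ assign f v (arrs s) × outp (⟦ fill f ⟧ (env v) s) ≡ outp s
  fill-correct f v s t = pointwise , Partial.output (proj₁ done)
   where
   done = Covers.filling (covers-fill f v s t) s (partial' (λ _ _ _ _ _ → refl) (λ _ _ _ _ → refl) refl)
   pointwise : arrs (⟦ fill f ⟧ (env v) s) ≈ assign f v (arrs s)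
   pointwise a i j k with toℕ (arrayOf f) ≡ᵇ a in b
   ... | false = Partial.others (proj₁ done) a (λ e → subst T b (≡⇒≡ᵇ _ _ e)) i j k
   ... | true with refl ← ≡ᵇ⇒≡ (toℕ (arrayOf f)) a (subst T (sym b) tt) with covered f i j k in c
   ... | true = proj₂ done c
   ... | false = Partial.old (proj₁ done) i j k c

  fills-correct : ∀ f fs v s → All (T ∘ legal) (f ∷ fs) →
   arrs (⟦ fills f fs ⟧ (env v) s) ≈ assigns (f ∷ fs) v (arrs s) × outp (⟦ fills f fs ⟧ (env v) s) ≡ outp s
  fills-correct f [] v s (l ∷ []) = fill-correct f v s l
  fills-correct f (h ∷ hs) v s (l ∷ ls) =
   let a1 , o1 = fill-correct f v s l
       a2 , o2 = fills-correct h hs v (⟦ fill f ⟧ (env v) s) ls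
   in (λ a i j k → a2 a i j k · assigns-cong (h ∷ hs) v a1 a i j k) , o2 · o1

module Algo where
 open GraphPoly
 open Tower
 open Lang hiding (keep; N; W)
 open Fills

 open import Data.Bool using (T)
 open import Data.Fin using (#_)

 infixl 6 _+E_
 infixl 7 _*E_
 _+E_ _*E_ : ∀ {Γ} → Exp Γ → Exp Γ → Exp Γ
 _+E_ = bin plus
 _*E_ = bin times

 Σe ΠE : ∀ {Γ} → Exp (suc Γ) → Exp Γ
 Σe = fold plus
 ΠE = fold times

 0E 1E : ∀ {Γ} → Exp Γ
 0E = lit false
 1E = lit true

 eqE : ∀ {Γ} → Ix Γ → Ix Γ → Exp Γ → Exp Γ → Exp Γ
 eqE i j e f = ifle i j (ifle j i e f) f

 arr0 : ∀ {Γ} → Fin arrays → Exp Γ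
 arr0 a = arr a origin origin origin

 arr1 : ∀ {Γ} → Fin arrays → Ix Γ → Exp Γ
 arr1 a i = arr a i origin origin

 arr2 : ∀ {Γ} → Fin arrays → Ix Γ → Ix Γ → Exp Γ
 arr2 a i j = arr a i j origin

 $G $R $X $A $N $N' $det $odd $z $co $rec $row $W $W' $coV $recV $V $t $f $w $g $s0 $s $c $X' $nxt $deg $st $pos $pos' $hit $par $par' $done $done' $ok $ok' $alive $A' $alive' : Fin arrays
 $G = # 0 ; $R = # 1 ; $X = # 2 ; $A = # 3 ; $N = # 4 ; $N' = # 5 ; $det = # 6 ; $odd = # 7 ; $z = # 8 ; $co = # 9
 $rec = # 10 ; $row = # 11 ; $W = # 12 ; $W' = # 13 ; $coV = # 14 ; $recV = # 15 ; $V = # 16 ; $t = # 17 ; $f = # 18 ; $w = # 19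
 $g = # 20 ; $s0 = # 21 ; $s = # 22 ; $c = # 23 ; $X' = # 24 ; $nxt = # 25 ; $deg = # 26 ; $st = # 27 ; $pos = # 28 ; $pos' = # 29
 $hit = # 30 ; $par = # 31 ; $par' = # 32 ; $done = # 33 ; $done' = # 34 ; $ok = # 35 ; $ok' = # 36 ; $alive = # 37 ; $A' = # 38 ; $alive' = # 39

 initFills updateFills vandermondeFills rowFills pickFills candidateFills pruneFills : List Fill

 initFills =
  fill2 $X (arr2 $G v1 v2 *E arr2 $R v1 v2) ∷
  fill3 $A (eqE v2 v3 1E 0E) ∷
  fill3 $N (eqE v2 v3 1E 0E) ∷
  fill1 $det 1E ∷
  fill1 $odd 0E ∷
  fill2 $W (eqE v1 v2 1E 0E) ∷ []

 -- Row v0 of the matrix $A p, with inverse $N p, is replaced by $row p.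
 updateFills =
  fill2 $z (eqE v2 v0 (arr1 $odd v1)
   (arr1 $det v1 *E Σe (arr $A v1 v2 v3 *E arr $A v1 v2 v3 *E (arr $N v1 v3 v0 *E arr $N v1 v3 v2)))) ∷
  fill2 $co (Σe (arr2 $row v1 v3 *E arr $N v1 v3 v2)) ∷
  fill1 $rec (inv (arr2 $co v1 v0)) ∷
  fill1 $odd (Σe (arr2 $co v1 v2 *E arr2 $z v1 v2)) ∷
  fill1 $done (arr2 $co v1 v0 *E arr1 $det v1) ∷
  fill1 $det (arr1 $done v1) ∷
  fill3 $N' (eqE v0 v3 (arr $N v1 v2 v0 *E arr1 $rec v1) (arr $N v1 v2 v3 +E arr $N v1 v2 v0 *E arr1 $rec v1 *E arr2 $co v1 v3)) ∷
  fill3 $N (arr $N' v1 v2 v3) ∷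
  fill3 $A' (eqE v2 v0 (arr2 $row v1 v3) (arr $A v1 v2 v3)) ∷
  fill3 $A (arr $A' v1 v2 v3) ∷ []

 vandermondeFills =
  fill1 $V (ΠE (ifle v2 v1 (pt v0) 1E)) ∷
  fill1 $coV (Σe (arr1 $V v2 *E arr2 $W v2 v1)) ∷
  fill0 $recV (inv (arr1 $coV v0)) ∷
  fill2 $W' (eqE v0 v2 (arr2 $W v1 v0 *E arr0 $recV) (arr2 $W v1 v2 +E arr2 $W v1 v0 *E arr0 $recV *E arr1 $coV v2)) ∷
  fill2 $W (arr2 $W' v1 v2) ∷ []

 rowFills = fill2 $row (eqE v0 v2 1E 0E +E pt v1 *E arr2 $X v0 v2) ∷ []

 firstE : Fin arrays → Exp 2
 firstE a = ifz (arr1 a v1) 0E (ΠE (ifle v1 v2 1E (ifz (arr1 a v2) 1E 0E)))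

 pickFills =
  fill1 $t (Σe (arr2 $W v1 v2 *E arr1 $odd v2)) ∷
  fill1 $f (firstE $t) ∷
  fill1 $w (Σe (arr1 $f v2 *E arr2 $W v2 v1)) ∷ []

 candidateFills =
  fill2 $z (eqE v2 v0 (arr1 $odd v1)
   (arr1 $det v1 *E Σe (arr $A v1 v2 v3 *E arr $A v1 v2 v3 *E (arr $N v1 v3 v0 *E arr $N v1 v3 v2)))) ∷
  fill2 $g (Σe (arr $N v1 v2 v3 *E arr2 $z v1 v3)) ∷
  fill0 $s0 (Σe (arr1 $w v1 *E arr2 $g v1 v0)) ∷
  fill1 $s (Σe (arr1 $w v2 *E (arr2 $g v2 v0 +E pt v2 *E arr2 $X v0 v1 *E arr2 $g v2 v1))) ∷ []

 pruneFills =
  fill1 $c (ifz (arr0 $s0) (firstE $s) 0E) ∷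
  fill2 $X' (eqE v1 v0 (arr1 $c v2 *E arr2 $X v1 v2) (arr2 $X v1 v2)) ∷
  fill2 $X (arr2 $X' v1 v2) ∷ []

 walkInitFills walkFills prepareFills followFills : List Fill

 -- A vertex without outgoing arcs is its own successor.
 walkInitFills =
  fill2 $X' (ifz (arr2 $X v1 v2) 0E (ΠE (ifle v2 v3 1E (ifz (arr2 $X v1 v3) 1E 0E)))) ∷
  fill1 $deg (Σe (arr2 $X' v1 v2)) ∷
  fill2 $nxt (arr2 $X' v1 v2 +E (1E +E arr1 $deg v1) *E eqE v1 v2 1E 0E) ∷
  fill1 $pos' (firstE $deg) ∷
  fill0 $hit (Σe (arr1 $pos' v1)) ∷
  fill1 $st (arr1 $pos' v1 +E (1E +E arr0 $hit) *E eqE origin v1 1E 0E) ∷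
  fill1 $pos (arr1 $st v1) ∷
  fill0 $par 0E ∷ fill0 $done 0E ∷ fill0 $ok 0E ∷ []

 walkFills =
  fill1 $pos' (Σe (arr1 $pos v2 *E arr2 $nxt v2 v1)) ∷
  fill1 $pos (arr1 $pos' v1) ∷
  fill0 $par' (1E +E arr0 $par) ∷
  fill0 $par (arr0 $par') ∷
  fill0 $hit (Σe (arr1 $pos v1 *E arr1 $st v1)) ∷
  fill0 $ok' (arr0 $ok +E (1E +E arr0 $done) *E arr0 $hit *E (1E +E arr0 $par)) ∷
  fill0 $ok (arr0 $ok') ∷
  fill0 $done' (arr0 $done +E (1E +E arr0 $done) *E arr0 $hit) ∷
  fill0 $done (arr0 $done') ∷ []

 prepareFills =
  fill1 $pos (arr1 $st v1) ∷
  fill0 $alive (arr0 $ok) ∷ []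

 followFills =
  fill1 $pos' (Σe (arr1 $pos v2 *E arr2 $nxt v2 v1)) ∷
  fill1 $pos (arr1 $pos' v1) ∷
  fill0 $hit (Σe (arr1 $pos v1 *E arr1 $st v1)) ∷
  fill0 $alive' (arr0 $alive *E (1E +E arr0 $hit)) ∷
  fill0 $alive (arr0 $alive') ∷ []

 body : List Fill → Cmd 1
 body [] = store $hit origin origin origin (arr0 $hit)
 body (f ∷ fs) = fills f fs

 algorithm : Cmd 0
 algorithm =
  for (body initFills) ⨾
  for (body (vandermondeFills ++ rowFills ++ updateFills)) ⨾
  for (body pickFills) ⨾
  for (body (candidateFills ++ pruneFills ++ rowFills ++ updateFills)) ⨾
  for (body walkInitFills) ⨾
  for (body walkFills) ⨾
  for (body prepareFills) ⨾
  for (for (emit (arr0 $alive *E arr1 $pos v1) v1) ⨾ body followFills)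

 legal-all : List Fill → Bool
 legal-all [] = true
 legal-all (f ∷ fs) = if legal f then legal-all fs else false

 legal-body : List Fill → Bool
 legal-body [] = false
 legal-body (f ∷ fs) = legal-all (f ∷ fs)

 legal⁺ : ∀ fs → T (legal-all fs) → All (T ∘ legal) fs
 legal⁺ [] t = []
 legal⁺ (f ∷ fs) t with legal f in e
 ... | true = subst T (sym e) tt ∷ legal⁺ fs t

 module Stages (K n' : ℕ) where
  open Semantics K n' public
  open Model K n' public
  open RingTheory (tower K) public
  open OddPermutations (tower K) public hiding (s; s*s≡1)
  open GraphPolynomials (tower K) public
  open IsField (tower-isField K) public

  point : Fin n → F K
  point p = dec K (suc (toℕ p))

  iter-sum : ∀ {m} (f : Fin m → F K) → iter (λ v x → x + f v) 0# ≡ sum f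
  iter-sum {zero} f = sym (sum-empty f)
  iter-sum {suc m} f = +-comm _ (f zero) · cong (f zero +_) (iter-sum (f ∘ suc)) · sym (sum-suc f)

  if-eq : ∀ (i j : Fin n) x y → (if toℕ i ≤ᵇ toℕ j then (if toℕ j ≤ᵇ toℕ i then x else y) else y) ≡ δ i j * x + (1# + δ i j) * y
  if-eq i j x y = by-cases (toℕ i ≤ᵇ toℕ j) (toℕ j ≤ᵇ toℕ i) refl refl · refl
   where
   same : i ≡ j → x ≡ δ i j * x + (1# + δ i j) * y
   same refl = solve 2 (λ x y → x := con true :* x :+ (con true :+ con true) :* y) refl x y · cong (λ d → d * x + (1# + d) * y) (sym (δ-same i))
   diff : i ≢ j → y ≡ δ i j * x + (1# + δ i j) * y
   diff i#j = solve 2 (λ x y → y := con false :* x :+ (con true :+ con false) :* y) refl x y · cong (λ d → d * x + (1# + d) * y) (sym (δ-diff i#j))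
   by-cases : ∀ b c → (toℕ i ≤ᵇ toℕ j) ≡ b → (toℕ j ≤ᵇ toℕ i) ≡ c → (if b then (if c then x else y) else y) ≡ δ i j * x + (1# + δ i j) * y
   by-cases true true p q = same (Fin.toℕ-injective (ℕ.≤-antisym (ℕ.≤ᵇ⇒≤ _ _ (subst T (sym p) tt)) (ℕ.≤ᵇ⇒≤ _ _ (subst T (sym q) tt))))
   by-cases true false p q = diff λ { refl → subst T q (ℕ.≤⇒≤ᵇ (ℕ.≤-refl {toℕ i})) }
   by-cases false c p q = diff λ { refl → subst T p (ℕ.≤⇒≤ᵇ (ℕ.≤-refl {toℕ i})) }

  if-eq-yes : ∀ (i j : Fin n) x y → i ≡ j → (if toℕ i ≤ᵇ toℕ j then (if toℕ j ≤ᵇ toℕ i then x else y) else y) ≡ x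
  if-eq-yes i _ x y refl = if-eq i i x y · cong (λ d → d * x + (1# + d) * y) (δ-same i) ·
   solve 2 (λ x y → con true :* x :+ (con true :+ con true) :* y := x) refl x y

  if-eq-no : ∀ (i j : Fin n) x y → i ≢ j → (if toℕ i ≤ᵇ toℕ j then (if toℕ j ≤ᵇ toℕ i then x else y) else y) ≡ y
  if-eq-no i j x y i#j = if-eq i j x y · cong (λ d → d * x + (1# + d) * y) (δ-diff i#j) ·
   solve 2 (λ x y → con false :* x :+ (con true :+ con false) :* y := y) refl x y

  if-δ : ∀ (i j : Fin n) → (if toℕ i ≤ᵇ toℕ j then (if toℕ j ≤ᵇ toℕ i then 1# else 0#) else 0#) ≡ δ i j
  if-δ i j = if-eq i j 1# 0# · solve 1 (λ d → d :* con true :+ (con true :+ d) :* con false := d) refl (δ i j)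

  record Point (A : Arrays) (p : Fin n) (B : Mat (F K) n) : Set where
   constructor mkPoint
   field
    matrix : ∀ j k → A 3 p j k ≡ B j k
    inverses : Inverses B (A 4 p)
    odd= : A 7 p zero zero ≡ Odd B
    det= : A 6 p zero zero ≡ Det B

  Point-cong : ∀ {A p B B'} → (∀ j k → B j k ≡ B' j k) → Point A p B → Point A p B'
  Point-cong {B = B} {B'} e (mkPoint m i o d) = mkPoint (λ j k → m j k · e j k)
   (record { AN = λ j l → (sum-cong-≗ λ k → cong (_* _) (sym (e j k))) · Inverses.AN i j l
    ; NA = λ j l → (sum-cong-≗ λ k → cong (_ *_) (sym (e k l))) · Inverses.NA i j l })
   (o · Odd-cong e) (d · Det-cong e)

  module _ (i : Fin n) (A : Arrays) (p : Fin n) (B : Mat (F K) n) (P : Point A p B) where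
   open Point P
   A1 = assigns (fill2 $z (eqE v2 v0 (arr1 $odd v1)
    (arr1 $det v1 *E Σe (arr $A v1 v2 v3 *E arr $A v1 v2 v3 *E (arr $N v1 v3 v0 *E arr $N v1 v3 v2)))) ∷ []) i A
   z-row : ∀ j → A1 8 p j zero ≡ oddRow inverses i j
   z-row j with j Fin.≟ i
   ... | yes e = if-eq-yes j i _ _ e · odd=
   ... | no ne = if-eq-no j i _ _ ne · (cong₂ _*_ det= (iter-sum _ ·
    (sum-cong-≗ λ k → cong (λ x → x * x * (A 4 p k i * A 4 p k j)) (matrix j k))))
   module _ (r : Fin n → F K) (r= : ∀ l → A 11 p l zero ≡ r l) (det≢0 : Det (B [ i ← r ]) ≢ 0#) where
    private
     A' = assigns updateFills i A
     open ≡-Reasoning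
     co : Fin n → F K
     co l = iter (λ k x → x + A 11 p k zero * A 4 p k l) 0#
     co= : ∀ l → co l ≡ coord inverses r l
     co= l = iter-sum _ · (sum-cong-≗ λ k → cong (_* A 4 p k l) (r= k))
    update-point : Point (assigns updateFills i A) p (B [ i ← r ])
    update-point = mkPoint new-matrix
     (inverses-replace inverses i r (inverse K (co i)) (A' 4 p)
      (cong (_* inverse K (co i)) (sym (co= i)) · inverse-correct K (co i) co≢0)
      λ k l → if-eq i l _ _ · cong (λ c → δ i l * (A 4 p k i * inverse K (co i)) + (1# + δ i l) * (A 4 p k l + A 4 p k i * inverse K (co i) * c)) (co= l))
     (iter-sum _ · (sum-cong-≗ λ j → cong₂ _*_ (co= j) (z-row j)) · sym (Odd-replace inverses i r))
     (cong₂ _*_ (co= i) det= · sym (Det-replace inverses i r))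
     where
     co≢0 : co i ≢ 0#
     co≢0 e = det≢0 (Det-replace inverses i r · cong (_* Det B) (sym (co= i) · e) · zeroˡ _)
     new-matrix : ∀ j k → A' 3 p j k ≡ (B [ i ← r ]) j k
     new-matrix j k with j Fin.≟ i
     ... | yes e = if-eq-yes j i _ _ e · r= k
     ... | no ne = if-eq-no j i _ _ ne · matrix j k
   private
    g : Fin n → F K
    g k = assigns candidateFills i A 20 p k zero
    g= : ∀ k → g k ≡ sum (λ j → A 4 p k j * oddRow inverses i j)
    g= k = iter-sum _ · (sum-cong-≗ λ j → cong (A 4 p k j *_) (z-row j))
   candidate : ∀ u c → g i + c * g u ≡ Odd (B [ i ← (λ k → δ i k + c * δ u k) ])
   candidate u c = sym (Odd-replace inverses i _ · (sum-cong-≗ λ j → cong (_* oddRow inverses i j) (co j) ·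
    solve 4 (λ a c b z → (a :+ c :* b) :* z := con true :* (a :* z) :+ c :* (b :* z)) refl (A 4 p i j) c (A 4 p u j) (oddRow inverses i j)) ·
    SignedPermanent.sum-linear (tower K) 1# (*-identityˡ 1#) {g = λ j → A 4 p i j * oddRow inverses i j} {h = λ j → A 4 p u j * oddRow inverses i j} 1# c (λ _ → refl) ·
     cong₂ _+_ (*-identityˡ _ · sym (g= i)) (cong (c *_) (sym (g= u))))
    where
    co : ∀ j → coord inverses (λ k → δ i k + c * δ u k) j ≡ A 4 p i j + c * A 4 p u j
    co j = (sum-cong-≗ λ k → solve 4 (λ a c b n → (a :+ c :* b) :* n := con true :* (a :* n) :+ c :* (b :* n)) refl (δ i k) c (δ u k) (A 4 p k j)) ·
     SignedPermanent.sum-linear (tower K) 1# (*-identityˡ 1#) {g = λ k → δ i k * A 4 p k j} {h = λ k → δ u k * A 4 p k j} 1# c (λ _ → refl) ·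
      (cong₂ _+_ (*-identityˡ _ · sum-δˡ i λ k → A 4 p k j) (cong (c *_) (sum-δˡ u λ k → A 4 p k j)))
   candidate0 = solve 2 (λ g h → g := g :+ con false :* h) refl (g i) (g i) · candidate i 0# ·
    (Odd-cong λ j k → SignedPermanent.←-cong (tower K) 1# (*-identityˡ 1#) {A = B} {B = B} {r = λ k → δ i k + 0# * δ i k} {r' = δ i} i (λ _ _ _ → refl)
     (λ k → solve 1 (λ d → d :+ con false :* d := d) refl (δ i k)) j k)

module Vander where
 open GraphPoly
 open Tower
 open Lang hiding (keep; N; W)
 open Fills
 open Algo

 open import Data.Nat using (_≤_)

 descend : ∀ {n} (P : ℕ → Set) → P n → (∀ (v : Fin n) → P (suc (toℕ v)) → P (toℕ v)) → ∀ m → m ≤ n → P m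
 descend {n} P base step m m≤n = go (n ∸ m) m (ℕ.m+[n∸m]≡n m≤n)
  where
  go : ∀ d m → m ℕ.+ d ≡ n → P m
  go zero m e = subst P (sym e · ℕ.+-identityʳ m) base
  go (suc d) m e = subst P (Fin.toℕ-fromℕ< m<n) (step (fromℕ< m<n)
   (subst (P ∘ suc) (sym (Fin.toℕ-fromℕ< m<n)) (go d (suc m) (sym (ℕ.+-suc m d) · e))))
   where
   m<n = ℕ.m≤m+n (suc m) d ≤≡ sym (ℕ.+-suc m d) · e

 module Vandermonde (K n' : ℕ) (n<q : suc n' < 2 ℕ.^ width K) where
  open Stages K n' public

  point-injective : ∀ {p q} → point p ≡ point q → p ≡ q
  point-injective {p} {q} e = Fin.toℕ-injective (ℕ.suc-injective (sym (enc-dec K _ (small p)) · cong (enc K) e · enc-dec K _ (small q)))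
   where
   small : ∀ p → suc (toℕ p) < 2 ℕ.^ width K
   small p = ℕ.≤-<-trans (Fin.toℕ<n p) n<q

  point≢0 : ∀ p → point p ≢ 0#
  point≢0 p e with () ← trans (sym (enc-0 K)) (cong (enc K) (sym e) · enc-dec K _ (ℕ.≤-<-trans (Fin.toℕ<n p) n<q))

  *-≢0 : ∀ {x y} → x ≢ 0# → y ≢ 0# → x * y ≢ 0#
  *-≢0 x≢0 y≢0 e = y≢0 (x*y≡0⇒y≡0 _ x≢0 e)

  ^-≢0 : ∀ {y} j → y ≢ 0# → y ^ j ≢ 0#
  ^-≢0 zero _ = 1≢0
  ^-≢0 (suc j) y≢0 = *-≢0 y≢0 (^-≢0 j y≢0)

  vand : Fin n → Fin n → F K
  vand i l = point i ^ suc (toℕ l)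

  power-product : ∀ {m} y (l : Fin m) → iter {n = m} (λ k x → x * (if toℕ k ≤ᵇ toℕ l then y else 1#)) 1# ≡ y ^ suc (toℕ l)
  power-product {suc m} y zero = cong (_* y) ((iter-cong {n = m} 1# λ v x → *-identityʳ x) · ones m) · *-comm 1# y
   where
   ones : ∀ m → iter {n = m} (λ v x → x) 1# ≡ 1#
   ones zero = refl
   ones (suc m) = ones m
  power-product {suc m} y (suc l) = cong (_* y) ((iter-cong {n = m} 1# λ v x → cong (λ b → x * (if b then y else 1#)) (≤ᵇ-suc (toℕ v) (toℕ l))) · power-product y l) · *-comm _ y
   where
   ≤ᵇ-suc : ∀ a b → (suc a ≤ᵇ suc b) ≡ (a ≤ᵇ b)
   ≤ᵇ-suc zero b = refl
   ≤ᵇ-suc (suc a) b = refl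

  stepV : Fin n → Mat (F K) n → Mat (F K) n
  stepV i N k l = if toℕ i ≤ᵇ toℕ l then (if toℕ l ≤ᵇ toℕ i then x else y) else y
   where
   co : Fin n → F K
   co l = iter (λ k x → x + vand i k * N k l) 0#
   x y : F K
   x = N k i * inverse K (co i)
   y = N k l + N k i * inverse K (co i) * co l

  stepV-cong : ∀ i {N N'} → (∀ k l → N k l ≡ N' k l) → ∀ k l → stepV i N k l ≡ stepV i N' k l
  stepV-cong i {N} {N'} e k l = cong₂ (λ x y → if toℕ i ≤ᵇ toℕ l then (if toℕ l ≤ᵇ toℕ i then x else y) else y)
   (cong₂ _*_ (e k i) (cong (inverse K) (co= i)))
   (cong₂ _+_ (e k l) (cong₂ _*_ (cong₂ _*_ (e k i) (cong (inverse K) (co= i))) (co= l)))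
   where
   co= : ∀ l → iter (λ k x → x + vand i k * N k l) 0# ≡ iter (λ k x → x + vand i k * N' k l) 0#
   co= l = iter-cong 0# λ k x → cong (λ y → x + vand i k * y) (e k l)

  vandermonde-step : ∀ i A {N} → (∀ k l → A 12 k l zero ≡ N k l) → ∀ k l → assigns vandermondeFills i A 12 k l zero ≡ stepV i N k l
  vandermonde-step i A {N} e k l = cong₂ (λ x y → if toℕ i ≤ᵇ toℕ l then (if toℕ l ≤ᵇ toℕ i then x else y) else y)
   (cong (λ z → A 12 k i zero * inverse K z) (co= i))
   (cong₂ (λ z z' → A 12 k l zero + A 12 k i zero * inverse K z * z') (co= i) (co= l)) ·
   stepV-cong i e k l
   where
   co= : ∀ l → iter (λ k x → x + iter {n = n} (λ m x → x * (if toℕ m ≤ᵇ toℕ k then point i else 1#)) 1# * A 12 k l zero) 0# ≡ iter (λ k x → x + vand i k * A 12 k l zero) 0#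
   co= l = iter-cong 0# λ k x → cong (λ v → x + v * A 12 k l zero) (power-product (point i) k)

  rowsV : ℕ → Mat (F K) n
  rowsV m = iter-from m (λ i B → B [ i ← vand i ]) δ

  Wₘ : ℕ → Mat (F K) n
  Wₘ m = iter-from m stepV δ

  rowsV-step : ∀ i → rowsV (toℕ i) ≡ rowsV (suc (toℕ i)) [ i ← vand i ]
  rowsV-step i = iter-from-step i (λ i B → B [ i ← vand i ]) δ

  rowsV-rows : ∀ m → m ≤ n → ∀ j k → (m ≤ toℕ j → rowsV m j k ≡ vand j k) × (toℕ j < m → rowsV m j k ≡ δ j k)
  rowsV-rows = descend (λ m → ∀ j k → (m ≤ toℕ j → rowsV m j k ≡ vand j k) × (toℕ j < m → rowsV m j k ≡ δ j k))
   (λ j k → (λ n≤j → contradiction (Fin.toℕ<n j) (ℕ.≤⇒≯ n≤j)) , λ _ → cong (λ B → B j k) (iter-from-end n (λ i B → B [ i ← vand i ]) δ))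
   step
   where
   step : ∀ v → (∀ j k → (suc (toℕ v) ≤ toℕ j → rowsV (suc (toℕ v)) j k ≡ vand j k) × (toℕ j < suc (toℕ v) → rowsV (suc (toℕ v)) j k ≡ δ j k)) →
    ∀ j k → (toℕ v ≤ toℕ j → rowsV (toℕ v) j k ≡ vand j k) × (toℕ j < toℕ v → rowsV (toℕ v) j k ≡ δ j k)
   step v ih j k rewrite rowsV-step v with j Fin.≟ v
   ... | yes refl = (λ _ → refl) , λ lt → contradiction lt (ℕ.<-irrefl refl)
   ... | no ne = (λ le → proj₁ (ih j k) (ℕ.≤∧≢⇒< le λ e → ne (Fin.toℕ-injective (sym e)))) , λ lt → proj₂ (ih j k) (ℕ.m≤n⇒m≤1+n lt)

  -- If the pivot vanished, the values at the point i of the polynomials in the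
  -- span of y ^ (i + 1), …, y ^ n would be combinations of those at the
  -- points l > i.
  pivot : ∀ i {N} (inverses : Inverses (rowsV (suc (toℕ i))) N) → coord inverses (vand i) i ≢ 0#
  pivot i {N} inverses pivot=0 = proj₂ (proj₂ (vanishing (suc (toℕ i)) (Fin.toℕ<n i) ℕ.≤-refl))
   (sym at-i · ext-Span w point monomials (proj₁ (vanishing (suc (toℕ i)) (Fin.toℕ<n i) ℕ.≤-refl)))
   where
   open ≡-Reasoning
   I = toℕ i
   c = coord inverses (vand i)
   w : Fin n → F K
   w l with I ℕ.<? toℕ l
   ... | yes _ = c l
   ... | no _ = δ i l
   poly : ℕ → F K → F K
   poly m = iter-from m (λ l f y → (y + point l) * f y) (_^ suc I)
   Vanishing : ℕ → Set
   Vanishing m = suc I ≤ m → Span (suc I) (suc I ℕ.+ (n ∸ m)) (poly m) × (∀ l → m ≤ toℕ l → poly m (point l) ≡ 0#) × poly m (point i) ≢ 0#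
   vanishing = descend Vanishing start step
    where
    end : ∀ y → poly n y ≡ y ^ suc I
    end y = cong (λ f → f y) (iter-from-end n (λ l f y → (y + point l) * f y) (_^ suc I))
    start : Vanishing n
    start _ = cons 1# (suc I) ℕ.≤-refl (ℕ.m≤m+n (suc I) (n ∸ n)) (nil {f = λ _ → 0#} λ _ → refl)
     (λ y → end y · solve 1 (λ p → p := con true :* p :+ con false) refl (y ^ suc I))
     , (λ l n≤l → contradiction (Fin.toℕ<n l) (ℕ.≤⇒≯ n≤l))
     , λ e → ^-≢0 (suc I) (point≢0 i) (sym (end (point i)) · e)
    step : ∀ v → Vanishing (suc (toℕ v)) → Vanishing (toℕ v)
    step v ih I<v = Span-cong unfold (Span-weaken ℕ.≤-refl (ℕ.≤-reflexive degree)
     (Span-+ (Span-weaken (ℕ.n≤1+n (suc I)) ℕ.≤-refl (Span-shift s)) (Span-weaken ℕ.≤-refl (ℕ.n≤1+n _) (Span-* (point v) s))))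
     , zeros , λ e → *-≢0 apart nz (sym (at (point i)) · e)
     where
     prev = ih (ℕ.m≤n⇒m≤1+n I<v)
     s = proj₁ prev
     z = proj₁ (proj₂ prev)
     nz = proj₂ (proj₂ prev)
     at : ∀ y → poly (toℕ v) y ≡ (y + point v) * poly (suc (toℕ v)) y
     at y = cong (λ f → f y) (iter-from-step v (λ l f y → (y + point l) * f y) (_^ suc I))
     unfold : ∀ y → poly (toℕ v) y ≡ y * poly (suc (toℕ v)) y + point v * poly (suc (toℕ v)) y
     unfold y = at y · distribʳ _ y (point v)
     degree = sym (ℕ.+-suc (suc I) _) · cong (suc I ℕ.+_) (sym (ℕ.+-∸-assoc 1 (Fin.toℕ<n v)))
     zeros : ∀ l → toℕ v ≤ toℕ l → poly (toℕ v) (point l) ≡ 0#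
     zeros l v≤l with ℕ.m≤n⇒m<n∨m≡n v≤l
     ... | inj₁ v<l = at (point l) · cong (_ *_) (z l v<l) · zeroʳ _
     ... | inj₂ v≡l = at (point l) · cong (_* poly (suc (toℕ v)) (point l))
      (cong (λ u → point u + point v) (sym (Fin.toℕ-injective v≡l)) · x+x≡0 (point v)) · zeroˡ _
     apart : point i + point v ≢ 0#
     apart e = ℕ.<-irrefl (cong toℕ (point-injective (x+y≡0⇒x≡y _ _ e))) I<v
   f = poly (suc I)
   w-i : w i ≡ 1#
   w-i with I ℕ.<? toℕ i
   ... | yes lt = contradiction lt (ℕ.<-irrefl refl)
   ... | no _ = δ-same i
   at-i = sum-single _ i others · cong (_* f (point i)) w-i · *-identityˡ _
    where
    others : ∀ l → l ≢ i → w l * f (point l) ≡ 0#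
    others l l#i with I ℕ.<? toℕ l
    ... | yes lt = cong (c l *_) (proj₁ (proj₂ (vanishing (suc I) (Fin.toℕ<n i) ℕ.≤-refl)) l lt) · zeroʳ _
    ... | no _ = cong (_* f (point l)) (δ-diff (l#i ∘ sym)) · zeroˡ _
   monomials : ∀ j → suc I ≤ j → j ≤ suc I ℕ.+ (n ∸ suc I) → ext w point (_^ j) ≡ 0#
   monomials (suc j) (s≤s I≤j) j≤ = sum-cong-≗ term · ∑-distrib-+ (λ l → c l * rowsV (suc I) l k) (λ l → δ i l * (point l ^ suc j)) ·
    cong₂ _+_ (sym (expand inverses (vand i) k)) (sum-δˡ i (λ l → point l ^ suc j) · cong (λ m → point i ^ suc m) (sym k=)) · x+x≡0 _
    where
    j<n = j≤ ≤≡ ℕ.m+[n∸m]≡n (Fin.toℕ<n i)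
    k = fromℕ< j<n
    k= = Fin.toℕ-fromℕ< j<n
    rows = rowsV-rows (suc I) (Fin.toℕ<n i)
    term : ∀ l → w l * point l ^ suc j ≡ c l * rowsV (suc I) l k + δ i l * (point l ^ suc j)
    term l with I ℕ.<? toℕ l
    ... | yes lt = sym (+-identityʳ _) · (cong₂ _+_
     (cong (c l *_) (cong (λ m → point l ^ suc m) (sym k=) · sym (proj₁ (rows l k) lt)))
     (sym (cong (_* _) (δ-diff λ e → ℕ.<-irrefl (cong toℕ e) lt) · zeroˡ _)))
    ... | no ge = sym (+-identityˡ _) · cong (_+ δ i l * (point l ^ suc j)) (sym vanish)
     where
     vanish : c l * rowsV (suc I) l k ≡ 0#
     vanish with l Fin.≟ i
     ... | yes refl = cong (_* rowsV (suc I) l k) pivot=0 · zeroˡ _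
     ... | no l#i = cong (c l *_) (proj₂ (rows l k) (s≤s (ℕ.≮⇒≥ ge)) ·
      (δ-diff λ e → l#i (Fin.toℕ-injective (ℕ.≤-antisym (ℕ.≮⇒≥ ge) (I≤j ≤≡ sym k= · cong toℕ (sym e)))))) · zeroʳ _

  W-inverses : ∀ m → m ≤ n → Inverses (rowsV m) (Wₘ m)
  W-inverses = descend (λ m → Inverses (rowsV m) (Wₘ m)) start step
   where
   start : Inverses (rowsV n) (Wₘ n)
   start rewrite iter-from-end n (λ i B → B [ i ← vand i ]) δ | iter-from-end n stepV δ = record
    { AN = λ i j → sum-δˡ i (λ k → δ k j) ; NA = λ i j → sum-δˡ i (λ k → δ k j) }
   step : ∀ v → Inverses (rowsV (suc (toℕ v))) (Wₘ (suc (toℕ v))) → Inverses (rowsV (toℕ v)) (Wₘ (toℕ v))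
   step v ih rewrite rowsV-step v | iter-from-step v stepV δ =
    inverses-replace ih v (vand v) (inverse K (co v)) _ (cong (_* inverse K (co v)) (sym (co= v)) · (inverse-correct K (co v) λ e → pivot v ih (sym (co= v) · e)))
     λ k l → if-eq v l _ _ · cong (λ c → δ v l * (N k v * inverse K (co v)) + (1# + δ v l) * (N k l + N k v * inverse K (co v) * c)) (co= l)
    where
    N = Wₘ (suc (toℕ v))
    co : Fin n → F K
    co l = iter (λ k x → x + vand v k * N k l) 0#
    co= : ∀ l → co l ≡ coord ih (vand v) l
    co= l = iter-sum _

  W = Wₘ 0

  ext-monomial : ∀ k s → ext (W k) point (_^ suc (toℕ s)) ≡ δ k s
  ext-monomial k s = (sum-cong-≗ λ p → cong (W k p *_) (sym (proj₁ (rowsV-rows 0 z≤n p s) z≤n))) · Inverses.NA (W-inverses 0 z≤n) k s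

module Chain where
 open Lang using (iter-from; iter-from-step; iter-from-end)
 open Vander using (descend)

 open import Data.List using (lookup)
 open import Data.Nat using (_≤_)

 private
  variable
   n : ℕ

 anyVec? : ∀ k {P : Vec (Fin n) k → Set} → (∀ v → Dec (P v)) → Dec (∃[ v ] P v)
 anyVec? zero P? = map′ (λ p → [] , p) (λ { ([] , p) → p }) (P? [])
 anyVec? (suc k) P? = map′ (λ { (x , v , p) → x ∷ v , p }) (λ { (x ∷ v , p) → x , v , p })
  (Fin.any? λ x → anyVec? k λ v → P? (x ∷ v))

 HasCycle : ℕ → Digraph n → Set
 HasCycle {n} κ H = ∃[ v ] IsEvenCycle H (toList {n = κ} v)

 hasCycle? : ∀ κ (H : Digraph n) → Dec (HasCycle κ H)
 hasCycle? κ H = anyVec? κ λ v → isEvenCycle? H (toList v)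

 hasCycle : ∀ (H : Digraph n) c → IsEvenCycle H c → HasCycle (length c) H
 hasCycle H c e = fromList c , subst (IsEvenCycle H) (sym (toList∘fromList c)) e

 least-cycle : ∀ (G : Digraph n) c → IsEvenCycle G c → ∃[ κ ] (HasCycle κ G × ∀ c → IsEvenCycle G c → κ ≤ length c)
 least-cycle G c e = search (length c) 0 (λ _ ()) (subst (λ j → HasCycle j G) (sym (ℕ.+-identityʳ (length c))) (hasCycle G c e))
  where
  search : ∀ d κ → (∀ j → j < κ → ¬ HasCycle j G) → HasCycle (d ℕ.+ κ) G → ∃[ κ ] (HasCycle κ G × ∀ c → IsEvenCycle G c → κ ≤ length c)
  search d κ below top with hasCycle? κ G
  ... | yes h = κ , h , λ c e → ℕ.≮⇒≥ λ lt → below (length c) lt (hasCycle G c e)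
  search zero κ below top | no ¬h = contradiction top ¬h
  search (suc d) κ below top | no ¬h = search d (suc κ) below' (subst (λ j → HasCycle j G) (sym (ℕ.+-suc d κ)) top)
   where
   below' : ∀ j → j < suc κ → ¬ HasCycle j G
   below' j (s≤s j≤κ) with ℕ.m≤n⇒m<n∨m≡n j≤κ
   ... | inj₁ lt = below j lt
   ... | inj₂ refl = ¬h

 Unique-length : ∀ {xs : List (Fin n)} → Unique xs → length xs ≤ n
 Unique-length {xs = xs} u = Fin.injective⇒≤ (injective xs u)
  where
  lookup-All : ∀ {P : Fin _ → Set} {xs : List (Fin _)} → All P xs → ∀ i → P (lookup xs i)
  lookup-All (p ∷ ps) zero = p
  lookup-All (p ∷ ps) (suc i) = lookup-All ps i
  injective : ∀ (xs : List (Fin _)) → Unique xs → ∀ {i j} → lookup xs i ≡ lookup xs j → i ≡ j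
  injective (x ∷ xs) (x∉ ∷ u) {zero} {zero} e = refl
  injective (x ∷ xs) (x∉ ∷ u) {zero} {suc j} e = contradiction e (lookup-All x∉ j)
  injective (x ∷ xs) (x∉ ∷ u) {suc i} {zero} e = contradiction (sym e) (lookup-All x∉ i)
  injective (x ∷ xs) (x∉ ∷ u) {suc i} {suc j} e = cong suc (injective xs u e)

 infix 4 _⊑_
 _⊑_ : Digraph n → Digraph n → Set
 H ⊑ G = ∀ {a b} → Arc H a b → Arc G a b

 IsEvenCycle-⊑ : ∀ {H G : Digraph n} → H ⊑ G → ∀ c → IsEvenCycle H c → IsEvenCycle G c
 IsEvenCycle-⊑ H⊑G (v ∷ vs) ((u , l) , e) = (u , Linked.map H⊑G l) , e

 HasCycle-⊑ : ∀ {κ} {H G : Digraph n} → H ⊑ G → HasCycle κ H → HasCycle κ G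
 HasCycle-⊑ H⊑G (v , e) = v , IsEvenCycle-⊑ H⊑G (toList v) e

 splice : Digraph n → Fin n → Digraph n → Digraph n
 splice G i H = record { adjacent = adj ; loopless = loop }
  where
  adj : Fin _ → Fin _ → Bool
  adj a b with a Fin.≟ i
  ... | yes _ = adjacent G a b
  ... | no _ = adjacent H a b
  loop : ∀ v → adj v v ≡ false
  loop v with v Fin.≟ i
  ... | yes _ = loopless G v
  ... | no _ = loopless H v

 splice-same : ∀ (G : Digraph n) i H b → adjacent (splice G i H) i b ≡ adjacent G i b
 splice-same G i H b with i Fin.≟ i
 ... | yes _ = refl
 ... | no ne = contradiction refl ne

 splice-diff : ∀ (G : Digraph n) {i} H {a} b → a ≢ i → adjacent (splice G i H) a b ≡ adjacent H a b
 splice-diff G {i} H {a} b ne with a Fin.≟ i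
 ... | yes e = contradiction e ne
 ... | no _ = refl

 empty : Digraph n
 empty = record { adjacent = λ _ _ → false ; loopless = λ _ → refl }

 target : Digraph n → Fin n → Digraph n
 target H u = record { adjacent = λ a b → adjacent H a b ∧ ⌊ b Fin.≟ u ⌋ ; loopless = λ v → cong (_∧ ⌊ v Fin.≟ u ⌋) (loopless H v) }

 clear : Digraph n → Fin n → Digraph n
 clear H i = splice empty i H

 only : Digraph n → Fin n → Fin n → Digraph n
 only H i u = splice (target H u) i H

 ∧-true : ∀ {a b} → a ∧ b ≡ true → a ≡ true × b ≡ true
 ∧-true {true} {true} _ = refl , refl

 ≟-true : ∀ {b u : Fin n} → ⌊ b Fin.≟ u ⌋ ≡ true → b ≡ u
 ≟-true {b = b} {u} e with b Fin.≟ u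
 ... | yes p = p

 clear-⊑ : ∀ (H : Digraph n) i → clear H i ⊑ H
 clear-⊑ H i {a} {b} e with a Fin.≟ i
 ... | no _ = e

 only-⊑ : ∀ (H : Digraph n) i u → only H i u ⊑ H
 only-⊑ H i u {a} {b} e with a Fin.≟ i
 ... | yes _ = proj₁ (∧-true e)
 ... | no _ = e

 only-row : ∀ (H : Digraph n) i u {b} → Arc (only H i u) i b → b ≡ u
 only-row H i u {b} e = ≟-true (proj₂ (∧-true {adjacent H i b} (sym (splice-same (target H u) i H b) · e)))

 clear-mono : ∀ {H G : Digraph n} i → H ⊑ G → clear H i ⊑ clear G i
 clear-mono i H⊑G {a} {b} e with a Fin.≟ i
 ... | no _ = H⊑G e

 only-⊑-clear : ∀ (H : Digraph n) i u → adjacent H i u ≡ false → only H i u ⊑ clear H i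
 only-⊑-clear H i u no-arc {a} {b} e = at (a Fin.≟ i)
  where
  at : Dec (a ≡ i) → Arc (clear H i) a b
  at (no ne) = splice-diff empty H b ne · sym (splice-diff (target H u) H b ne) · e
  at (yes refl) with only-row H i u {b} e
  ... | refl with () ← trans (sym no-arc) (only-⊑ H i u {a} {b} e)

 module _ (H : Digraph n) (i : Fin n) where

  linked-avoiding : ∀ (G : Digraph n) v vs z → i ∉ v ∷ vs → Linked (Arc H) (v ∷ vs ∷ʳ z) → Linked (Arc (splice G i H)) (v ∷ vs ∷ʳ z)
  linked-avoiding G v [] z i∉ (e ∷ [-]) = trans (splice-diff G H z λ q → i∉ (here (sym q))) e ∷ [-]
  linked-avoiding G v (w ∷ vs) z i∉ (e ∷ l) = trans (splice-diff G H w λ q → i∉ (here (sym q))) e ∷ linked-avoiding G w vs z (i∉ ∘ there) l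

  arc-only : ∀ {u} → Arc H i u → Arc (only H i u) i u
  arc-only {u} e = splice-same (target H u) i H u · (cong₂ _∧_ e same)
   where
   same : ⌊ u Fin.≟ u ⌋ ≡ true
   same with u Fin.≟ u
   ... | yes _ = refl
   ... | no ne = contradiction refl ne

  linked-through : ∀ v vs z → Unique (v ∷ vs) → i ∈ v ∷ vs → Linked (Arc H) (v ∷ vs ∷ʳ z) → ∃[ u ] Linked (Arc (only H i u)) (v ∷ vs ∷ʳ z)
  linked-through v [] z _ (here refl) (e ∷ [-]) = z , arc-only e ∷ [-]
  linked-through v (w ∷ vs) z (v∉ ∷ _) (here refl) (e ∷ l) = w , arc-only e ∷ linked-avoiding (target H w) w vs z (λ p → All.lookup v∉ p refl) l
  linked-through v (w ∷ vs) z (v∉ ∷ unique) (there p) (e ∷ l) =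
   let u , l' = linked-through w vs z unique p l in
   u , trans (splice-diff (target H u) H w (All.lookup v∉ p)) e ∷ l'

  avoid-or-use : ∀ {κ} → HasCycle κ H → HasCycle κ (clear H i) ⊎ ∃[ u ] HasCycle κ (only H i u)
  avoid-or-use (v ∷ vs , (unique , l) , even) with DecMembership._∈?_ Fin._≟_ i (v ∷ toList vs)
  ... | no i∉ = inj₁ (v ∷ vs , (unique , linked-avoiding empty v (toList vs) v i∉ l) , even)
  ... | yes i∈ = let u , l' = linked-through v (toList vs) v unique i∈ l in inj₂ (u , v ∷ vs , (unique , l') , even)

  clear-cycle : ∀ c → IsEvenCycle H c → i ∉ c → IsEvenCycle (clear H i) c
  clear-cycle (v ∷ vs) ((unique , l) , even) i∉ = (unique , linked-avoiding empty v vs v i∉ l) , even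

 least-Fin : ∀ {m} {P : Fin m → Set} → (∀ u → Dec (P u)) → ∃[ u ] P u → ∃[ u ] (P u × ∀ v → toℕ v < toℕ u → ¬ P v)
 least-Fin {suc m} P? (u , p) with P? zero
 ... | yes p0 = zero , p0 , λ _ ()
 least-Fin {suc m} P? (zero , p) | no ¬p₀ = contradiction p ¬p₀
 least-Fin {suc m} P? (suc u , p) | no ¬p₀ =
  let w , q , min = least-Fin (P? ∘ suc) (u , p) in
  suc w , q , λ { zero _ → ¬p₀ ; (suc v) (s≤s lt) → min v lt }

 module Pruning (κ : ℕ) where

  data Pruned (H : Digraph n) (i : Fin n) : Digraph n → Set where
   cleared : HasCycle κ (clear H i) → Pruned H i (clear H i)
   kept : ∀ u → ¬ HasCycle κ (clear H i) → HasCycle κ (only H i u) →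
    (∀ v → toℕ v < toℕ u → ¬ HasCycle κ (only H i v)) → Pruned H i (only H i u)

  prune : Fin n → Digraph n → Digraph n
  prune i H with hasCycle? κ (clear H i)
  ... | yes _ = clear H i
  ... | no _ with Fin.any? (λ u → hasCycle? κ (only H i u))
  ... | yes e = only H i (proj₁ (least-Fin (λ u → hasCycle? κ (only H i u)) e))
  ... | no _ = H

  pruned : ∀ i (H : Digraph n) → HasCycle κ H → Pruned H i (prune i H)
  pruned i H h with hasCycle? κ (clear H i)
  ... | yes c = cleared c
  ... | no ¬c with Fin.any? (λ u → hasCycle? κ (only H i u))
  ... | yes e = let u , p , min = least-Fin (λ u → hasCycle? κ (only H i u)) e in kept u ¬c p min
  ... | no ¬e with avoid-or-use H i h
  ... | inj₁ c = contradiction c ¬c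
  ... | inj₂ e = contradiction e ¬e

  Pruned-⊑ : ∀ {H : Digraph n} {i H'} → Pruned H i H' → H' ⊑ H
  Pruned-⊑ {H = H} {i} (cleared _) {a} {b} = clear-⊑ H i {a} {b}
  Pruned-⊑ {H = H} {i} (kept u _ _ _) {a} {b} = only-⊑ H i u {a} {b}

  Pruned-has : ∀ {H : Digraph n} {i H'} → Pruned H i H' → HasCycle κ H'
  Pruned-has (cleared h) = h
  Pruned-has (kept _ _ h _) = h

  Pruned-other : ∀ {H : Digraph n} {i H'} → Pruned H i H' → ∀ {a} b → a ≢ i → adjacent H' a b ≡ adjacent H a b
  Pruned-other {H = H} (cleared _) b ne = splice-diff empty H b ne
  Pruned-other {H = H} (kept u _ _ _) b ne = splice-diff (target H u) H b ne

  -- Row i of H has at most one arc, and this arc is on every even cycle of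
  -- length κ.
  data Row (H : Digraph n) (i : Fin n) : Set where
   none : (∀ b → adjacent H i b ≡ false) → Row H i
   single : ∀ u → (∀ b → Arc H i b → b ≡ u) → Arc H i u → ¬ HasCycle κ (clear H i) → Row H i

  Pruned-row : ∀ {H : Digraph n} {i H'} → Pruned H i H' → Row H' i
  Pruned-row {H = H} {i} (cleared _) = none (splice-same empty i H)
  Pruned-row {H = H} {i} (kept u ¬c h _) = single u (λ b → only-row H i u {b}) arc (¬c ∘ HasCycle-⊑ λ {a} {b} → clear-mono i (λ {a} {b} → only-⊑ H i u {a} {b}) {a} {b})
   where
   arc : Arc (only H i u) i u
   arc with adjacent H i u in e
   ... | true = arc-only H i e
   ... | false = contradiction (HasCycle-⊑ (λ {a} {b} → only-⊑-clear H i u e {a} {b}) h) ¬c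

  Row-pruned : ∀ {H : Digraph n} {i H' j} → Pruned H i H' → j ≢ i → Row H j → Row H' j
  Row-pruned p j#i (none e) = none λ b → Pruned-other p b j#i · e b
  Row-pruned {j = j} p j#i (single u only1 arc ¬c) = single u (λ b e → only1 b (sym (Pruned-other p b j#i) · e)) (Pruned-other p u j#i · arc)
   (¬c ∘ HasCycle-⊑ λ {a} {b} → clear-mono j (λ {a} {b} → Pruned-⊑ p {a} {b}) {a} {b})

  module _ (G : Digraph n) (G-has : HasCycle κ G) where
   pruning : ℕ → Digraph n
   pruning m = iter-from m prune G
   pruning-step : ∀ v → pruning (toℕ v) ≡ prune v (pruning (suc (toℕ v)))
   pruning-step v = iter-from-step v prune G
   pruning-⊑ = descend (λ m → pruning m ⊑ G × HasCycle κ (pruning m))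
    (subst (λ H → H ⊑ G × HasCycle κ H) (sym (iter-from-end n prune G)) ((λ e → e) , G-has))
    λ v (s , h) → subst (λ H → H ⊑ G × HasCycle κ H) (sym (pruning-step v))
     ((λ {a} {b} e → s (Pruned-⊑ (pruned v _ h) {a} {b} e)) , Pruned-has (pruned v _ h))
   pruning-pruned : ∀ v → Pruned (pruning (suc (toℕ v))) v (pruning (toℕ v))
   pruning-pruned v = subst (Pruned _ v) (sym (pruning-step v)) (pruned v _ (proj₂ (pruning-⊑ (suc (toℕ v)) (Fin.toℕ<n v))))
   pruning-rows = descend (λ m → ∀ j → m ≤ toℕ j → Row (pruning m) j) (λ j n≤j → contradiction (Fin.toℕ<n j) (ℕ.≤⇒≯ n≤j)) step
    where
    step : ∀ v → (∀ j → suc (toℕ v) ≤ toℕ j → Row (pruning (suc (toℕ v))) j) → ∀ j → toℕ v ≤ toℕ j → Row (pruning (toℕ v)) j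
    step v ih j v≤j with j Fin.≟ v
    ... | yes refl = Pruned-row (pruning-pruned v)
    ... | no j#v = Row-pruned (pruning-pruned v) j#v (ih j (ℕ.≤∧≢⇒< v≤j λ e → j#v (Fin.toℕ-injective (sym e))))

 inserting : Digraph n → ℕ → Digraph n
 inserting G m = iter-from m (splice G) empty

 inserting-step : ∀ (G : Digraph n) v → inserting G (toℕ v) ≡ splice G v (inserting G (suc (toℕ v)))
 inserting-step G v = iter-from-step v (splice G) empty

 inserting-end : ∀ (G : Digraph n) → inserting G n ≡ empty
 inserting-end G = iter-from-end _ (splice G) empty

 inserting-all : ∀ (G : Digraph n) a b → adjacent (inserting G 0) a b ≡ adjacent G a b
 inserting-all {n} G a b = descend (λ m → ∀ a → m ≤ toℕ a → adjacent (inserting G m) a b ≡ adjacent G a b)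
  (λ a n≤a → contradiction (Fin.toℕ<n a) (ℕ.≤⇒≯ n≤a)) step 0 z≤n a z≤n
  where
  step : ∀ v → (∀ a → suc (toℕ v) ≤ toℕ a → adjacent (inserting G (suc (toℕ v))) a b ≡ adjacent G a b) →
   ∀ a → toℕ v ≤ toℕ a → adjacent (inserting G (toℕ v)) a b ≡ adjacent G a b
  step v ih a v≤a rewrite inserting-step G v with a Fin.≟ v
  ... | yes refl = refl
  ... | no ne = ih a (ℕ.≤∧≢⇒< v≤a λ e → ne (Fin.toℕ-injective (sym e)))

module Walk where
 open import Data.List.Properties using (∷-injectiveʳ)
 open import Data.Nat using (_+_)
 open import Data.Nat.Divisibility using (_∣_; ∣1⇒≡1)
 open import Data.Nat.GeneralisedArithmetic using (fold; fold-+)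

 private
  variable
   n : ℕ

 module Orbit {A : Set} (f : A → A) where

  fold-suc : ∀ a t → fold a f (suc t) ≡ fold (f a) f t
  fold-suc a t = cong (fold a f) (sym (ℕ.+-comm t 1)) · fold-+ a f t

  fold-comm : ∀ a s t → fold (fold a f s) f t ≡ fold (fold a f t) f s
  fold-comm a s t = sym (fold-+ a f t) · cong (fold a f) (ℕ.+-comm t s) · fold-+ a f s

  record FirstReturn (a : A) (L : ℕ) : Set where
   constructor firstReturn
   field
    positive : 0 < L
    returns : fold a f L ≡ a
    earliest : ∀ i → 0 < i → i < L → fold a f i ≢ a

  trail : A → ℕ → List A
  trail a zero = []
  trail a (suc t) = a ∷ trail (f a) t

  length-trail : ∀ a t → length (trail a t) ≡ t
  length-trail a zero = refl
  length-trail a (suc t) = cong suc (length-trail (f a) t)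

  trail-∷ʳ : ∀ a t → trail a (suc t) ≡ trail a t ∷ʳ fold a f t
  trail-∷ʳ a zero = refl
  trail-∷ʳ a (suc t) = cong (a ∷_) (trail-∷ʳ (f a) t · cong (trail (f a) t ∷ʳ_) (sym (fold-suc a t)))

  trail-All : ∀ {P : A → Set} a t → (∀ i → i < t → P (fold a f i)) → All P (trail a t)
  trail-All a zero p = []
  trail-All {P = P} a (suc t) p = p 0 (s≤s z≤n) ∷ trail-All (f a) t λ i i<t → subst P (fold-suc a i) (p (suc i) (s≤s i<t))

  trail-∈ : ∀ a t {x} → x ∈ trail a t → ∃[ j ] (j < t × fold a f j ≡ x)
  trail-∈ a (suc t) (here refl) = 0 , s≤s z≤n , refl
  trail-∈ a (suc t) (there x∈) = let j , j<t , e = trail-∈ (f a) t x∈ in suc j , s≤s j<t , fold-suc a j · e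

  trail-Unique : ∀ a t → (∀ i j → i < j → j < t → fold a f i ≢ fold a f j) → Unique (trail a t)
  trail-Unique a zero d = []
  trail-Unique a (suc t) d =
   trail-All (f a) t (λ j j<t e → d 0 (suc j) (s≤s z≤n) (s≤s j<t) (e · sym (fold-suc a j))) ∷
   trail-Unique (f a) t λ i j i<j j<t e → d (suc i) (suc j) (s≤s i<j) (s≤s j<t) (fold-suc a i · e · sym (fold-suc a j))

  trail-Linked : ∀ {R : A → A → Set} a t → (∀ i → i < t → R (fold a f i) (f (fold a f i))) → Linked R (trail a t ∷ʳ fold a f t)
  trail-Linked a zero r = [-]
  trail-Linked {R = R} a (suc zero) r = r 0 (s≤s z≤n) ∷ [-]
  trail-Linked {R = R} a (suc (suc t)) r = r 0 (s≤s z≤n) ∷ subst (λ z → Linked R (trail (f a) (suc t) ∷ʳ z)) (sym (fold-suc a (suc t)))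
   (trail-Linked (f a) (suc t) λ i i<t → subst (λ z → R z (f z)) (fold-suc a i) (r (suc i) (s≤s i<t)))

  linked-trail : ∀ v vs z → Linked (λ a b → f a ≡ b) (v ∷ vs ∷ʳ z) → v ∷ vs ≡ trail v (suc (length vs)) × fold v f (suc (length vs)) ≡ z
  linked-trail v [] z (e ∷ [-]) = refl , e
  linked-trail v (w ∷ vs) z (refl ∷ l) = let e , r = linked-trail w vs z l in cong (v ∷_) e , fold-suc v (suc (length vs)) · r

  first-return-distinct : ∀ {a L} → FirstReturn a L → ∀ i j → i < j → j < L → fold a f i ≢ fold a f j
  first-return-distinct {a} {L} (firstReturn _ returns earliest) i j i<j j<L e = earliest (L ∸ j + i)
   (ℕ.<-≤-trans (ℕ.m<n⇒0<n∸m j<L) (ℕ.m≤m+n _ i)) (ℕ.<-≤-trans (ℕ.+-monoʳ-< (L ∸ j) i<j) (ℕ.≤-reflexive (ℕ.m∸n+n≡m (ℕ.<⇒≤ j<L))))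
   (fold-+ a f (L ∸ j) · cong (λ b → fold b f (L ∸ j)) e ·
    sym (fold-+ a f (L ∸ j)) · cong (fold a f) (ℕ.m∸n+n≡m (ℕ.<⇒≤ j<L)) · returns)

  cycle-first-return : ∀ v vs s → Unique (v ∷ vs) → Linked (λ a b → f a ≡ b) (v ∷ vs ∷ʳ v) → s ∈ v ∷ vs → FirstReturn s (suc (length vs))
  cycle-first-return v vs s (v∉ ∷ _) l s∈ with linked-trail v vs v l
  ... | e , returns with trail-∈ v (suc (length vs)) (subst (s ∈_) e s∈)
  ... | j , j<κ , refl = firstReturn (s≤s z≤n) (fold-comm v j κ · cong (λ b → fold b f j) returns) earliest
   where
   κ = suc (length vs)
   back = sym (fold-+ v f (κ ∸ j)) · cong (fold v f) (ℕ.m∸n+n≡m (ℕ.<⇒≤ j<κ)) · returns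
   member : ∀ i → i < length vs → fold v f (suc i) ∈ trail (f v) (length vs)
   member i i< = subst (_∈ trail (f v) (length vs)) (sym (fold-suc v i)) (go (f v) (length vs) i i<)
    where
    go : ∀ a t i → i < t → fold a f i ∈ trail a t
    go a (suc t) zero _ = here refl
    go a (suc t) (suc i) (s≤s i<t) = there (subst (_∈ trail (f a) t) (sym (fold-suc a i)) (go (f a) t i i<t))
   vs= = ∷-injectiveʳ e
   earliest : ∀ i → 0 < i → i < κ → fold (fold v f j) f i ≢ fold v f j
   earliest (suc i) _ (s≤s i<) q = All.lookup v∉ (subst (fold v f (suc i) ∈_) (sym vs=) (member i i<)) (sym (begin
    fold v f (suc i) ≡⟨ cong (λ b → fold b f (suc i)) (sym back) ⟩
    fold (fold (fold v f j) f (κ ∸ j)) f (suc i) ≡⟨ fold-comm (fold v f j) (κ ∸ j) (suc i) ⟩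
    fold (fold (fold v f j) f (suc i)) f (κ ∸ j) ≡⟨ cong (λ b → fold b f (κ ∸ j)) q ⟩
    fold (fold v f j) f (κ ∸ j) ≡⟨ back ⟩
    v ∎))
    where open ≡-Reasoning

 module _ (G : Digraph n) (f : Fin n → Fin n) (arcs : ∀ i → f i ≢ i → Arc G i (f i)) where
  open Orbit f

  first-return-cycle : ∀ {s L} → FirstReturn s L → 2 ∣ L → IsEvenCycle G (trail s L)
  first-return-cycle {s} {zero} (firstReturn () _ _) even
  first-return-cycle {s} {suc (suc L)} fr@(firstReturn _ returns earliest) even =
   ( trail-Unique s _ (first-return-distinct fr)
   , subst (λ z → Linked (Arc G) (trail s (suc (suc L)) ∷ʳ z)) returns (trail-Linked s (suc (suc L)) λ i i<L → arcs _ (moves i i<L)) )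
   , subst (2 ∣_) (sym (length-trail s (suc (suc L)))) even
   where
   moves : ∀ i → i < suc (suc L) → f (fold s f i) ≢ fold s f i
   moves i i<L e = earliest 1 (s≤s z≤n) (s≤s (s≤s z≤n)) (begin
    f s ≡⟨ cong f (sym back) ⟩
    f (fold (fold s f i) f (suc (suc L) ∸ i)) ≡⟨ fold-comm (fold s f i) (suc (suc L) ∸ i) 1 ⟩
    fold (f (fold s f i)) f (suc (suc L) ∸ i) ≡⟨ cong (λ b → fold b f (suc (suc L) ∸ i)) e ⟩
    fold (fold s f i) f (suc (suc L) ∸ i) ≡⟨ back ⟩
    s ∎)
    where
    open ≡-Reasoning
    back = sym (fold-+ s f (suc (suc L) ∸ i)) · cong (fold s f) (ℕ.m∸n+n≡m (ℕ.<⇒≤ i<L)) · returns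
  first-return-cycle {s} {suc zero} fr even with () ← ∣1⇒≡1 even

module Prob where
 open Tower

 import Data.Bool as Bool
 open import Data.List using (filter)
 open import Data.List.Properties using (length-++; filter-++; drop-drop; ≡-dec)
 open import Data.Nat hiding (_≟_)
 open import Data.Nat.Properties hiding (_≟_)
 open import Level using (0ℓ)

 sumBits : ℕ → (List Bool → ℕ) → ℕ
 sumBits zero g = g []
 sumBits (suc m) g = sumBits m (g ∘ (false ∷_)) + sumBits m (g ∘ (true ∷_))

 sumBits-mono : ∀ m {g h : List Bool → ℕ} → (∀ u → length u ≡ m → g u ≤ h u) → sumBits m g ≤ sumBits m h
 sumBits-mono zero e = e [] refl
 sumBits-mono (suc m) e = +-mono-≤ (sumBits-mono m λ u l → e (false ∷ u) (cong suc l)) (sumBits-mono m λ u l → e (true ∷ u) (cong suc l))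

 sumBits-cong : ∀ m {g h : List Bool → ℕ} → (∀ u → length u ≡ m → g u ≡ h u) → sumBits m g ≡ sumBits m h
 sumBits-cong zero e = e [] refl
 sumBits-cong (suc m) e = cong₂ _+_ (sumBits-cong m λ u l → e (false ∷ u) (cong suc l)) (sumBits-cong m λ u l → e (true ∷ u) (cong suc l))

 sumBits-+ : ∀ m (g h : List Bool → ℕ) → sumBits m (λ u → g u + h u) ≡ sumBits m g + sumBits m h
 sumBits-+ zero g h = refl
 sumBits-+ (suc m) g h = cong₂ _+_ (sumBits-+ m (g ∘ (false ∷_)) (h ∘ (false ∷_))) (sumBits-+ m (g ∘ (true ∷_)) (h ∘ (true ∷_))) ·
  interchange (sumBits m (g ∘ (false ∷_))) (sumBits m (h ∘ (false ∷_))) (sumBits m (g ∘ (true ∷_))) (sumBits m (h ∘ (true ∷_)))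
  where
  interchange : ∀ a b c d → a + b + (c + d) ≡ a + c + (b + d)
  interchange = solve-∀

 sumBits-const : ∀ m c → sumBits m (λ _ → c) ≡ c * 2 ^ m
 sumBits-const zero c = sym (*-identityʳ c)
 sumBits-const (suc m) c = cong₂ _+_ (sumBits-const m c) (sumBits-const m c) · double c (2 ^ m)
  where
  double : ∀ c x → c * x + c * x ≡ c * (2 * x)
  double = solve-∀

 sumBits-++ : ∀ a b (g : List Bool → ℕ) → sumBits (a + b) g ≡ sumBits a (λ u → sumBits b λ v → g (u ++ v))
 sumBits-++ zero b g = refl
 sumBits-++ (suc a) b g = cong₂ _+_ (sumBits-++ a b (g ∘ (false ∷_))) (sumBits-++ a b (g ∘ (true ∷_)))

 ind : ∀ {P : Set} → Dec P → ℕ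
 ind p = if does p then 1 else 0

 ind≤1 : ∀ {P : Set} (p : Dec P) → ind p ≤ 1
 ind≤1 (yes _) = ≤-refl
 ind≤1 (no _) = z≤n

 find-bits : ∀ m {E : List Bool → Set} → (∀ u → Dec (E u)) → (∃[ u ] (length u ≡ m × E u)) ⊎ (∀ u → length u ≡ m → ¬ E u)
 find-bits zero E? with E? []
 ... | yes e = inj₁ ([] , refl , e)
 ... | no ne = inj₂ λ { [] _ → ne }
 find-bits (suc m) E? with find-bits m (E? ∘ (false ∷_)) | find-bits m (E? ∘ (true ∷_))
 ... | inj₁ (u , l , e) | _ = inj₁ (false ∷ u , cong suc l , e)
 ... | inj₂ _ | inj₁ (u , l , e) = inj₁ (true ∷ u , cong suc l , e)
 ... | inj₂ f | inj₂ t = inj₂ λ { (false ∷ u) l → f u (suc-injective l) ; (true ∷ u) l → t u (suc-injective l) }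

 sumBits-single : ∀ m u → sumBits m (λ v → ind (≡-dec Bool._≟_ v u)) ≤ 1
 sumBits-single zero u = ind≤1 (≡-dec Bool._≟_ [] u)
 sumBits-single (suc m) [] = cong₂ _+_ (sumBits-const m 0) (sumBits-const m 0) · refl ≡≤ z≤n
 sumBits-single (suc m) (false ∷ u) = +-mono-≤
  (sumBits-mono m {h = λ v → ind (≡-dec Bool._≟_ v u)} λ v _ → shift v) (≤-reflexive (sumBits-const m 0)) ·≤
  +-identityʳ _ ≡≤ sumBits-single m u
  where
  shift : ∀ v → ind (≡-dec Bool._≟_ (false ∷ v) (false ∷ u)) ≤ ind (≡-dec Bool._≟_ v u)
  shift v with ≡-dec Bool._≟_ v u
  ... | yes _ = ≤-refl
  ... | no _ = z≤n
 sumBits-single (suc m) (true ∷ u) = +-mono-≤ (≤-reflexive (sumBits-const m 0))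
  (sumBits-mono m {h = λ v → ind (≡-dec Bool._≟_ v u)} λ v _ → shift v) ·≤ sumBits-single m u
  where
  shift : ∀ v → ind (≡-dec Bool._≟_ (true ∷ v) (true ∷ u)) ≤ ind (≡-dec Bool._≟_ v u)
  shift v with ≡-dec Bool._≟_ v u
  ... | yes _ = ≤-refl
  ... | no _ = z≤n

 sumBits-*ʳ : ∀ m g c → sumBits m g * c ≡ sumBits m (λ u → g u * c)
 sumBits-*ʳ zero g c = refl
 sumBits-*ʳ (suc m) g c = *-distribʳ-+ c (sumBits m (g ∘ (false ∷_))) _ · (cong₂ _+_ (sumBits-*ʳ m (g ∘ (false ∷_)) c) (sumBits-*ʳ m (g ∘ (true ∷_)) c))

 sumBits-except : ∀ m (g : List Bool → ℕ) u0 C B q → (∀ u → length u ≡ m → g u ≤ C) → (∀ u → length u ≡ m → u ≢ u0 → g u * q ≤ B) →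
  sumBits m g * q ≤ C * q + B * 2 ^ m
 sumBits-except m g u0 C B q bounded small =
  sumBits-*ʳ m g q ≡≤ sumBits-mono m {h = λ u → hit u * (C * q) + B} pointwise ·≤
   sumBits-+ m (λ u → hit u * (C * q)) (λ _ → B) · cong₂ _+_ (sym (sumBits-*ʳ m hit (C * q))) (sumBits-const m B) ≡≤
    +-monoˡ-≤ (B * 2 ^ m) (*-monoˡ-≤ (C * q) (sumBits-single m u0) ≤≡ *-identityˡ (C * q))
  where
  hit : List Bool → ℕ
  hit u = ind (≡-dec Bool._≟_ u u0)
  decide : ∀ u → length u ≡ m → (d : Dec (u ≡ u0)) → g u * q ≤ ind d * (C * q) + B
  decide u l (yes _) = *-monoˡ-≤ q (bounded u l) ·≤ sym (*-identityˡ (C * q)) ≡≤ m≤m+n _ B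
  decide u l (no ne) = small u l ne
  pointwise : ∀ u → length u ≡ m → g u * q ≤ hit u * (C * q) + B
  pointwise u l = decide u l (≡-dec Bool._≟_ u u0)

 module Sampling (K : ℕ) where
  open RingTheory (tower K) using (Carrier; 0#; 1#; x+y≡0⇒x≡y; solve; _:=_; _:+_; _:*_; con) renaming (_+_ to _⊕_; _*_ to _⊛_)
  open IsField (tower-isField K)

  S : ℕ
  S = width K

  record MultiAffine {N} (P : (Fin N → F K) → F K) : Set where
   field
    respects : ∀ {u v} → (∀ i → u i ≡ v i) → P u ≡ P v
    affine : ∀ a c {u v w} → (∀ i → i ≢ a → u i ≡ v i) → (∀ i → i ≢ a → u i ≡ w i) → u a ≡ c ⊛ v a ⊕ (1# ⊕ c) ⊛ w a →
     P u ≡ c ⊛ P v ⊕ (1# ⊕ c) ⊛ P w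

  sample : ∀ N → List Bool → Fin N → F K
  sample (suc N) l zero = fromBits K (take S l)
  sample (suc N) l (suc i) = sample N (drop S l) i

  sample-chunk : ∀ N l i → sample N l i ≡ fromBits K (take S (drop (toℕ i * S) l))
  sample-chunk (suc N) l zero = refl
  sample-chunk (suc N) l (suc i) = sample-chunk N (drop S l) i ·
   cong (λ l → fromBits K (take S l)) (drop-drop S (toℕ i * S) l · refl)

  infixr 5 _◂_
  _◂_ : ∀ {N} → F K → (Fin N → F K) → Fin (suc N) → F K
  (t ◂ v) zero = t
  (t ◂ v) (suc i) = v i

  slice-affine : ∀ {N P} t → MultiAffine {suc N} P → MultiAffine {N} (λ v → P (t ◂ v))
  slice-affine t m = record
   { respects = λ e → respects λ { zero → refl ; (suc i) → e i }
   ; affine = λ a c e f g → affine (suc a) c (λ { zero _ → refl ; (suc i) ne → e i (ne ∘ cong suc) }) (λ { zero _ → refl ; (suc i) ne → f i (ne ∘ cong suc) }) g }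
   where open MultiAffine m

  root-unique : ∀ {N P} → MultiAffine {suc N} P → ∀ v t0 → P (t0 ◂ v) ≢ 0# → ∀ s t → P (s ◂ v) ≡ 0# → P (t ◂ v) ≡ 0# → s ≡ t
  root-unique {P = P} m v t0 nz s t e f with (s ⊕ t) ≟ 0#
  ... | yes z = x+y≡0⇒x≡y s t z
  ... | no ne = contradiction (MultiAffine.affine m zero c {t0 ◂ v} {s ◂ v} {t ◂ v}
   (λ { zero q → contradiction refl q ; (suc i) _ → refl }) (λ { zero q → contradiction refl q ; (suc i) _ → refl }) combination0 ·
   cong₂ (λ x y → c ⊛ x ⊕ (1# ⊕ c) ⊛ y) e f · solve 1 (λ c → c :* con false :+ (con true :+ c) :* con false := con false) refl c) nz
   where
   c r : F K
   r = inverse K (s ⊕ t)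
   c = (t0 ⊕ t) ⊛ r
   combination0 = sym (solve 4 (λ t0 s t r → (t0 :+ t) :* r :* s :+ (con true :+ (t0 :+ t) :* r) :* t := (t0 :+ t) :* ((s :+ t) :* r) :+ t) refl t0 s t r ·
    cong (λ z → (t0 ⊕ t) ⊛ z ⊕ t) (inverse-correct K (s ⊕ t) ne) · solve 2 (λ t0 t → (t0 :+ t) :* con true :+ t := t0) refl t0 t)

  take-++ : ∀ (u v : List Bool) → take (length u) (u ++ v) ≡ u
  take-++ [] v = refl
  take-++ (b ∷ u) v = cong (b ∷_) (take-++ u v)

  drop-++ : ∀ (u v : List Bool) → drop (length u) (u ++ v) ≡ v
  drop-++ [] v = refl
  drop-++ (b ∷ u) v = drop-++ u v

  zeros : ∀ N r → ((Fin N → F K) → F K) → ℕ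
  zeros N r P = sumBits (N * S + r) (λ l → ind (P (sample N l) ≟ 0#))

  zeros-slice : ∀ N r {P} → MultiAffine {suc N} P → zeros (suc N) r P ≡ sumBits S (λ u → zeros N r λ v → P (fromBits K u ◂ v))
  zeros-slice N r {P} m = cong (λ k → sumBits k λ l → ind (P (sample (suc N) l) ≟ 0#)) (+-assoc S (N * S) r) ·
   sumBits-++ S (N * S + r) (λ l → ind (P (sample (suc N) l) ≟ 0#)) ·
    (sumBits-cong S λ u l → sumBits-cong (N * S + r) λ v _ → cong (λ y → ind (y ≟ 0#)) (MultiAffine.respects m λ
     { zero → cong (fromBits K) (cong (λ k → take k (u ++ v)) (sym l) · take-++ u v)
     ; (suc i) → cong (λ l → sample N l i) (cong (λ k → drop k (u ++ v)) (sym l) · drop-++ u v) }))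

  -- A nonzero polynomial that is affine in each of N variables vanishes on at
  -- most a fraction of N / q of the points.
  few-zeros : ∀ N r {P} → MultiAffine {N} P → ∀ v0 → P v0 ≢ 0# → zeros N r P * 2 ^ S ≤ N * 2 ^ (N * S + r)
  few-zeros zero r {P} m v0 nz = ≤-reflexive (cong (_* 2 ^ S) ((sumBits-cong r λ l _ → never l) · sumBits-const r 0))
   where
   never : ∀ l → ind (P (sample zero l) ≟ 0#) ≡ 0
   never l with P (sample zero l) ≟ 0#
   ... | yes e = contradiction ((MultiAffine.respects m λ ()) · e) nz
   ... | no _ = refl
  few-zeros (suc N) r {P} m v0 nz = subst (λ z → z * 2 ^ S ≤ suc N * 2 ^ (suc N * S + r)) (sym (zeros-slice N r m))
   (bound (find-bits S λ u → P (fromBits K u ◂ v') ≟ 0#) ≤≡ total)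
   where
   v' = v0 ∘ suc
   R : ℕ
   R = 2 ^ (N * S + r)
   nz' : P (v0 zero ◂ v') ≢ 0#
   nz' e = nz ((MultiAffine.respects m λ { zero → refl ; (suc i) → refl }) · e)
   total = rearrange R (2 ^ S) N · cong (suc N *_) (sym (^-distribˡ-+-* 2 S (N * S + r)) · cong (2 ^_) (sym (+-assoc S (N * S) r)))
    where
    rearrange : ∀ R q N → R * q + N * R * q ≡ (1 + N) * (q * R)
    rearrange = solve-∀
   g : List Bool → ℕ
   g u = zeros N r (λ v → P (fromBits K u ◂ v))
   all-strings : ∀ u → g u ≤ R
   all-strings u = (sumBits-mono (N * S + r) {h = λ _ → 1} λ l _ → ind≤1 (P (fromBits K u ◂ sample N l) ≟ 0#)) ≤≡ sumBits-const (N * S + r) 1 · *-identityˡ R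
   generic : ∀ u → P (fromBits K u ◂ v') ≢ 0# → g u * 2 ^ S ≤ N * R
   generic u ne = few-zeros N r (slice-affine (fromBits K u) m) v' ne
   bound : (∃[ u ] (length u ≡ S × P (fromBits K u ◂ v') ≡ 0#)) ⊎ (∀ u → length u ≡ S → P (fromBits K u ◂ v') ≢ 0#) → sumBits S g * 2 ^ S ≤ R * 2 ^ S + N * R * 2 ^ S
   bound (inj₁ (u0 , l0 , e0)) = sumBits-except S g u0 R (N * R) (2 ^ S) (λ u _ → all-strings u) λ u l u#u₀ → generic u λ e →
    u#u₀ (sym (toBits-fromBits K u l) · cong (toBits K) (root-unique m v' (v0 zero) nz' _ _ e e0) · toBits-fromBits K u0 l0)
   bound (inj₂ none) = sumBits-*ʳ S g (2 ^ S) ≡≤ (sumBits-mono S {h = λ _ → N * R} λ u l → generic u (none u l)) ·≤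
    sumBits-const S (N * R) ≡≤ m≤n+m _ _

  NonvanishingAffine : ∀ {N} → ((Fin N → F K) → F K) → Set
  NonvanishingAffine P = MultiAffine P × ∃[ v ] P v ≢ 0#

  failures : ∀ {N} → List ((Fin N → F K) → F K) → (Fin N → F K) → ℕ
  failures [] v = 0
  failures (P ∷ Ps) v = ind (P v ≟ 0#) + failures Ps v

  failure : ∀ {N} (Ps : List ((Fin N → F K) → F K)) v → All (λ P → P v ≢ 0#) Ps ⊎ 1 ≤ failures Ps v
  failure [] v = inj₁ []
  failure (P ∷ Ps) v with P v ≟ 0#
  ... | yes _ = inj₂ (s≤s z≤n)
  ... | no ne with failure Ps v
  ... | inj₁ all = inj₁ (ne ∷ all)
  ... | inj₂ h = inj₂ h

  few-failures : ∀ N r (Ps : List ((Fin N → F K) → F K)) → All NonvanishingAffine Ps →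
   sumBits (N * S + r) (λ l → failures Ps (sample N l)) * 2 ^ S ≤ length Ps * (N * 2 ^ (N * S + r))
  few-failures N r [] [] = ≤-reflexive (cong (_* 2 ^ S) (sumBits-const (N * S + r) 0))
  few-failures N r (P ∷ Ps) ((m , v , nz) ∷ ps) = cong (_* 2 ^ S) (sumBits-+ (N * S + r) (λ l → ind (P (sample N l) ≟ 0#)) λ l → failures Ps (sample N l)) ·
   *-distribʳ-+ (2 ^ S) (zeros N r P) _ ≡≤
   +-mono-≤ (few-zeros N r m v nz) (few-failures N r Ps ps)

 length-filter : ∀ m {P : Pred (Vec Bool m) 0ℓ} (P? : Decidable P) (f : List Bool → ℕ) → (∀ ω → ¬ P ω → 1 ≤ f (toList ω)) →
  2 ^ m ≤ length (filter P? (allCoins m)) + sumBits m f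
 length-filter zero P? f h with P? []
 ... | yes _ = s≤s z≤n
 ... | no np = h [] np
 length-filter (suc m) {P} P? f h = begin
  2 ^ m + (2 ^ m + 0) ≡⟨ cong (2 ^ m +_) (+-identityʳ (2 ^ m)) ⟩
  2 ^ m + 2 ^ m ≤⟨ +-mono-≤ (length-filter m (P? ∘ (false ∷_)) (f ∘ (false ∷_)) λ ω → h (false ∷ ω))
   (length-filter m (P? ∘ (true ∷_)) (f ∘ (true ∷_)) λ ω → h (true ∷ ω)) ⟩
  (a + sumBits m (f ∘ (false ∷_))) + (b + sumBits m (f ∘ (true ∷_))) ≡⟨ interchange a _ b _ ⟩
  (a + b) + sumBits (suc m) f ≡⟨ cong (_+ sumBits (suc m) f) (sym counts) ⟩
  length (filter P? (allCoins (suc m))) + sumBits (suc m) f ∎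
  where
  open ≤-Reasoning
  a = length (filter (P? ∘ (false ∷_)) (allCoins m))
  b = length (filter (P? ∘ (true ∷_)) (allCoins m))
  interchange : ∀ a b c d → a + b + (c + d) ≡ a + c + (b + d)
  interchange = solve-∀
  filter-map : ∀ x (l : List (Vec Bool m)) → length (filter P? (map (x ∷_) l)) ≡ length (filter (P? ∘ (x ∷_)) l)
  filter-map x [] = refl
  filter-map x (ω ∷ l) with P? (x ∷ ω)
  ... | yes _ = cong suc (filter-map x l)
  ... | no _ = filter-map x l
  counts = cong length (filter-++ P? (map (false ∷_) (allCoins m)) _) · length-++ (filter P? (map (false ∷_) (allCoins m))) ·
   (cong₂ _+_ (filter-map false (allCoins m)) (filter-map true (allCoins m)))

module Stage where
 open GraphPoly
 open Tower
 open Lang hiding (keep; N; W; fold)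
 open Fills
 open Algo
 open Vander
 open Chain
 open Walk
 open Prob

 open import Data.Bool using (T)
 open import Data.Bool.Properties using (∧-identityʳ; ∧-zeroʳ)
 open import Data.Fin using (combine)
 open import Data.List using (tabulate)
 open import Data.List.Properties using (length-++; length-tabulate)
 open import Data.Nat using (_≤_)
 open import Data.Nat.Divisibility using (_∣_; _∣?_)
 open import Data.Nat.GeneralisedArithmetic using (fold)
 open import Relation.Binary.Definitions using (tri<; tri≈; tri>)

 module Phases (K n' : ℕ) (n<q : suc n' < 2 ℕ.^ width K) where
  open Vandermonde K n' n<q public

  ifzero-yes : ∀ {x} y z → x ≡ 0# → ifzero x y z ≡ y
  ifzero-yes {x} y z e with x ≟ 0#
  ... | yes _ = refl
  ... | no ne = contradiction e ne

  ifzero-no : ∀ {x} y z → x ≢ 0# → ifzero x y z ≡ z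
  ifzero-no {x} y z ne with x ≟ 0#
  ... | yes e = contradiction e ne
  ... | no _ = refl

  first : (Fin n → F K) → Fin n → F K
  first s u = ifzero (s u) 0# (iter (λ m x → x * (if toℕ u ≤ᵇ toℕ m then 1# else ifzero (s m) 1# 0#)) 1#)

  product-one : ∀ {m} (f : Fin m → F K) → (∀ i → f i ≡ 1#) → iter (λ i x → x * f i) 1# ≡ 1#
  product-one {zero} f e = refl
  product-one {suc m} f e = cong₂ _*_ (product-one (f ∘ suc) (e ∘ suc)) (e zero) · *-identityʳ 1#

  product-zero : ∀ {m} (f : Fin m → F K) i → f i ≡ 0# → iter (λ i x → x * f i) 1# ≡ 0#
  product-zero {suc m} f zero e = cong (iter (λ i x → x * f (suc i)) 1# *_) e · zeroʳ _
  product-zero {suc m} f (suc i) e = cong (_* f zero) (product-zero (f ∘ suc) i e) · zeroˡ _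

  first-none : ∀ s → (∀ u → s u ≡ 0#) → ∀ u → first s u ≡ 0#
  first-none s none u = ifzero-yes _ _ (none u)

  first-≡ : ∀ s u0 → s u0 ≢ 0# → (∀ v → toℕ v < toℕ u0 → s v ≡ 0#) → ∀ u → first s u ≡ δ u0 u
  first-≡ s u0 nz below u = at (u0 Fin.≟ u)
   where
   not-first : u0 ≢ u → (if toℕ u ≤ᵇ toℕ u0 then 1# else ifzero (s u0) 1# 0#) ≡ 0# ⊎ s u ≡ 0#
   not-first u0#u with toℕ u ≤ᵇ toℕ u0 in e
   ... | false = inj₁ (ifzero-no _ _ nz)
   ... | true = inj₂ (below u (ℕ.≤∧≢⇒< (ℕ.≤ᵇ⇒≤ _ _ (subst T (sym e) tt)) λ q → u0#u (Fin.toℕ-injective (sym q))))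
   factor : ∀ m → (if toℕ u0 ≤ᵇ toℕ m then 1# else ifzero (s m) 1# 0#) ≡ 1#
   factor m with toℕ u0 ≤ᵇ toℕ m in e
   ... | true = refl
   ... | false = ifzero-yes _ _ (below m (ℕ.≰⇒> λ le → subst T e (ℕ.≤⇒≤ᵇ le)))
   at : Dec (u0 ≡ u) → first s u ≡ δ u0 u
   at (yes refl) = ifzero-no _ _ nz · product-one _ factor · sym (δ-same u0)
   at (no u0#u) = by-cases (s u ≟ 0#) (not-first u0#u) · sym (δ-diff u0#u)
    where
    by-cases : Dec (s u ≡ 0#) → (if toℕ u ≤ᵇ toℕ u0 then 1# else ifzero (s u0) 1# 0#) ≡ 0# ⊎ s u ≡ 0# → first s u ≡ 0#
    by-cases (yes e) _ = ifzero-yes _ _ e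
    by-cases (no ne) (inj₁ f) = ifzero-no _ _ ne · product-zero (λ m → if toℕ u ≤ᵇ toℕ m then 1# else ifzero (s m) 1# 0#) u0 f
    by-cases (no ne) (inj₂ e) = contradiction e ne

  Holds : (Arrays → Set) → Store → Set
  Holds P s = ∃[ A ] (arrs s ≈ A × P A)

  ρ0 : Env
  ρ0 _ = zero

  body-correct : ∀ fs v s → T (legal-body fs) → arrs (⟦ body fs ⟧ (env v) s) ≈ assigns fs v (arrs s) × outp (⟦ body fs ⟧ (env v) s) ≡ outp s
  body-correct (f ∷ fs) v s t = fills-correct f fs v s (legal⁺ (f ∷ fs) t)

  record Triple (P : Store → Set) (c : Cmd 0) (Q : Store → Set) : Set where
   constructor triple
   field
    after : ∀ s → P s → Q (⟦ c ⟧ ρ0 s)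

  open Triple public

  infixr 5 _⨟_
  _⨟_ : ∀ {P Q R c d} → Triple P c Q → Triple Q d R → Triple P (c ⨾ d) R
  triple h ⨟ triple k = triple λ s p → k _ (h s p)

  weaken : ∀ {P P' Q c} → (∀ s → P' s → P s) → Triple P c Q → Triple P' c Q
  weaken i (triple h) = triple λ s p → h s (i s p)

  Quiet : (Arrays → Set) → Store → Set
  Quiet P s = Holds P s × outp s ≡ []

  Quiet-map : ∀ {P Q : Arrays → Set} → (∀ A → P A → Q A) → ∀ s → Quiet P s → Quiet Q s
  Quiet-map f s ((A , e , p) , o) = (A , e , f A p) , o

  run-quiet : ∀ {I Q c} → Triple (Quiet I) c Q → ∀ A → I A → Q (⟦ c ⟧ ρ0 store⟨ A , [] ⟩)
  run-quiet t A i = after t store⟨ A , [] ⟩ ((A , (λ a i j k → refl) , i) , refl)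

  loop : ∀ fs (P : ℕ → Arrays → Set) → T (legal-body fs) → (∀ v A → P (suc (toℕ v)) A → P (toℕ v) (assigns fs v A)) →
   Triple (Quiet (P n)) (for (body fs)) (Quiet (P 0))
  loop fs P t step = triple λ s h → descend (λ m → Quiet (P m) (iter-from m g s)) (subst (Quiet (P n)) (sym (iter-from-end n g s)) h) (down s) 0 z≤n
   where
   g : Fin n → Store → Store
   g v = ⟦ body fs ⟧ (env v)
   down : ∀ s v → Quiet (P (suc (toℕ v))) (iter-from (suc (toℕ v)) g s) → Quiet (P (toℕ v)) (iter-from (toℕ v) g s)
   down s v ((A , e , p) , o) = subst (Quiet (P (toℕ v))) (sym (iter-from-step v g s))
    ( (assigns fs v A , (λ a i j k → proj₁ done a i j k · assigns-cong fs v e a i j k) , step v A p)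
    , proj₂ done · o)
    where
    done = body-correct fs v (iter-from (suc (toℕ v)) g s) t

  loop-once : ∀ fs (I Q : Arrays → Set) → T (legal-body fs) → (∀ v A → I A → I (assigns fs v A) × Q (assigns fs v A)) →
   Triple (Quiet I) (for (body fs)) (Quiet λ A → I A × Q A)
  loop-once fs I Q t step = triple λ s h → Quiet-map (λ A (i , q) → i , q (s≤s z≤n)) _
   (after (loop fs (λ m A → I A × (m < n → Q A)) t λ v A (i , _) → let i' , q = step v A i in i' , λ _ → q) s
    (Quiet-map (λ A i → i , λ n<n → contradiction refl (ℕ.<⇒≢ n<n)) s h))

  assigns-++ : ∀ fs gs v A → assigns (fs ++ gs) v A ≡ assigns gs v (assigns fs v A)
  assigns-++ [] gs v A = refl
  assigns-++ (f ∷ fs) gs v A = assigns-++ fs gs v (assign f v A)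

  assigns-++₂ : ∀ (P : Arrays → Set) fs gs v A → (∀ A1 → A1 ≡ assigns fs v A → P (assigns gs v A1)) → P (assigns (fs ++ gs) v A)
  assigns-++₂ P fs gs v A h = subst P (sym (assigns-++ fs gs v A)) (h (assigns fs v A) refl)

  Point-rows : ∀ (G H : Digraph n) x i y j k → mat (splice G i H) x y j k ≡ (mat H x y [ i ← mat G x y i ]) j k
  Point-rows G H x i y j k = at (j Fin.≟ i)
   where
   at : Dec (j ≡ i) → _
   at (yes refl) = cong (λ b → δ j k + y * (if b then x j k else 0#)) (splice-same G j H k) · sym (←-same (mat H x y) j (mat G x y j) k)
   at (no j#i) = cong (λ b → δ j k + y * (if b then x j k else 0#)) (splice-diff G H k j#i) · sym (←-diff (mat H x y) (mat G x y i) k j#i)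

  cells= : ∀ {A A' : Arrays} → A' ≡ A → ∀ a i j k → A' a i j k ≡ A a i j k
  cells= refl _ _ _ _ = refl

  Point-carry : ∀ {A A' p B} → (∀ j k → A' 3 p j k ≡ A 3 p j k) → (∀ j k → A' 4 p j k ≡ A 4 p j k) → A' 7 p zero zero ≡ A 7 p zero zero →
   A' 6 p zero zero ≡ A 6 p zero zero → Point A p B → Point A' p B
  Point-carry {A} {A'} {p} {B} m i o d (mkPoint m' i' o' d') = mkPoint (λ j k → m j k · m' j k)
   (record { AN = λ j l → (sum-cong-≗ λ k → cong (B j k *_) (i k l)) · Inverses.AN i' j l
    ; NA = λ j l → (sum-cong-≗ λ k → cong (_* B k l) (i j k)) · Inverses.NA i' j l })
   (o · o') (d · d')

  row-update : ∀ (G H : Digraph n) x i A p → (∀ l → A 2 i l zero ≡ masked G x i l) → Point A p (mat H x (point p)) →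
   Det (mat (splice G i H) x (point p)) ≢ 0# → Point (assigns (rowFills ++ updateFills) i A) p (mat (splice G i H) x (point p))
  row-update G H x i A p row= P det≢0 = Point-cong (λ j k → sym (Point-rows G H x i (point p) j k))
   (update-point i (assigns rowFills i A) p (mat H x (point p))
    (mkPoint (Point.matrix P) (Point.inverses P) (Point.odd= P) (Point.det= P))
    (mat G x (point p) i)
    (λ l → cong₂ (λ d e → d + point p * e) (if-δ i l) (row= l))
    λ e → det≢0 (Det-cong (Point-rows G H x i (point p)) · e))

  data FirstNonzero (s : Fin n → F K) : Set where
   vanishing : (∀ u → s u ≡ 0#) → FirstNonzero s
   firstAt : ∀ u → s u ≢ 0# → (∀ w → toℕ w < toℕ u → s w ≡ 0#) → FirstNonzero s

  firstNonzero : ∀ s → FirstNonzero s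
  firstNonzero s with Fin.any? (λ u → ¬? (s u ≟ 0#))
  ... | yes p = let u , nz , below = least-Fin (λ u → ¬? (s u ≟ 0#)) p in firstAt u nz λ w w<u → decide (s w ≟ 0#) (below w w<u)
   where
   decide : ∀ {y} → Dec (y ≡ 0#) → ¬ ¬ (y ≡ 0#) → y ≡ 0#
   decide (yes e) _ = e
   decide (no ne) h = contradiction ne h
  ... | no ¬p = vanishing λ u → decide (s u ≟ 0#) λ ne → ¬p (u , ne)
   where
   decide : ∀ {y} → Dec (y ≡ 0#) → ¬ ¬ (y ≡ 0#) → y ≡ 0#
   decide (yes e) _ = e
   decide (no ne) h = contradiction ne h

  index : ∀ {s} → Fin n → FirstNonzero s → Fin n
  index d (vanishing _) = d
  index d (firstAt u _ _) = u

  nonempty : ∀ {s} → FirstNonzero s → F K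
  nonempty (vanishing _) = 0#
  nonempty (firstAt _ _ _) = 1#

  sum-first : ∀ s (p : FirstNonzero s) → sum (first s) ≡ nonempty p
  sum-first s (vanishing z) = sum-zero _ (first-none s z)
  sum-first s (firstAt u nz below) = (sum-single (first s) u λ w w#u → first-≡ s u nz below w · δ-diff (w#u ∘ sym)) ·
   first-≡ s u nz below u · δ-same u

  first-index : ∀ s d (p : FirstNonzero s) u → first s u + (1# + sum (first s)) * δ d u ≡ δ (index d p) u
  first-index s d p u = cong (λ z → first s u + (1# + z) * δ d u) (sum-first s p) · by-cases p
   where
   by-cases : (p : FirstNonzero s) → first s u + (1# + nonempty p) * δ d u ≡ δ (index d p) u
   by-cases (vanishing z) = cong (_+ (1# + 0#) * δ d u) (first-none s z u) · solve 1 (λ d → con false :+ (con true :+ con false) :* d := d) refl (δ d u)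
   by-cases (firstAt w nz below) = cong (_+ (1# + 1#) * δ d u) (first-≡ s w nz below u) · solve 2 (λ e d → e :+ (con true :+ con true) :* d := e) refl (δ w u) (δ d u)

  first-cong : ∀ {s s'} → (∀ u → s u ≡ s' u) → ∀ u → first s u ≡ first s' u
  first-cong {s} {s'} e u = cong (λ z → ifzero z 0# (iter (λ m x → x * (if toℕ u ≤ᵇ toℕ m then 1# else ifzero (s m) 1# 0#)) 1#)) (e u) ·
   cong (ifzero (s' u) 0#) (iter-cong 1# λ m x → cong (λ z → x * (if toℕ u ≤ᵇ toℕ m then 1# else ifzero z 1# 0#)) (e m))

  iter-idle : ∀ {S : Set} {m} (g : Fin m → S → S) s → (∀ v → g v s ≡ s) → iter g s ≡ s
  iter-idle {m = zero} g s e = refl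
  iter-idle {m = suc m} g s e = cong (g zero) (iter-idle (g ∘ suc) s (e ∘ suc)) · e zero

  iter-one : ∀ {S : Set} {m} (g : Fin m → S → S) u s → (∀ v → v ≢ u → g v s ≡ s × g v (g u s) ≡ g u s) → iter g s ≡ g u s
  iter-one g zero s e = cong (g zero) (iter-idle (g ∘ suc) s λ v → proj₁ (e (suc v) λ ()))
  iter-one g (suc u) s e = cong (g zero) (iter-one (g ∘ suc) u s λ v v#u → e (suc v) (v#u ∘ Fin.suc-injective)) · proj₂ (e zero λ ())

  emit-0 : ∀ {Γ} (e : Exp Γ) i ρ s → ⟦ e ⟧E ρ (arrs s) ≡ 0# → ⟦ emit e i ⟧ ρ s ≡ s
  emit-0 e i ρ s z with ⟦ e ⟧E ρ (arrs s) ≟ 0#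
  ... | yes _ = refl
  ... | no ne = contradiction z ne

  emit-1 : ∀ {Γ} (e : Exp Γ) i ρ s → ⟦ e ⟧E ρ (arrs s) ≡ 1# → ⟦ emit e i ⟧ ρ s ≡ store⟨ arrs s , outp s ∷ʳ ⟦ i ⟧I ρ ⟩
  emit-1 e i ρ s z with ⟦ e ⟧E ρ (arrs s) ≟ 0#
  ... | yes q = contradiction (sym z · q) 1≢0
  ... | no _ = refl

  emissions : Cmd 1
  emissions = for (emit (arr0 $alive *E arr1 $pos v1) v1)

  emissions-0 : ∀ v s → arrs s 37 zero zero zero ≡ 0# → ⟦ emissions ⟧ (env v) s ≡ s
  emissions-0 v s e = iter-idle (λ u → ⟦_⟧ {2} (emit (arr0 $alive *E arr1 $pos v1) v1) (env v [ 1 ↦ u ])) s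
   λ u → emit-0 {2} (arr0 $alive *E arr1 $pos v1) v1 (env v [ 1 ↦ u ]) s (cong (_* arrs s 28 u zero zero) e · zeroˡ _)

  emissions-1 : ∀ v s u → arrs s 37 zero zero zero ≡ 1# → (∀ w → arrs s 28 w zero zero ≡ δ u w) → ⟦ emissions ⟧ (env v) s ≡ store⟨ arrs s , outp s ∷ʳ u ⟩
  emissions-1 v s u e pos = (iter-one g u s λ w w#u → idle w s (value w w#u) , cong (g w) here' · idle w _ (value w w#u) · sym here') · here'
   where
   g : Fin n → Store → Store
   g w = ⟦_⟧ {2} (emit (arr0 $alive *E arr1 $pos v1) v1) (env v [ 1 ↦ w ])
   idle : ∀ w s → arrs s 37 zero zero zero * arrs s 28 w zero zero ≡ 0# → g w s ≡ s
   idle w s = emit-0 {2} (arr0 $alive *E arr1 $pos v1) v1 (env v [ 1 ↦ w ]) s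
   value : ∀ w → w ≢ u → arrs s 37 zero zero zero * arrs s 28 w zero zero ≡ 0#
   value w w#u = cong (arrs s 37 zero zero zero *_) (pos w · δ-diff (w#u ∘ sym)) · zeroʳ _
   here' = emit-1 {2} (arr0 $alive *E arr1 $pos v1) v1 (env v [ 1 ↦ u ]) s (cong₂ _*_ e (pos u · δ-same u) · *-identityʳ 1#)

  index-spec : ∀ {s} d (p : FirstNonzero s) → index d p ≡ d ⊎ s (index d p) ≢ 0#
  index-spec d (vanishing _) = inj₁ refl
  index-spec d (firstAt u nz _) = inj₂ nz

  index-unique : ∀ {s} d (p : FirstNonzero s) u → s u ≢ 0# → (∀ w → s w ≢ 0# → w ≡ u) → index d p ≡ u
  index-unique d (vanishing z) u nz unique = contradiction (z u) nz
  index-unique d (firstAt w nw _) u nz unique = unique w nw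

  nonempty≢0 : ∀ {s} (p : FirstNonzero s) {u} → s u ≢ 0# → nonempty p ≢ 0#
  nonempty≢0 (vanishing z) nz = contradiction (z _) nz
  nonempty≢0 (firstAt _ _ _) nz = 1≢0

  nonempty-0 : ∀ {s} (p : FirstNonzero s) → (∀ u → s u ≡ 0#) → nonempty p ≡ 0#
  nonempty-0 (vanishing z) _ = refl
  nonempty-0 (firstAt u nz _) z = contradiction (z u) nz

  index-nonzero : ∀ {s} d (p : FirstNonzero s) {u} → s u ≢ 0# → s (index d p) ≢ 0#
  index-nonzero d (vanishing z) nz = contradiction (z _) nz
  index-nonzero d (firstAt _ nw _) nz = nw

  endgame : Cmd 0
  endgame = for (body walkInitFills) ⨾ for (body walkFills) ⨾ for (body prepareFills) ⨾ for (emissions ⨾ body followFills)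

  module Following (X : Fin n → Fin n → F K) where
   row : ∀ i → FirstNonzero (X i)
   row i = firstNonzero (X i)
   next : Fin n → Fin n
   next i = index i (row i)
   deg : Fin n → F K
   deg i = sum (first (X i))
   start : Fin n
   start = index zero (firstNonzero deg)
   open Orbit next public
   record Walking (t : ℕ) (A : Arrays) : Set where
    constructor walking
    field
     nexts : ∀ i u → A 25 i u zero ≡ δ (next i) u
     starts : ∀ u → A 27 u zero zero ≡ δ start u
     position : ∀ u → A 28 u zero zero ≡ δ (fold start next t) u
   data Status (t : ℕ) (done ok : F K) : Set where
    pending : (∀ i → 0 < i → i ≤ t → fold start next i ≢ start) → done ≡ 0# → ok ≡ 0# → Status t done ok
    returned : ∀ L → FirstReturn start L → L ≤ t → done ≡ 1# → ok ≡ 1# + par L → Status t done ok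
   Walked : ℕ → Arrays → Set
   Walked t A = Walking t A × A 31 zero zero zero ≡ par t × Status t (A 33 zero zero zero) (A 35 zero zero zero)
   module _ {t A} (w : Walking t A) where
    open Walking w
    step-position : ∀ u → iter (λ v x → x + A 28 v zero zero * A 25 v u zero) 0# ≡ δ (fold start next (suc t)) u
    step-position u = iter-sum _ · (sum-cong-≗ λ v → cong₂ _*_ (position v) (nexts v u)) · sum-δˡ (fold start next t) (λ v → δ (next v) u)
    step-hit = iter-sum _ · (sum-cong-≗ λ u → cong₂ _*_ (step-position u) (starts u)) · sum-δˡ (fold start next (suc t)) (δ start)
   init-walk : ∀ v A → (∀ i u → A 2 i u zero ≡ X i u) → let A' = assigns walkInitFills v A in (∀ i u → A' 2 i u zero ≡ X i u) × Walked 0 A'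
   init-walk v A X= = X= , walking
    (λ i u → (cong₂ _+_ (first-cong (X= i) u) (cong₂ _*_ (cong (1# +_) (deg= i)) (if-δ i u))) · first-index (X i) i (row i) u)
    starts starts , refl , pending (λ i 0<i i≤0 → contradiction 0<i (ℕ.≤⇒≯ i≤0)) refl refl
    where
    A' = assigns walkInitFills v A
    deg' : Fin n → F K
    deg' i = iter (λ u x → x + first (λ u → A 2 i u zero) u) 0#
    deg= : ∀ i → deg' i ≡ deg i
    deg= i = iter-sum _ · sum-cong-≗ (first-cong (X= i))
    starts : ∀ u → A' 27 u zero zero ≡ δ start u
    starts u = cong₂ _+_ (first-cong deg= u) (cong₂ _*_ (cong (1# +_) (iter-sum _ · sum-cong-≗ (first-cong deg=))) (if-δ zero u)) · first-index deg zero (firstNonzero deg) u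
   status-step : ∀ t d o h p → h ≡ δ start (fold start next (suc t)) → p ≡ par t → Status t d o → Status (suc t) (d + (1# + d) * h) (o + (1# + d) * h * (1# + (1# + p)))
   status-step t d o h p h= p= (returned L fr L≤t d= o=) = returned L fr (ℕ.m≤n⇒m≤1+n L≤t)
    (cong (λ d → d + (1# + d) * h) d= · solve 1 (λ h → con true :+ (con true :+ con true) :* h := con true) refl h)
    (cong (λ d → o + (1# + d) * h * (1# + (1# + p))) d= ·
     solve 3 (λ o h p → o :+ (con true :+ con true) :* h :* p := o) refl o h (1# + (1# + p)) · o=)
   status-step t d o h p h= p= (pending before d= o=) = decide (start Fin.≟ fold start next (suc t))
    where
    extend : start ≢ fold start next (suc t) → ∀ i → 0 < i → i < suc t ⊎ i ≡ suc t → fold start next i ≢ start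
    extend ne i 0<i (inj₁ i<) q = before i 0<i (ℕ.≤-pred i<) q
    extend ne i 0<i (inj₂ refl) q = ne (sym q)
    decide : Dec (start ≡ fold start next (suc t)) → Status (suc t) (d + (1# + d) * h) (o + (1# + d) * h * (1# + (1# + p)))
    decide (yes e) = returned (suc t) (firstReturn (s≤s z≤n) (sym e) λ i 0<i i< → before i 0<i (ℕ.≤-pred i<)) ℕ.≤-refl
     (cong₂ (λ d h → d + (1# + d) * h) d= h=1 · solve 0 (con false :+ (con true :+ con false) :* con true := con true) refl)
     (cong₂ (λ o z → o + z) o= (cong₂ (λ z p → z * (1# + (1# + p))) (cong₂ (λ d h → (1# + d) * h) d= h=1) p=) ·
      solve 1 (λ p → con false :+ (con true :+ con false) :* con true :* (con true :+ p) := con true :+ p) refl (1# + par t))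
     where
     h=1 : h ≡ 1#
     h=1 = h= · cong (δ start) (sym e) · δ-same start
    decide (no ne) = pending (λ i 0<i i≤ → extend ne i 0<i (ℕ.m≤n⇒m<n∨m≡n i≤))
     (cong₂ (λ d h → d + (1# + d) * h) d= h=0 · solve 0 (con false :+ (con true :+ con false) :* con false := con false) refl)
     (cong₂ (λ o z → o + z) o= (cong (_* (1# + (1# + p))) (cong₂ (λ d h → (1# + d) * h) d= h=0)) ·
      solve 1 (λ p → con false :+ (con true :+ con false) :* con false :* p := con false) refl (1# + (1# + p)))
     where
     h=0 : h ≡ 0#
     h=0 = h= · δ-diff ne
   walk-step : ∀ v t A → Walked t A → Walked (suc t) (assigns walkFills v A)
   walk-step v t A (w , parity , status) = walking (Walking.nexts w) (Walking.starts w) (step-position w) , cong (1# +_) parity ,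
    status-step t (A 33 zero zero zero) (A 35 zero zero zero) _ (A 31 zero zero zero) (step-hit w) parity status
   data Alive (t : ℕ) (alive : F K) (out : List (Fin n)) : Set where
    silent : (∀ L → FirstReturn start L → L ≤ n → ¬ 2 ∣ L) → alive ≡ 0# → out ≡ [] → Alive t alive out
    running : ∀ L → FirstReturn start L → L ≤ n → 2 ∣ L → t < L → alive ≡ 1# → out ≡ trail start t → Alive t alive out
    finished : ∀ L → FirstReturn start L → 2 ∣ L → alive ≡ 0# → out ≡ trail start L → Alive t alive out
   first-return-unique : ∀ {a L L'} → FirstReturn a L → FirstReturn a L' → L ≡ L'
   first-return-unique {L = L} {L'} (firstReturn p r e) (firstReturn p' r' e') with ℕ.<-cmp L L'
   ... | tri< l _ _ = contradiction r (e' L p l)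
   ... | tri≈ _ q _ = q
   ... | tri> _ _ l = contradiction r' (e L' p' l)
   Ready : Arrays → Set
   Ready A = (∀ i u → A 25 i u zero ≡ δ (next i) u) × (∀ u → A 27 u zero zero ≡ δ start u) × Status n (A 33 zero zero zero) (A 35 zero zero zero)
   prepare : ∀ v A → Ready A → let A' = assigns prepareFills v A in Ready A' × Walking 0 A' × Alive 0 (A' 37 zero zero zero) []
   prepare v A (nexts , starts , status) = (nexts , starts , status) , walking nexts starts starts , alive status
    where
    ok = A 35 zero zero zero
    alive : Status n (A 33 zero zero zero) ok → Alive 0 ok []
    alive (pending before _ o) = silent (λ L fr L≤n → contradiction (FirstReturn.returns fr) (before L (FirstReturn.positive fr) L≤n)) o refl
    alive (returned L fr L≤n _ o) with 2 ∣? L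
    ... | yes even = running L fr L≤n even (FirstReturn.positive fr) (o · cong (1# +_) (par-even L even) · +-identityʳ 1#) refl
    ... | no odd = silent (λ L' fr' _ even → odd (subst (2 ∣_) (first-return-unique fr' fr) even)) (o · cong (1# +_) (par-odd L odd) · x+x≡0 1#) refl
   emitted : F K → ℕ → List (Fin n) → List (Fin n)
   emitted alive t out with alive ≟ 0#
   ... | yes _ = out
   ... | no _ = out ∷ʳ fold start next t
   emitted-0 : ∀ {alive} t out → alive ≡ 0# → emitted alive t out ≡ out
   emitted-0 {alive} t out e with alive ≟ 0#
   ... | yes _ = refl
   ... | no ne = contradiction e ne
   emitted-1 : ∀ {alive} t out → alive ≡ 1# → emitted alive t out ≡ out ∷ʳ fold start next t
   emitted-1 {alive} t out e with alive ≟ 0#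
   ... | yes z = contradiction (sym e · z) 1≢0
   ... | no _ = refl
   alive-step : ∀ t a out h → h ≡ δ start (fold start next (suc t)) → Alive t a out → Alive (suc t) (a * (1# + h)) (emitted a t out)
   alive-step t a out h h= (silent none e o) = silent none (cong (_* (1# + h)) e · zeroˡ _) (emitted-0 t out e · o)
   alive-step t a out h h= (finished L fr even e o) = finished L fr even (cong (_* (1# + h)) e · zeroˡ _) (emitted-0 t out e · o)
   alive-step t a out h h= (running L fr L≤n even t<L e o) = decide (ℕ.m≤n⇒m<n∨m≡n t<L)
    where
    longer = emitted-1 t out e · cong (_∷ʳ fold start next t) o · sym (trail-∷ʳ start t)
    decide : suc t < L ⊎ suc t ≡ L → Alive (suc t) (a * (1# + h)) (emitted a t out)
    decide (inj₁ t+1<L) = running L fr L≤n even t+1<L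
     (cong₂ (λ a h → a * (1# + h)) e (h= · (δ-diff λ q → FirstReturn.earliest fr (suc t) (s≤s z≤n) t+1<L (sym q))) · solve 0 (con true :* (con true :+ con false) := con true) refl) longer
    decide (inj₂ refl) = finished L fr even
     (cong₂ (λ a h → a * (1# + h)) e (h= · cong (δ start) (FirstReturn.returns fr) · δ-same start) · solve 0 (con true :* (con true :+ con true) := con false) refl) longer
   follow-step : ∀ v t A out → Walking t A → Alive t (A 37 zero zero zero) out → let A' = assigns followFills v A in
    Walking (suc t) A' × Alive (suc t) (A' 37 zero zero zero) (emitted (A 37 zero zero zero) t out)
   follow-step v t A out w alive = walking (Walking.nexts w) (Walking.starts w) (step-position w) ,
    alive-step t (A 37 zero zero zero) out _ (step-hit w) alive
   data Outcome (out : List (Fin n)) : Set where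
    nothing-found : (∀ L → FirstReturn start L → L ≤ n → ¬ 2 ∣ L) → out ≡ [] → Outcome out
    found : ∀ L → FirstReturn start L → 2 ∣ L → out ≡ trail start L → Outcome out
   outcome : ∀ {alive out} → Alive n alive out → Outcome out
   outcome (silent none _ o) = nothing-found none o
   outcome (running L _ L≤n _ n<L _ _) = contradiction n<L (ℕ.≤⇒≯ L≤n)
   outcome (finished L fr even _ o) = found L fr even o
   later : ∀ (v : Fin n) → n ∸ toℕ v ≡ suc (n ∸ suc (toℕ v))
   later v = ℕ.+-∸-assoc 1 (Fin.toℕ<n v)
   end : n ∸ n ≡ 0
   end = ℕ.n∸n≡0 n
   follow : ∀ fs → T (legal-body fs) →
    (∀ v t A out → Walking t A → Alive t (A 37 zero zero zero) out → Walking (suc t) (assigns fs v A) × Alive (suc t) (assigns fs v A 37 zero zero zero) (emitted (A 37 zero zero zero) t out)) →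
    ∀ s A → arrs s ≈ A → Walking 0 A → Alive 0 (A 37 zero zero zero) (outp s) → Outcome (outp (⟦ for (emissions ⨾ body fs) ⟧ ρ0 s))
   follow fs legal-fs follow-step s A e w a = let _ , _ , _ , alive = descend (λ m → P m (iter-from m g s)) base down 0 z≤n in outcome alive
    where
    g : Fin n → Store → Store
    g v = ⟦ emissions ⨾ body fs ⟧ (env v)
    P : ℕ → Store → Set
    P m s = ∃[ A ] (arrs s ≈ A × Walking (n ∸ m) A × Alive (n ∸ m) (A 37 zero zero zero) (outp s))
    base = subst (P n) (sym (iter-from-end n g s)) (A , e , subst (λ t → Walking t A) (sym end) w , subst (λ t → Alive t (A 37 zero zero zero) (outp s)) (sym end) a)
    down : ∀ v → P (suc (toℕ v)) (iter-from (suc (toℕ v)) g s) → P (toℕ v) (iter-from (toℕ v) g s)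
    down v (A , e , w , a) = subst (P (toℕ v)) (sym (iter-from-step v g s))
     ( A'
     , (λ i j k l → proj₁ done i j k l · assigns-cong fs v (λ i j k l → cong (λ s → arrs s i j k l) emission · e i j k l) i j k l)
     , subst (λ t → Walking t A') (sym (later v)) (proj₁ stepped)
     , subst (λ t → Alive t (A' 37 zero zero zero) (outp (g v s0))) (sym (later v)) (subst (Alive (suc t) (A' 37 zero zero zero)) (sym (proj₂ done · cong outp emission)) (proj₂ stepped)) )
     where
     s0 = iter-from (suc (toℕ v)) g s
     t = n ∸ suc (toℕ v)
     A' = assigns fs v A
     s1 = store⟨ arrs s0 , emitted (A 37 zero zero zero) t (outp s0) ⟩
     stepped = follow-step v t A (outp s0) w a
     emission = by-cases a
      where
      none' : A 37 zero zero zero ≡ 0# → ⟦ emissions ⟧ (env v) s0 ≡ s1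
      none' z = emissions-0 v s0 (e _ _ _ _ · z) · (cong store⟨ arrs s0 ,_⟩ (sym (emitted-0 t (outp s0) z)))
      by-cases : Alive t (A 37 zero zero zero) (outp s0) → ⟦ emissions ⟧ (env v) s0 ≡ s1
      by-cases (silent _ z _) = none' z
      by-cases (finished _ _ _ z _) = none' z
      by-cases (running _ _ _ _ _ z _) = emissions-1 v s0 (fold start next t) (e _ _ _ _ · z) (λ u → e _ _ _ _ · Walking.position w u) ·
       (cong store⟨ arrs s0 ,_⟩ (sym (emitted-1 t (outp s0) z)))
     done = body-correct fs v (⟦ emissions ⟧ (env v) s0) legal-fs
   Start : Arrays → Set
   Start A = ∀ i u → A 2 i u zero ≡ X i u
   walk-stage : ∀ v A → Walked (n ∸ suc (toℕ v)) A → Walked (n ∸ toℕ v) (assigns walkFills v A)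
   walk-stage v A w = subst (λ t → Walked t (assigns walkFills v A)) (sym (later v)) (walk-step v (n ∸ suc (toℕ v)) A w)
   Armed : Arrays → Set
   Armed A = Walking 0 A × Alive 0 (A 37 zero zero zero) []
   init-triple = loop-once walkInitFills Start (Walked 0) tt init-walk
   walk-triple = loop walkFills (λ m → Walked (n ∸ m)) tt walk-stage
   prepare-triple = loop-once prepareFills Ready Armed tt prepare
   follow-triple : Triple (Quiet λ A → Ready A × Armed A) (for (emissions ⨾ body followFills)) (λ s → Outcome (outp s))
   follow-triple = triple λ { s ((A , e , _ , w , alive) , o) → follow followFills tt follow-step s A e w (subst (Alive 0 (A 37 zero zero zero)) (sym o) alive) }
   walked : ∀ A → Start A × Walked 0 A → Walked (n ∸ n) A
   walked A (_ , w) = subst (λ t → Walked t A) (sym end) w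
   ready : ∀ A → Walked n A → Ready A
   ready A (w , _ , status) = Walking.nexts w , Walking.starts w , status
   endgame-triple : Triple (Quiet Start) endgame (λ s → Outcome (outp s))
   endgame-triple = init-triple ⨟ weaken (Quiet-map walked) walk-triple ⨟ weaken (Quiet-map ready) prepare-triple ⨟ follow-triple

  module Analysis (G : Digraph n) (x : Mat (F K) n) where
   coefficient : Fin n → Digraph n → F K
   coefficient k H = ext (W k) point (λ y → Odd (mat H x y))
   record Good : Set where
    field
     kk : Fin n
     has : HasCycle (suc (toℕ kk)) G
     least : ∀ c → IsEvenCycle G c → suc (toℕ kk) ≤ length c
    open Pruning (suc (toℕ kk)) public
    field
     det-insert : ∀ (i p : Fin n) → Det (mat (inserting G (toℕ i)) x (point p)) ≢ 0#
     det-prune : ∀ (i p : Fin n) → Det (mat (pruning G has (toℕ i)) x (point p)) ≢ 0#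
     detected : coefficient kk G ≢ 0#
     ext-prune : ∀ (i : Fin n) → coefficient kk (pruning G has (toℕ i)) ≢ 0#
   NoArc : Arrays → Set
   NoArc A = ∀ u v → adjacent G u v ≡ false → A 2 u v zero ≡ 0#
   Input : Arrays → Set
   Input A = (∀ u v → A 0 u v zero ≡ (if adjacent G u v then 1# else 0#)) × (∀ u v → A 1 u v zero ≡ x u v)
   record InsertState (g : Good) (m : ℕ) (A : Arrays) : Set where
    constructor insertState
    open Good g
    field
     weights : ∀ u v → A 2 u v zero ≡ masked G x u v
     extract : ∀ k l → A 12 k l zero ≡ Wₘ m k l
     points : ∀ p → Point A p (mat (inserting G m) x (point p))
   record PruneState (g : Good) (m : ℕ) (A : Arrays) : Set where
    constructor pruneState
    open Good g
    field
     weights : ∀ u v → A 2 u v zero ≡ masked (pruning G has m) x u v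
     extract : ∀ l → A 19 l zero zero ≡ W kk l
     points : ∀ p → Point A p (mat (pruning G has m) x (point p))
   unit-point : ∀ A p → (∀ j k → A 3 p j k ≡ δ j k) → (∀ j k → A 4 p j k ≡ δ j k) → A 7 p zero zero ≡ 0# → A 6 p zero zero ≡ 1# →
    Point A p (mat (empty {n}) x (point p))
   unit-point A p m i o d = Point-cong {B = δ} {B' = mat (empty {n}) x (point p)} (λ j k → solve 2 (λ d y → d := d :+ y :* con false) refl (δ j k) (point p))
    (mkPoint m (record { AN = λ j k → sum-δˡ j (λ l → A 4 p l k) · i j k ; NA = λ j k → sum-δʳ k (A 4 p j) · i j k })
     (o · sym (cong proj₂ (D-δ {n}))) (d · sym (cong proj₁ (D-δ {n}))))
   init-step : ∀ v A → Input A → let A' = assigns initFills v A in Input A' × NoArc A' × (∀ g → InsertState g n A')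
   init-step v A (a= , x=) = (a= , x=) , no-arc , λ g → insertState weights
    (λ k l → if-δ k l · cong (λ N → N k l) (sym (iter-from-end n stepV δ)))
    λ p → subst (λ H → Point A' p (mat H x (point p))) (sym (inserting-end G))
     (unit-point A' p (λ j k → if-δ j k) (λ j k → if-δ j k) refl refl)
    where
    A' = assigns initFills v A
    weights : ∀ u v → A' 2 u v zero ≡ masked G x u v
    weights u v = cong₂ _*_ (a= u v) (x= u v) · at (adjacent G u v)
     where
     at : ∀ b → (if b then 1# else 0#) * x u v ≡ (if b then x u v else 0#)
     at true = *-identityˡ _
     at false = zeroˡ _
    no-arc : NoArc A'
    no-arc u v e = weights u v · masked-no-arc G x e
   insert-step : ∀ v A → NoArc A → let A' = assigns (vandermondeFills ++ rowFills ++ updateFills) v A in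
    NoArc A' × (∀ g → InsertState g (suc (toℕ v)) A → InsertState g (toℕ v) A')
   insert-step v A na = na , λ g S → let open InsertState S in let open Good g in
    assigns-++₂ (InsertState g (toℕ v)) vandermondeFills (rowFills ++ updateFills) v A λ A1 e → insertState
     (λ j k → cong (λ A → A 2 j k zero) e · weights j k)
     (λ k l → cong (λ A → A 12 k l zero) e · vandermonde-step v A extract k l · cong (λ N → N k l) (sym (iter-from-step v stepV δ)))
     λ p → subst (λ H → Point (assigns (rowFills ++ updateFills) v A1) p (mat H x (point p))) (sym (inserting-step G v))
      (row-update G (inserting G (suc (toℕ v))) x v A1 p (λ l → cong (λ A → A 2 v l zero) e · weights v l)
       (Point-carry (cells= e 3 p) (cells= e 4 p) (cells= e 7 p zero zero) (cells= e 6 p zero zero) (points p))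
       (subst (λ H → Det (mat H x (point p)) ≢ 0#) (inserting-step G v) (det-insert v p)))
   prune-no-arc : ∀ v A → NoArc A → NoArc (assigns (candidateFills ++ pruneFills ++ rowFills ++ updateFills) v A)
   prune-no-arc v A na = assigns-++₂ NoArc candidateFills (pruneFills ++ rowFills ++ updateFills) v A λ A1 e → assigns-++₂ NoArc pruneFills (rowFills ++ updateFills) v A1 λ A2 e2 →
    λ j k no → cong (λ A → A 2 j k zero) e2 · if-eq j v _ _ · vanish (cong (λ A → A 2 j k zero) e · na j k no)
    where
    vanish : ∀ {d c y} → y ≡ 0# → d * (c * y) + (1# + d) * y ≡ 0#
    vanish {d} {c} refl = solve 2 (λ d c → d :* (c :* con false) :+ (con true :+ d) :* con false := con false) refl d c
   module _ (g : Good) where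
    open Good g
    coefficient-zero : ∀ (H : Digraph n) k κ → (∀ c → IsEvenCycle H c → κ < length c) → toℕ k < κ → coefficient k H ≡ 0#
    coefficient-zero H k κ long k<κ = ext-Span (W k) point monomials (Odd-span H x κ long)
     where
     monomials : ∀ j → suc κ ≤ j → j ≤ n → ext (W k) point (_^ j) ≡ 0#
     monomials (suc j) (s≤s κ≤j) j≤n = cong (λ j → ext (W k) point (_^ suc j)) (sym (Fin.toℕ-fromℕ< j≤n)) ·
      ext-monomial k (fromℕ< j≤n) · (δ-diff λ e → ℕ.<-irrefl (cong toℕ e) (ℕ.<-≤-trans k<κ (κ≤j ≤≡ sym (Fin.toℕ-fromℕ< j≤n))))
    below-zero : ∀ k → toℕ k < toℕ kk → coefficient k G ≡ 0#
    below-zero k k<kk = coefficient-zero G k (toℕ kk) least k<kk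
    acyclic-zero : ∀ (H : Digraph n) → H ⊑ G → ¬ HasCycle (suc (toℕ kk)) H → coefficient kk H ≡ 0#
    acyclic-zero H H⊑G acyclic = coefficient-zero H kk (suc (toℕ kk)) long ℕ.≤-refl
     where
     long : ∀ c → IsEvenCycle H c → suc (toℕ kk) < length c
     long c e = ℕ.≤∧≢⇒< (least c (IsEvenCycle-⊑ (λ {a} {b} → H⊑G {a} {b}) c e))
      λ q → acyclic (subst (λ κ → HasCycle κ H) (sym q) (hasCycle H c e))
    inserted : ∀ {A} → InsertState g 0 A → ∀ p → Point A p (mat G x (point p))
    inserted S p = Point-cong (λ j k → cong (λ b → δ j k + point p * (if b then x j k else 0#)) (inserting-all G j k)) (InsertState.points S p)
    pick : ∀ v A → InsertState g 0 A → InsertState g 0 (assigns pickFills v A) × PruneState g n (assigns pickFills v A)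
    pick v A S = insertState weights extract (λ p → Point-carry (λ j k → refl) (λ j k → refl) refl refl (points p)) , pruneState (λ j k → weights j k · cong (λ H → masked H x j k) (sym start))
     (λ l → iter-sum _ · (sum-cong-≗ λ k → cong₂ _*_ (first-≡ t kk (λ e → detected (sym (t= kk) · e)) (λ k k< → t= k · below-zero k k<) k) (extract k l)) · sum-δˡ kk λ k → W k l)
     λ p → subst (λ H → Point (assigns pickFills v A) p (mat H x (point p))) (sym start)
      (mkPoint (Point.matrix (P p)) (Point.inverses (P p)) (Point.odd= (P p)) (Point.det= (P p)))
     where
     open InsertState S
     P = inserted S
     start = iter-from-end n prune G
     t : Fin n → F K
     t k = iter (λ l x → x + A 12 k l zero * A 7 l zero zero) 0#
     t= : ∀ k → t k ≡ coefficient k G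
     t= k = iter-sum _ · (sum-cong-≗ λ l → cong₂ _*_ (extract k l) (Point.odd= (P l)))
    module _ (v : Fin n) (A : Arrays) (S : PruneState g (suc (toℕ v)) A) where
     private
      open PruneState S
      H H' : Digraph n
      H = pruning G has (suc (toℕ v))
      H' = pruning G has (toℕ v)
      H⊑G : H ⊑ G
      H⊑G {a} {b} = proj₁ (pruning-⊑ G has (suc (toℕ v)) (Fin.toℕ<n v)) {a} {b}
      s0= = iter-sum _ · (sum-cong-≗ λ p → cong₂ _*_ (extract p)
       (candidate0 v A p _ (points p) · (Odd-cong λ j k → SignedPermanent.←-cong (tower K) 1# (*-identityˡ 1#) {A = mat H x (point p)} {B = mat H x (point p)} {r = δ v} {r' = mat (empty {n}) x (point p) v} v (λ _ _ _ → refl)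
        (λ k → solve 2 (λ d y → d := d :+ y :* con false) refl (δ v k) (point p)) j k ·
        sym (Point-rows empty H x v (point p) j k))))
      same : ∀ (u : Fin n) → ⌊ u Fin.≟ u ⌋ ≡ true
      same u with u Fin.≟ u
      ... | yes _ = refl
      ... | no ne = contradiction refl ne
      diff : ∀ {k u : Fin n} → k ≢ u → ⌊ k Fin.≟ u ⌋ ≡ false
      diff {k} {u} ne with k Fin.≟ u
      ... | yes e = contradiction e ne
      ... | no _ = refl
      target-row : ∀ u k → masked H x v u * δ u k ≡ masked (target H u) x v k
      target-row u k = at (k Fin.≟ u)
       where
       masked-target : Bool → F K
       masked-target b = if b then x v k else 0#
       at : Dec (k ≡ u) → masked H x v u * δ u k ≡ masked (target H u) x v k
       at (yes refl) = cong (masked H x v u *_) (δ-same u) · *-identityʳ _ · cong masked-target (sym (cong (adjacent H v u ∧_) (same u) · ∧-identityʳ _))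
       at (no k#u) = cong (masked H x v u *_) (δ-diff (k#u ∘ sym)) · zeroʳ _ · cong masked-target (sym (cong (adjacent H v k ∧_) (diff k#u) · ∧-zeroʳ _))
      s= : ∀ u → assigns candidateFills v A 22 u zero zero ≡ coefficient kk (only H v u)
      s= u = iter-sum _ · (sum-cong-≗ λ p → cong₂ _*_ (extract p)
       (candidate v A p _ (points p) u (point p * A 2 v u zero) · (Odd-cong λ j k → SignedPermanent.←-cong (tower K) 1# (*-identityˡ 1#) {A = mat H x (point p)} {B = mat H x (point p)}
        {r = λ k → δ v k + point p * A 2 v u zero * δ u k} {r' = mat (target H u) x (point p) v} v (λ _ _ _ → refl)
        (λ k → cong (δ v k +_) (*-assoc _ _ _ · cong (point p *_) (cong (_* δ u k) (weights v u) · target-row u k))) j k ·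
        sym (Point-rows (target H u) H x v (point p) j k))))
     module _ (A1 : Arrays) (s0= : A1 21 zero zero zero ≡ coefficient kk (clear H v)) (s= : ∀ u → A1 22 u zero zero ≡ coefficient kk (only H v u))
      (weights1 : ∀ j k → A1 2 j k zero ≡ A 2 j k zero) (extract1 : ∀ l → A1 19 l zero zero ≡ A 19 l zero zero)
      (carry1 : ∀ p {B} → Point A p B → Point A1 p B) where
      s0 : F K
      s0 = A1 21 zero zero zero
      s c : Fin n → F K
      s u = A1 22 u zero zero
      c u = ifzero s0 (first s u) 0#
      weights' : ∀ j k → A1 2 j k zero ≡ masked H x j k
      weights' j k = weights1 j k · weights j k
      chosen : ∀ {H'} → Pruned H v H' → coefficient kk H' ≢ 0# → ∃[ G' ] (H' ≡ splice G' v H × ∀ k → c k * masked H x v k ≡ masked G' x v k)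
      chosen (cleared _) nz = empty , refl , λ k → cong (_* masked H x v k) (ifzero-no _ _ λ e → nz (sym s0= · e)) · zeroˡ _
      chosen (kept u acyclic _ least) nz = target H u , refl , λ k → cong (_* masked H x v k) (ifzero-yes _ _ (s0= · acyclic-zero (clear H v) (λ {a} {b} e → H⊑G {a} {b} (clear-⊑ H v {a} {b} e)) acyclic) ·
       first-≡ s u (λ e → nz (sym (s= u) · e)) (λ w w<u → s= w · acyclic-zero (only H v w) (λ {a} {b} e → H⊑G {a} {b} (only-⊑ H v w {a} {b} e)) (least w w<u)) k) ·
       move u k (u Fin.≟ k) · target-row u k
       where
       move : ∀ u k → Dec (u ≡ k) → δ u k * masked H x v k ≡ masked H x v u * δ u k
       move u _ (yes refl) = *-comm _ _
       move u k (no u#k) = cong (_* masked H x v k) (δ-diff u#k) · zeroˡ _ · sym (cong (masked H x v u *_) (δ-diff u#k) · zeroʳ _)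
      prune-step : ∀ A2 → (∀ j k → A2 2 j k zero ≡ (if toℕ j ≤ᵇ toℕ v then (if toℕ v ≤ᵇ toℕ j then c k * A1 2 j k zero else A1 2 j k zero) else A1 2 j k zero)) →
       (∀ l → A2 19 l zero zero ≡ A1 19 l zero zero) → (∀ p {B} → Point A1 p B → Point A2 p B) → PruneState g (toℕ v) (assigns (rowFills ++ updateFills) v A2)
      prune-step A2 cells extract= carry = from-choice (chosen (pruning-pruned G has v) (ext-prune v))
       where
       new-weights : ∀ G' → H' ≡ splice G' v H → (∀ k → c k * masked H x v k ≡ masked G' x v k) → ∀ j k → Dec (j ≡ v) → A2 2 j k zero ≡ masked H' x j k
       new-weights G' H'≡ row j k (yes refl) = cells j k · if-eq-yes j j _ _ refl · cong (c k *_) (weights' j k) · row k ·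
        cong (λ b → if b then x j k else 0#) (sym (splice-same G' j H k)) · cong (λ H → masked H x j k) (sym H'≡)
       new-weights G' H'≡ row j k (no j#v) = cells j k · if-eq-no j v _ _ j#v · weights' j k ·
        cong (λ b → if b then x j k else 0#) (sym (splice-diff G' H k j#v)) · cong (λ H → masked H x j k) (sym H'≡)
       from-choice : ∃[ G' ] (H' ≡ splice G' v H × ∀ k → c k * masked H x v k ≡ masked G' x v k) → PruneState g (toℕ v) (assigns (rowFills ++ updateFills) v A2)
       from-choice (G' , H'≡ , row) = pruneState (λ j k → new-weights G' H'≡ row j k (j Fin.≟ v)) (λ l → extract= l · extract1 l · extract l)
        λ p → subst (λ H → Point (assigns (rowFills ++ updateFills) v A2) p (mat H x (point p))) (sym H'≡)
        (row-update G' H x v A2 p (λ l → cells v l · if-eq-yes v v _ _ refl · cong (c l *_) (weights' v l) · row l)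
         (carry p (carry1 p (points p)))
         (subst (λ H → Det (mat H x (point p)) ≢ 0#) H'≡ (det-prune v p)))
      prune-last = assigns-++₂ (PruneState g (toℕ v)) pruneFills (rowFills ++ updateFills) v A1 λ A2 e →
       prune-step A2 (λ j k → cong (λ A → A 2 j k zero) e) (λ l → cong (λ A → A 19 l zero zero) e)
        λ p → Point-carry (cells= e 3 p) (cells= e 4 p) (cells= e 7 p zero zero) (cells= e 6 p zero zero)
     prune-stage = assigns-++₂ (PruneState g (toℕ v)) candidateFills (pruneFills ++ rowFills ++ updateFills) v A λ A1 e →
      prune-last A1 (cong (λ A → A 21 zero zero zero) e · s0=) (λ u → cong (λ A → A 22 u zero zero) e · s= u)
       (λ j k → cong (λ A → A 2 j k zero) e) (λ l → cong (λ A → A 19 l zero zero) e)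
        λ p → Point-carry (cells= e 3 p) (cells= e 4 p) (cells= e 7 p zero zero) (cells= e 6 p zero zero)
    RowResult : Digraph n → (Fin n → Fin n → F K) → Fin n → Set
    RowResult H X i = ((∀ u → X i u ≡ 0#) × ∀ u → adjacent H i u ≡ false) ⊎
     ∃[ u ] (X i u ≢ 0# × (∀ w → X i w ≢ 0# → w ≡ u) × (∀ w → Arc H i w → w ≡ u) × ∀ c → IsEvenCycle H c → length c ≡ suc (toℕ kk) → i ∈ c)
    row-result : ∀ H X → H ⊑ G → (∀ i u → X i u ≡ masked H x i u) → coefficient kk H ≢ 0# → ∀ i → Row H i → RowResult H X i
    row-result H X H⊑G X= nz i (none no-arc) = inj₁ ((λ u → X= i u · masked-no-arc H x (no-arc u)) , no-arc)
    row-result H X H⊑G X= nz i (single u unique arc acyclic) = inj₂ (u , (λ e → nz (cleared-row (sym (X= i u) · e))) , arcs , unique , through)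
     where
     cleared-row : masked H x i u ≡ 0# → coefficient kk H ≡ 0#
     cleared-row e = (sum-cong-≗ λ p → cong (W kk p *_) (Odd-cong λ j k → cong (λ z → δ j k + point p * z) (same j k (j Fin.≟ i)))) ·
      acyclic-zero (clear H i) (λ {a} {b} q → H⊑G {a} {b} (clear-⊑ H i {a} {b} q)) acyclic
      where
      same : ∀ j k → Dec (j ≡ i) → masked H x j k ≡ masked (clear H i) x j k
      same j k (no ne) = cong (λ b → if b then x j k else 0#) (sym (splice-diff empty H k ne))
      same j k (yes refl) = row (k Fin.≟ u) · sym (masked-no-arc (clear H i) x (splice-same empty i H k))
       where
       row : Dec (k ≡ u) → masked H x i k ≡ 0#
       row (yes refl) = e
       row (no k#u) with adjacent H i k in a
       ... | false = refl
       ... | true = contradiction (unique k a) k#u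
     arcs : ∀ w → X i w ≢ 0# → w ≡ u
     arcs w ne with adjacent H i w in a
     ... | true = unique w a
     ... | false = contradiction (X= i w · masked-no-arc H x a) ne
     through : ∀ c → IsEvenCycle H c → length c ≡ suc (toℕ kk) → i ∈ c
     through c e l with DecMembership._∈?_ Fin._≟_ i c
     ... | yes i∈ = i∈
     ... | no i∉ = contradiction (subst (λ κ → HasCycle κ (clear H i)) l (hasCycle (clear H i) c (clear-cycle H i c e i∉))) acyclic
    record Final (X : Fin n → Fin n → F K) : Set where
     constructor final'
     field
      {graph} : Digraph n
      cyclic : HasCycle (suc (toℕ kk)) graph
      onArcs : ∀ i u → X i u ≡ masked graph x i u
      row : ∀ i → RowResult graph X i
    final : ∀ A → PruneState g 0 A → Final (λ i u → A 2 i u zero)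
    final A S = final' (proj₂ bounds) (PruneState.weights S)
     λ i → row-result (pruning G has 0) (λ i u → A 2 i u zero) (λ {a} {b} → proj₁ bounds {a} {b}) (PruneState.weights S) (ext-prune zero) i (pruning-rows G has 0 z≤n i z≤n)
     where
     bounds = pruning-⊑ G has 0 z≤n
    module _ (X : Fin n → Fin n → F K) (F : Final X) where
     open Final F renaming (graph to H; row to rows)
     open Following X
     next-arc : ∀ {a b} → Arc H a b → next a ≡ b
     next-arc {a} {b} e with rows a
     ... | inj₁ (_ , empty-row) = contradiction (sym (empty-row b) · e) λ ()
     ... | inj₂ (u , nz , unique , arcs , _) = index-unique a (row a) u nz unique · sym (arcs b e)
     deg≢0 : ∀ {a b} → Arc H a b → deg a ≢ 0#
     deg≢0 {a} {b} e z with rows a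
     ... | inj₁ (_ , empty-row) = contradiction (sym (empty-row b) · e) λ ()
     ... | inj₂ (u , nz , _) = nonempty≢0 (row a) nz (sym (sum-first (X a) (row a)) · z)
     on-cycle : ∀ i → deg i ≢ 0# → ∀ c → IsEvenCycle H c → length c ≡ suc (toℕ kk) → i ∈ c
     on-cycle i d with rows i
     ... | inj₁ (z , _) = contradiction (sum-first (X i) (row i) · nonempty-0 (row i) z) d
     ... | inj₂ (_ , _ , _ , _ , through) = through
     shortest-return = from (toList (proj₁ cyclic)) (proj₂ cyclic) (length-toList (proj₁ cyclic))
      where
      first-arc : ∀ v vs → Linked (Arc H) (v ∷ vs ∷ʳ v) → ∃[ w ] Arc H v w
      first-arc v [] (e ∷ _) = _ , e
      first-arc v (w ∷ vs) (e ∷ _) = _ , e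
      from : ∀ c → IsEvenCycle H c → length c ≡ suc (toℕ kk) → FirstReturn start (suc (toℕ kk)) × 2 ∣ suc (toℕ kk)
      from (v ∷ vs) e@((unique , linked) , even) len =
       subst (λ L → FirstReturn start L × 2 ∣ L) len
        ( cycle-first-return v vs start unique (Linked.map next-arc linked)
         (on-cycle start (index-nonzero zero (firstNonzero deg) (deg≢0 (proj₂ (first-arc v vs linked)))) (v ∷ vs) e len)
        , even )
   Result : List (Fin n) → Set
   Result out = (out ≡ [] ⊎ IsEvenCycle G out) × (Good → IsEvenCycle G out × ∀ c → IsEvenCycle G c → length out ≤ length c)
   module _ (X : Fin n → Fin n → F K) (no-arc : ∀ u v → adjacent G u v ≡ false → X u v ≡ 0#) (final-X : ∀ g → Final g X) where
    open Following X
    next-arcs : ∀ i → next i ≢ i → Arc G i (next i)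
    next-arcs i ne with index-spec i (row i)
    ... | inj₁ e = contradiction e ne
    ... | inj₂ nz with adjacent G i (next i) in a
    ... | true = refl
    ... | false = contradiction (no-arc i (next i) a) nz
    outcome-result : ∀ {out} → Outcome out → Result out
    outcome-result (nothing-found odd o) = inj₁ o , λ g →
     let fr , even = shortest-return g X (final-X g) in contradiction even (odd _ fr (Fin.toℕ<n (Good.kk g)))
    outcome-result (found L fr even refl) = inj₂ cycle , λ g → cycle , λ c e →
     length-trail start L · first-return-unique fr (proj₁ (shortest-return g X (final-X g))) ≡≤ Good.least g c e
     where
     cycle = first-return-cycle G next next-arcs fr even
   Inserting Pruning' : ℕ → Arrays → Set
   Inserting m A = NoArc A × (∀ g → InsertState g m A)
   Pruning' m A = NoArc A × (∀ g → PruneState g m A)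
   init-triple = loop-once initFills Input (Inserting n) tt init-step
   insert-triple = loop (vandermondeFills ++ rowFills ++ updateFills) Inserting tt
    λ v A (na , S) → let na' , step = insert-step v A na in na' , λ g → step g (S g)
   pick-triple = loop-once pickFills (Inserting 0) (Pruning' n) tt
    λ v A (na , S) → (na , λ g → proj₁ (pick g v A (S g))) , (na , λ g → proj₂ (pick g v A (S g)))
   prune-triple = loop (candidateFills ++ pruneFills ++ rowFills ++ updateFills) Pruning' tt
    λ v A (na , S) → prune-no-arc v A na , λ g → prune-stage g v A (S g)
   endgame-result : Triple (Quiet (Pruning' 0)) endgame (λ s → Result (outp s))
   endgame-result = triple λ { s ((A , e , na , S) , o) → outcome-result (λ i u → A 2 i u zero) na (λ g → final g A (S g))
    (after (Following.endgame-triple λ i u → A 2 i u zero) s ((A , e , λ i u → refl) , o)) }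
   algorithm-result : Triple (Quiet Input) algorithm (λ s → Result (outp s))
   algorithm-result = init-triple ⨟ weaken (Quiet-map λ A → proj₂) insert-triple ⨟ pick-triple ⨟ weaken (Quiet-map λ A → proj₂) prune-triple ⨟ endgame-result

  module _ where
   open Sampling K
   entries : (Fin (n ℕ.* n) → F K) → Mat (F K) n
   entries v i j = v (combine i j)
   determinant : Digraph n → F K → (Fin (n ℕ.* n) → F K) → F K
   determinant H y v = Det (mat H (entries v) y)
   oddPart : (Fin n → F K) → Digraph n → (Fin (n ℕ.* n) → F K) → F K
   oddPart w H v = ext w point (λ y → Odd (mat H (entries v) y))
   full-cong : ∀ (H : Digraph n) {x x' : Mat (F K) n} y → (∀ i j → x i j ≡ x' i j) → ∀ i j → mat H x y i j ≡ mat H x' y i j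
   full-cong H y e i j = cong (λ z → δ i j + y * (if adjacent H i j then z else 0#)) (e i j)
   module _ (H : Digraph n) (a : Fin (n ℕ.* n)) (c : F K) {u v w : Fin (n ℕ.* n) → F K}
    (u~v : ∀ i → i ≢ a → u i ≡ v i) (u~w : ∀ i → i ≢ a → u i ≡ w i) (at-a : u a ≡ c * v a + (1# + c) * w a) where
    i0 : Fin n
    i0 = proj₁ (remQuot {n} n a)
    combination : ∀ b → u b ≡ c * v b + (1# + c) * w b
    combination b with b Fin.≟ a
    ... | yes refl = at-a
    ... | no b#a = solve 2 (λ c u → u := c :* u :+ (con true :+ c) :* u) refl c (u b) · cong₂ (λ x y → c * x + (1# + c) * y) (u~v b b#a) (u~w b b#a)
    other-row : ∀ j k → j ≢ i0 → combine j k ≢ a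
    other-row j k j≢ e = j≢ (sym (cong proj₁ (Fin.remQuot-combine j k)) · cong (λ b → proj₁ (remQuot {n} n b)) e)
    entry : ∀ y b d {p q r} → p ≡ c * q + (1# + c) * r →
     d + y * (if b then p else 0#) ≡ c * (d + y * (if b then q else 0#)) + (1# + c) * (d + y * (if b then r else 0#))
    entry y true d {p} {q} {r} e = cong (λ z → d + y * z) e · solve 5 (λ d y c q r → d :+ y :* (c :* q :+ (con true :+ c) :* r) :=
     c :* (d :+ y :* q) :+ (con true :+ c) :* (d :+ y :* r)) refl d y c q r
    entry y false d e = solve 3 (λ d y c → d :+ y :* con false := c :* (d :+ y :* con false) :+ (con true :+ c) :* (d :+ y :* con false)) refl d y c
    affine-at : ∀ y → determinant H y u ≡ c * determinant H y v + (1# + c) * determinant H y w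
     × Odd (mat H (entries u) y) ≡ c * Odd (mat H (entries v) y) + (1# + c) * Odd (mat H (entries w) y)
    affine-at y = D-linear' {A = mat H (entries u) y} {mat H (entries v) y} {mat H (entries w) y} i0 c (1# + c)
     (λ j k j≢ → cong (λ z → δ j k + y * (if adjacent H j k then z else 0#)) (u~v _ (other-row j k j≢)))
     (λ j k j≢ → cong (λ z → δ j k + y * (if adjacent H j k then z else 0#)) (u~w _ (other-row j k j≢)))
     λ k → entry y (adjacent H i0 k) (δ i0 k) (combination (combine i0 k))
   determinant-affine : ∀ H y → MultiAffine (determinant H y)
   determinant-affine H y = record
    { respects = λ e → Det-cong (full-cong H y λ i j → e (combine i j))
    ; affine = λ a c u~v u~w at-a → proj₁ (affine-at H a c u~v u~w at-a y) }
   oddPart-affine : ∀ w H → MultiAffine (oddPart w H)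
   oddPart-affine w H = record
    { respects = λ e → sum-cong-≗ λ p → cong (w p *_) (Odd-cong (full-cong H (point p) λ i j → e (combine i j)))
    ; affine = λ a c {u} {v} {v'} u~v u~w at-a → SignedPermanent.sum-linear (tower K) 1# (*-identityˡ 1#)
     {g = λ p → w p * Odd (mat H (entries v) (point p))} {h = λ p → w p * Odd (mat H (entries v') (point p))} c (1# + c)
     λ p → cong (w p *_) (proj₂ (affine-at H a c u~v u~w at-a (point p))) ·
      solve 4 (λ w c x y → w :* (c :* x :+ (con true :+ c) :* y) := c :* (w :* x) :+ (con true :+ c) :* (w :* y)) refl (w p) c
       (Odd (mat H (entries v) (point p))) (Odd (mat H (entries v') (point p))) }
   determinant-nonvanishing : ∀ H y → NonvanishingAffine (determinant H y)
   determinant-nonvanishing H y = determinant-affine H y , (λ _ → 0#) , λ e → 1≢0 (sym (Det-cong at-0 · cong proj₁ (D-δ {n})) · e)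
    where
    if-same : ∀ b → (if b then 0# else 0#) ≡ 0#
    if-same true = refl
    if-same false = refl
    at-0 : ∀ i j → full (masked H λ _ _ → 0#) y i j ≡ δ i j
    at-0 i j = cong (λ z → δ i j + y * z) (if-same (adjacent H i j)) · solve 2 (λ d y → d :+ y :* con false := d) refl (δ i j) y
   oddPart-nonvanishing : ∀ kk H → HasCycle (suc (toℕ kk)) H → NonvanishingAffine (oddPart (W kk) H)
   oddPart-nonvanishing kk H (c , e) =
    let x , nz = even-cycle-witness (W kk) point (_≟ 0#) H (toList c) e
         λ z → 1≢0 (sym (ext-monomial kk kk · δ-same kk) · cong (λ l → ext (W kk) point (_^ l)) (sym (length-toList c)) · z)
    in oddPart-affine (W kk) H , (λ a → x (proj₁ (remQuot {n} n a)) (proj₂ (remQuot {n} n a))) , λ z → nz ((sum-cong-≗ λ p → cong (W kk p *_) (Odd-cong (full-cong H (point p) λ i j → sym (cong (λ (i , j) → x i j) (Fin.remQuot-combine i j))))) · z)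
   module _ (G : Digraph n) (kk : Fin n) (has : HasCycle (suc (toℕ kk)) G) where
    H : ℕ → Digraph n
    H m = Pruning.pruning (suc (toℕ kk)) G has m
    insertEvent pruneEvent : Fin (n ℕ.* n) → (Fin (n ℕ.* n) → F K) → F K
    insertEvent e = determinant (inserting G (toℕ (proj₁ (remQuot {n} n e)))) (point (proj₂ (remQuot {n} n e)))
    pruneEvent e = determinant (H (toℕ (proj₁ (remQuot {n} n e)))) (point (proj₂ (remQuot {n} n e)))
    oddEvent : Fin n → (Fin (n ℕ.* n) → F K) → F K
    oddEvent i = oddPart (W kk) (H (toℕ i))
    events = tabulate insertEvent ++ tabulate pruneEvent ++ tabulate oddEvent ++ oddPart (W kk) G ∷ []
    length-events : length events ≡ n ℕ.* n ℕ.+ (n ℕ.* n ℕ.+ (n ℕ.+ 1))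
    length-events = length-++ (tabulate insertEvent) · cong₂ ℕ._+_ (length-tabulate insertEvent)
     (length-++ (tabulate pruneEvent) · cong₂ ℕ._+_ (length-tabulate pruneEvent)
      (length-++ (tabulate oddEvent) · cong (ℕ._+ 1) (length-tabulate oddEvent)))
    events-nonvanishing : All NonvanishingAffine events
    events-nonvanishing = All.++⁺ (All.tabulate⁺ λ e → determinant-nonvanishing (inserting G (toℕ (proj₁ (remQuot {n} n e)))) (point (proj₂ (remQuot {n} n e))))
     (All.++⁺ (All.tabulate⁺ λ e → determinant-nonvanishing (H (toℕ (proj₁ (remQuot {n} n e)))) (point (proj₂ (remQuot {n} n e))))
     (All.++⁺ (All.tabulate⁺ λ i → oddPart-nonvanishing kk (H (toℕ i)) (proj₂ (Pruning.pruning-⊑ (suc (toℕ kk)) G has (toℕ i) (ℕ.<⇒≤ (Fin.toℕ<n i)))))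
      (oddPart-nonvanishing kk G has ∷ [])))
    events-good : (∀ c → IsEvenCycle G c → suc (toℕ kk) ≤ length c) → ∀ v → All (λ P → P v ≢ 0#) events → Analysis.Good G (entries v)
    events-good least v all = record
     { kk = kk ; has = has ; least = least
     ; det-insert = λ i p e → All.tabulate⁻ {f = insertEvent} i-all (combine i p) (cong (λ (i , p) → determinant (inserting G (toℕ i)) (point p) v) (Fin.remQuot-combine i p) · e)
     ; det-prune = λ i p e → All.tabulate⁻ {f = pruneEvent} p-all (combine i p) (cong (λ (i , p) → determinant (H (toℕ i)) (point p) v) (Fin.remQuot-combine i p) · e)
     ; detected = All.head g-all
     ; ext-prune = All.tabulate⁻ {f = oddEvent} o-all }
     where
     i-all = proj₁ (All.++⁻ (tabulate insertEvent) all)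
     rest1 = proj₂ (All.++⁻ (tabulate insertEvent) all)
     p-all = proj₁ (All.++⁻ (tabulate pruneEvent) rest1)
     rest2 = proj₂ (All.++⁻ (tabulate pruneEvent) rest1)
     o-all = proj₁ (All.++⁻ (tabulate oddEvent) rest2)
     g-all = proj₂ (All.++⁻ (tabulate oddEvent) rest2)

module Params where
 open Lang
 open Tower using (width; width>0)
 open Setup using (octuple; threshold)

 open import Data.Nat
 open import Data.Nat.Logarithm using (⌊log₂_⌋; ⌊log₂⌋-mono-≤; ⌊log₂[2^n]⌋≡n)
 open import Data.Nat.Properties
 open Machine using (m<2^m)

 k<width : ∀ k → k < width k
 k<width zero = s≤s z≤n
 k<width (suc k) = +-comm 1 (suc k) ≡≤ +-mono-≤ (k<width k) (width>0 k)

 record Level (t : ℕ) : Set where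
  constructor mkLevel
  field
   level : ℕ
   enough : t ≤ 2 ^ width level
   minimal : ∀ k → k < level → 2 ^ width k < t

 findLevel : ∀ t → Level t
 findLevel t = search t 0 (λ _ ()) ((<⇒≤ (m<2^m t)) ·≤ ^-monoʳ-≤ 2 (subst (λ j → t ≤ width j) (sym (+-identityʳ t)) (<⇒≤ (k<width t))))
  where
  search : ∀ d k → (∀ j → j < k → 2 ^ width j < t) → t ≤ 2 ^ width (d + k) → Level t
  search d k below top with t ≤? 2 ^ width k
  ... | yes t≤ = mkLevel k t≤ below
  search zero k below top | no t≰ = contradiction top t≰
  search (suc d) k below top | no t≰ = search d (suc k) below' (subst (λ j → t ≤ 2 ^ width j) (sym (+-suc d k)) top)
   where
   below' : ∀ j → j < suc k → 2 ^ width j < t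
   below' j (s≤s j≤k) with m≤n⇒m<n∨m≡n j≤k
   ... | inj₁ lt = below j lt
   ... | inj₂ refl = ≰⇒> t≰

 abstract
  fieldLevel : ℕ → ℕ
  fieldLevel n = Level.level (findLevel (threshold n))

  fieldLevel-enough : ∀ n → threshold n ≤ 2 ^ width (fieldLevel n)
  fieldLevel-enough n = Level.enough (findLevel (threshold n))

  fieldLevel-minimal : ∀ n k → k < fieldLevel n → 2 ^ width k < threshold n
  fieldLevel-minimal n = Level.minimal (findLevel (threshold n))

 fieldWidth : ℕ → ℕ
 fieldWidth n = width (fieldLevel n)

 octuple= : ∀ n → octuple n ≡ 8 * n
 octuple= n = doublings n
  where
  doublings : ∀ n → n + n + (n + n) + (n + n + (n + n)) ≡ 8 * n
  doublings = solve-∀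

 threshold= : ∀ n → threshold n ≡ 8 * n * (8 * n) * (8 * n * (8 * n)) * (8 * n * (8 * n)) * (8 * n)
 threshold= n = cong (λ t → t * t * (t * t) * (t * t) * t) (octuple= n)

 module _ (n : ℕ) (n>0 : 0 < n) where
  m = 8 * n
  n≤m : n ≤ m
  n≤m = m≤n*m n 8
  m>0 : 0 < m
  m>0 = n>0 ·≤ n≤m
  grow : ∀ x → x ≤ x * m
  grow x = m≤m*n x m {{>-nonZero m>0}}
  split : ∀ m → m * m * m * (m * m * m) * m ≡ m * m * (m * m) * (m * m) * m
  split = solve-∀

  threshold-bound : ∀ {x} → x ≤ m * m * m → x ≤ threshold n
  threshold-bound {x} x≤ = x≤ ·≤ m≤m*n (m * m * m) (m * m * m) {{>-nonZero (*-mono-≤ (*-mono-≤ m>0 m>0) m>0)}} ·≤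
   grow (m * m * m * (m * m * m)) ≤≡ split m · sym (threshold= n)

  cube-bound : n * n * n * 40 ≤ threshold n
  cube-bound = threshold-bound (m≤m+n _ (n * n * n * 472) ≤≡ expand n)
   where
   expand : ∀ n → n * n * n * 40 + n * n * n * 472 ≡ 8 * n * (8 * n) * (8 * n)
   expand = solve-∀

  square-bound : n * n ≤ threshold n
  square-bound = threshold-bound (*-mono-≤ n≤m n≤m ·≤ grow (m * m))

  linear-bound : n < threshold n
  linear-bound = +-comm 1 n ≡≤ +-monoʳ-≤ n n>0 ·≤ m≤m+n (n + n) (6 * n) ·≤ eight n ≡≤
   threshold-bound (grow m ·≤ grow (m * m))
   where
   eight : ∀ n → n + n + 6 * n ≡ 8 * n
   eight = solve-∀

  arrays-bound : 40 < threshold n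
  arrays-bound = threshold-bound (m≤m+n 41 471 ·≤ *-mono-≤ (*-mono-≤ 8≤m 8≤m) 8≤m)
   where
   8≤m : 8 ≤ m
   8≤m = sym (*-identityʳ 8) ≡≤ *-monoʳ-≤ 8 n>0

  seventh-bound : 4 * (n * n * (n * n) * (n * n * n)) ≤ threshold n
  seventh-bound = regroup n ≡≤ *-mono-≤ (*-mono-≤ (*-mono-≤ (*-mono-≤ n≤m n≤m) (*-mono-≤ n≤m n≤m)) (*-mono-≤ n≤m n≤m)) 4n≤m ≤≡ sym (threshold= n)
   where
   regroup : ∀ n → 4 * (n * n * (n * n) * (n * n * n)) ≡ n * n * (n * n) * (n * n) * (4 * n)
   regroup = solve-∀
   4n≤m : 4 * n ≤ m
   4n≤m = *-monoˡ-≤ n (m≤m+n 4 4)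

 n<2^[1+log] : ∀ n → n < 2 ^ suc ⌊log₂ n ⌋
 n<2^[1+log] n = ≰⇒> λ le → <⇒≱ (n<1+n ⌊log₂ n ⌋) (sym (⌊log₂[2^n]⌋≡n (suc ⌊log₂ n ⌋)) ≡≤ ⌊log₂⌋-mono-≤ le)

 threshold<2^ : ∀ n → threshold n < 2 ^ (7 * ⌊log₂ n ⌋ + 28)
 threshold<2^ n = s≤s (≤-reflexive (threshold= n)) ·≤ product (8 * n) (2 ^ e) 8n< ≤≡ powers
  where
  e = 4 + ⌊log₂ n ⌋
  8n< : 8 * n < 2 ^ e
  8n< = *-monoʳ-< 8 (n<2^[1+log] n) ≤≡ sym (^-distribˡ-+-* 2 3 (suc ⌊log₂ n ⌋))
  product : ∀ m x → m < x → m * m * (m * m) * (m * m) * m < x * x * (x * x) * (x * x) * x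
  product m x m<x = *-mono-< (*-mono-< (*-mono-< (*-mono-< m<x m<x) (*-mono-< m<x m<x)) (*-mono-< m<x m<x)) m<x
  square : ∀ a → 2 ^ a * 2 ^ a ≡ 2 ^ (a + a)
  square a = sym (^-distribˡ-+-* 2 a a)
  total : ∀ l → (4 + l + (4 + l) + (4 + l + (4 + l)) + (4 + l + (4 + l))) + (4 + l) ≡ 7 * l + 28
  total = solve-∀
  powers : 2 ^ e * 2 ^ e * (2 ^ e * 2 ^ e) * (2 ^ e * 2 ^ e) * 2 ^ e ≡ 2 ^ (7 * ⌊log₂ n ⌋ + 28)
  powers = cong (λ x → x * x * x * 2 ^ e) (square e) · cong (λ x → x * 2 ^ (e + e) * 2 ^ e) (square (e + e)) ·
   cong (_* 2 ^ e) (sym (^-distribˡ-+-* 2 (e + e + (e + e)) (e + e))) · sym (^-distribˡ-+-* 2 (e + e + (e + e) + (e + e)) e) · cong (2 ^_) (total ⌊log₂ n ⌋)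

 1≤log : ∀ {n} → 2 ≤ n → 1 ≤ ⌊log₂ n ⌋
 1≤log 2≤n = refl ≡≤ ⌊log₂⌋-mono-≤ 2≤n

 width-bound : ∀ n → 2 ≤ n → fieldWidth n ≤ 70 * ⌊log₂ n ⌋
 width-bound n 2≤n = by-cases (fieldLevel n) (fieldLevel-minimal n)
  where
  l = ⌊log₂ n ⌋
  l≥1 : 1 ≤ l
  l≥1 = 1≤log 2≤n
  by-cases : ∀ k → (∀ j → j < k → 2 ^ width j < threshold n) → width k ≤ 70 * l
  by-cases zero _ = l≥1 ·≤ m≤n*m l 70
  by-cases (suc k) minimal = +-mono-≤ half half ·≤ double l ≡≤ +-monoʳ-≤ (14 * l) (*-monoʳ-≤ 56 l≥1) ≤≡ seventy l
   where
   half : width k ≤ 7 * l + 28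
   half = <⇒≤ (≰⇒> λ le → <⇒≱ (<-trans (minimal k ≤-refl) (threshold<2^ n)) (^-monoʳ-≤ 2 le))
   double : ∀ l → 7 * l + 28 + (7 * l + 28) ≡ 14 * l + 56 * 1
   double = solve-∀
   seventy : ∀ l → 14 * l + 56 * l ≡ 70 * l
   seventy = solve-∀

 log≤ : ∀ n → 1 ≤ n → ⌊log₂ n ⌋ ≤ n
 log≤ n n>0 = ⌊log₂⌋-mono-≤ (<⇒≤ (m<2^m n)) ≤≡ ⌊log₂[2^n]⌋≡n n

 mass degN degW : Poly → ℕ
 mass (conᴾ c) = c
 mass N = 1
 mass W = 1
 mass (p ⊞ q) = mass p + mass q
 mass (p ⊠ q) = mass p * mass q
 degN (conᴾ c) = 0
 degN N = 1
 degN W = 0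
 degN (p ⊞ q) = degN p ⊔ degN q
 degN (p ⊠ q) = degN p + degN q
 degW (conᴾ c) = 0
 degW N = 0
 degW W = 1
 degW (p ⊞ q) = degW p ⊔ degW q
 degW (p ⊠ q) = degW p + degW q

 module _ (n w : ℕ) (n>0 : 1 ≤ n) (w>0 : 1 ≤ w) where
  private
   instance
    n≢0 : NonZero n
    n≢0 = >-nonZero n>0
    w≢0 : NonZero w
    w≢0 = >-nonZero w>0

  eval-bound : ∀ p → eval p n w ≤ mass p * (n ^ degN p * w ^ degW p)
  eval-bound (conᴾ c) = ≤-reflexive (sym (*-identityʳ c))
  eval-bound N = ≤-reflexive (sym (*-identityˡ _ · *-identityʳ _ · *-identityʳ n))
  eval-bound W = ≤-reflexive (sym (*-identityˡ _ · *-identityˡ _ · *-identityʳ w))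
  eval-bound (p ⊞ q) = +-mono-≤
   (eval-bound p ·≤ *-monoʳ-≤ (mass p) (*-mono-≤ (^-monoʳ-≤ n (m≤m⊔n (degN p) (degN q))) (^-monoʳ-≤ w (m≤m⊔n (degW p) (degW q)))))
   (eval-bound q ·≤ *-monoʳ-≤ (mass q) (*-mono-≤ (^-monoʳ-≤ n (m≤n⊔m (degN p) (degN q))) (^-monoʳ-≤ w (m≤n⊔m (degW p) (degW q))))) ≤≡ sym (*-distribʳ-+ (n ^ degN (p ⊞ q) * w ^ degW (p ⊞ q)) (mass p) (mass q))
  eval-bound (p ⊠ q) = *-mono-≤ (eval-bound p) (eval-bound q) ≤≡ regroup (mass p) (n ^ degN p) (w ^ degW p) (mass q) (n ^ degN q) (w ^ degW q) ·
    cong₂ (λ x y → mass p * mass q * (x * y)) (sym (^-distribˡ-+-* n (degN p) (degN q))) (sym (^-distribˡ-+-* w (degW p) (degW q)))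
   where
   regroup : ∀ a x y b z u → a * (x * y) * (b * (z * u)) ≡ a * b * (x * z * (y * u))
   regroup = solve-∀

 eval-monoᴺ : ∀ p {n n'} w → n ≤ n' → eval p n w ≤ eval p n' w
 eval-monoᴺ (conᴾ c) w n≤ = ≤-refl
 eval-monoᴺ N w n≤ = n≤
 eval-monoᴺ W w n≤ = ≤-refl
 eval-monoᴺ (p ⊞ q) w n≤ = +-mono-≤ (eval-monoᴺ p w n≤) (eval-monoᴺ q w n≤)
 eval-monoᴺ (p ⊠ q) w n≤ = *-mono-≤ (eval-monoᴺ p w n≤) (eval-monoᴺ q w n≤)

module Final where
 open Tower
 open Machine
 open Lang
 open Setup using (sizesP; tableP; tableᴾ; threshold; module Sizes)
 open Input using (inputP; inputᴾ; module InputCorrectness)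
 open Fills
 open Params

 open import Defs hiding (run)
 open import Data.Nat
 open import Data.Nat.Properties

 mainProgram program : Cmd 0 → Program
 mainProgram c = sizesP ++ tableP ++ inputP ++ compile c
 program c = branch 0 (mainProgram c) [] ∷ []

 stepsᴾ : Cmd 0 → Poly
 stepsᴾ c = conᴾ 1 ⊞ ((W ⊠ conᴾ 4 ⊞ conᴾ 18) ⊞ (tableᴾ ⊞ (inputᴾ ⊞ cost c)))

 wordBits : ℕ → ℕ
 wordBits n = pred (4 * fieldWidth n)

 memorySize : ℕ → ℕ
 memorySize n = n * n + fieldWidth n * fieldWidth n + n * n * n * arrays

 module Running (n' : ℕ) where
  n K S b base cells : ℕ
  n = suc n'
  K = fieldLevel n
  S = width K
  b = wordBits n
  base = n * n + S * S
  cells = Layout.cells n arrays base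

  open Execution b cells

  q : ℕ
  q = 2 ^ S
  n>0 : 0 < n
  n>0 = s≤s z≤n
  big : threshold n ≤ q
  big = fieldLevel-enough n
  q≥2 : 2 ≤ q
  q≥2 = ^-monoʳ-≤ 2 (width>0 K)
  limit= = cong (2 ^_) (suc-pred (4 * S) {{m*n≢0 4 S {{_}} {{>-nonZero (width>0 K)}}}} · four S) ·
   ^-distribˡ-+-* 2 (S + S) (S + S) · (cong₂ _*_ (^-distribˡ-+-* 2 S S) (^-distribˡ-+-* 2 S S))
   where
   four : ∀ S → 4 * S ≡ S + S + (S + S)
   four = solve-∀
  roomy = *-monoˡ-≤ (q * q) (*-mono-≤ q≥2 q≥2) ≤≡ sym limit=
  q≤q² : q ≤ q * q
  q≤q² = m≤m*n q q {{>-nonZero (s≤s z≤n ·≤ q≥2)}}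
  S≤q : S ≤ q
  S≤q = <⇒≤ (m<2^m S)
  three<four : ∀ {x} → x ≤ q * q + q * q + q * q → x < limit
  three<four x≤ = <-≤-trans (≤-<-trans x≤ (m<m+n (q * q + q * q + q * q) (s≤s z≤n ·≤ q≥2 ·≤ q≤q²)))
   (fourfold (q * q) ≡≤ roomy)
   where
   fourfold : ∀ x → x + x + x + x ≡ 4 * x
   fourfold = solve-∀
  n²≤ : n * n ≤ q * q
  n²≤ = square-bound n n>0 ·≤ big ·≤ q≤q²
  S²≤ : S * S ≤ q * q
  S²≤ = *-mono-≤ S≤q S≤q
  cells< : cells < limit
  cells< = three<four (Layout.cells= n arrays base ≡≤ +-mono-≤ (+-mono-≤ n²≤ S²≤) (cube-bound n n>0 ·≤ big ·≤ q≤q²))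
  room = three<four (+-mono-≤ n²≤ (+-mono-≤ S²≤ (S≤q ·≤ q≤q²)) ≤≡ sym (+-assoc (q * q) (q * q) (q * q)))
  2q≤ : 2 ^ suc S ≤ limit
  2q≤ = *-mono-≤ (m≤m+n 2 2) q≤q² ·≤ roomy
  n<q : n < q
  n<q = <-≤-trans (linear-bound n n>0) big
  arrays< = <-≤-trans (<-≤-trans (arrays-bound n n>0) big) (q≤q² ·≤ m≤n*m (q * q) 4 ·≤ roomy)
  base≤cells = m≤m+n base _ ≤≡ sym (Layout.cells= n arrays base)
  below : ∀ i j → i < S → j < S → n * n + (i * S + j) < base
  below i j i<S j<S = +-monoʳ-< (n * n) (+-monoʳ-< (i * S) j<S ·≤ +-comm (i * S) S ≡≤ *-monoˡ-≤ S i<S)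

  module Z = Sizes b cells n K n>0
  module I = InputCorrectness b K n'
  module C = Correctness b K n' (n * n) S base
  open Semantics K n' using (Store; store⟨_,_⟩; outp; ⟦_⟧; Env)

  module _ (c : Cmd 0) (G : Digraph n) (coins : List Bool) (enough : n * n * S ≤ length coins) where
   start : State
   start = ⟨ (λ _ → 0) [ 0 ≔ n ] , inputMemory G , coins , [] ⟩
   weight = I.weight cells< 2q≤ below G coins enough
   origin-env : Env
   origin-env _ = zero
   initialStore : Store
   initialStore = store⟨ I.inputArrays G weight , [] ⟩
   finish : Store
   finish = ⟦ c ⟧ origin-env initialStore
   zero-memory : ∀ a → n * n ≤ a → inputMemory G a ≡ 0
   zero-memory a le with a <? n * n
   ... | no _ = refl
   ... | yes lt = contradiction lt (≤⇒≯ le)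
   main-exec : Exec (mainProgram c) start ((13 + (K * 4 + suc 4)) + (eval tableᴾ 0 S + (eval inputᴾ n S + eval (cost c) n S)))
    λ σ → o σ ≡ map toℕ (outp finish)
   main-exec = x-seq {p = sizesP} (Z.sizes-spec roomy big (fieldLevel-minimal n) arrays< refl refl) λ σ1 (z , m1 , w1 , o1) →
    x-seq {p = tableP} (Z.table-spec roomy big (fieldLevel-minimal n) base≤cells z) λ σ2 t → let open Z.Tabled t ; open Z.Sized z in
    x-seq {p = inputP} (I.input-spec cells< 2q≤ below G coins enough
     (I.ready consts (r40 · size) (r46 · base=) (r47 · count) tab)
     (ω= · w1) (λ a a< → outside a (inj₁ a<) · cong (λ M → M a) m1)
     λ a ≤a → outside a (inj₂ ≤a) · cong (λ M → M a) m1 · zero-memory a (m≤m+n (n * n) (S * S) ·≤ ≤a))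
     λ σ3 (r , cell , o3) →
    x-mono (λ σ4 (s , _) → C.SimS.outs s)
     (C.compile-correct 2q≤ room (<⇒≤ cells<) n<q below c {ρ = origin-env} {s = initialStore}
      (C.simS (C.sim (I.Ready.consts r) (I.Ready.size r) (I.Ready.base= r) (I.Ready.count r) (I.Ready.tab r) (λ ()) cell)
       (o3 · o= · o1)))

module Theorem where
 open Tower
 open Machine
 open Lang
 open Setup using (tableᴾ)
 open Input using (inputᴾ; module InputCorrectness)
 open Algo using (algorithm)
 open Chain using (HasCycle; least-cycle; Unique-length)
 open Prob
 open Stage
 open Params
 open Final

 open import Defs
 open import Data.Fin using (combine)
 import Data.Integer as ℤ
 import Data.Integer.Properties as ℤ
 open import Data.List using (filter)
 open import Data.List.Properties using (++-identityʳ)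
 open import Data.Nat
 open import Data.Nat.GeneralisedArithmetic using (iterate)
 open import Data.Nat.Logarithm using (⌊log₂_⌋)
 open import Data.Nat.Properties
 open import Data.Rational using (ℚ; 0ℚ; 1ℚ; toℚᵘ; _-_) renaming (_/_ to _/ℚ_; _≤_ to _≤ℚ_)
 import Data.Rational as ℚ
 import Data.Rational.Properties as ℚ
 open import Data.Rational.Unnormalised using (mkℚᵘ; 1ℚᵘ; *≤*)
 import Data.Rational.Unnormalised as ℚᵘ
 import Data.Rational.Unnormalised.Properties as ℚᵘ

 1-1/c≤g/M : ∀ g M c .{{_ : NonZero M}} .{{_ : NonZero c}} → M * c ≤ g * c + M → 1ℚ - (ℤ.+ 1 /ℚ c) ≤ℚ (ℤ.+ g /ℚ M)
 1-1/c≤g/M g (suc M) (suc c) h = ℚ.toℚᵘ-cancel-≤ (begin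
  toℚᵘ (1ℚ - x) ≃⟨ ℚ.toℚᵘ-homo-+ 1ℚ (ℚ.- x) ⟩
  1ℚᵘ ℚᵘ.+ toℚᵘ (ℚ.- x) ≃⟨ ℚᵘ.+-congʳ 1ℚᵘ (ℚᵘ.≃-trans (ℚ.toℚᵘ-homo‿- x) (ℚᵘ.-‿cong (ℚ.toℚᵘ-fromℚᵘ (mkℚᵘ (ℤ.+ 1) c)))) ⟩
  1ℚᵘ ℚᵘ.+ (ℚᵘ.- mkℚᵘ (ℤ.+ 1) c) ≤⟨ *≤* integers ⟩
  mkℚᵘ (ℤ.+ g) M ≃⟨ ℚᵘ.≃-sym (ℚ.toℚᵘ-fromℚᵘ (mkℚᵘ (ℤ.+ g) M)) ⟩
  toℚᵘ (ℤ.+ g /ℚ suc M) ∎)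
  where
  open ℚᵘ.≤-Reasoning
  x = ℤ.+ 1 /ℚ suc c
  naturals = +-cancelʳ-≤ (suc M) (c * suc M) (g * suc c) (swap M c ≡≤ h)
   where
   swap : ∀ M c → c * (1 + M) + (1 + M) ≡ (1 + M) * (1 + c)
   swap = solve-∀
  numerator = cong (ℤ._+ ℤ.-[1+ 0 ]) (ℤ.*-identityˡ (ℤ.+ suc c))
  integers = subst (λ z → z ℤ.* ℤ.+ suc M ℤ.≤ ℤ.+ g ℤ.* ℤ.+ suc (c + 0)) (sym numerator)
   (subst (λ d → ℤ.+ c ℤ.* ℤ.+ suc M ℤ.≤ ℤ.+ g ℤ.* ℤ.+ suc d) (sym (+-identityʳ c))
    (subst (λ z → z ℤ.≤ ℤ.+ g ℤ.* ℤ.+ suc c) (ℤ.pos-* c (suc M)) (subst (λ z → ℤ.+ (c * suc M) ℤ.≤ z) (ℤ.pos-* g (suc c)) (ℤ.+≤+ naturals))))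

 stepCostᴾ : Poly
 stepCostᴾ = conᴾ 4 ⊠ W ⊠ (conᴾ 4 ⊠ W) ⊞ (conᴾ 4 ⊠ W ⊞ conᴾ 4 ⊠ W)

 timeᴾ : Cmd 0 → Poly
 timeᴾ c = N ⊠ N ⊠ W ⊞ stepsᴾ c ⊠ (conᴾ 1 ⊞ stepCostᴾ)

 time : Cmd 0 → ℕ → ℕ
 time c n = eval (timeᴾ c) n (fieldWidth n)

 word : ℕ → ℕ
 word n = suc (wordBits n)

 word= : ∀ n → word n ≡ 4 * fieldWidth n
 word= n = suc-pred (4 * fieldWidth n) {{m*n≢0 4 (fieldWidth n) {{_}} {{>-nonZero (width>0 (fieldLevel n))}}}}

 error : ℕ → ℚ
 error zero = 0ℚ
 error (suc n) = _/ℚ_ (ℤ.+ 1) (suc n ^ 3) {{m^n≢0 (suc n) 3}}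

 stepCost= : ∀ n s → Execution.stepCost (wordBits n) s ≡ eval stepCostᴾ n (fieldWidth n)
 stepCost= n s = cong (λ k → k * k + (k + k)) (word= n)

 steps×cost≤time : ∀ c n s → eval (stepsᴾ c) n (fieldWidth n) * Execution.stepCost (wordBits n) s ≤ time c n
 steps×cost≤time c n s = *-monoʳ-≤ (eval (stepsᴾ c) n (fieldWidth n)) (stepCost= n s ≡≤ n≤1+n _) ·≤ m≤n+m _ (n * n * fieldWidth n)

 steps≤time : ∀ c n → eval (stepsᴾ c) n (fieldWidth n) ≤ time c n
 steps≤time c n = sym (*-identityʳ _) ≡≤ *-monoʳ-≤ (eval (stepsᴾ c) n (fieldWidth n)) (s≤s z≤n) ·≤ m≤n+m _ (n * n * fieldWidth n)

 product-^ : ∀ a b k → (a * b) ^ k ≡ a ^ k * b ^ k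
 product-^ a b zero = refl
 product-^ a b (suc k) = cong (a * b *_) (product-^ a b k) · interchange a b (a ^ k) (b ^ k)
  where
  interchange : ∀ a b x y → a * b * (x * y) ≡ a * x * (b * y)
  interchange = solve-∀

 polynomial-bound : ∀ p → degN p ≤ 4 → (λ n → eval p n (fieldWidth n)) =Õ (λ n → n ^ 4)
 polynomial-bound p degree = degW p , mass p * 70 ^ degW p , 2 , λ n 2≤n →
  let n≥1 = s≤s z≤n ·≤ 2≤n in
  eval-bound n (fieldWidth n) n≥1 (width>0 (fieldLevel n)) p ·≤
   *-monoʳ-≤ (mass p) (*-mono-≤ (^-monoʳ-≤ n {{>-nonZero n≥1}} degree)
    (^-monoˡ-≤ (degW p) (width-bound n 2≤n) ≤≡ product-^ 70 ⌊log₂ n ⌋ (degW p))) ≤≡ regroup (mass p) (n ^ 4) (70 ^ degW p) (⌊log₂ n ⌋ ^ degW p)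
  where
  regroup : ∀ m x y z → m * (x * (y * z)) ≡ m * y * (x * z)
  regroup = solve-∀

 time-bound : time algorithm =Õ (λ n → n ^ 4)
 time-bound = polynomial-bound (timeᴾ algorithm) (≤ᵇ⇒≤ (degN (timeᴾ algorithm)) 4 tt)

 error-bound : error =O[1/n^ 3 ]
 error-bound = 1 , 0 , λ { (suc n) _ → ℚ.≤-refl }

 word-bound : word =O (λ n → ⌊log₂ n ⌋)
 word-bound = 280 , 2 , λ n 2≤n → word= n ≡≤ *-monoʳ-≤ 4 (width-bound n 2≤n) ≤≡ sym (*-assoc 4 70 ⌊log₂ n ⌋)

 memory-bound : memorySize =O (λ n → n ^ 3)
 memory-bound = 4941 , 2 , λ n 2≤n →
  let n≥1 = s≤s z≤n ·≤ 2≤n ; w≤ = width-bound n 2≤n ·≤ *-monoʳ-≤ 70 (log≤ n n≥1) in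
  +-monoˡ-≤ (n * n * n * arrays) (+-monoʳ-≤ (n * n) (*-mono-≤ w≤ w≤)) ·≤
   +-monoˡ-≤ (n * n * n * arrays) (squares n ≡≤ *-monoʳ-≤ 4901 (m≤m*n (n * n) n {{>-nonZero n≥1}})) ≤≡ cubes n
  where
  squares : ∀ n → n * n + 70 * n * (70 * n) ≡ 4901 * (n * n)
  squares = solve-∀
  cubes : ∀ n → 4901 * (n * n * n) + n * n * n * 40 ≡ 4941 * (n * (n * (n * 1)))
  cubes = solve-∀

 record Finished {n m} (p : Program) (G : Digraph n) (ω : Vec Bool m) (t s d : ℕ) (Q : List ℕ → Set) : Set where
  field
   halts : HaltsWithin p G ω t
   space : UsesSpace p G ω s d
   report : Q (output (run p G ω t))

 finish : ∀ {n m} p (G : Digraph n) (ω : Vec Bool m) b {s s' B t Q} → s ≡ s' →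
  Execution.Exec b s p ⟨ (λ _ → 0) [ 0 ≔ n ] , inputMemory G , toList ω , [] ⟩ B (λ σ → Q (o σ)) →
  Execution.FitsState b s ⟨ (λ _ → 0) [ 0 ≔ n ] , inputMemory G , toList ω , [] ⟩ →
  B ≤ t → B * Execution.stepCost b s ≤ t → Finished p G ω t s' (suc b) Q
 finish {n} p G ω b {s} {t = t} {Q} refl e fits B≤t cost≤t =
  let σ' , k , k≤ , q , _ , paths = Execution.run e fits
      t' , t'≤ , path = paths [] 0
      end = Execution.path-halts b s t path refl (k≤ ·≤ B≤t)
  in record
   { halts = cong (λ q → code (iterate step (config q σ0 0) t)) (sym (++-identityʳ p)) · cong code end
    , subst (_≤ t) (sym (cong (λ q → clock (iterate step (config q σ0 0) t)) (sym (++-identityʳ p)) · cong clock end))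
     (t'≤ ·≤ *-monoˡ-≤ (Execution.stepCost b s) k≤ ·≤ cost≤t)
   ; space = λ t → subst (λ q → Execution.FitsConfig b s (iterate step (config q σ0 0) t)) (++-identityʳ p) (Execution.path-fits b s t path refl)
   ; report = subst Q (sym (cong (λ q → output (iterate step (config q σ0 0) t)) (sym (++-identityʳ p)) · cong output end)) q }
  where
  σ0 : State
  σ0 = ⟨ (λ _ → 0) [ 0 ≔ n ] , inputMemory G , toList ω , [] ⟩

 abstract
  fieldLarge : ∀ n' → suc n' < 2 ^ fieldWidth (suc n')
  fieldLarge n' = <-≤-trans (linear-bound (suc n') (s≤s z≤n)) (fieldLevel-enough (suc n'))

 -- What the analysis shows about a command, with the weights x as input.
 Analysed : ∀ (c : Cmd 0) n' (G : Digraph (suc n')) (x : Fin (suc n') → Fin (suc n') → F (fieldLevel (suc n'))) → Set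
 Analysed c n' G x = Phases.Triple (fieldLevel (suc n')) n' (fieldLarge n') (Phases.Quiet (fieldLevel (suc n')) n' (fieldLarge n') (Phases.Analysis.Input (fieldLevel (suc n')) n' (fieldLarge n') G x)) c
  λ s → Phases.Analysis.Result (fieldLevel (suc n')) n' (fieldLarge n') G x (Semantics.Store.outp s)

 module Outcome (c : Cmd 0) (n' : ℕ) (G : Digraph (suc n')) (ω : Vec Bool (time c (suc n'))) where
  private
   n S cells : ℕ
   n = suc n'
   S = fieldWidth n
   cells = Running.cells n'
   tosses = toList ω

  enough-tosses = m≤m+n (n * n * S) _ ≤≡ sym (length-toList ω)

  start = Running.start n' c G tosses enough-tosses

  open Execution (wordBits n) cells using (limit; Exec; stepCost; FitsState; Path; path-halts; path-fits; x-branch-≢0; x-seq; x-done; x-≤)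

  found = Semantics.Store.outp (Running.finish n' c G tosses enough-tosses)

  program-exec : Exec (program c) start (eval (stepsᴾ c) n S) (λ σ → o σ ≡ map toℕ found)
  program-exec = x-≤ steps≤ (x-branch-≢0 {p = []} (λ ()) (x-seq {p = mainProgram c} {p' = []} (Running.main-exec n' c G tosses enough-tosses) λ σ e → x-done e))
   where
   K = fieldLevel n
   a = eval tableᴾ 0 S
   b = eval tableᴾ n S
   r = eval inputᴾ n S + eval (cost c) n S
   sizes≤ = regroup K ≡≤ +-monoˡ-≤ 18 (*-monoˡ-≤ 4 (<⇒≤ (k<width K)))
    where
    regroup : ∀ K → 13 + (K * 4 + 5) ≡ K * 4 + 18
    regroup = solve-∀
   steps≤ = s≤s (+-identityʳ _ ≡≤ +-mono-≤ sizes≤ (+-monoˡ-≤ r (eval-monoᴺ tableᴾ S (z≤n {n}))))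

  start-fits : FitsState start
  start-fits = registers , memory , unused
   where
   limit= : 2 ^ word n ≡ limit
   limit= = refl
   n<limit = <-≤-trans (linear-bound n (s≤s z≤n)) (fieldLevel-enough n ·≤ ^-monoʳ-≤ 2 (m≤n*m S 4 ≤≡ sym (word= n)))
   registers : ∀ r → ((λ _ → 0) [ 0 ≔ n ]) r < limit
   registers zero = n<limit
   registers (suc r) = m^n>0 2 (word n)
   bit< : ∀ b → (if b then 1 else 0) < limit
   bit< true = ≤-<-trans (s≤s z≤n) n<limit
   bit< false = m^n>0 2 (word n)
   memory : ∀ a → inputMemory G a < limit
   memory a with a <? n * n
   ... | no _ = m^n>0 2 (word n)
   ... | yes a<nn = bit< (adjacent G _ _)
   unused : ∀ a → cells ≤ a → inputMemory G a ≡ 0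
   unused a le with a <? n * n
   ... | no _ = refl
   ... | yes lt = contradiction (m≤m+n (n * n) _ ·≤ m≤m+n (n * n + S * S) _ ·≤ sym (Layout.cells= n arrays (n * n + S * S)) ≡≤ le) (<⇒≱ lt)

  finished : Finished (program c) G ω (time c n) (memorySize n) (word n) λ out → out ≡ map toℕ found
  finished = finish (program c) G ω (wordBits n) (Layout.cells= n arrays (n * n + S * S)) program-exec start-fits (steps≤time c n) (steps×cost≤time c n cells)

  K : ℕ
  K = fieldLevel n

  sampled = Sampling.sample K (n * n) tosses

  sampled-weights : ∀ i j → Running.weight n' c G tosses enough-tosses i j ≡ Phases.entries K n' (fieldLarge n') sampled i j
  sampled-weights i j = sym (Sampling.sample-chunk K (n * n) tosses (combine i j) ·
   cong (λ a → fromBits K (take S (drop (a * S) tosses))) (combine-index i j))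

  x = Phases.entries K n' (fieldLarge n') sampled

  result : Analysed c n' G x → Phases.Analysis.Result K n' (fieldLarge n') G x found
  result h = Phases.run-quiet K n' (fieldLarge n') {I = Phases.Analysis.Input K n' (fieldLarge n') G x} {Q = λ s → Phases.Analysis.Result K n' (fieldLarge n') G x (Semantics.Store.outp s)} {c = c} h
   (InputCorrectness.inputArrays (wordBits n) K n' G (Running.weight n' c G tosses enough-tosses)) ((λ u v → refl) , sampled-weights)

 few-failing-coins : ∀ n q F M l → 0 < n → 4 * (n * n * (n * n) * (n * n * n)) ≤ q → F * q ≤ l * (n * n * M) → l ≤ 4 * (n * n) → F * (n * n * n) ≤ M
 few-failing-coins n q F M l n>0 q≥ F≤ l≤ = *-cancelˡ-≤ (4 * (n * n * (n * n))) {{>-nonZero (*-mono-≤ {1} {4} (s≤s z≤n) (*-mono-≤ (*-mono-≤ n>0 n>0) (*-mono-≤ n>0 n>0)))}}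
  (regroup n F ≡≤ *-monoʳ-≤ F q≥ ·≤ F≤ ·≤ *-monoˡ-≤ (n * n * M) l≤ ≤≡ collect n M)
  where
  regroup : ∀ n F → 4 * (n * n * (n * n)) * (F * (n * n * n)) ≡ F * (4 * (n * n * (n * n) * (n * n * n)))
  regroup = solve-∀
  collect : ∀ n M → 4 * (n * n) * (n * n * M) ≡ 4 * (n * n * (n * n)) * M
  collect = solve-∀

 cube : ∀ n → n ^ 3 ≡ n * n * n
 cube n = expand n
  where
  expand : ∀ n → n * (n * (n * 1)) ≡ n * n * n
  expand = solve-∀

 claim : ∀ {n} {G : Digraph n} {out found} → found ≡ [] ⊎ IsEvenCycle G found → out ≡ map toℕ found → ReportsNone out ⊎ ∃[ c ] (Reports out c × IsEvenCycle G c)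
 claim (inj₁ refl) e = inj₁ e
 claim (inj₂ cycle) e = inj₂ (_ , e , cycle)

 none : ∀ {n} {G : Digraph n} {out} → ¬ (∃[ c ] IsEvenCycle G c) → ReportsNone out ⊎ ∃[ c ] (Reports out c × IsEvenCycle G c) → ReportsNone out
 none acyclic (inj₁ e) = e
 none acyclic (inj₂ (c , _ , cycle)) = contradiction (c , cycle) acyclic

 Succeeds : Cmd 0 → ∀ {n} → Digraph n → Set
 Succeeds c {n} G = 1ℚ - error n ≤ℚ Pr (time c n) λ ω → reportsShortest? G (output (run (program c) G ω (time c n)))

 module _ (c : Cmd 0) (n' : ℕ) (G : Digraph (suc n')) where
  private
   n K S t r : ℕ
   n = suc n'
   K = fieldLevel n
   S = fieldWidth n
   t = time c n
   r = eval (stepsᴾ c ⊠ (conᴾ 1 ⊞ stepCostᴾ)) n S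

  probable : (E : List ((Fin (n * n) → F K) → F K)) → All (Sampling.NonvanishingAffine K) E → length E ≡ n * n + (n * n + (n + 1)) →
   (∀ ω → All (λ P → P (Outcome.sampled c n' G ω) ≢ BinaryRing.0# (tower K)) E → ReportsShortest G (output (run (program c) G ω t))) →
   Succeeds c G
  probable E nonvanishing length= good = 1-1/c≤g/M successes (2 ^ t) (n ^ 3) {{m^n≢0 2 t}} {{m^n≢0 n 3}} count
   where
   P? : ∀ ω → Dec (ReportsShortest G (output (run (program c) G ω t)))
   P? ω = reportsShortest? G (output (run (program c) G ω t))
   f : List Bool → ℕ
   f l = Sampling.failures K E (Sampling.sample K (n * n) l)
   fails : ∀ ω → ¬ ReportsShortest G (output (run (program c) G ω t)) → 1 ≤ f (toList ω)
   fails ω bad = Sum.[ (λ all → contradiction (good ω all) bad) , (λ h → h) ]′ (Sampling.failure K E (Sampling.sample K (n * n) (toList ω)))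
   l≤ = length= ≡≤
    +-monoʳ-≤ (n * n) (+-monoʳ-≤ (n * n) (+-mono-≤ (m≤m*n n n) (s≤s z≤n))) ≤≡ four (n * n)
    where
    four : ∀ x → x + (x + (x + x)) ≡ 4 * x
    four = solve-∀
   bound = few-failing-coins n (2 ^ S) (sumBits t f) (2 ^ t) (length E) (s≤s z≤n) (seventh-bound n (s≤s z≤n) ·≤ fieldLevel-enough n)
    (Sampling.few-failures K (n * n) r E nonvanishing) l≤
   successes = length (filter P? (allCoins t))
   count = *-monoˡ-≤ (n ^ 3) (length-filter t P? f fails) ·≤ *-distribʳ-+ (n ^ 3) successes (sumBits t f) ≡≤
    +-monoʳ-≤ (successes * n ^ 3) (cong (sumBits t f *_) (cube n) ≡≤ bound)

 module Success (c : Cmd 0) (n' : ℕ) (G : Digraph (suc n'))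
  (correct : ∀ x → Analysed c n' G x) where
  private
   n K S t : ℕ
   n = suc n'
   K = fieldLevel n
   S = fieldWidth n
   t = time c n

  module _ (ω : Vec Bool (time c (suc n'))) where
   found-result = Outcome.result c n' G ω (correct (Outcome.x c n' G ω))
   output= = Finished.report (Outcome.finished c n' G ω)
   claim-correct = claim (proj₁ found-result) output=
   none-correct : ¬ (∃[ c' ] IsEvenCycle G c') → ReportsNone (output (run (program c) G ω t))
   none-correct acyclic = none acyclic claim-correct
   shortest : Phases.Analysis.Good K n' (fieldLarge n') G (Outcome.x c n' G ω) → ReportsShortest G (output (run (program c) G ω t))
   shortest good = Outcome.found c n' G ω , output= , proj₂ found-result good

  likely : ∀ (kk : Fin n) (has : HasCycle (suc (toℕ kk)) G) → (∀ c → IsEvenCycle G c → suc (toℕ kk) ≤ length c) →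
   Succeeds c G
  likely kk has least = probable c n' G (Phases.events K n' (fieldLarge n') G kk has) (Phases.events-nonvanishing K n' (fieldLarge n') G kk has)
   (Phases.length-events K n' (fieldLarge n') G kk has) λ ω all → shortest ω (Phases.events-good K n' (fieldLarge n') G kk has least (Outcome.sampled c n' G ω) all)

  success : ∃[ c ] IsEvenCycle G c → Succeeds c G
  success (cycle , e) = at (least-cycle G cycle e)
   where
   at : ∃[ κ ] (HasCycle κ G × ∀ c → IsEvenCycle G c → κ ≤ length c) → Succeeds c G
   at (zero , ([] , (() , _)) , _)
   at (suc κ , has , least) = likely (fromℕ< κ<n) (subst (λ k → HasCycle (suc k) G) (sym κ=) has) (λ c e → subst (λ k → suc k ≤ length c) (sym κ=) (least c e))
    where
    cycle-length : ∀ (has : HasCycle (suc κ) G) → suc κ ≤ n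
    cycle-length (v ∷ vs , (unique , _) , _) = subst (_≤ n) (length-toList (v ∷ vs)) (Unique-length unique)
    κ<n = cycle-length has
    κ= = Fin.toℕ-fromℕ< κ<n

 module Empty (c : Cmd 0) (G : Digraph 0) (ω : Vec Bool (time c 0)) where
  open Execution (wordBits 0) (memorySize 0)

  no-memory : ∀ a → inputMemory G a ≡ 0
  no-memory a with a <? 0
  ... | no _ = refl

  start : State
  start = ⟨ (λ _ → 0) [ 0 ≔ 0 ] , inputMemory G , toList ω , [] ⟩

  zeros : ∀ r → ((λ _ → 0) [ 0 ≔ 0 ]) r ≡ 0
  zeros zero = refl
  zeros (suc r) = refl

  fits : FitsState start
  fits = (λ r → subst (_< limit) (sym (zeros r)) (m^n>0 2 (word 0))) , (λ a → subst (_< limit) (sym (no-memory a)) (m^n>0 2 (word 0))) , λ a _ → no-memory a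

  finished : Finished (program c) G ω (time c 0) (memorySize 0) (word 0) (_≡ [])
  finished = finish (program c) G ω (wordBits 0) refl (x-branch-0 {p = []} refl (x-done refl)) fits (s≤s z≤n ·≤ steps≤time c 0)
   (*-monoˡ-≤ stepCost {1} {eval (stepsᴾ c) 0 (fieldWidth 0)} (s≤s z≤n) ·≤ steps×cost≤time c 0 (memorySize 0))

 correct : ∀ (c : Cmd 0) → (∀ n' (G : Digraph (suc n')) x → Analysed c n' G x) →
  ∀ n (G : Digraph n) →
   (∀ (ω : Vec Bool (time c n)) →
    HaltsWithin (program c) G ω (time c n)
    × UsesSpace (program c) G ω (memorySize n) (word n)
    × (ReportsNone (output (run (program c) G ω (time c n)))
     ⊎ (∃[ cycle ] (Reports (output (run (program c) G ω (time c n))) cycle × IsEvenCycle G cycle)))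
    × (¬ (∃[ cycle ] IsEvenCycle G cycle) → ReportsNone (output (run (program c) G ω (time c n)))))
   × ((∃[ cycle ] IsEvenCycle G cycle) →
    Succeeds c G)
 correct c h zero G =
  (λ ω → let open Finished (Empty.finished c G ω) in halts , space , inj₁ report , λ _ → report)
  , λ { ([] , () , _) ; (() ∷ _ , _) }
 correct c h (suc n') G =
  (λ ω → let open Finished (Outcome.finished c n' G ω) in
   halts , space , Success.claim-correct c n' G (h n' G) ω , Success.none-correct c n' G (h n' G) ω)
  , Success.success c n' G (h n' G)

open import Defs
open import Data.Bool using (Bool)
open import Data.Nat using (_^_)
open import Data.Nat.Logarithm using (⌊log₂_⌋)
open import Data.Rational using (1ℚ; _-_; _≤_)
open Algo using (algorithm)
open Final using (program; memorySize)
open Params using (fieldLevel)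
open Theorem

theorem1p3 :
  ∃[ p ] ∃[ T ] ∃[ S ] ∃[ d ] ∃[ ε ]
    ( T =Õ (λ n → n ^ 4)
    × ε =O[1/n^ 3 ]
    × S =O (λ n → n ^ 3)
    × d =O (λ n → ⌊log₂ n ⌋)
    × (∀ n (G : Digraph n) →
        (∀ (ω : Vec Bool (T n)) →
            HaltsWithin p G ω (T n)
          × UsesSpace p G ω (S n) (d n)
          × (ReportsNone (output (run p G ω (T n)))
             ⊎ (∃[ c ] (Reports (output (run p G ω (T n))) c × IsEvenCycle G c)))
          × (¬ (∃[ c ] IsEvenCycle G c) → ReportsNone (output (run p G ω (T n)))))
        × ((∃[ c ] IsEvenCycle G c) →
            1ℚ - ε n ≤ Pr (T n) (λ ω → reportsShortest? G (output (run p G ω (T n)))))))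
theorem1p3 = program algorithm , time algorithm , memorySize , word , error , time-bound , error-bound , memory-bound , word-bound ,
  correct algorithm λ n′ G → Stage.Phases.Analysis.algorithm-result (fieldLevel (suc n′)) n′ (fieldLarge n′) G
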